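{- There is a deterministic weak $(1-\epsilon)$-approximation algorithm for UNBOUNDED SUBSET SUM running in $\tilde{O}(n+\epsilon^{ -1})$ time. That is, there is a deterministic algorithm which, given a set $X=\{x_1,\dots,x_n\}$ of $n$ distinct positive integers, a target $t>0$ and $\epsilon>0$, returns in $\tilde{O}(n+\epsilon^{ -1})$ time a multiset $X'$, all of whose elements belong to $X$ (with arbitrary multiplicities), such that $$(1-\epsilon)\,\mathrm{OPT}\le\Sigma(X')\le(1+\epsilon)t,\qquad \mathrm{OPT}:=\max\Big\{\sum_{i=1}^n x_iy_i : y_1,\dots,y_n\in\mathbb{Z}_{\ge0},\ \sum_{i=1}^n x_iy_i\le t\Big\}.$$
   Context: $\Sigma(X')$ is the sum of the elements of the multiset $X'$ with multiplicity. UNBOUNDED SUBSET SUM: given a set $X=\{x_1,\dots,x_n\}$ of distinct positive integers and a target $t>0$, find non-negative integers $m_1,\dots,m_n$ maximizing $\sum_i x_im_i$ subject to $\sum_i x_im_i\le t$. The output multiset may be represented by the multiplicities of the elements of $X$. The notation $\tilde{O}$ hides factors polylogarithmic in $n$ and $1/\epsilon$. Here $\epsilon$ is an arbitrarily small positive number. Running times are worst-case, in the usual unit-cost RAM model. -}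

module Defs where

open import Data.Bool.Base using (if_then_else_)
open import Data.Fin.Base using (Fin; zero; suc; toℕ; fromℕ<)
import Data.Integer.Base as ℤ
open import Data.List.Base using (List; head; drop)
open import Data.Maybe.Base using (Maybe; just; nothing)
open import Data.Nat.Base
open import Data.Nat.Logarithm using (⌈log₂_⌉)
open import Data.Nat.Properties
open import Data.Product.Base using (∃; _×_; _,_; proj₁; proj₂)
open import Data.Rational.Base as ℚ using (ℚ; Positive; 1/_; ceiling; ↥_; ↧ₙ_)
open import Data.Rational.Properties using (pos⇒nonZero)
open import Data.Vec.Functional as Vector using (Vector)
open import Relation.Binary.PropositionalEquality
open import Relation.Nullary using (Dec; yes; no; contradiction)
open import Relation.Nullary.Decidable using (map′; _×-dec_)
open import Algebra.Properties.Semiring.Sum +-*-semiring using (sum)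

------------------------------------------------------------------------
-- Unbounded subset sum

-- The multiset containing x i with multiplicity m i has sum Σ⟨ x , m ⟩.
Σ⟨_,_⟩ : ∀ {n} → Vector ℕ n → Vector ℕ n → ℕ
Σ⟨ x , m ⟩ = sum (λ i → x i * m i)

FeasibleSum : ∀ {n} → Vector ℕ n → ℕ → ℕ → Set
FeasibleSum {n} x t v = ∃ λ (y : Vector ℕ n) → Σ⟨ x , y ⟩ ≡ v × v ≤ t

IsMaximum : (ℕ → Set) → ℕ → Set
IsMaximum S v = S v × (∀ w → S w → w ≤ v)

private
  attainable? : ∀ {n} (x : Vector ℕ n) v → Dec (∃ λ y → Σ⟨ x , y ⟩ ≡ v)
  attainable? {zero}  x v = map′ (λ p → (λ ()) , p) proj₂ (0 ≟ v)
  attainable? {suc n} x v = map′ to from (anyUpTo? step? (suc v))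
    where
    x₀ = x zero
    xs = Vector.tail x

    Step : ℕ → Set
    Step m = x₀ * m ≤ v × ∃ λ y → Σ⟨ xs , y ⟩ ≡ v ∸ x₀ * m

    step? : ∀ m → Dec (Step m)
    step? m = (x₀ * m ≤? v) ×-dec attainable? xs (v ∸ x₀ * m)

    to : (∃ λ m → m < suc v × Step m) → ∃ λ y → Σ⟨ x , y ⟩ ≡ v
    to (m , _ , le , y , eq) =
      (m Vector.∷ y) , trans (cong (x₀ * m +_) eq) (m+[n∸m]≡n le)

    from : (∃ λ y → Σ⟨ x , y ⟩ ≡ v) → ∃ λ m → m < suc v × Step m
    from (y , refl) with x zero in x₀≡
    ... | zero  = 0 , z<s , z≤n , Vector.tail y , refl
    ... | suc k = y zero , s≤s (≤-trans (m≤n*m (y zero) (suc k)) le) , le ,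
                  Vector.tail y , sym (m+n∸m≡n (suc k * y zero) _)
      where le = m≤m+n (suc k * y zero) Σ⟨ xs , Vector.tail y ⟩

  sum-*0 : ∀ {n} (x : Vector ℕ n) → Σ⟨ x , (λ _ → 0) ⟩ ≡ 0
  sum-*0 {zero}  x = refl
  sum-*0 {suc n} x = cong₂ _+_ (*-zeroʳ (x zero)) (sum-*0 (Vector.tail x))

optimum : ∀ {n} (x : Vector ℕ n) t → ∃ (IsMaximum (FeasibleSum x t))
optimum x zero = 0 , ((λ _ → 0) , sum-*0 x , z≤n) , λ _ → λ { (_ , _ , le) → le }
optimum x (suc t) with attainable? x (suc t)
... | yes (y , eq) = suc t , (y , eq , ≤-refl) , λ _ → λ { (_ , _ , le) → le }
... | no ¬p with optimum x t
...   | v , (y , eq , le) , max = v , (y , eq , m≤n⇒m≤1+n le) , max′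
  where
  max′ : ∀ w → FeasibleSum x (suc t) w → w ≤ v
  max′ w (y′ , eq′ , le′) with w ≟ suc t
  ... | yes refl = contradiction (y′ , eq′) ¬p
  ... | no  w≢   = max w (y′ , eq′ , ≤-pred (≤∧≢⇒< le′ w≢))

OPT : ∀ {n} → Vector ℕ n → ℕ → ℕ
OPT x t = proj₁ (optimum x t)

ℕ→ℚ : ℕ → ℚ
ℕ→ℚ k = ℤ.+ k ℚ./ 1

------------------------------------------------------------------------
-- Unit-cost RAM over natural numbers

-- Subtraction is truncated, and dividing by zero yields zero.
data Op : Set where
  add sub mul div : Op

⟦_⟧ : Op → ℕ → ℕ → ℕ
⟦ add ⟧ a b       = a + b
⟦ sub ⟧ a b       = a ∸ b
⟦ mul ⟧ a b       = a * b
⟦ div ⟧ a zero    = 0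
⟦ div ⟧ a (suc b) = a / suc b

Reg Label : Set
Reg   = ℕ
Label = ℕ

data Instr : Set where
  const : Reg → ℕ → Instr             -- r ≔ k
  arith : Op → Reg → Reg → Reg → Instr -- r ≔ a op b
  load  : Reg → Reg → Instr            -- r ≔ mem[a]
  store : Reg → Reg → Instr            -- mem[a] ≔ r
  jump  : Label → Instr
  jzero : Reg → Label → Instr          -- jump if r = 0

Program : Set
Program = List Instr

record State : Set where
  constructor state
  field
    pc  : Label
    reg : ℕ → ℕ
    mem : ℕ → ℕ

open State public

_[_≔_] : (ℕ → ℕ) → ℕ → ℕ → (ℕ → ℕ)
(f [ a ≔ v ]) b = if a ≡ᵇ b then v else f b

-- A machine word holds the numbers up to B; computing a larger one is an
-- error.  Without such a limit, unit-cost multiplication could operate on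
-- whole arrays packed into a single number.
setReg : ℕ → Reg → ℕ → State → Maybe State
setReg B r v s =
  if v ≤ᵇ B
  then just (state (suc (pc s)) (reg s [ r ≔ v ]) (mem s))
  else nothing

exec : ℕ → Instr → State → Maybe State
exec B (const r k)      s = setReg B r k s
exec B (arith op r a b) s = setReg B r (⟦ op ⟧ (reg s a) (reg s b)) s
exec B (load r a)       s = setReg B r (mem s (reg s a)) s
exec B (store a r)      s = just (state (suc (pc s)) (reg s) (mem s [ reg s a ≔ reg s r ]))
exec B (jump l)         s = just (state l (reg s) (mem s))
exec B (jzero r l)      s =
  just (state (if reg s r ≡ᵇ 0 then l else suc (pc s)) (reg s) (mem s))

fetch : Program → Label → Maybe Instr
fetch P l = head (drop l P)

-- P , B ⊢ s ⇓[ T ] s′ : with words bounded by B, the program P started in s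
-- halts in s′ after exactly T instructions.  Halting means leaving the
-- program; an overflow is not a halt.
infix 4 _,_⊢_⇓[_]_

data _,_⊢_⇓[_]_ (P : Program) (B : ℕ) : State → ℕ → State → Set where
  halt : ∀ {s} → fetch P (pc s) ≡ nothing → P , B ⊢ s ⇓[ 0 ] s
  step : ∀ {s s′ s″ i T} →
         fetch P (pc s) ≡ just i →
         exec B i s ≡ just s′ →
         P , B ⊢ s′ ⇓[ T ] s″ →
         P , B ⊢ s ⇓[ suc T ] s″

------------------------------------------------------------------------
-- Input, output and resource bounds

-- The array x in cells 0 , … , n-1, and zero elsewhere.
array : ∀ {n} → Vector ℕ n → ℕ → ℕ
array {n} x a with a <? n
... | yes a<n = x (fromℕ< a<n)
... | no  _   = 0

numerator : ℚ → ℕ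
numerator ε = ℤ.∣ ↥ ε ∣

inputRegs : ∀ {n} → Vector ℕ n → ℕ → ℚ → ℕ → ℕ
inputRegs {n} x t ε 0 = n
inputRegs {n} x t ε 1 = t
inputRegs {n} x t ε 2 = numerator ε
inputRegs {n} x t ε 3 = ↧ₙ ε
inputRegs {n} x t ε _ = 0

input : ∀ {n} → Vector ℕ n → ℕ → ℚ → State
input x t ε = state 0 (inputRegs x t ε) (array x)

-- The multiplicities of x 0 , … , x (n-1) are returned in cells 0 , … , n-1.
output : ∀ {n} → State → Vector ℕ n
output s i = mem s (toℕ i)

largestInput : ∀ {n} → Vector ℕ n → ℕ → ℚ → ℕ
largestInput {n} x t ε = n ⊔ t ⊔ numerator ε ⊔ ↧ₙ ε ⊔ Vector.foldr _⊔_ 0 x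

-- Words of O(log N) bits, where N is the largest number in the input; the
-- factor hidden in O is c.
wordBound : ℕ → ∀ {n} → Vector ℕ n → ℕ → ℚ → ℕ
wordBound c x t ε = (2 + largestInput x t ε) ^ c

⌈1/_⌉ : (ε : ℚ) → .{{Positive ε}} → ℕ
⌈1/ ε ⌉ = ℤ.∣ ceiling ((1/ ε) {{pos⇒nonZero ε}}) ∣

-- For N ≥ 1 the logarithm is at least 1, so  ∃ C k. ∀ N. f N ≤ polylogTimes C k N
-- says f(N) = Õ(N).
polylogTimes : ℕ → ℕ → ℕ → ℕ
polylogTimes C k N = C * (N * ⌈log₂ suc N ⌉ ^ k)

{-# OPTIONS --safe #-}

-- Let P ≥ 4/ε be a power of two.  When the items are rounded to multiples of
-- t/(4P²), a pigeonhole argument on subset sums turns an optimal solution into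
-- one of the same rounded value whose support is logarithmic in P, and binary
-- expansion of its multiplicities makes it a sum of K = polylog P multiples
-- 2^j x.  (If some x is at most t/P, multiples of a multiple of this x suffice.)
-- Rounding these multiples down to units of t/M with M = 4KP loses at most K
-- units, so it is enough to compute the K-fold sumset of the rounded values
-- below M + K and to trace back one sum, each of the K steps by a linear scan.
-- A step is a Boolean convolution of length O(M).  It is computed exactly by
-- Nussbaumer's method, arranged level by level so that no recursion is needed
-- and with X^N in place of −1 so that no subtraction is needed.  Its correctness
-- is a congruence between values at X modulo X^N + 1, for X arbitrarily large.
-- The program is written in a language with bounded loops, compiled to the RAM;
-- its running time is a product of the bounds for nested loops, at most one of
-- which is not polylogarithmic.

module Submission where

open import Data.Bool.Base using (Bool; true; false; if_then_else_; _∧_; _∨_; not; T)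
open import Data.Empty using (⊥)
open import Data.Fin.Base using (Fin; zero; suc; toℕ; fromℕ<)
open import Data.Fin.Properties using (toℕ<n; toℕ-fromℕ<; fromℕ<-toℕ; pigeonhole)
open import Data.List.Base using (List; []; _∷_; _++_; length; head; drop)
open import Data.List.Properties using (++-assoc; length-++)
open import Data.List.Relation.Unary.All as All using (All; []; _∷_)
open import Data.List.Relation.Unary.All.Properties using (++⁺)
open import Data.Maybe.Base using (just; nothing)
open import Data.Nat.Base
open import Data.Nat.DivMod
open import Data.Nat.Logarithm using (⌈log₂_⌉; ⌈log₂⌉-mono-≤; ⌈log₂2*n⌉≡1+⌈log₂n⌉; ⌈log₂2^n⌉≡n)
open import Data.Nat.Properties
open import Data.Nat.Tactic.RingSolver using (solve-∀)
open import Data.Product.Base using (∃; ∃₂; ∃-syntax; _×_; _,_; proj₁; proj₂)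
open import Data.Rational.Base as ℚ using (ℚ; 1ℚ; Positive)
open import Data.Sum.Base using (_⊎_; inj₁; inj₂)
open import Data.Unit.Base using (⊤; tt)
open import Data.Vec.Functional using (Vector)
open import Function.Base using (_∘_; case_of_)
open import Function.Definitions using (Injective)
open import Relation.Binary.PropositionalEquality hiding ([_])
open import Relation.Nullary using (¬_; yes; no; contradiction)
open import Defs

-- Everything is shaped by the bound on machine words: each intermediate value must stay polynomial
-- in the largest input, and there are no complex numbers or convenient primes with roots of unity.
-- Hence the roots of unity are adjoined as powers of a variable y, by which one multiplies through
-- rotating coefficients. Each level halves the exponent of the block length, so the depth is doubly
-- logarithmic: the doubling by padding on each level costs only a polylogarithmic factor, and the
-- growth of the values telescopes. The transforms are not normalised; their constant factor is
-- harmless, because only the support of a product is needed. The exchange argument belongs to the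
-- analysis alone. It is applied to rounded values since there are only O(P²) of them; for exact
-- values the support would depend on log t. Both rounding steps may understate a sum, so the
-- computed sum can exceed t, which a weak approximation permits. The loss is additive, of order
-- t/P. It becomes a fraction of the optimum because OPT = 0 or t ≤ 2 OPT.

infixr 4 _⨾_
infix 5 _⇐_ _⟨_⟩⇐_
infixl 6 _⊕_ _⊖_
infixl 7 _⊗_ _⊘_

-- Syntax and semantics of the loop language

data Exp : Set where
  lit var : ℕ → Exp
  bin     : Op → Exp → Exp → Exp
  at      : ℕ → Exp → Exp

_⊕_ _⊖_ _⊗_ _⊘_ : Exp → Exp → Exp
_⊕_ = bin add
_⊖_ = bin sub
_⊗_ = bin mul
_⊘_ = bin div

-- Loops are classified by the bound on the number of their rounds:
-- polylogarithmic or quasilinear.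
data Kind : Set where
  short long : Kind

-- get and put access the cells shared by the input and the output; the other
-- cells are presented as eight unbounded arrays.
data Cmd : Set where
  _⇐_   : ℕ → Exp → Cmd
  _⟨_⟩⇐_ : ℕ → Exp → Exp → Cmd
  get   : ℕ → Exp → Cmd
  put   : Exp → Exp → Cmd
  _⨾_   : Cmd → Cmd → Cmd
  for   : Kind → ℕ → ℕ → Cmd → Cmd

record St : Set where
  constructor st
  field
    env io : ℕ → ℕ
    arr    : ℕ → ℕ → ℕ

open St public

updateArr : (ℕ → ℕ → ℕ) → ℕ → ℕ → ℕ → ℕ → ℕ → ℕ
updateArr A k i v l = if k ≡ᵇ l then A l [ i ≔ v ] else A l

setVar : St → ℕ → ℕ → St
setVar s r v = st (env s [ r ≔ v ]) (io s) (arr s)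

setIO : St → ℕ → ℕ → St
setIO s i v = st (env s) (io s [ i ≔ v ]) (arr s)

setArr : St → ℕ → ℕ → ℕ → St
setArr s k i v = st (env s) (io s) (updateArr (arr s) k i v)

eval : Exp → St → ℕ
eval (lit k)      s = k
eval (var r)      s = env s r
eval (bin op a b) s = ⟦ op ⟧ (eval a s) (eval b s)
eval (at k e)     s = arr s k (eval e s)

≡ᵇ-refl : ∀ a → (a ≡ᵇ a) ≡ true
≡ᵇ-refl zero    = refl
≡ᵇ-refl (suc a) = ≡ᵇ-refl a

≢⇒≡ᵇ : ∀ {a b} → a ≢ b → (a ≡ᵇ b) ≡ false
≢⇒≡ᵇ {zero}  {zero}  p = contradiction refl p
≢⇒≡ᵇ {zero}  {suc b} p = refl
≢⇒≡ᵇ {suc a} {zero}  p = refl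
≢⇒≡ᵇ {suc a} {suc b} p = ≢⇒≡ᵇ (p ∘ cong suc)

≡ᵇ⇒≢ : ∀ {a b} → (a ≡ᵇ b) ≡ false → a ≢ b
≡ᵇ⇒≢ {a} q refl with a ≡ᵇ a | ≡ᵇ-refl a
≡ᵇ⇒≢ () refl | true | _

set-same : ∀ (f : ℕ → ℕ) a v → (f [ a ≔ v ]) a ≡ v
set-same f a v rewrite ≡ᵇ-refl a = refl

set-other : ∀ (f : ℕ → ℕ) {a b} v → a ≢ b → (f [ a ≔ v ]) b ≡ f b
set-other f v p rewrite ≢⇒≡ᵇ p = refl

∧-true : ∀ {a b} → a ∧ b ≡ true → a ≡ true × b ≡ true
∧-true {true} {true} refl = refl , refl

∨-false : ∀ {a b} → a ∨ b ≡ false → a ≡ false × b ≡ false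
∨-false {false} {false} refl = refl , refl

<ᵇ-true : ∀ {a b} → (a <ᵇ b) ≡ true → a < b
<ᵇ-true {a} {b} p = <ᵇ⇒< a b (subst T (sym p) tt)

≤ᵇ-true : ∀ {a b} → a ≤ b → (a ≤ᵇ b) ≡ true
≤ᵇ-true {a} {b} p with a ≤ᵇ b | ≤⇒≤ᵇ p
... | true | _ = refl

module Execution (W n : ℕ) (limit : Kind → ℕ) where

  mutual
    -- Only values that reach a variable or a cell must be at most `W`; values inside an expression
    -- are unrestricted here and are controlled through `size`. The index of a shared cell may equal
    -- `n`: cell `n` is a spare one, touched when there are no items and the table entry for value 0
    -- is picked.
    data Exec : Cmd → St → St → Set where
      assign : ∀ {s r e} → eval e s ≤ W → Exec (r ⇐ e) s (setVar s r (eval e s))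
      write  : ∀ {s k e f} → eval f s ≤ W →
               Exec (k ⟨ e ⟩⇐ f) s (setArr s k (eval e s) (eval f s))
      read   : ∀ {s r e} → eval e s ≤ n → Exec (get r e) s (setVar s r (io s (eval e s)))
      emit   : ∀ {s e f} → eval e s ≤ n → eval f s ≤ W →
               Exec (put e f) s (setIO s (eval e s) (eval f s))
      _then_ : ∀ {s s′ s″ c d} → Exec c s s′ → Exec d s′ s″ → Exec (c ⨾ d) s s″
      repeat : ∀ {s s′ k r b c} → env s b ≤ limit k →
               Loop r b c (env s b) (setVar s r 0) s′ → Exec (for k r b c) s s′

    -- The number of rounds is fixed on entry; that it agrees with the test
    -- env r < env b made by the compiled code is required in each round.
    data Loop (r b : ℕ) (c : Cmd) : ℕ → St → St → Set where
      done : ∀ {s} → env s b ≡ env s r → Loop r b c 0 s s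
      next : ∀ {s s′ s″ j} → env s b ≡ env s r + suc j → Exec c s s′ →
             suc (env s′ r) ≤ W →
             Loop r b c j (setVar s′ r (suc (env s′ r))) s″ →
             Loop r b c (suc j) s s″

  record Bounded (s : St) : Set where
    constructor bounded
    field
      envB : ∀ r → env s r ≤ W
      ioB  : ∀ i → io s i ≤ W
      arrB : ∀ k i → arr s k i ≤ W
  open Bounded public

  set-≤ : ∀ (f : ℕ → ℕ) a v → (∀ b → f b ≤ W) → v ≤ W → ∀ b → (f [ a ≔ v ]) b ≤ W
  set-≤ f a v p q b with a ≡ᵇ b
  ... | true  = q
  ... | false = p b

  updateArr-≤ : ∀ A k i v → (∀ l j → A l j ≤ W) → v ≤ W →
                ∀ l j → updateArr A k i v l j ≤ W
  updateArr-≤ A k i v p q l j with k ≡ᵇ l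
  ... | true  = set-≤ (A l) i v (p l) q j
  ... | false = p l j

  setVar-bounded : ∀ {s} r {v} → Bounded s → v ≤ W → Bounded (setVar s r v)
  setVar-bounded {s} r {v} b q = bounded (set-≤ (env s) r v (envB b) q) (ioB b) (arrB b)

  mutual
    exec-bounded : ∀ {c s s′} → Exec c s s′ → Bounded s → Bounded s′
    exec-bounded (assign {r = r} q) bd = setVar-bounded r bd q
    exec-bounded {s = s} (write {k = k} {e} {f} q) bd =
      bounded (envB bd) (ioB bd) (updateArr-≤ (arr s) k (eval e s) (eval f s) (arrB bd) q)
    exec-bounded (read {r = r} q) bd = setVar-bounded r bd (ioB bd _)
    exec-bounded {s = s} (emit {e = e} {f} _ q) bd =
      bounded (envB bd) (set-≤ (io s) (eval e s) (eval f s) (ioB bd) q) (arrB bd)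
    exec-bounded (p then q) b = exec-bounded q (exec-bounded p b)
    exec-bounded (repeat {r = r} _ l) b = loop-bounded l (setVar-bounded r b z≤n)

    loop-bounded : ∀ {r b c j s s′} → Loop r b c j s s′ → Bounded s → Bounded s′
    loop-bounded (done _) p = p
    loop-bounded {r} (next _ e q l) p = loop-bounded l (setVar-bounded r (exec-bounded e p) q)

-- Frame conditions

modVar modArr : Cmd → ℕ → Bool
modVar (r ⇐ e)       x = r ≡ᵇ x
modVar (k ⟨ e ⟩⇐ f)  x = false
modVar (get r e)     x = r ≡ᵇ x
modVar (put e f)     x = false
modVar (c ⨾ d)       x = modVar c x ∨ modVar d x
modVar (for k r b c) x = (r ≡ᵇ x) ∨ modVar c x
modArr (r ⇐ e)       x = false
modArr (k ⟨ e ⟩⇐ f)  x = k ≡ᵇ x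
modArr (get r e)     x = false
modArr (put e f)     x = false
modArr (c ⨾ d)       x = modArr c x ∨ modArr d x
modArr (for k r b c) x = modArr c x

modIO : Cmd → Bool
modIO (r ⇐ e)       = false
modIO (k ⟨ e ⟩⇐ f)  = false
modIO (get r e)     = false
modIO (put e f)     = true
modIO (c ⨾ d)       = modIO c ∨ modIO d
modIO (for k r b c) = modIO c

-- The premises are Boolean equations, so for a concrete command and a concrete variable or array
-- they are proved by `refl`.
record Frame (c : Cmd) (s s′ : St) : Set where
  constructor frame
  field
    sameVar : ∀ r → modVar c r ≡ false → env s′ r ≡ env s r
    sameArr : ∀ k → modArr c k ≡ false → ∀ i → arr s′ k i ≡ arr s k i
    sameIO  : modIO c ≡ false → ∀ i → io s′ i ≡ io s i
open Frame public

frame-refl : ∀ {c s} → Frame c s s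
frame-refl = frame (λ _ _ → refl) (λ _ _ _ → refl) (λ _ _ → refl)

frame-trans : ∀ {c s s′ s″} → Frame c s s′ → Frame c s′ s″ → Frame c s s″
frame-trans (frame a b c) (frame a′ b′ c′) =
  frame (λ r p → trans (a′ r p) (a r p)) (λ k p i → trans (b′ k p i) (b k p i))
        (λ p i → trans (c′ p i) (c p i))

frame-set : ∀ {k b c} s r v → Frame (for k r b c) s (setVar s r v)
frame-set s r v = frame (λ x p → set-other (env s) v (≡ᵇ⇒≢ {r} (proj₁ (∨-false p))))
                        (λ _ _ _ → refl) (λ _ _ → refl)

frame-body : ∀ {k r b c s s′} → Frame c s s′ → Frame (for k r b c) s s′
frame-body (frame x y z) = frame (λ r p → x r (proj₂ (∨-false p))) y z

module _ {W n : ℕ} {limit : Kind → ℕ} where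
  open Execution W n limit

  mutual
    exec-frame : ∀ {c s s′} → Exec c s s′ → Frame c s s′
    exec-frame {s = s} (assign {r = r} {e} _) =
      frame (λ x p → set-other (env s) (eval e s) (≡ᵇ⇒≢ {r} p)) (λ _ _ _ → refl) (λ _ _ → refl)
    exec-frame {s = s} (write {k = k} {e} {f} _) =
      frame (λ _ _ → refl)
            (λ l p i → cong (λ b → (if b then arr s l [ eval e s ≔ eval f s ] else arr s l) i) p)
            (λ _ _ → refl)
    exec-frame {s = s} (read {r = r} {e} _) =
      frame (λ x p → set-other (env s) (io s (eval e s)) (≡ᵇ⇒≢ {r} p)) (λ _ _ _ → refl) (λ _ _ → refl)
    exec-frame (emit _ _) = frame (λ _ _ → refl) (λ _ _ _ → refl) (λ ())
    exec-frame (p then q) with exec-frame p | exec-frame q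
    ... | frame a b c | frame a′ b′ c′ =
      frame (λ r z → let u , v = ∨-false z in trans (a′ r v) (a r u))
            (λ k z i → let u , v = ∨-false z in trans (b′ k v i) (b k u i))
            (λ z i → let u , v = ∨-false z in trans (c′ v i) (c u i))
    exec-frame {for k r b c} {s} (repeat _ l) = frame-trans (frame-set s r 0) (loop-frame k l)

    loop-frame : ∀ {r b c j s s′} k → Loop r b c j s s′ → Frame (for k r b c) s s′
    loop-frame k (done _) = frame-refl
    loop-frame k (next {s′ = s′} _ e _ l) =
      frame-trans (frame-body (exec-frame e)) (frame-trans (frame-set s′ _ _) (loop-frame k l))

-- Registers from 64 on are scratch space, and register 0 always holds n.

arrayAddress : ℕ → ℕ → List Instr
arrayAddress k d =
  const (suc d) 1 ∷ arith add d d (suc d) ∷ arith add d d 0 ∷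
  const (suc d) 8 ∷ arith mul d d (suc d) ∷
  const (suc d) k ∷ arith add d d (suc d) ∷ []

compileExp : Exp → Reg → List Instr
compileExp (lit k)      d = const d k ∷ []
-- No instruction copies a register; zero is added instead.
compileExp (var r)      d = const d 0 ∷ arith add d r d ∷ []
compileExp (bin op a b) d =
  compileExp a d ++ compileExp b (suc d) ++ arith op d d (suc d) ∷ []
compileExp (at k e)     d = compileExp e d ++ arrayAddress k d ++ load d d ∷ []

compile : Cmd → Label → List Instr
compile (r ⇐ e)       l = compileExp e 64 ++ const 65 0 ∷ arith add r 64 65 ∷ []
compile (k ⟨ e ⟩⇐ f)  l =
  compileExp e 64 ++ arrayAddress k 64 ++ compileExp f 65 ++ store 64 65 ∷ []
compile (get r e)     l = compileExp e 64 ++ load r 64 ∷ []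
compile (put e f)     l = compileExp e 64 ++ compileExp f 65 ++ store 64 65 ∷ []
compile (c ⨾ d)       l = let p = compile c l in p ++ compile d (l + length p)
compile (for k r b c) l =
  const r 0 ∷ arith sub 64 b r ∷ jzero 64 (length body + (6 + l)) ∷
  body ++ const 64 1 ∷ arith add r r 64 ∷ jump (1 + l) ∷ []
  where body = compile c (3 + l)

cost : (Kind → ℕ) → Cmd → ℕ
cost limit (c ⨾ d)       = cost limit c + cost limit d
-- A round consists of the test (two instructions), the body, the increment (two) and the jump back.
-- Initialisation and the last, failing test account for the 3.
cost limit (for k r b c) = 3 + limit k * (5 + cost limit c)
cost limit c             = length (compile c 0)

wfExp : Exp → Bool
wfExp (lit k)      = true
wfExp (var r)      = r <ᵇ 64
wfExp (bin op a b) = wfExp a ∧ wfExp b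
wfExp (at k e)     = (k <ᵇ 8) ∧ wfExp e

wfReg : ℕ → Bool
wfReg r = (0 <ᵇ r) ∧ (r <ᵇ 64)

wf : Cmd → Bool
wf (r ⇐ e)       = wfReg r ∧ wfExp e
wf (k ⟨ e ⟩⇐ f)  = (k <ᵇ 8) ∧ (wfExp e ∧ wfExp f)
wf (get r e)     = wfReg r ∧ wfExp e
wf (put e f)     = wfExp e ∧ wfExp f
wf (c ⨾ d)       = wf c ∧ wf d
wf (for k r b c) = wfReg r ∧ ((b <ᵇ 64) ∧ wf c)

-- If all values in the state are at most W, then all values arising in the
-- evaluation of e are at most W ^ size e.
size : Exp → ℕ
size (lit k)      = suc k
size (var r)      = 1
size (bin op a b) = size a + size b
size (at k e)     = size e + 6

sizeCmd : Cmd → ℕ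
sizeCmd (r ⇐ e)       = size e
sizeCmd (k ⟨ e ⟩⇐ f)  = size (at 0 e) ⊔ size f
sizeCmd (get r e)     = size e
sizeCmd (put e f)     = size e ⊔ size f
sizeCmd (c ⨾ d)       = sizeCmd c ⊔ sizeCmd d
sizeCmd (for k r b c) = sizeCmd c

-- Correctness of the compiled code

infixr 5 _∷ᶜ_
data CodeAt (P : Program) : Label → List Instr → Set where
  []ᶜ  : ∀ {l} → CodeAt P l []
  _∷ᶜ_ : ∀ {l i is} → fetch P l ≡ just i → CodeAt P (suc l) is → CodeAt P l (i ∷ is)

codeAt-++ : ∀ {P} l is {js} → CodeAt P l (is ++ js) →
            CodeAt P l is × CodeAt P (length is + l) js
codeAt-++ l []       c        = []ᶜ , c
codeAt-++ {P} l (i ∷ is) {js} (f ∷ᶜ c) with codeAt-++ (suc l) is c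
... | a , b = f ∷ᶜ a , subst (λ l → CodeAt P l js) (+-suc (length is) l) b

codeAt-self : ∀ P → CodeAt P 0 P
codeAt-self P = go [] P
  where
  fetch-++ : ∀ (pre : List Instr) {i is} → head (drop (length pre) (pre ++ i ∷ is)) ≡ just i
  fetch-++ []        = refl
  fetch-++ (_ ∷ pre) = fetch-++ pre
  go : ∀ pre is → CodeAt (pre ++ is) (length pre) is
  go pre []       = []ᶜ
  go pre (i ∷ is) = fetch-++ pre ∷ᶜ
    subst₂ (λ P l → CodeAt P l is) (++-assoc pre (i ∷ []) is)
      (trans (length-++ pre) (+-comm (length pre) 1)) (go (pre ++ i ∷ []) is)

-- The relation `⇓` speaks of halting runs only. A run that stops in the middle of the program is
-- therefore described by what it adds in front of any halting run.
record Reach (P : Program) (B : ℕ) (s : State) (T : ℕ) (s′ : State) : Set where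
  constructor reach
  field
    before : ∀ {T′ s″} → P , B ⊢ s′ ⇓[ T′ ] s″ → P , B ⊢ s ⇓[ T + T′ ] s″
open Reach public

module _ {P : Program} {B : ℕ} where

  infixr 5 _⟫_
  _⟫_ : ∀ {s s′ s″ T T′} → Reach P B s T s′ → Reach P B s′ T′ s″ → Reach P B s (T + T′) s″
  _⟫_ {s} {T = T} {T′} (reach p) (reach q) =
    reach λ {T″} {s‴} r → subst (λ z → P , B ⊢ s ⇓[ z ] s‴) (sym (+-assoc T T′ T″)) (p (q r))

  reach-exec : ∀ {i s s′} → fetch P (pc s) ≡ just i → exec B i s ≡ just s′ → Reach P B s 1 s′
  reach-exec p q = reach (step p q)

  setReg-≤ : ∀ r v s → v ≤ B →
             setReg B r v s ≡ just (state (suc (pc s)) (reg s [ r ≔ v ]) (mem s))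
  setReg-≤ r v s p rewrite ≤ᵇ-true p = refl

  reach-const : ∀ {l ρ μ r k} → fetch P l ≡ just (const r k) → k ≤ B →
                Reach P B (state l ρ μ) 1 (state (suc l) (ρ [ r ≔ k ]) μ)
  reach-const {l} {ρ} {μ} {r = r} p q = reach-exec p (setReg-≤ r _ (state l ρ μ) q)

  reach-arith : ∀ {l ρ μ op r a b} → fetch P l ≡ just (arith op r a b) → ⟦ op ⟧ (ρ a) (ρ b) ≤ B →
                Reach P B (state l ρ μ) 1 (state (suc l) (ρ [ r ≔ ⟦ op ⟧ (ρ a) (ρ b) ]) μ)
  reach-arith {l} {ρ} {μ} {r = r} p q = reach-exec p (setReg-≤ r _ (state l ρ μ) q)

  reach-load : ∀ {l ρ μ r a} → fetch P l ≡ just (load r a) → μ (ρ a) ≤ B →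
               Reach P B (state l ρ μ) 1 (state (suc l) (ρ [ r ≔ μ (ρ a) ]) μ)
  reach-load {l} {ρ} {μ} {r = r} p q = reach-exec p (setReg-≤ r _ (state l ρ μ) q)

-- The eight arrays are interleaved by the residue modulo 8 and lie above the cells 0, ..., n, so
-- that none of them needs a length fixed in advance.
address : ℕ → ℕ → ℕ → ℕ
address n k i = (i + 1 + n) * 8 + k

remainder-unique : ∀ {a k} → k < 8 → (a * 8 + k) % 8 ≡ k
remainder-unique {a} {k} k<8 =
  trans (cong (_% 8) (+-comm (a * 8) k)) (trans ([m+kn]%n≡m%n k a 8) (m<n⇒m%n≡m k<8))

address-injective : ∀ n {k i k′ i′} → k < 8 → k′ < 8 →
                    address n k i ≡ address n k′ i′ → k ≡ k′ × i ≡ i′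
address-injective n {k} {i} {k′} {i′} p p′ eq with k≡k′
  where
  k≡k′ : k ≡ k′
  k≡k′ = trans (sym (remainder-unique {i + 1 + n} p))
               (trans (cong (_% 8) eq) (remainder-unique {i′ + 1 + n} p′))
... | refl = refl ,
  +-cancelʳ-≡ 1 i i′ (+-cancelʳ-≡ n (i + 1) (i′ + 1)
    (*-cancelʳ-≡ (i + 1 + n) (i′ + 1 + n) 8 (+-cancelʳ-≡ k _ _ eq)))

n<address : ∀ n k i → n < address n k i
n<address n k i = begin-strict
  n                   <⟨ n<1+n n ⟩
  1 + n               ≤⟨ +-monoˡ-≤ n (m≤n+m 1 i) ⟩
  i + 1 + n           ≤⟨ m≤m*n (i + 1 + n) 8 ⟩
  (i + 1 + n) * 8     ≤⟨ m≤m+n _ k ⟩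
  (i + 1 + n) * 8 + k ∎
  where open ≤-Reasoning

record Rel (n : ℕ) (s : St) (ρ μ : ℕ → ℕ) : Set where
  constructor rel
  field
    vars : ∀ r → r < 64 → ρ r ≡ env s r
    ios  : ∀ i → i ≤ n → μ i ≡ io s i
    arrs : ∀ k i → k < 8 → μ (address n k i) ≡ arr s k i
    size-reg : env s 0 ≡ n
open Rel

module _ {W n : ℕ} {limit : Kind → ℕ} (2≤W : 2 ≤ W) where
  open Execution W n limit

  private
    instance
      W≢0 : NonZero W
      W≢0 = >-nonZero (<-≤-trans z<s 2≤W)

  size>0 : ∀ e → 0 < size e
  size>0 (lit k)      = z<s
  size>0 (var r)      = z<s
  size>0 (bin op a b) = <-≤-trans (size>0 a) (m≤m+n (size a) (size b))
  size>0 (at k e)     = <-≤-trans (size>0 e) (m≤m+n (size e) 6)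

  sizeCmd>0 : ∀ c → 0 < sizeCmd c
  sizeCmd>0 (r ⇐ e)       = size>0 e
  sizeCmd>0 (k ⟨ e ⟩⇐ f)  = <-≤-trans (size>0 f) (m≤n⊔m (size (at 0 e)) (size f))
  sizeCmd>0 (get r e)     = size>0 e
  sizeCmd>0 (put e f)     = <-≤-trans (size>0 f) (m≤n⊔m (size e) (size f))
  sizeCmd>0 (c ⨾ d)       = <-≤-trans (sizeCmd>0 d) (m≤n⊔m (sizeCmd c) (sizeCmd d))
  sizeCmd>0 (for k r b c) = sizeCmd>0 c

  2≤W^ : ∀ {i} → 0 < i → 2 ≤ W ^ i
  2≤W^ {suc i} _ = ≤-trans 2≤W (subst (_≤ W ^ suc i) (^-identityʳ W) (^-monoʳ-≤ W {1} {suc i} (s≤s z≤n)))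

  n<2^n : ∀ k → k < 2 ^ k
  n<2^n zero    = z<s
  n<2^n (suc k) = begin-strict
    suc k           <⟨ s<s (n<2^n k) ⟩
    suc (2 ^ k)     ≤⟨ +-mono-≤ (m^n>0 2 k) (m≤m+n (2 ^ k) 0) ⟩
    2 ^ k + (2 ^ k + 0) ∎
    where open ≤-Reasoning

  m+n≤m*n : ∀ {a b} → 2 ≤ a → 2 ≤ b → a + b ≤ a * b
  m+n≤m*n {suc (suc u)} {suc (suc v)} (s≤s (s≤s _)) (s≤s (s≤s _)) =
    ≤-trans (m≤m+n _ (u * v + u + v)) (≤-reflexive (lemma u v))
    where
    lemma : ∀ u v → 2 + u + (2 + v) + (u * v + u + v) ≡ (2 + u) * (2 + v)
    lemma = solve-∀

  -- As both bounds are at least 2, their product dominates their sum. So a single rule, adding the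
  -- exponents of W, covers all four operations.
  op-≤ : ∀ op {a b x y} → a ≤ x → b ≤ y → 2 ≤ x → 2 ≤ y → ⟦ op ⟧ a b ≤ x * y
  op-≤ add p q u v = ≤-trans (+-mono-≤ p q) (m+n≤m*n u v)
  op-≤ sub {a} {b} {x} {y} p q u v =
    ≤-trans (m∸n≤m a b) (≤-trans p (m≤m*n x y {{>-nonZero (<-≤-trans z<s v)}}))
  op-≤ mul p q u v = *-mono-≤ p q
  op-≤ div {b = zero} p q u v = z≤n
  op-≤ div {a} {suc b} {x} {y} p q u v =
    ≤-trans (m/n≤m a (suc b)) (≤-trans p (m≤m*n x y {{>-nonZero (<-≤-trans z<s v)}}))

  eval-≤ : ∀ e {s} → Bounded s → eval e s ≤ W ^ size e
  eval-≤ (lit k) bd = begin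
    k           ≤⟨ n≤1+n k ⟩
    suc k       ≤⟨ <⇒≤ (n<2^n (suc k)) ⟩
    2 ^ suc k   ≤⟨ ^-monoˡ-≤ (suc k) 2≤W ⟩
    W ^ suc k   ∎
    where open ≤-Reasoning
  eval-≤ (var r) bd = subst (_ ≤_) (sym (^-identityʳ W)) (envB bd r)
  eval-≤ (bin op a b) bd =
    subst (_ ≤_) (sym (^-distribˡ-+-* W (size a) (size b)))
      (op-≤ op (eval-≤ a bd) (eval-≤ b bd) (2≤W^ (size>0 a)) (2≤W^ (size>0 b)))
  eval-≤ (at k e) {s} bd = ≤-trans (arrB bd k (eval e s))
    (subst (_≤ W ^ size (at k e)) (^-identityʳ W)
      (^-monoʳ-≤ W {1} {size (at k e)} (size>0 (at k e))))

  -- This is the origin of the 6 in `size (at k e)`: the address is at most 32 · W ^ size e · W, and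
  -- 32 = 2^5 ≤ W^5. The second half covers the constant 8 loaded by `arrayAddress`.
  address-≤ : ∀ e {s} k → Bounded s → env s 0 ≡ n → k < 8 →
              address n k (eval e s) ≤ W ^ (size e + 6) × 8 ≤ W ^ (size e + 6)
  address-≤ e {s} k bd n≡ k<8 = bound , ≤-trans (m≤m*n 8 (A * W) {{m*n≢0 A W {{m^n≢0 W (size e)}}}})
      (≤-trans (*-monoˡ-≤ (A * W) {8} {32} (m≤m+n 8 24)) upper)
    where
    open ≤-Reasoning
    A = W ^ size e
    upper : 32 * (A * W) ≤ W ^ (size e + 6)
    upper = begin
      2 ^ 5 * (A * W)  ≤⟨ *-monoˡ-≤ (A * W) (^-monoˡ-≤ 5 2≤W) ⟩
      W ^ 5 * (A * W)  ≡⟨ *-comm (W ^ 5) (A * W) ⟩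
      A * W * W ^ 5    ≡⟨ *-assoc A W (W ^ 5) ⟩
      A * W ^ 6        ≡⟨ ^-distribˡ-+-* W (size e) 6 ⟨
      W ^ (size e + 6) ∎
    instance
      A≢0 : NonZero A
      A≢0 = m^n≢0 W (size e)
    A≤ : A ≤ A * W
    A≤ = m≤m*n A W
    1≤ : 1 ≤ A * W
    1≤ = ≤-trans (m^n>0 W (size e)) A≤
    W≤ : W ≤ A * W
    W≤ = m≤n*m W A {{m^n≢0 W (size e)}}
    bound : address n k (eval e s) ≤ W ^ (size e + 6)
    bound = begin
      (eval e s + 1 + n) * 8 + k             ≤⟨ +-mono-≤
          (*-monoˡ-≤ 8 (+-mono-≤ (+-mono-≤ (≤-trans (eval-≤ e bd) A≤) 1≤)
                                                  (≤-trans (subst (_≤ W) n≡ (envB bd 0)) W≤)))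
                                                  (≤-trans (<⇒≤ k<8) (m≤m*n 8 (A * W) {{>-nonZero 1≤}})) ⟩
      (A * W + A * W + A * W) * 8 + 8 * (A * W) ≡⟨ lemma (A * W) ⟩
      32 * (A * W)                           ≤⟨ upper ⟩
      W ^ (size e + 6) ∎
      where
      lemma : ∀ a → (a + a + a) * 8 + 8 * a ≡ 32 * a
      lemma = solve-∀

  Runs : Program → ℕ → List Instr → Label → (ℕ → ℕ) → (ℕ → ℕ) → (ℕ → ℕ) → (ℕ → ℕ) → Set
  Runs P B is l ρ μ ρ′ μ′ =
    Reach P B (state l ρ μ) (length is) (state (length is + l) ρ′ μ′)

  module _ {P : Program} {B : ℕ} where

    ExpRun : List Instr → Reg → Label → (ℕ → ℕ) → (ℕ → ℕ) → ℕ → Set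
    ExpRun is d l ρ μ v = ∃ λ ρ′ → Runs P B is l ρ μ ρ′ μ × ρ′ d ≡ v × (∀ r → r < d → ρ′ r ≡ ρ r)

    runs-++ : ∀ is {js l ρ μ ρ′ μ′ ρ″ μ″} → Runs P B is l ρ μ ρ′ μ′ →
              Runs P B js (length is + l) ρ′ μ′ ρ″ μ″ → Runs P B (is ++ js) l ρ μ ρ″ μ″
    runs-++ is {js} {l} {ρ} {μ} {_} {_} {ρ″} {μ″} p q =
      subst₂ (λ T l′ → Reach P B (state l ρ μ) T (state l′ ρ″ μ″))
        (sym (length-++ is)) eq (p ⟫ q)
      where
      eq : length js + (length is + l) ≡ length (is ++ js) + l
      eq rewrite length-++ is {js} = lemma (length is) (length js) l
        where lemma : ∀ a b c → b + (a + c) ≡ a + b + c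
              lemma = solve-∀

    runs-address : ∀ k d {l ρ μ} → CodeAt P l (arrayAddress k d) → 64 ≤ d → k < 8 → ρ 0 ≡ n →
                   address n k (ρ d) ≤ B → 8 ≤ B →
                   ExpRun (arrayAddress k d) d l ρ μ (address n k (ρ d))
    runs-address k d {l} {ρ} {μ} (c₁ ∷ᶜ c₂ ∷ᶜ c₃ ∷ᶜ c₄ ∷ᶜ c₅ ∷ᶜ c₆ ∷ᶜ c₇ ∷ᶜ []ᶜ) 64≤d k<8 ρ0 a≤B 8≤B =
      ρ₇ , (reach-const {ρ = ρ} c₁ (≤-trans (m≤m+n 1 7) 8≤B) ⟫
            reach-arith {ρ = ρ₁} {op = add} {a = d} {b = suc d} c₂ (b e₂ (m≤m+n _ n)) ⟫
            reach-arith {ρ = ρ₂} {op = add} {a = d} {b = 0} c₃ (b e₃ ≤-refl) ⟫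
            reach-const {ρ = ρ₃} c₄ 8≤B ⟫
            reach-arith {ρ = ρ₄} {op = mul} {a = d} {b = suc d} c₅
              (≤-trans (≤-reflexive e₅) (≤-trans (m≤m+n _ k) a≤B)) ⟫
            reach-const {ρ = ρ₅} c₆ (≤-trans (<⇒≤ k<8) 8≤B) ⟫
            reach-arith {ρ = ρ₆} {op = add} {a = d} {b = suc d} c₇ (≤-trans (≤-reflexive e₇) a≤B)) ,
      trans (set-same ρ₆ d v₇) e₇ , other
      where
      ρ₁ = ρ [ suc d ≔ 1 ]
      ρ₂ = ρ₁ [ d ≔ ⟦ add ⟧ (ρ₁ d) (ρ₁ (suc d)) ]
      ρ₃ = ρ₂ [ d ≔ ⟦ add ⟧ (ρ₂ d) (ρ₂ 0) ]
      ρ₄ = ρ₃ [ suc d ≔ 8 ]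
      ρ₅ = ρ₄ [ d ≔ ⟦ mul ⟧ (ρ₄ d) (ρ₄ (suc d)) ]
      ρ₆ = ρ₅ [ suc d ≔ k ]
      ρ₇ = ρ₆ [ d ≔ ⟦ add ⟧ (ρ₆ d) (ρ₆ (suc d)) ]
      v₂ = ⟦ add ⟧ (ρ₁ d) (ρ₁ (suc d))
      v₃ = ⟦ add ⟧ (ρ₂ d) (ρ₂ 0)
      v₅ = ⟦ mul ⟧ (ρ₄ d) (ρ₄ (suc d))
      v₇ = ⟦ add ⟧ (ρ₆ d) (ρ₆ (suc d))
      d≢0 : d ≢ 0
      d≢0 refl = contradiction 64≤d λ ()
      e₂ : ρ₁ d + ρ₁ (suc d) ≡ ρ d + 1
      e₂ = cong₂ _+_ (set-other ρ 1 1+n≢n) (set-same ρ (suc d) 1)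
      e₃ : ρ₂ d + ρ₂ 0 ≡ ρ d + 1 + n
      e₃ = cong₂ _+_ (trans (set-same ρ₁ d v₂) e₂)
                     (trans (set-other ρ₁ v₂ d≢0) (trans (set-other ρ {suc d} {0} 1 1+n≢0) ρ0))
      e₅ : ρ₄ d * ρ₄ (suc d) ≡ (ρ d + 1 + n) * 8
      e₅ = cong₂ _*_ (trans (set-other ρ₃ 8 1+n≢n) (trans (set-same ρ₂ d v₃) e₃)) (set-same ρ₃ (suc d) 8)
      e₇ : ρ₆ d + ρ₆ (suc d) ≡ address n k (ρ d)
      e₇ = cong₂ _+_ (trans (set-other ρ₅ k 1+n≢n) (trans (set-same ρ₄ d v₅) e₅)) (set-same ρ₅ (suc d) k)
      b : ∀ {x y} → x ≡ y → y ≤ ρ d + 1 + n → x ≤ B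
      b refl q = ≤-trans q (≤-trans (m≤m*n (ρ d + 1 + n) 8) (≤-trans (m≤m+n _ k) a≤B))
      other : ∀ r → r < d → ρ₇ r ≡ ρ r
      other r r<d =
        trans (set-other ρ₆ v₇ d≢r) (trans (set-other ρ₅ k sd≢r) (trans (set-other ρ₄ v₅ d≢r)
          (trans (set-other ρ₃ 8 sd≢r) (trans (set-other ρ₂ v₃ d≢r) (trans (set-other ρ₁ v₂ d≢r)
            (set-other ρ 1 sd≢r))))))
        where
        d≢r : d ≢ r
        d≢r refl = n≮n d r<d
        sd≢r : suc d ≢ r
        sd≢r refl = n≮n d (<-trans (n<1+n d) r<d)

    -- The registers from `d` on serve as an evaluation stack. Since nothing below `d` is changed,
    -- the left operand in `d` survives the evaluation of the right one, which starts at `suc d`.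
    runs-exp : ∀ e d {l s ρ μ} → CodeAt P l (compileExp e d) → wfExp e ≡ true → 64 ≤ d →
               Rel n s ρ μ → Bounded s → W ^ size e ≤ B →
               ExpRun (compileExp e d) d l ρ μ (eval e s)
    runs-exp (lit k) d {s = s} {ρ} (c ∷ᶜ []ᶜ) _ _ _ bd q =
      ρ [ d ≔ k ] , reach-const c (≤-trans (eval-≤ (lit k) bd) q) , set-same ρ d k ,
      λ r r<d → set-other ρ k (≢-sym (<⇒≢ r<d))
    runs-exp (var x) d {s = s} {ρ} (c₁ ∷ᶜ c₂ ∷ᶜ []ᶜ) wf 64≤d R bd q =
      ρ₂ , (reach-const {ρ = ρ} {r = d} c₁ z≤n ⟫
            reach-arith {ρ = ρ₁} {op = add} {a = x} {b = d} c₂ (≤-trans (≤-reflexive e)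
                (≤-trans (eval-≤ (var x) bd) q))) ,
      trans (set-same ρ₁ d v) e ,
      λ r r<d → trans (set-other ρ₁ v (≢-sym (<⇒≢ r<d))) (set-other ρ 0 (≢-sym (<⇒≢ r<d)))
      where
      ρ₁ = ρ [ d ≔ 0 ]
      v = ⟦ add ⟧ (ρ₁ x) (ρ₁ d)
      ρ₂ = ρ₁ [ d ≔ v ]
      x<64 = <ᵇ-true {x} wf
      e : ρ₁ x + ρ₁ d ≡ env s x
      e = trans (cong₂ _+_ (trans (set-other ρ 0 (≢-sym (<⇒≢ (<-≤-trans x<64 64≤d)))) (vars R x x<64))
                           (set-same ρ d 0)) (+-identityʳ _)
    runs-exp (bin op a b) d {l} {s} {ρ} {μ} c wf 64≤d R bd q
      with ∧-true {wfExp a} wf | codeAt-++ l (compileExp a d) c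
    ... | wa , wb | ca , cbo with codeAt-++ _ (compileExp b (suc d)) cbo
    ... | cb , co ∷ᶜ []ᶜ
      with runs-exp a d ca wa 64≤d R bd (≤-trans (^-monoʳ-≤ W (m≤m+n (size a) (size b))) q)
    ... | ρ₁ , run₁ , v₁ , same₁
      with runs-exp b (suc d) {ρ = ρ₁} {μ} cb wb (m≤n⇒m≤1+n 64≤d)
             (rel (λ r p → trans (same₁ r (<-≤-trans p 64≤d)) (vars R r p)) (ios R) (arrs R) (size-reg R))
             bd (≤-trans (^-monoʳ-≤ W (m≤n+m (size b) (size a))) q)
    ... | ρ₂ , run₂ , v₂ , same₂ =
      ρ₂ [ d ≔ ⟦ op ⟧ (ρ₂ d) (ρ₂ (suc d)) ] ,
      runs-++ (compileExp a d) run₁ (runs-++ (compileExp b (suc d)) run₂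
        (reach-arith {ρ = ρ₂} {op = op} {a = d} {b = suc d} co (≤-trans (≤-reflexive e)
            (≤-trans (eval-≤ (bin op a b) bd) q)))) ,
      trans (set-same ρ₂ d v) e ,
      λ r r<d → trans (set-other ρ₂ v (≢-sym (<⇒≢ r<d)))
                  (trans (same₂ r (<-trans r<d (n<1+n d))) (same₁ r r<d))
      where
      v = ⟦ op ⟧ (ρ₂ d) (ρ₂ (suc d))
      e : ⟦ op ⟧ (ρ₂ d) (ρ₂ (suc d)) ≡ ⟦ op ⟧ (eval a s) (eval b s)
      e = cong₂ ⟦ op ⟧ (trans (same₂ d (n<1+n d)) v₁) v₂
    runs-exp (at k e) d {l} {s} {ρ} {μ} c wf 64≤d R bd q = finish
      (proj₁ rest) (proj₂ rest)
      (runs-exp e d (proj₁ split) (proj₂ (∧-true {k <ᵇ 8} wf)) 64≤d R bd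
        (≤-trans (^-monoʳ-≤ W (m≤m+n (size e) 6)) q))
      where
      k<8 = <ᵇ-true {k} (proj₁ (∧-true wf))
      split = codeAt-++ l (compileExp e d) c
      l₁ = length (compileExp e d) + l
      rest = codeAt-++ l₁ (arrayAddress k d) (proj₂ split)
      aB : address n k (eval e s) ≤ B
      aB = ≤-trans (proj₁ (address-≤ e k bd (size-reg R) k<8)) q
      8B : 8 ≤ B
      8B = ≤-trans (proj₂ (address-≤ e k bd (size-reg R) k<8)) q
      finish : CodeAt P l₁ (arrayAddress k d) → CodeAt P (7 + l₁) (load d d ∷ []) →
        ExpRun (compileExp e d) d l ρ μ (eval e s) →
        ExpRun (compileExp (at k e) d) d l ρ μ (eval (at k e) s)
      finish ca (cl ∷ᶜ []ᶜ) (ρ₁ , run₁ , v₁ , same₁) = finish′ (runs-address k d {ρ = ρ₁} {μ} ca 64≤d k<8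
             (trans (same₁ 0 (<-≤-trans z<s 64≤d)) (trans (vars R 0 z<s) (size-reg R)))
             (≤-trans (≤-reflexive (cong (address n k) v₁)) aB) 8B)
        where
        finish′ : ExpRun (arrayAddress k d) d l₁ ρ₁ μ (address n k (ρ₁ d)) →
          ExpRun (compileExp (at k e) d) d l ρ μ (eval (at k e) s)
        finish′ (ρ₂ , run₂ , v₂ , same₂) =
          ρ₂ [ d ≔ μ (ρ₂ d) ] ,
          runs-++ (compileExp e d) run₁ (runs-++ (arrayAddress k d) {load d d ∷ []} run₂
            (reach-load {ρ = ρ₂} {μ} {a = d} cl (≤-trans (≤-reflexive eq) (≤-trans (eval-≤ (at k e) bd) q))))
                ,
          trans (set-same ρ₂ d (μ (ρ₂ d))) eq ,
          λ r r<d → trans (set-other ρ₂ (μ (ρ₂ d)) (≢-sym (<⇒≢ r<d))) (trans (same₂ r r<d) (same₁ r r<d))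
          where
          eq : μ (ρ₂ d) ≡ arr s k (eval e s)
          eq = trans (cong μ (trans v₂ (cong (address n k) v₁))) (arrs R k (eval e s) k<8)

    rel-same : ∀ {s ρ ρ′ μ} → (∀ r → r < 64 → ρ′ r ≡ ρ r) → Rel n s ρ μ → Rel n s ρ′ μ
    rel-same q R = rel (λ r p → trans (q r p) (vars R r p)) (ios R) (arrs R) (size-reg R)

    set-cong : ∀ (f g : ℕ → ℕ) {v w} a x → v ≡ w → f x ≡ g x → (f [ a ≔ v ]) x ≡ (g [ a ≔ w ]) x
    set-cong f g a x p q with a ≡ᵇ x
    ... | true  = p
    ... | false = q

    rel-setVar : ∀ {s ρ μ v w} r → 0 < r → v ≡ w → Rel n s ρ μ → Rel n (setVar s r w) (ρ [ r ≔ v ]) μ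
    rel-setVar {s} {ρ} {w = w} r 0<r e R =
      rel (λ x p → set-cong ρ (env s) r x e (vars R x p)) (ios R) (arrs R)
          (trans (set-other (env s) w (≢-sym (<⇒≢ 0<r))) (size-reg R))

    rel-scratch : ∀ {s ρ μ v} r → 64 ≤ r → Rel n s ρ μ → Rel n s (ρ [ r ≔ v ]) μ
    rel-scratch {ρ = ρ} {v = v} r q =
      rel-same (λ x p → set-other ρ v (≢-sym (<⇒≢ (<-≤-trans p q))))

    rel-setIO : ∀ {s ρ μ a b v w} → a ≡ b → b ≤ n → v ≡ w → Rel n s ρ μ →
                Rel n (setIO s b w) ρ (μ [ a ≔ v ])
    rel-setIO {s} {ρ} {μ} {a} {v = v} refl b≤n e R =
      rel (vars R) (λ i p → set-cong μ (io s) a i e (ios R i p))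
          (λ k i p → trans (set-other μ v (<⇒≢ (≤-<-trans b≤n (n<address n k i)))) (arrs R k i p))
          (size-reg R)

    rel-setArr : ∀ {s ρ μ k a j v w} → a ≡ address n k j → k < 8 → v ≡ w → Rel n s ρ μ →
                 Rel n (setArr s k j w) ρ (μ [ a ≔ v ])
    rel-setArr {s} {ρ} {μ} {k} {j = j} {v} {w} refl k<8 refl R =
      rel (vars R)
          (λ i p → trans (set-other μ v (≢-sym (<⇒≢ (≤-<-trans p (n<address n k j))))) (ios R i p))
          arrs′ (size-reg R)
      where
      arrs′ : ∀ l i → l < 8 → (μ [ address n k j ≔ v ]) (address n l i) ≡ updateArr (arr s) k j v l i
      arrs′ l i l<8 with k ≟ l | j ≟ i
      ... | yes refl | yes refl rewrite ≡ᵇ-refl k | ≡ᵇ-refl j = set-same μ (address n k j) v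
      ... | yes refl | no q rewrite ≡ᵇ-refl k | ≢⇒≡ᵇ q =
        trans (set-other μ v (λ z → q (proj₂ (address-injective n {i = j} {k} {i} k<8 l<8 z))))
            (arrs R k i l<8)
      ... | no q | _ rewrite ≢⇒≡ᵇ q =
        trans (set-other μ v (λ z → q (proj₁ (address-injective n {i = j} {l} {i} k<8 l<8 z))))
            (arrs R l i l<8)

    record CmdRun (is : List Instr) (bound : ℕ) (l : Label) (s′ : St) (ρ μ : ℕ → ℕ) : Set where
      constructor cmdRun
      field
        {ρ′ μ′} : ℕ → ℕ
        {time}  : ℕ
        run     : Reach P B (state l ρ μ) time (state (length is + l) ρ′ μ′)
        time≤   : time ≤ bound
        related : Rel n s′ ρ′ μ′
    open CmdRun

    BasicRun : Cmd → Label → St → (ℕ → ℕ) → (ℕ → ℕ) → Set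
    BasicRun c l = CmdRun (compile c l) (length (compile c 0)) l

    wfReg⇒ : ∀ {r} → wfReg r ≡ true → 0 < r × r < 64
    wfReg⇒ {r} p with ∧-true {0 <ᵇ r} p
    ... | a , b = <ᵇ-true a , <ᵇ-true {r} b

    run-assign : ∀ {r e s l ρ μ} → wf (r ⇐ e) ≡ true → CodeAt P l (compile (r ⇐ e) l) →
                 Rel n s ρ μ → Bounded s → W ^ size e ≤ B →
                 BasicRun (r ⇐ e) l (setVar s r (eval e s)) ρ μ
    run-assign {r} {e} {s} {l} {ρ} {μ} w c R bd q = finish (proj₂ split)
        (runs-exp e 64 {ρ = ρ} {μ} (proj₁ split) (proj₂ w′) ≤-refl R bd q)
      where
      w′ = ∧-true {wfReg r} w
      split = codeAt-++ l (compileExp e 64) c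
      finish : CodeAt P (length (compileExp e 64) + l) (const 65 0 ∷ arith add r 64 65 ∷ []) →
        ExpRun (compileExp e 64) 64 l ρ μ (eval e s) →
        BasicRun (r ⇐ e) l (setVar s r (eval e s)) ρ μ
      finish (c₁ ∷ᶜ c₂ ∷ᶜ []ᶜ) (ρ₁ , run₁ , v₁ , same₁) = cmdRun
        (runs-++ (compileExp e 64) run₁
          (reach-const {ρ = ρ₁} {r = 65} c₁ z≤n ⟫
           reach-arith {ρ = ρ₁ [ 65 ≔ 0 ]} {op = add} {r = r} {a = 64} {b = 65} c₂
             (≤-trans (≤-reflexive eq) (≤-trans (eval-≤ e bd) q))))
        ≤-refl
        (rel-setVar {ρ = ρ₁ [ 65 ≔ 0 ]} r (proj₁ (wfReg⇒ (proj₁ w′))) eq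
          (rel-scratch 65 (n≤1+n 64) (rel-same same₁ R)))
        where
        eq : ρ₁ 64 + 0 ≡ eval e s
        eq = trans (+-identityʳ (ρ₁ 64)) v₁

    run-get : ∀ {r e s l ρ μ} → wf (get r e) ≡ true → CodeAt P l (compile (get r e) l) →
              Rel n s ρ μ → Bounded s → W ^ size e ≤ B → eval e s ≤ n →
              BasicRun (get r e) l (setVar s r (io s (eval e s))) ρ μ
    run-get {r} {e} {s} {l} {ρ} {μ} w c R bd q i≤n = finish (proj₂ split)
        (runs-exp e 64 {ρ = ρ} {μ} (proj₁ split) (proj₂ w′) ≤-refl R bd q)
      where
      w′ = ∧-true {wfReg r} w
      split = codeAt-++ l (compileExp e 64) c
      finish : CodeAt P (length (compileExp e 64) + l) (load r 64 ∷ []) →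
        ExpRun (compileExp e 64) 64 l ρ μ (eval e s) →
        BasicRun (get r e) l (setVar s r (io s (eval e s))) ρ μ
      finish (c₁ ∷ᶜ []ᶜ) (ρ₁ , run₁ , v₁ , same₁) = cmdRun
        (runs-++ (compileExp e 64) run₁ (reach-load {ρ = ρ₁} {μ} {r = r} {a = 64} c₁ fits))
        ≤-refl
        (rel-setVar {ρ = ρ₁} r (proj₁ (wfReg⇒ (proj₁ w′))) eq (rel-same same₁ R))
        where
        eq : μ (ρ₁ 64) ≡ io s (eval e s)
        eq = trans (cong μ v₁) (ios R (eval e s) i≤n)
        fits : μ (ρ₁ 64) ≤ B
        fits = ≤-trans (≤-reflexive eq) (≤-trans (ioB bd (eval e s))
                 (≤-trans (subst (_≤ W ^ size e) (^-identityʳ W) (^-monoʳ-≤ W {1} {size e} (size>0 e))) q))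

    run-put : ∀ {e f s l ρ μ} → wf (put e f) ≡ true → CodeAt P l (compile (put e f) l) →
              Rel n s ρ μ → Bounded s → W ^ size e ≤ B → W ^ size f ≤ B → eval e s ≤ n →
              BasicRun (put e f) l (setIO s (eval e s) (eval f s)) ρ μ
    run-put {e} {f} {s} {l} {ρ} {μ} w c R bd q q′ i≤n =
        step₁ (runs-exp e 64 {ρ = ρ} {μ} (proj₁ split) (proj₁ w′) ≤-refl R bd q)
      where
      w′ = ∧-true {wfExp e} w
      split = codeAt-++ l (compileExp e 64) c
      l₁ = length (compileExp e 64) + l
      split₂ = codeAt-++ l₁ (compileExp f 65) (proj₂ split)
      Goal = BasicRun (put e f) l (setIO s (eval e s) (eval f s)) ρ μ
      step₁ : ExpRun (compileExp e 64) 64 l ρ μ (eval e s) → Goal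
      step₁ (ρ₁ , run₁ , v₁ , same₁) =
          step₂ (proj₂ split₂) (runs-exp f 65 {ρ = ρ₁} {μ} (proj₁ split₂) (proj₂ w′) (n≤1+n 64)
              (rel-same same₁ R) bd q′)
        where
        step₂ : CodeAt P (length (compileExp f 65) + l₁) (store 64 65 ∷ []) →
                ExpRun (compileExp f 65) 65 l₁ ρ₁ μ (eval f s) → Goal
        step₂ (c₁ ∷ᶜ []ᶜ) (ρ₂ , run₂ , v₂ , same₂) = cmdRun
          (runs-++ (compileExp e 64) run₁ (runs-++ (compileExp f 65) {store 64 65 ∷ []} run₂
            (reach-exec c₁ refl)))
          ≤-refl
          (rel-setIO {a = ρ₂ 64} (trans (same₂ 64 ≤-refl) v₁) i≤n v₂
            (rel-same (λ r p → trans (same₂ r (m≤n⇒m≤1+n p)) (same₁ r p)) R))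

    run-write : ∀ {k e f s l ρ μ} → wf (k ⟨ e ⟩⇐ f) ≡ true → CodeAt P l (compile (k ⟨ e ⟩⇐ f) l) →
                Rel n s ρ μ → Bounded s → W ^ size (at 0 e) ≤ B → W ^ size f ≤ B →
                BasicRun (k ⟨ e ⟩⇐ f) l (setArr s k (eval e s) (eval f s)) ρ μ
    run-write {k} {e} {f} {s} {l} {ρ} {μ} w c R bd q q′ =
        step₁ (runs-exp e 64 {ρ = ρ} {μ} (proj₁ split) (proj₁ w″) ≤-refl R bd
                 (≤-trans (^-monoʳ-≤ W (m≤m+n (size e) 6)) q))
      where
      w′ = ∧-true {k <ᵇ 8} w
      w″ = ∧-true {wfExp e} (proj₂ w′)
      k<8 : k < 8
      k<8 = <ᵇ-true {k} (proj₁ w′)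
      split = codeAt-++ l (compileExp e 64) c
      l₁ = length (compileExp e 64) + l
      split₂ = codeAt-++ l₁ (arrayAddress k 64) (proj₂ split)
      split₃ = codeAt-++ (7 + l₁) (compileExp f 65) (proj₂ split₂)
      Goal = BasicRun (k ⟨ e ⟩⇐ f) l (setArr s k (eval e s) (eval f s)) ρ μ
      step₁ : ExpRun (compileExp e 64) 64 l ρ μ (eval e s) → Goal
      step₁ (ρ₁ , run₁ , v₁ , same₁) =
          step₂ (runs-address k 64 {ρ = ρ₁} {μ} (proj₁ split₂) ≤-refl k<8
            (trans (same₁ 0 z<s) (trans (vars R 0 z<s) (size-reg R)))
            (≤-trans (≤-reflexive (cong (address n k) v₁))
                (≤-trans (proj₁ (address-≤ e k bd (size-reg R) k<8)) q))
            (≤-trans (proj₂ (address-≤ e k bd (size-reg R) k<8)) q))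
        where
        step₂ : ExpRun (arrayAddress k 64) 64 l₁ ρ₁ μ (address n k (ρ₁ 64)) → Goal
        step₂ (ρ₂ , run₂ , v₂ , same₂) =
            step₃ (proj₂ split₃) (runs-exp f 65 {ρ = ρ₂} {μ} (proj₁ split₃) (proj₂ w″) (n≤1+n 64)
              (rel-same (λ r p → trans (same₂ r p) (same₁ r p)) R) bd q′)
          where
          step₃ : CodeAt P (length (compileExp f 65) + (7 + l₁)) (store 64 65 ∷ []) →
                  ExpRun (compileExp f 65) 65 (7 + l₁) ρ₂ μ (eval f s) → Goal
          step₃ (c₁ ∷ᶜ []ᶜ) (ρ₃ , run₃ , v₃ , same₃) = cmdRun
            (runs-++ (compileExp e 64) run₁ (runs-++ (arrayAddress k 64) {compileExp f 65 ++ store 64 65 ∷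
                []} run₂
              (runs-++ (compileExp f 65) {store 64 65 ∷ []} run₃ (reach-exec c₁ refl))))
            ≤-refl
            (rel-setArr {k = k} {a = ρ₃ 64} {j = eval e s} (trans (same₃ 64 ≤-refl)
                (trans v₂ (cong (address n k) v₁))) k<8 v₃
              (rel-same (λ r p → trans (same₃ r (m≤n⇒m≤1+n p)) (trans (same₂ r p) (same₁ r p))) R))

    record LoopRun (c : Cmd) (j : ℕ) (l : Label) (s′ : St) (ρ μ : ℕ → ℕ) : Set where
      constructor loopRun
      field
        {ρ′ μ′} : ℕ → ℕ
        {time}  : ℕ
        run     : Reach P B (state (1 + l) ρ μ) time (state (length (compile c (3 + l)) + (6 + l)) ρ′ μ′)
        time≤   : time ≤ 2 + j * (5 + cost limit c)
        related : Rel n s′ ρ′ μ′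

    mutual
      run-cmd : ∀ {c s s′ l ρ μ} → Exec c s s′ → wf c ≡ true → CodeAt P l (compile c l) →
                Rel n s ρ μ → Bounded s → W ^ sizeCmd c ≤ B →
                CmdRun (compile c l) (cost limit c) l s′ ρ μ
      run-cmd (assign {r = r} {e} _) w c R bd q = run-assign {r} {e} w c R bd q
      run-cmd (read {r = r} {e} i) w c R bd q = run-get {r} {e} w c R bd q i
      run-cmd (emit {e = e} {f} i _) w c R bd q =
        run-put {e} {f} w c R bd (≤-trans (^-monoʳ-≤ W (m≤m⊔n (size e) (size f))) q)
          (≤-trans (^-monoʳ-≤ W (m≤n⊔m (size e) (size f))) q) i
      run-cmd (write {k = k} {e} {f} _) w c R bd q =
        run-write {k} {e} {f} w c R bd
          (≤-trans (^-monoʳ-≤ W (m≤m⊔n (size (at 0 e)) (size f))) q)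
          (≤-trans (^-monoʳ-≤ W (m≤n⊔m (size (at 0 e)) (size f))) q)
      run-cmd {c ⨾ d} {s} {s″} {l} {ρ} {μ} (_then_ {s′ = s′} x y) w code R bd q =
          continue (run-cmd x (proj₁ w′) (proj₁ split) R bd
              (≤-trans (^-monoʳ-≤ W (m≤m⊔n (sizeCmd c) (sizeCmd d))) q))
        where
        w′ = ∧-true {wf c} w
        is = compile c l
        split = codeAt-++ l is code
        l′≡ : l + length is ≡ length is + l
        l′≡ = +-comm l (length is)
        js = compile d (l + length is)
        continue : CmdRun is (cost limit c) l s′ ρ μ →
                   CmdRun (compile (c ⨾ d) l) (cost limit (c ⨾ d)) l s″ ρ μ
        continue (cmdRun {ρ₁} {μ₁} {T₁} run₁ t₁ R₁) =
            finish (run-cmd y (proj₂ w′) (subst (λ z → CodeAt P z js) (sym l′≡) (proj₂ split)) R₁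
                (exec-bounded x bd)
                     (≤-trans (^-monoʳ-≤ W (m≤n⊔m (sizeCmd c) (sizeCmd d))) q))
          where
          finish : CmdRun js (cost limit d) (l + length is) s″ ρ₁ μ₁ →
                   CmdRun (compile (c ⨾ d) l) (cost limit (c ⨾ d)) l s″ ρ μ
          finish (cmdRun {ρ₂} {μ₂} {T₂} run₂ t₂ R₂) = cmdRun
            (run₁ ⟫ subst₂ (λ a b → Reach P B (state a ρ₁ μ₁) T₂ (state b ρ₂ μ₂)) l′≡ end≡ run₂)
            (+-mono-≤ t₁ t₂) R₂
            where
            end≡ : length js + (l + length is) ≡ length (is ++ js) + l
            end≡ rewrite length-++ is {js} = lemma (length js) l (length is)
              where lemma : ∀ a b c → a + (b + c) ≡ c + a + b
                    lemma = solve-∀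
      run-cmd {for k r b c} {s} {s′} {l} {ρ} {μ} (repeat few L) w (c₁ ∷ᶜ c₂ ∷ᶜ c₃ ∷ᶜ code) R bd q =
          finish (run-loop {r} {b} {c} {l = l} {ρ [ r ≔ 0 ]} {μ} L (proj₁ wr) (proj₂ wr)
              (<ᵇ-true {b} (proj₁ w″)) (proj₂ w″)
                   c₂ c₃ (proj₁ split) (proj₂ split)
                   (rel-setVar {ρ = ρ} r (proj₁ wr) refl R)
                   (setVar-bounded r bd z≤n) q)
        where
        w′ = ∧-true {wfReg r} w
        wr = wfReg⇒ {r} (proj₁ w′)
        w″ = ∧-true {b <ᵇ 64} (proj₂ w′)
        body = compile c (3 + l)
        split = codeAt-++ (3 + l) body code
        finish : LoopRun c (env s b) l s′ (ρ [ r ≔ 0 ]) μ →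
                 CmdRun (compile (for k r b c) l) (cost limit (for k r b c)) l s′ ρ μ
        finish (loopRun {ρ′} {μ′} {T} run t R′) = cmdRun
          (reach-const {ρ = ρ} {r = r} c₁ z≤n ⟫
            subst (λ z → Reach P B (state (1 + l) (ρ [ r ≔ 0 ]) μ) T (state z ρ′ μ′)) end≡ run)
          (s≤s (≤-trans t (+-monoʳ-≤ 2 (*-monoˡ-≤ (5 + cost limit c) few)))) R′
          where
          end≡ : length body + (6 + l) ≡ length (compile (for k r b c) l) + l
          end≡ rewrite length-++ body {const 64 1 ∷ arith add r r 64 ∷ jump (1 + l) ∷ []} = lemma
              (length body) l
            where lemma : ∀ a b → a + (6 + b) ≡ 3 + (a + 3) + b
                  lemma = solve-∀

      run-loop : ∀ {r b c j s s′ l ρ μ} → Loop r b c j s s′ → 0 < r → r < 64 → b < 64 → wf c ≡ true →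
                 fetch P (1 + l) ≡ just (arith sub 64 b r) →
                 fetch P (2 + l) ≡ just (jzero 64 (length (compile c (3 + l)) + (6 + l))) →
                 CodeAt P (3 + l) (compile c (3 + l)) →
                 CodeAt P (length (compile c (3 + l)) + (3 + l))
                   (const 64 1 ∷ arith add r r 64 ∷ jump (1 + l) ∷ []) →
                 Rel n s ρ μ → Bounded s → W ^ sizeCmd c ≤ B →
                 LoopRun c j l s′ ρ μ
      run-loop {r} {b} {c} {s = s} {l = l} {ρ} {μ} (done eq) 0<r r<64 b<64 w c₂ c₃ code (_ ∷ᶜ _ ∷ᶜ _ ∷ᶜ []ᶜ)
          R bd q =
        loopRun {ρ′ = ρ₁}
        (reach-arith {ρ = ρ} {op = sub} {r = 64} {a = b} {b = r} c₂ (≤-trans (≤-reflexive zero′) z≤n) ⟫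
         reach-exec c₃ (cong (λ z → just (state (if z ≡ᵇ 0 then length (compile c (3 + l)) + (6 + l) else 3 +
             l) ρ₁ μ)) zero′))
        ≤-refl (rel-scratch 64 ≤-refl R)
        where
        ρ₁ = ρ [ 64 ≔ ρ b ∸ ρ r ]
        zero′ : ρ b ∸ ρ r ≡ 0
        zero′ rewrite vars R b b<64 | vars R r r<64 | eq = n∸n≡0 (env s r)
      run-loop {r} {b} {c} {suc j} {s} {s″} {l} {ρ} {μ} (next {s′ = s′} eq x small L) 0<r r<64 b<64 w c₂ c₃
          code
        tail@(d₁ ∷ᶜ d₂ ∷ᶜ d₃ ∷ᶜ []ᶜ) R bd q =
          continue (run-cmd x w code (rel-scratch {ρ = ρ} 64 ≤-refl R) bd q)
        where
        body = compile c (3 + l)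
        end = length body + (6 + l)
        ρ₁ = ρ [ 64 ≔ ρ b ∸ ρ r ]
        diff : ρ b ∸ ρ r ≡ suc j
        diff rewrite vars R b b<64 | vars R r r<64 | eq = m+n∸m≡n (env s r) (suc j)
        continue : CmdRun body (cost limit c) (3 + l) s′ ρ₁ μ → LoopRun c (suc j) l s″ ρ μ
        continue (cmdRun {ρ₂} {μ₂} {T₂} run₂ t₂ R₂) = finish
            (run-loop {r} {b} {c} {l = l} {ρ₃ [ r ≔ ρ₃ r + ρ₃ 64 ]} {μ₂} L 0<r r<64 b<64 w c₂ c₃ code tail
              (rel-setVar {ρ = ρ₃} r 0<r inc (rel-scratch {ρ = ρ₂} 64 ≤-refl R₂))
              (setVar-bounded r (exec-bounded x bd) small) q)
          where
          ρ₃ = ρ₂ [ 64 ≔ 1 ]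
          inc : ρ₃ r + ρ₃ 64 ≡ suc (env s′ r)
          inc = trans (cong₂ _+_ (trans (set-other ρ₂ 1 (≢-sym (<⇒≢ r<64))) (vars R₂ r r<64)) refl)
                      (+-comm (env s′ r) 1)
          W≤B : W ≤ B
          W≤B = ≤-trans (subst (_≤ W ^ sizeCmd c) (^-identityʳ W) (^-monoʳ-≤ W {1} {sizeCmd c}
              (sizeCmd>0 c))) q
          finish : LoopRun c j l s″ (ρ₃ [ r ≔ ρ₃ r + ρ₃ 64 ]) μ₂ → LoopRun c (suc j) l s″ ρ μ
          finish (loopRun run t R′) = loopRun
            (reach-arith {ρ = ρ} {op = sub} {r = 64} {a = b} {b = r} c₂
               (≤-trans (m∸n≤m (ρ b) (ρ r)) (≤-trans (≤-reflexive (vars R b b<64))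
                   (≤-trans (envB bd b) W≤B))) ⟫
             reach-exec c₃ (cong (λ z → just (state (if z ≡ᵇ 0 then end else 3 + l) ρ₁ μ)) diff) ⟫
             run₂ ⟫
             reach-const {ρ = ρ₂} {r = 64} d₁ (≤-trans (≤-trans (n≤1+n 1) 2≤W) W≤B) ⟫
             reach-arith {ρ = ρ₃} {op = add} {r = r} {a = r} {b = 64} d₂
               (≤-trans (≤-reflexive inc) (≤-trans small W≤B)) ⟫
             reach-exec d₃ refl ⟫ run)
            (≤-trans (+-monoʳ-≤ 2 (+-mono-≤ t₂ (+-monoʳ-≤ 3 t)))
                     (≤-reflexive (lemma (cost limit c) (j * (5 + cost limit c)))))
            R′
            where
            lemma : ∀ a b → 2 + (a + (3 + (2 + b))) ≡ 2 + (5 + a + b)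
            lemma = solve-∀

-- Running time as a monomial in the two loop bounds

limits : ℕ → ℕ → Kind → ℕ
limits S L short = S
limits S L long  = L

-- The cost is a polynomial in S and L. It is majorised by one monomial, whose degrees are the
-- nesting depths of the two kinds of loops, maximised separately, and whose coefficient grows with
-- the length of the code only. For a concrete program all three numbers are found by evaluation.
shortDegree longDegree weight : Cmd → ℕ
shortDegree (c ⨾ d)           = shortDegree c ⊔ shortDegree d
shortDegree (for short r b c) = suc (shortDegree c)
shortDegree (for long r b c)  = shortDegree c
shortDegree _                 = 0
longDegree (c ⨾ d)           = longDegree c ⊔ longDegree d
longDegree (for short r b c) = longDegree c
longDegree (for long r b c)  = suc (longDegree c)
longDegree _                 = 0
weight (c ⨾ d)       = weight c + weight d
weight (for k r b c) = 8 + weight c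
weight c             = length (compile c 0)

module _ {S L : ℕ} (1≤S : 1 ≤ S) (1≤L : 1 ≤ L) where
  private
    instance
      S≢0 : NonZero S
      S≢0 = >-nonZero 1≤S
      L≢0 : NonZero L
      L≢0 = >-nonZero 1≤L

    scale : Cmd → ℕ
    scale c = S ^ shortDegree c * L ^ longDegree c

    1≤scale : ∀ a b → 1 ≤ S ^ a * L ^ b
    1≤scale a b = *-mono-≤ (m^n>0 S a) (m^n>0 L b)

    loop-cost : ∀ l → 1 ≤ l → ∀ {c w z} → c ≤ w * z → 1 ≤ z → 3 + l * (5 + c) ≤ (8 + w) * (l * z)
    loop-cost l 1≤l {c} {w} {z} p q = begin
      3 + l * (5 + c)           ≤⟨ +-mono-≤ (*-mono-≤ {3} ≤-refl (*-mono-≤ 1≤l q))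
                                     (*-monoʳ-≤ l (+-mono-≤ (*-mono-≤ {5} ≤-refl q) p)) ⟩
      3 * (l * z) + l * (5 * z + w * z) ≡⟨ lemma l z w ⟩
      (8 + w) * (l * z)         ∎
      where
      open ≤-Reasoning
      lemma : ∀ l z w → 3 * (l * z) + l * (5 * z + w * z) ≡ (8 + w) * (l * z)
      lemma = solve-∀

    basic-cost : ∀ w → w ≤ w * (S ^ 0 * L ^ 0)
    basic-cost w = ≤-reflexive (sym (*-identityʳ w))

  cost-≤ : ∀ c → cost (limits S L) c ≤ weight c * (S ^ shortDegree c * L ^ longDegree c)
  cost-≤ (r ⇐ e)      = basic-cost _
  cost-≤ (k ⟨ e ⟩⇐ f) = basic-cost _
  cost-≤ (get r e)    = basic-cost _
  cost-≤ (put e f)    = basic-cost _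
  cost-≤ (c ⨾ d) = begin
    cost (limits S L) c + cost (limits S L) d ≤⟨ +-mono-≤ (cost-≤ c) (cost-≤ d) ⟩
    weight c * scale c + weight d * scale d   ≤⟨ +-mono-≤
      (*-monoʳ-≤ (weight c) (*-mono-≤ (^-monoʳ-≤ S (m≤m⊔n (shortDegree c) (shortDegree d)))
          (^-monoʳ-≤ L (m≤m⊔n (longDegree c) (longDegree d)))))
      (*-monoʳ-≤ (weight d) (*-mono-≤ (^-monoʳ-≤ S (m≤n⊔m (shortDegree c) (shortDegree d)))
          (^-monoʳ-≤ L (m≤n⊔m (longDegree c) (longDegree d))))) ⟩
    weight c * scale (c ⨾ d) + weight d * scale (c ⨾ d) ≡⟨ *-distribʳ-+ (scale (c ⨾ d)) (weight c) (weight d)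
        ⟨
    (weight c + weight d) * scale (c ⨾ d)     ∎
    where open ≤-Reasoning
  cost-≤ (for short r b c) =
    ≤-trans (loop-cost S 1≤S {w = weight c} (cost-≤ c) (1≤scale (shortDegree c) (longDegree c)))
      (≤-reflexive (cong ((8 + weight c) *_) (sym (*-assoc S (S ^ shortDegree c) (L ^ longDegree c)))))
  cost-≤ (for long r b c) =
    ≤-trans (loop-cost L 1≤L {w = weight c} (cost-≤ c) (1≤scale (shortDegree c) (longDegree c)))
      (≤-reflexive (cong ((8 + weight c) *_) (lemma L (S ^ shortDegree c) (L ^ longDegree c))))
    where lemma : ∀ a b c → a * (b * c) ≡ b * (a * c)
          lemma = solve-∀

-- A program logic for total correctness

noArr : ℕ → Exp → Bool
noArr k (lit x)      = true
noArr k (var x)      = true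
noArr k (bin op a b) = noArr k a ∧ noArr k b
noArr k (at l e)     = not (k ≡ᵇ l) ∧ noArr k e

eval-cong : ∀ {s s′} k e → noArr k e ≡ true → (∀ r → env s r ≡ env s′ r) →
            (∀ l → (k ≡ᵇ l) ≡ false → ∀ i → arr s l i ≡ arr s′ l i) → eval e s ≡ eval e s′
eval-cong k (lit x) q f g = refl
eval-cong k (var x) q f g = f x
eval-cong k (bin op a b) q f g =
  let qa , qb = ∧-true {noArr k a} q in cong₂ ⟦ op ⟧ (eval-cong k a qa f g) (eval-cong k b qb f g)
eval-cong {s} {s′} k (at l e) q f g with k ≡ᵇ l in eq
... | false = trans (cong (arr s l) (eval-cong k e q f g)) (g l eq (eval e s′))

module Hoare (W n : ℕ) (limit : Kind → ℕ) where
  open Execution W n limit public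

  record Ends (c : Cmd) (s : St) (Q : St → Set) : Set where
    constructor ends
    field
      {final} : St
      trace   : Exec c s final
      post    : Q final
  open Ends public

  weaken : ∀ {c s} {Q R : St → Set} → Bounded s → Ends c s Q →
           (∀ s′ → Q s′ → Bounded s′ → Frame c s s′ → R s′) → Ends c s R
  weaken b (ends x q) f = ends x (f _ q (exec-bounded x b) (exec-frame x))

  infixr 3 _andThen_
  _andThen_ : ∀ {c d s} {Q R : St → Set} → Ends c s Q × Bounded s →
              (∀ s′ → Q s′ → Bounded s′ → Frame c s s′ → Ends d s′ R) → Ends (c ⨾ d) s R
  (ends x q , b) andThen f with f _ q (exec-bounded x b) (exec-frame x)
  ... | ends y r = ends (x then y) r

  assign-then : ∀ {r e d s} {R : St → Set} → Bounded s → eval e s ≤ W →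
                (Bounded (setVar s r (eval e s)) → Ends d (setVar s r (eval e s)) R) → Ends ((r ⇐ e) ⨾ d) s R
  assign-then {r} b q f with f (setVar-bounded r b q)
  ... | ends y z = ends (assign q then y) z

  assign-ends : ∀ {r e s} {R : St → Set} → eval e s ≤ W → R (setVar s r (eval e s)) → Ends (r ⇐ e) s R
  assign-ends q z = ends (assign q) z

  loop-ends : ∀ {r b c} (I : ℕ → St → Set) {N} →
    modVar c r ≡ false → modVar c b ≡ false → r ≢ b → N ≤ W →
    (∀ i s → i < N → env s r ≡ i → env s b ≡ N → Bounded s → I i s →
      Ends c s (λ s′ → I (suc i) (setVar s′ r (suc i)))) →
    ∀ j i s → i + j ≡ N → env s r ≡ i → env s b ≡ N → Bounded s → I i s →
    ∃ λ s′ → Loop r b c j s s′ × I N s′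
  loop-ends I mr mb r≢b N≤W body zero i s i+j eqr eqb bd z =
    s , done (trans eqb (trans (sym i+j) (trans (+-identityʳ i) (sym eqr)))) ,
    subst (λ k → I k s) (trans (sym (+-identityʳ i)) i+j) z
  loop-ends {r} {b} I {N} mr mb r≢b N≤W body (suc j) i s i+j eqr eqb bd z
    with body i s (subst (i <_) i+j (m<m+n i z<s)) eqr eqb bd z
  ... | ends {s′} x z′
    with loop-ends I mr mb r≢b N≤W body j (suc i) (setVar s′ r (suc (env s′ r)))
           (trans (sym (+-suc i j)) i+j)
           (trans (set-same (env s′) r (suc (env s′ r))) (cong suc r′≡i))
           (trans (set-other (env s′) (suc (env s′ r)) r≢b) (trans (sameVar (exec-frame x) b mb) eqb))
           (setVar-bounded r (exec-bounded x bd) small)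
           (subst (λ k → I (suc i) (setVar s′ r (suc k))) (sym r′≡i) z′)
    where
    r′≡i = trans (sameVar (exec-frame x) r mr) eqr
    small : suc (env s′ r) ≤ W
    small = subst (λ k → suc k ≤ W) (sym r′≡i) (≤-trans (subst (i <_) i+j (m<m+n i z<s)) N≤W)
  ... | s″ , L , z″ = s″ , next (trans eqb (trans (sym i+j) (cong (_+ suc j) (sym eqr)))) x
                             (subst (λ k → suc k ≤ W) (sym (trans (sameVar (exec-frame x) r mr) eqr))
                               (≤-trans (subst (i <_) i+j (m<m+n i z<s)) N≤W)) L , z″

  -- The frame condition relative to the state before the loop is carried along with `I`, so an
  -- invariant need mention only what the loop changes. The body has to establish `I (suc i)` for
  -- the state in which the counter has already been advanced.
  for-ends : ∀ {k r b c s} (I : ℕ → St → Set) → Bounded s → env s b ≤ limit k →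
    modVar c r ≡ false → modVar c b ≡ false → (r ≡ᵇ b) ≡ false →
    I 0 (setVar s r 0) →
    (∀ i s′ → i < env s b → env s′ r ≡ i → Bounded s′ → Frame (for k r b c) s s′ → I i s′ →
      Ends c s′ (λ s″ → I (suc i) (setVar s″ r (suc i)))) →
    Ends (for k r b c) s (I (env s b))
  for-ends {k} {r} {b} {c} {s} I bd few mr mb r≢b start body
    with loop-ends {r} {b} {c} (λ i s′ → I i s′ × Frame (for k r b c) s s′) {env s b} mr mb (≡ᵇ⇒≢ {r} r≢b)
        (envB bd b)
           (λ i s′ i<N eqr eqb bd′ z → weaken bd′ (body i s′ i<N eqr bd′ (proj₂ z) (proj₁ z))
             λ s″ z′ bd″ fr → z′ , frame-trans (proj₂ z) (frame-trans (frame-body fr)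
                 (frame-set s″ r (suc i))))
           (env s b) 0 (setVar s r 0) refl (set-same (env s) r 0) (set-other (env s) 0 (≡ᵇ⇒≢ {r} r≢b))
           (setVar-bounded r bd z≤n) (start , frame-set s r 0)
  ... | s′ , L , z , _ = ends (repeat few L) z

  updateArr-other : ∀ A k i v j → j ≢ i → updateArr A k i v k j ≡ A k j
  updateArr-other A k i v j q rewrite ≡ᵇ-refl k = set-other (A k) v (q ∘ sym)

  updateArr-same : ∀ A k i v → updateArr A k i v k i ≡ v
  updateArr-same A k i v rewrite ≡ᵇ-refl k = set-same (A k) i v

  Tabulated : Exp → ℕ → ℕ → ℕ → ℕ → St → St → Set
  Tabulated e k r base N s s′ =
    (∀ p → p < N → arr s′ k (base + p) ≡ eval e (setVar s r p)) ×
    (∀ q → (∀ p → p < N → q ≢ base + p) → arr s′ k q ≡ arr s k q)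

  -- Neither `d` nor `e` reads the array that is written, so every entry may be evaluated in the
  -- state before the loop with only the counter replaced.
  tabulate-ends : ∀ {l r b k s} d e base → Bounded s → env s b ≤ limit l → (r ≡ᵇ b) ≡ false →
    noArr k d ∧ noArr k e ≡ true →
    (∀ p → p < env s b → eval d (setVar s r p) ≡ base + p) →
    (∀ p → p < env s b → eval e (setVar s r p) ≤ W) →
    Ends (for l r b (k ⟨ d ⟩⇐ e)) s (Tabulated e k r base (env s b) s)
  tabulate-ends {l} {r} {b} {k} {s} d e base bd few r≢b none d≡ e≤ =
    for-ends (λ i → Tabulated e k r base i s) bd few refl refl r≢b ((λ _ ()) , λ _ _ → refl) body
    where
    none′ = ∧-true {noArr k d} none
    body : ∀ i s′ → i < env s b → env s′ r ≡ i → Bounded s′ → Frame (for l r b (k ⟨ d ⟩⇐ e)) s s′ →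
           Tabulated e k r base i s s′ →
           Ends (k ⟨ d ⟩⇐ e) s′ (λ s″ → Tabulated e k r base (suc i) s (setVar s″ r (suc i)))
    body i s′ i<N eqr bd′ fr (old , rest) =
      ends (write (subst (_≤ W) (sym (same e (proj₂ none′))) (e≤ i i<N))) (new , rest′)
      where
      same : ∀ x → noArr k x ≡ true → eval x s′ ≡ eval x (setVar s r i)
      same x q = eval-cong k x q vars′ (λ m z → sameArr fr m z)
        where
        vars′ : ∀ x → env s′ x ≡ (env s [ r ≔ i ]) x
        vars′ x with r ≡ᵇ x in eq
        ... | true  = trans (cong (env s′) (sym (≡ᵇ⇒≡ r x (subst T (sym eq) tt)))) eqr
        ... | false = sameVar fr x (cong (_∨ false) eq)
      here : eval d s′ ≡ base + i
      here = trans (same d (proj₁ none′)) (d≡ i i<N)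
      A′ = updateArr (arr s′) k (eval d s′) (eval e s′)
      new : ∀ p → p < suc i → A′ k (base + p) ≡ eval e (setVar s r p)
      new p p<1+i with p ≟ i
      ... | yes refl = trans (cong (A′ k) (sym here))
          (trans (updateArr-same (arr s′) k (eval d s′) (eval e s′)) (same e (proj₂ none′)))
      ... | no p≢i = trans (updateArr-other (arr s′) k (eval d s′) (eval e s′) (base + p)
                              (λ z → p≢i (+-cancelˡ-≡ base p i (trans z here))))
                           (old p (≤∧≢⇒< (≤-pred p<1+i) p≢i))
      rest′ : ∀ q → (∀ p → p < suc i → q ≢ base + p) → A′ k q ≡ arr s k q
      rest′ q far = trans (updateArr-other (arr s′) k (eval d s′) (eval e s′) q
          (λ z → far i (n<1+n i) (trans z here)))
                          (rest q (λ p p<i → far p (m≤n⇒m≤1+n p<i)))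

-- The division of the machine; quo a 0 = 0 and rem a 0 = a.

quo rem : ℕ → ℕ → ℕ
quo a b = ⟦ div ⟧ a b
rem a b = a ∸ quo a b * b

quo-rem : ∀ a b → a ≡ quo a b * b + rem a b
quo-rem a b = sym (m+[n∸m]≡n (le a b))
  where
  le : ∀ a b → quo a b * b ≤ a
  le a zero    = z≤n
  le a (suc b) = m/n*n≤m a (suc b)

rem-< : ∀ a {b} → 0 < b → rem a b < b
rem-< a {suc b} _ = subst (_< suc b) (m%n≡m∸m/n*n a (suc b)) (m%n<n a (suc b))

quo-unique : ∀ a {b c} → c < b → quo (a * b + c) b ≡ a
quo-unique a {suc b} {c} c<b = begin
  (a * suc b + c) / suc b              ≡⟨ +-distrib-/-∣ˡ c (divides-refl a) ⟩
  a * suc b / suc b + c / suc b        ≡⟨ cong₂ _+_ (m*n/n≡m a (suc b)) (m<n⇒m/n≡0 c<b) ⟩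
  a + 0                                ≡⟨ +-identityʳ a ⟩
  a                                    ∎
  where
  open ≡-Reasoning
  open import Data.Nat.Divisibility using (divides-refl)

rem-unique : ∀ a {b c} → c < b → rem (a * b + c) b ≡ c
rem-unique a {b} {c} c<b = trans (cong (λ z → a * b + c ∸ z * b) (quo-unique a c<b)) (m+n∸m≡n (a * b) c)

quo-<ᵐ : ∀ a m {b} → a < m * b → quo a b < m
quo-<ᵐ a m {zero} p = contradiction (subst (a <_) (*-zeroʳ m) p) λ ()
quo-<ᵐ a m {suc b} p = m<n*o⇒m/o<n p

quo-≤ : ∀ a b → quo a b ≤ a
quo-≤ a zero    = z≤n
quo-≤ a (suc b) = m/n≤m a (suc b)

quo-*-≤ : ∀ a b → quo a b * b ≤ a
quo-*-≤ a zero    = z≤n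
quo-*-≤ a (suc b) = m/n*n≤m a (suc b)

<-quo : ∀ a {b} → 0 < b → a < suc (quo a b) * b
<-quo a {b} 0<b = subst₂ _<_ (sym (quo-rem a b)) (+-comm (quo a b * b) b) (+-monoʳ-< (quo a b * b)
    (rem-< a 0<b))

pair-< : ∀ {a b m k} → a < m → b < k → a * k + b < m * k
pair-< {a} {b} {m} {k} p q = begin-strict
  a * k + b <⟨ +-monoʳ-< (a * k) q ⟩
  a * k + k ≡⟨ +-comm (a * k) k ⟩
  suc a * k ≤⟨ *-monoˡ-≤ k p ⟩
  m * k     ∎
  where open ≤-Reasoning

-- Finite sums

∑ : ℕ → (ℕ → ℕ) → ℕ
∑ zero    f = 0
∑ (suc n) f = f 0 + ∑ n (f ∘ suc)

∑-cong : ∀ n {f g} → (∀ i → i < n → f i ≡ g i) → ∑ n f ≡ ∑ n g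
∑-cong zero    p = refl
∑-cong (suc n) p = cong₂ _+_ (p 0 z<s) (∑-cong n λ i q → p (suc i) (s<s q))

∑-zero : ∀ n {f} → (∀ i → i < n → f i ≡ 0) → ∑ n f ≡ 0
∑-zero zero    p = refl
∑-zero (suc n) p = cong₂ _+_ (p 0 z<s) (∑-zero n λ i q → p (suc i) (s<s q))

∑-split : ∀ a b f → ∑ (a + b) f ≡ ∑ a f + ∑ b (λ i → f (a + i))
∑-split zero    b f = refl
∑-split (suc a) b f = trans (cong (f 0 +_) (∑-split a b (f ∘ suc))) (sym (+-assoc (f 0) _ _))

∑-+ : ∀ n f g → ∑ n (λ i → f i + g i) ≡ ∑ n f + ∑ n g
∑-+ zero    f g = refl
∑-+ (suc n) f g = trans (cong (f 0 + g 0 +_) (∑-+ n (f ∘ suc) (g ∘ suc))) (lemma (f 0) (g 0) _ _)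
  where lemma : ∀ a b c d → a + b + (c + d) ≡ a + c + (b + d)
        lemma = solve-∀

∑-*ˡ : ∀ n c f → ∑ n (λ i → c * f i) ≡ c * ∑ n f
∑-*ˡ zero    c f = sym (*-zeroʳ c)
∑-*ˡ (suc n) c f = trans (cong (c * f 0 +_) (∑-*ˡ n c (f ∘ suc))) (sym (*-distribˡ-+ c (f 0) _))

∑-*ʳ : ∀ n c f → ∑ n (λ i → f i * c) ≡ ∑ n f * c
∑-*ʳ n c f = trans (∑-cong n λ i _ → *-comm (f i) c) (trans (∑-*ˡ n c f) (*-comm c _))

∑-swap : ∀ m n (f : ℕ → ℕ → ℕ) → ∑ m (λ i → ∑ n (f i)) ≡ ∑ n (λ j → ∑ m (λ i → f i j))
∑-swap zero    n f = sym (∑-zero n λ _ _ → refl)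
∑-swap (suc m) n f =
  trans (cong (∑ n (f 0) +_) (∑-swap m n (f ∘ suc))) (sym (∑-+ n (f 0) (λ j → ∑ m (λ i → f (suc i) j))))

∑-*∑ : ∀ m n f g → ∑ m f * ∑ n g ≡ ∑ m (λ i → ∑ n (λ j → f i * g j))
∑-*∑ m n f g = trans (sym (∑-*ʳ m (∑ n g) f)) (∑-cong m λ i _ → sym (∑-*ˡ n (f i) g))

∑-block : ∀ m n f → ∑ (m * n) f ≡ ∑ m (λ i → ∑ n (λ j → f (i * n + j)))
∑-block zero    n f = refl
∑-block (suc m) n f = trans (∑-split n (m * n) f) (cong (∑ n f +_)
  (trans (∑-block m n (λ i → f (n + i)))
    (∑-cong m λ i _ → ∑-cong n λ j _ → cong f (sym (+-assoc n (i * n) j)))))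

∑-even-odd : ∀ n f → ∑ (n + n) f ≡ ∑ n (λ i → f (i + i) + f (suc (i + i)))
∑-even-odd zero    f = refl
∑-even-odd (suc n) f =
  trans (cong (λ z → f 0 + ∑ z (f ∘ suc)) (+-suc n n))
    (trans (sym (+-assoc (f 0) (f 1) _)) (cong (f 0 + f 1 +_)
      (trans (∑-even-odd n (λ i → f (suc (suc i))))
        (∑-cong n λ i _ → cong (λ z → f z + f (suc z)) (cong suc (sym (+-suc i i)))))))

∑-const : ∀ n c → ∑ n (λ _ → c) ≡ n * c
∑-const zero    c = refl
∑-const (suc n) c = cong (c +_) (∑-const n c)

∑-mono : ∀ n {f g} → (∀ i → i < n → f i ≤ g i) → ∑ n f ≤ ∑ n g
∑-mono zero    p = z≤n
∑-mono (suc n) p = +-mono-≤ (p 0 z<s) (∑-mono n λ i q → p (suc i) (s<s q))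

-- Arithmetic modulo 1 + σ, so that σ plays the role of −1

module Modular (σ : ℕ) where

  infix 4 _≈_
  record _≈_ (a b : ℕ) : Set where
    constructor modulo
    field remainders : a % suc σ ≡ b % suc σ
  open _≈_ public

  ≡⇒≈ : ∀ {a b} → a ≡ b → a ≈ b
  ≡⇒≈ refl = modulo refl

  ≈-refl : ∀ {a} → a ≈ a
  ≈-refl = modulo refl

  ≈-sym : ∀ {a b} → a ≈ b → b ≈ a
  ≈-sym (modulo p) = modulo (sym p)

  ≈-trans : ∀ {a b c} → a ≈ b → b ≈ c → a ≈ c
  ≈-trans (modulo p) (modulo q) = modulo (trans p q)

  +-≈ : ∀ {a b c d} → a ≈ b → c ≈ d → a + c ≈ b + d
  +-≈ {a} {b} {c} {d} (modulo p) (modulo q) = modulo (trans (%-distribˡ-+ a c (suc σ))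
    (trans (cong₂ (λ x y → (x + y) % suc σ) p q) (sym (%-distribˡ-+ b d (suc σ)))))

  *-≈ : ∀ {a b c d} → a ≈ b → c ≈ d → a * c ≈ b * d
  *-≈ {a} {b} {c} {d} (modulo p) (modulo q) = modulo (trans (%-distribˡ-* a c (suc σ))
    (trans (cong₂ (λ x y → (x * y) % suc σ) p q) (sym (%-distribˡ-* b d (suc σ)))))

  ^-≈ : ∀ {a b} n → a ≈ b → a ^ n ≈ b ^ n
  ^-≈ zero    p = ≈-refl
  ^-≈ (suc n) p = *-≈ p (^-≈ n p)

  ∑-≈ : ∀ n {f g} → (∀ i → i < n → f i ≈ g i) → ∑ n f ≈ ∑ n g
  ∑-≈ zero    p = ≈-refl
  ∑-≈ (suc n) p = +-≈ (p 0 z<s) (∑-≈ n λ i q → p (suc i) (s<s q))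

  *1+σ≈0 : ∀ a → a * (1 + σ) ≈ 0
  *1+σ≈0 a = modulo (m*n%n≡0 a (suc σ))

  σ*σ≈1 : σ * σ ≈ 1
  σ*σ≈1 = modulo (begin
    (σ * σ) % suc σ             ≡⟨ [m+kn]%n≡m%n (σ * σ) 1 (suc σ) ⟨
    (σ * σ + 1 * suc σ) % suc σ ≡⟨ cong (_% suc σ) (lemma σ) ⟩
    (1 + σ * suc σ) % suc σ     ≡⟨ [m+kn]%n≡m%n 1 σ (suc σ) ⟩
    1 % suc σ                   ∎)
    where
    open ≡-Reasoning
    lemma : ∀ s → s * s + 1 * suc s ≡ 1 + s * suc s
    lemma = solve-∀

  module ≈-Reasoning where
    open import Relation.Binary.Bundles using (Setoid)
    modular : Setoid _ _
    modular = record { Carrier = ℕ ; _≈_ = _≈_ ; isEquivalence = record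
      { refl = ≈-refl ; sym = ≈-sym ; trans = ≈-trans } }
    open import Relation.Binary.Reasoning.Setoid modular public

  ∑-delta : ∀ n {f} a → a < n → (∀ i → i < n → i ≢ a → f i ≈ 0) → ∑ n f ≈ f a
  ∑-delta (suc n) {f} zero _ p = ≈-trans
    (+-≈ (≈-refl {f 0}) (≈-trans (∑-≈ n λ i q → p (suc i) (s<s q) λ ()) (≡⇒≈ (∑-zero n λ _ _ → refl))))
    (≡⇒≈ (+-identityʳ (f 0)))
  ∑-delta (suc n) {f} (suc a) (s<s a<n) p =
    +-≈ (p 0 z<s λ ()) (∑-delta n a a<n λ i q i≢a → p (suc i) (s<s q) (λ z → i≢a (suc-injective z)))

-- Roots of unity modulo 1 + σ

half : ∀ d → ∃ λ h → d ≡ h + h ⊎ d ≡ suc (h + h)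
half zero = 0 , inj₁ refl
half (suc d) with half d
... | h , inj₁ p = h , inj₂ (cong suc p)
... | h , inj₂ p = suc h , inj₁ (trans (cong suc p) (cong suc (sym (+-suc h h))))

module RootOfUnity (σ : ℕ) where
  open Modular σ

  double : ∀ κ → 2 ^ suc κ ≡ 2 ^ κ + 2 ^ κ
  double κ = cong (2 ^ κ +_) (+-identityʳ (2 ^ κ))

  order : ∀ κ ω → ω ^ 2 ^ κ ≈ σ → ∀ e → ω ^ (2 ^ suc κ * e) ≈ 1
  order κ ω p e = begin
    ω ^ (2 ^ suc κ * e)          ≡⟨ ^-*-assoc ω (2 ^ suc κ) e ⟨
    (ω ^ 2 ^ suc κ) ^ e          ≈⟨ ^-≈ e (≈-trans
        (≡⇒≈ (trans (cong (ω ^_) (double κ)) (^-distribˡ-+-* ω (2 ^ κ) (2 ^ κ))))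
                                     (≈-trans (*-≈ p p) σ*σ≈1)) ⟩
    1 ^ e                        ≡⟨ ^-zeroˡ e ⟩
    1                            ∎
    where open ≈-Reasoning

  orthogonal-yes : ∀ κ ω → ω ^ 2 ^ κ ≈ σ → ∀ e → ∑ (2 ^ suc κ) (λ b → ω ^ (b * (2 ^ suc κ * e))) ≈ 2 ^ suc κ
  orthogonal-yes κ ω p e = ≈-trans
    (∑-≈ (2 ^ suc κ) λ b _ → ≈-trans (≡⇒≈ (cong (ω ^_) (lemma b (2 ^ suc κ) e))) (order κ ω p (b * e)))
    (≡⇒≈ (trans (∑-const (2 ^ suc κ) 1) (*-identityʳ _)))
    where lemma : ∀ b k e → b * (k * e) ≡ k * (b * e)
          lemma = solve-∀

  halves : ∀ κ ω d c → ω ^ (2 ^ κ * d) ≈ c →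
           ∑ (2 ^ suc κ) (λ b → ω ^ (b * d)) ≈ (1 + c) * ∑ (2 ^ κ) (λ b → ω ^ (b * d))
  halves κ ω d c p = begin
    ∑ (2 ^ suc κ) f                ≡⟨ cong (λ z → ∑ z f) (double κ) ⟩
    ∑ (N + N) f                    ≡⟨ ∑-split N N f ⟩
    ∑ N f + ∑ N (λ b → f (N + b))  ≈⟨ +-≈ ≈-refl (∑-≈ N λ b _ → ≈-trans (≡⇒≈ (shift b)) (*-≈ p ≈-refl)) ⟩
    ∑ N f + ∑ N (λ b → c * f b)    ≡⟨ cong (∑ N f +_) (∑-*ˡ N c f) ⟩
    ∑ N f + c * ∑ N f              ∎
    where
    open ≈-Reasoning
    N = 2 ^ κ
    f : ℕ → ℕ
    f b = ω ^ (b * d)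
    shift : ∀ b → f (N + b) ≡ ω ^ (N * d) * f b
    shift b = trans (cong (ω ^_) (*-distribʳ-+ d N b)) (^-distribˡ-+-* ω (N * d) (b * d))

  -- Summing the geometric series would require cancelling ω^d - 1, which may be a zero divisor.
  -- Instead the sum is halved. For odd `d` the two halves differ by the factor σ and 1 + σ
  -- vanishes; for even `d` they agree, and the sum is twice the one for ω², d/2 and κ - 1. At κ = 0
  -- an even `d` is excluded by the hypothesis.
  orthogonal-no : ∀ κ ω → ω ^ 2 ^ κ ≈ σ → ∀ d → (∀ e → d ≢ 2 ^ suc κ * e) →
                  ∑ (2 ^ suc κ) (λ b → ω ^ (b * d)) ≈ 0
  orthogonal-no κ ω p d ¬div with half d
  orthogonal-no κ ω p d ¬div | h , inj₂ odd = ≈-trans (halves κ ω d σ odd-power)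
      (≈-trans (≡⇒≈ (*-comm (1 + σ) S)) (*1+σ≈0 S))
    where
    S = ∑ (2 ^ κ) (λ b → ω ^ (b * d))
    open ≈-Reasoning
    odd-power : ω ^ (2 ^ κ * d) ≈ σ
    odd-power = begin
      ω ^ (2 ^ κ * d)                  ≡⟨ cong (ω ^_) (trans (cong (2 ^ κ *_) odd) (lemma (2 ^ κ) h)) ⟩
      ω ^ (2 ^ κ + 2 ^ suc κ * h)      ≡⟨ ^-distribˡ-+-* ω (2 ^ κ) (2 ^ suc κ * h) ⟩
      ω ^ 2 ^ κ * ω ^ (2 ^ suc κ * h)  ≈⟨ *-≈ p (order κ ω p h) ⟩
      σ * 1                            ≡⟨ *-identityʳ σ ⟩
      σ                                ∎
      where lemma : ∀ k h → k * suc (h + h) ≡ k + 2 * k * h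
            lemma = solve-∀
  orthogonal-no zero ω p d ¬div | h , inj₁ even =
    contradiction (trans even (cong (h +_) (sym (+-identityʳ h)))) (¬div h)
  orthogonal-no (suc κ) ω p d ¬div | h , inj₁ even = ≈-trans (halves (suc κ) ω d 1 one)
      (*-≈ (≈-refl {2})
        (≈-trans (≡⇒≈ (∑-cong (2 ^ suc κ) λ b _ → square b))
          (orthogonal-no κ (ω * ω) (≈-trans (≡⇒≈ root) p) h ¬div′)))
    where
    one : ω ^ (2 ^ suc κ * d) ≈ 1
    one = ≈-trans (≡⇒≈ (cong (ω ^_) (trans (cong (2 ^ suc κ *_) even) (lemma (2 ^ suc κ) h))))
        (order (suc κ) ω p h)
      where lemma : ∀ k h → k * (h + h) ≡ 2 * k * h
            lemma = solve-∀
    power² : ∀ x → (ω * ω) ^ x ≡ ω ^ (2 * x)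
    power² x = trans (cong (_^ x) (sym (cong (ω *_) (*-identityʳ ω)))) (^-*-assoc ω 2 x)
    square : ∀ b → ω ^ (b * d) ≡ (ω * ω) ^ (b * h)
    square b = trans (cong (ω ^_) (trans (cong (b *_) even) (lemma b h))) (sym (power² (b * h)))
      where lemma : ∀ b h → b * (h + h) ≡ 2 * (b * h)
            lemma = solve-∀
    root : (ω * ω) ^ 2 ^ κ ≡ ω ^ 2 ^ suc κ
    root = power² (2 ^ κ)
    ¬div′ : ∀ e → h ≢ 2 ^ suc κ * e
    ¬div′ e q = ¬div e (trans even (trans (cong₂ _+_ q q) (lemma (2 ^ suc κ) e)))
      where lemma : ∀ k e → k * e + k * e ≡ 2 * k * e
            lemma = solve-∀

-- Nussbaumer's negacyclic convolution on natural numbers.  An array f stands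
-- for Σ f(i) X^i with i < 2N, where X^N plays −1; with N = 2^ρ K and y = X^K
-- this is a polynomial of degree < K in X over polynomials in y.  pad extends
-- it to length 2K, stage is one round of a (self-sorting) Fourier transform of
-- length 2K with a power of y as root of unity, and fold substitutes
-- y = X^K again after a second forward transform, which inverts the first one
-- up to a reversal of the indices.

padAt : (K R : ℕ) → (ℕ → ℕ) → ℕ → ℕ → ℕ
padAt K R f q i =
  f (quo q (2 * K) * (R * K) + i * K + rem (rem q (2 * K)) K) * (1 ∸ quo (rem q (2 * K)) K)

pad : (K R : ℕ) → (ℕ → ℕ) → ℕ → ℕ
pad K R f p = padAt K R f (quo p R) (rem p R)

-- The data flow of Stockham's transform: inside a group of 2K blocks, the output with index i · 2S
-- + b is computed from the blocks i · S + (b mod S) and, K places further on, (i + K / S) · S + (b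
-- mod S).
lower : (K S q : ℕ) → ℕ
lower K S q = quo q (2 * K) * (2 * K) + (quo (rem q (2 * K)) (2 * S) * S + rem (rem q (2 * K)) S)

stageAt : (K R S : ℕ) → (ℕ → ℕ) → ℕ → ℕ → ℕ
stageAt K R S f q i =
  f (lower K S q * R + i) +
  f ((lower K S q + K) * R + rem (i + (R ∸ rem (rem q (2 * K)) (2 * S) * quo R (2 * S))) R)

stage : (K R S : ℕ) → (ℕ → ℕ) → ℕ → ℕ
stage K R S f p = stageAt K R S f (quo p R) (rem p R)

stages : (K R s : ℕ) → (ℕ → ℕ) → ℕ → ℕ
stages K R zero    f = f
stages K R (suc s) f = stage K R (2 ^ s) (stages K R s f)

foldAt : (K R : ℕ) → (ℕ → ℕ) → ℕ → ℕ → ℕ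
foldAt K R f q i =
  f ((quo q R * (2 * K) + rem (2 * K ∸ i) (2 * K)) * R + rem q R) +
  f ((quo q R * (2 * K) + (K ∸ i)) * R + rem (rem q R + (R ∸ 1)) R)

fold : (K R : ℕ) → (ℕ → ℕ) → ℕ → ℕ
fold K R f p = foldAt K R f (quo p K) (rem p K)

blockwise : ∀ (F : ℕ → ℕ → ℕ) R q {i} → i < R → F (quo (q * R + i) R) (rem (q * R + i) R) ≡ F q i
blockwise F R q i<R = cong₂ F (quo-unique q i<R) (rem-unique q i<R)

ev : ℕ → ℕ → (ℕ → ℕ) → ℕ → ℕ
ev X n f a = ∑ n (λ i → f (a + i) * X ^ i)

-- The Fourier transform on one level

module Level (κ ρ X : ℕ) (κ≤ρ : κ ≤ ρ) where
  K R σ y : ℕ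
  K = 2 ^ κ
  R = 2 ^ suc ρ
  σ = X ^ 2 ^ (κ + ρ)
  y = X ^ K
  open Modular σ
  open RootOfUnity σ

  0<K : 0 < K
  0<K = m^n>0 2 κ
  0<R : 0 < R
  0<R = m^n>0 2 (suc ρ)

  y^2^ρ : y ^ 2 ^ ρ ≡ σ
  y^2^ρ = trans (^-*-assoc X K (2 ^ ρ)) (cong (X ^_) (sym (^-distribˡ-+-* 2 κ ρ)))

  y^R≈1 : y ^ R ≈ 1
  y^R≈1 = ≈-trans (≡⇒≈ (cong (y ^_) (sym (*-identityʳ R)))) (order ρ y (≡⇒≈ y^2^ρ) 1)

  -- A power of y acts by rotating the coefficients, as y^R plays 1. This is what the redundant
  -- length R, instead of 2^ρ where y^(2^ρ) plays -1, is good for: the coefficients that wrap around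
  -- need no change of sign.
  shift-∑ : ∀ (h : ℕ → ℕ) E → E < R → ∑ R (λ i → h (rem (i + (R ∸ E)) R) * y ^ i) ≈ y ^ E * ∑ R
      (λ i → h i * y ^ i)
  shift-∑ h E E<R = begin
    ∑ R f                                         ≡⟨ cong (λ z → ∑ z f) E+D ⟨
    ∑ (E + D) f                                   ≡⟨ ∑-split E D f ⟩
    ∑ E f + ∑ D (λ j → f (E + j))                 ≈⟨ +-≈ (∑-≈ E low) (∑-≈ D λ j j<D → ≡⇒≈ (high j j<D)) ⟩
    ∑ E (λ i → y ^ E * g (D + i)) + ∑ D (λ j → y ^ E * g j)
                                                  ≡⟨ cong₂ _+_ (∑-*ˡ E (y ^ E) (λ i → g (D + i)))
                                                      (∑-*ˡ D (y ^ E) g) ⟩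
    y ^ E * ∑ E (λ i → g (D + i)) + y ^ E * ∑ D g ≡⟨ +-comm (y ^ E * ∑ E (λ i → g (D + i))) (y ^ E * ∑ D g) ⟩
    y ^ E * ∑ D g + y ^ E * ∑ E (λ i → g (D + i)) ≡⟨ *-distribˡ-+ (y ^ E) (∑ D g) _ ⟨
    y ^ E * (∑ D g + ∑ E (λ i → g (D + i)))       ≡⟨ cong (y ^ E *_) (∑-split D E g) ⟨
    y ^ E * ∑ (D + E) g                           ≡⟨ cong (λ z → y ^ E * ∑ z g) (trans (+-comm D E) E+D) ⟩
    y ^ E * ∑ R g                                 ∎
    where
    open ≈-Reasoning
    D = R ∸ E
    E+D : E + D ≡ R
    E+D = m+[n∸m]≡n (<⇒≤ E<R)
    f g : ℕ → ℕ
    f i = h (rem (i + D) R) * y ^ i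
    g i = h i * y ^ i
    swap₃ : ∀ a b c → a * (b * c) ≡ b * (a * c)
    swap₃ = solve-∀
    low : ∀ i → i < E → f i ≈ y ^ E * g (D + i)
    low i i<E = begin
      h (rem (i + D) R) * y ^ i          ≡⟨ cong (λ z → h z * y ^ i) (trans (rem-unique 0 i+D<R)
          (+-comm i D)) ⟩
      h (D + i) * y ^ i                  ≡⟨ cong (h (D + i) *_) (sym (*-identityˡ (y ^ i))) ⟩
      h (D + i) * (1 * y ^ i)            ≈⟨ *-≈ (≈-refl {h (D + i)}) (*-≈ (≈-sym y^R≈1) (≈-refl {y ^ i})) ⟩
      h (D + i) * (y ^ R * y ^ i)        ≡⟨ cong (h (D + i) *_) powers ⟩
      h (D + i) * (y ^ E * y ^ (D + i))  ≡⟨ swap₃ (h (D + i)) (y ^ E) (y ^ (D + i)) ⟩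
      y ^ E * g (D + i)                  ∎
      where
      i+D<R : i + D < R
      i+D<R = subst (i + D <_) E+D (+-monoˡ-< D i<E)
      powers : y ^ R * y ^ i ≡ y ^ E * y ^ (D + i)
      powers = trans (sym (^-distribˡ-+-* y R i)) (trans (cong (y ^_)
        (trans (cong (_+ i) (sym E+D)) (+-assoc E D i))) (^-distribˡ-+-* y E (D + i)))
    high : ∀ j → j < D → f (E + j) ≡ y ^ E * g j
    high j j<D = trans (cong₂ (λ a b → h a * b) index (^-distribˡ-+-* y E j)) (swap₃ (h j) (y ^ E) (y ^ j))
      where
      index : rem (E + j + D) R ≡ j
      index = trans (cong (λ z → rem z R) (trans (lemma E j D)
          (cong (_+ j) (trans E+D (sym (*-identityˡ R))))))
                    (rem-unique 1 (<-≤-trans j<D (m∸n≤m R E)))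
        where lemma : ∀ a b c → a + b + c ≡ a + c + b
              lemma = solve-∀

  ev-stage : ∀ S f q → rem (rem q (2 * K)) (2 * S) * quo R (2 * S) < R →
             ev y R (stage K R S f) (q * R) ≈
             ev y R f (lower K S q * R) +
             y ^ (rem (rem q (2 * K)) (2 * S) * quo R (2 * S)) * ev y R f ((lower K S q + K) * R)
  ev-stage S f q E<R = begin
    ev y R (stage K R S f) (q * R)
      ≡⟨ ∑-cong R (λ i i<R → cong (_* y ^ i) (blockwise (stageAt K R S f) R q i<R)) ⟩
    ∑ R (λ i → (f (l * R + i) + f ((l + K) * R + rem (i + (R ∸ E)) R)) * y ^ i)
      ≡⟨ ∑-cong R (λ i _ → *-distribʳ-+ (y ^ i) (f (l * R + i)) _) ⟩
    ∑ R (λ i → f (l * R + i) * y ^ i + f ((l + K) * R + rem (i + (R ∸ E)) R) * y ^ i)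
      ≡⟨ ∑-+ R (λ i → f (l * R + i) * y ^ i) _ ⟩
    ev y R f (l * R) + ∑ R (λ i → f ((l + K) * R + rem (i + (R ∸ E)) R) * y ^ i)
      ≈⟨ +-≈ (≈-refl {ev y R f (l * R)}) (shift-∑ (λ i → f ((l + K) * R + i)) E E<R) ⟩
    ev y R f (l * R) + y ^ E * ev y R f ((l + K) * R) ∎
    where
    open ≈-Reasoning
    l = lower K S q
    E = rem (rem q (2 * K)) (2 * S) * quo R (2 * S)

  module _ (f : ℕ → ℕ) (g : ℕ) where
    private
      u : ℕ → ℕ → ℕ
      u s i = ev y R (stages K R s f) ((g * (2 * K) + i) * R)

    -- The invariant of decimation in time: after `s` stages a group of 2K blocks holds 2^c
    -- transforms of length 2^s, the one at `i` being that of the inputs congruent to `i` modulo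
    -- 2^c. A stage merges the transforms at `i` and `i + 2 ^ c` of the finer decomposition, which
    -- supply the even and the odd terms.
    dft-stages : ∀ s c d → 2 ^ c * 2 ^ s ≡ 2 * K → 2 ^ d * 2 ^ s ≡ R →
                 ∀ i b → i < 2 ^ c → b < 2 ^ s →
                 u s (i * 2 ^ s + b) ≈ ∑ (2 ^ s) (λ q → (y ^ 2 ^ d) ^ (q * b) * u 0 (i + q * 2 ^ c))
    dft-stages zero c d pc pd i zero i< _ =
      ≡⇒≈ (trans (cong (u 0) (lemma i)) (sym (trans (+-identityʳ _) (trans (*-identityˡ _)
          (cong (u 0) (+-identityʳ i))))))
      where lemma : ∀ i → i * 1 + 0 ≡ i
            lemma = solve-∀
    dft-stages zero c d pc pd i (suc b) i< (s≤s ())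
    dft-stages (suc s) c d pc pd i b i<L b<2S = begin
      u (suc s) idx
        ≈⟨ subst (λ E → u (suc s) idx ≈ ev y R F (lower K S (g * (2 * K) + idx) * R) +
                         y ^ E * ev y R F ((lower K S (g * (2 * K) + idx) + K) * R))
             E≡ (ev-stage S F (g * (2 * K) + idx) (subst (_< R) (sym E≡) E<R)) ⟩
      ev y R F (lower K S (g * (2 * K) + idx) * R) + y ^ (b * D) * ev y R F
          ((lower K S (g * (2 * K) + idx) + K) * R)
        ≡⟨ cong₂ (λ p q → ev y R F (p * R) + y ^ (b * D) * ev y R F (q * R)) lower≡ upper≡ ⟩
      u s (i * S + b₀) + y ^ (b * D) * u s ((i + L) * S + b₀)
        ≈⟨ +-≈ (dft-stages s (suc c) (suc d) pc′ pd′ i b₀ i<2L b₀<S)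
               (*-≈ (≈-refl {y ^ (b * D)}) (dft-stages s (suc c) (suc d) pc′ pd′ (i + L) b₀ i+L<2L b₀<S)) ⟩
      ∑ S (λ q → (y ^ 2 ^ suc d) ^ (q * b₀) * u 0 (i + q * 2 ^ suc c)) +
      y ^ (b * D) * ∑ S (λ q → (y ^ 2 ^ suc d) ^ (q * b₀) * u 0 (i + L + q * 2 ^ suc c))
        ≡⟨ cong (∑ S (λ q → (y ^ 2 ^ suc d) ^ (q * b₀) * u 0 (i + q * 2 ^ suc c)) +_)
             (sym (∑-*ˡ S (y ^ (b * D)) (λ q → (y ^ 2 ^ suc d) ^ (q * b₀) * u 0 (i + L + q * 2 ^ suc c)))) ⟩
      ∑ S (λ q → (y ^ 2 ^ suc d) ^ (q * b₀) * u 0 (i + q * 2 ^ suc c)) +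
      ∑ S (λ q → y ^ (b * D) * ((y ^ 2 ^ suc d) ^ (q * b₀) * u 0 (i + L + q * 2 ^ suc c)))
        ≈⟨ +-≈ (∑-≈ S λ q _ → even q) (∑-≈ S λ q _ → odd q) ⟩
      ∑ S (λ q → h (q + q)) + ∑ S (λ q → h (suc (q + q)))
        ≡⟨ ∑-+ S (λ q → h (q + q)) (λ q → h (suc (q + q))) ⟨
      ∑ S (λ q → h (q + q) + h (suc (q + q)))
        ≡⟨ ∑-even-odd S h ⟨
      ∑ (S + S) h
        ≡⟨ cong (λ z → ∑ z h) (double s) ⟨
      ∑ (2 ^ suc s) h ∎
      where
      open ≈-Reasoning
      S = 2 ^ s
      L = 2 ^ c
      D = 2 ^ d
      F = stages K R s f
      idx = i * 2 ^ suc s + b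
      b₀ = rem b S
      h₀ = quo b S
      0<S : 0 < S
      0<S = m^n>0 2 s
      b₀<S : b₀ < S
      b₀<S = rem-< b 0<S
      b≡ : b ≡ h₀ * S + b₀
      b≡ = quo-rem b S
      h : ℕ → ℕ
      h q = (y ^ D) ^ (q * b) * u 0 (i + q * L)
      pc′ : 2 ^ suc c * S ≡ 2 * K
      pc′ = trans (lemma L S) pc
        where lemma : ∀ a b → 2 * a * b ≡ a * (2 * b)
              lemma = solve-∀
      pd′ : 2 ^ suc d * S ≡ R
      pd′ = trans (lemma D S) pd
        where lemma : ∀ a b → 2 * a * b ≡ a * (2 * b)
              lemma = solve-∀
      i<2L : i < 2 ^ suc c
      i<2L = <-≤-trans i<L (m≤m+n L (L + 0))
      i+L<2L : i + L < 2 ^ suc c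
      i+L<2L = subst (i + L <_) (cong (L +_) (sym (+-identityʳ L))) (+-monoˡ-< L i<L)
      idx<2K : idx < 2 * K
      idx<2K = subst (idx <_) pc (pair-< i<L b<2S)
      rem≡ : rem (g * (2 * K) + idx) (2 * K) ≡ idx
      rem≡ = rem-unique g idx<2K
      quo≡ : quo (g * (2 * K) + idx) (2 * K) ≡ g
      quo≡ = quo-unique g idx<2K
      E≡ : rem (rem (g * (2 * K) + idx) (2 * K)) (2 * S) * quo R (2 * S) ≡ b * D
      E≡ = cong₂ _*_ (trans (cong (λ z → rem z (2 * S)) rem≡) (rem-unique i b<2S))
                     (trans (cong (λ z → quo z (2 * S)) (trans (sym pd) (sym (+-identityʳ _))))
                         (quo-unique D (m^n>0 2 (suc s))))
      E<R : b * D < R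
      E<R = subst (b * D <_) (trans (*-comm (2 ^ suc s) D) pd) (*-monoˡ-< D {{m^n≢0 2 d}} b<2S)
      remS : rem idx S ≡ b₀
      remS = trans (cong (λ z → rem z S) (trans (cong (i * 2 ^ suc s +_) b≡) (lemma i S h₀ b₀)))
                   (rem-unique (2 * i + h₀) b₀<S)
        where lemma : ∀ i s h b → i * (2 * s) + (h * s + b) ≡ (2 * i + h) * s + b
              lemma = solve-∀
      lower≡ : lower K S (g * (2 * K) + idx) ≡ g * (2 * K) + (i * S + b₀)
      lower≡ = cong₂ (λ p q → p * (2 * K) + q) quo≡
        (cong₂ (λ p q → p * S + q) (trans (cong (λ z → quo z (2 * S)) rem≡) (quo-unique i b<2S))
                                   (trans (cong (λ z → rem z S) rem≡) remS))
      L*S : L * S ≡ K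
      L*S = *-cancelˡ-≡ (L * S) K 2 (trans (lemma L S) pc)
        where lemma : ∀ a b → 2 * (a * b) ≡ a * (2 * b)
              lemma = solve-∀
      upper≡ : lower K S (g * (2 * K) + idx) + K ≡ g * (2 * K) + ((i + L) * S + b₀)
      upper≡ = trans (cong₂ _+_ lower≡ (sym L*S)) (lemma (g * (2 * K)) i S b₀ L)
        where lemma : ∀ a i s b l → a + (i * s + b) + l * s ≡ a + ((i + l) * s + b)
              lemma = solve-∀
      -- For the even terms `b` may be reduced modulo S, because the exponent of y changes by a
      -- multiple of R.
      exponent : ∀ q → D * ((q + q) * b) ≡ R * (q * h₀) + 2 ^ suc d * (q * b₀)
      exponent q = trans (cong (λ z → D * ((q + q) * z)) b≡)
        (trans (lemma D q h₀ S b₀) (cong (λ z → z * (q * h₀) + 2 * D * (q * b₀)) pd′))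
        where lemma : ∀ d q h s b → d * ((q + q) * (h * s + b)) ≡ 2 * d * s * (q * h) + 2 * d * (q * b)
              lemma = solve-∀
      reduce : ∀ q → (y ^ D) ^ ((q + q) * b) ≈ (y ^ 2 ^ suc d) ^ (q * b₀)
      reduce q = begin
        (y ^ D) ^ ((q + q) * b)                       ≡⟨ ^-*-assoc y D ((q + q) * b) ⟩
        y ^ (D * ((q + q) * b))                       ≡⟨ cong (y ^_) (exponent q) ⟩
        y ^ (R * (q * h₀) + 2 ^ suc d * (q * b₀))     ≡⟨ ^-distribˡ-+-* y (R * (q * h₀))
            (2 ^ suc d * (q * b₀)) ⟩
        y ^ (R * (q * h₀)) * y ^ (2 ^ suc d * (q * b₀)) ≈⟨ *-≈ (order ρ y (≡⇒≈ y^2^ρ) (q * h₀)) ≈-refl ⟩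
        1 * y ^ (2 ^ suc d * (q * b₀))                ≡⟨ *-identityˡ _ ⟩
        y ^ (2 ^ suc d * (q * b₀))                    ≡⟨ ^-*-assoc y (2 ^ suc d) (q * b₀) ⟨
        (y ^ 2 ^ suc d) ^ (q * b₀)                    ∎
      even : ∀ q → (y ^ 2 ^ suc d) ^ (q * b₀) * u 0 (i + q * 2 ^ suc c) ≈ h (q + q)
      even q = *-≈ (≈-sym (reduce q)) (≡⇒≈ (cong (λ z → u 0 (i + z)) (lemma q L)))
        where
        lemma : ∀ q l → q * (2 * l) ≡ (q + q) * l
        lemma = solve-∀
      odd : ∀ q → y ^ (b * D) * ((y ^ 2 ^ suc d) ^ (q * b₀) * u 0 (i + L + q * 2 ^ suc c)) ≈ h (suc (q + q))
      odd q = begin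
        y ^ (b * D) * ((y ^ 2 ^ suc d) ^ (q * b₀) * u 0 (i + L + q * 2 ^ suc c))
          ≈⟨ *-≈ (≈-refl {y ^ (b * D)}) (≈-trans (≡⇒≈ (cong (λ z → (y ^ 2 ^ suc d) ^ (q * b₀) * u 0 z)
              (lemma i L q)))
                (*-≈ (≈-sym (reduce q)) ≈-refl)) ⟩
        y ^ (b * D) * ((y ^ D) ^ ((q + q) * b) * u 0 (i + suc (q + q) * L))
          ≡⟨ *-assoc (y ^ (b * D)) ((y ^ D) ^ ((q + q) * b)) _ ⟨
        y ^ (b * D) * (y ^ D) ^ ((q + q) * b) * u 0 (i + suc (q + q) * L)
          ≡⟨ cong (λ z → z * (y ^ D) ^ ((q + q) * b) * u 0 (i + suc (q + q) * L))
               (trans (cong (y ^_) (*-comm b D)) (sym (^-*-assoc y D b))) ⟩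
        (y ^ D) ^ b * (y ^ D) ^ ((q + q) * b) * u 0 (i + suc (q + q) * L)
          ≡⟨ cong (_* u 0 (i + suc (q + q) * L)) (^-distribˡ-+-* (y ^ D) b ((q + q) * b)) ⟨
        h (suc (q + q)) ∎
        where
        lemma : ∀ i l q → i + l + q * (2 * l) ≡ i + suc (q + q) * l
        lemma = solve-∀

-- The convolution theorem for one level

module LevelCorrect (κ ρ X : ℕ) (κ≤ρ : κ ≤ ρ) where
  open Level κ ρ X κ≤ρ public
  open Modular σ
  open RootOfUnity σ

  -- The root of unity for a transform of length 2K: its power 2^κ is y^(2^ρ) = σ, that is -1. It is
  -- a power of y because κ ≤ ρ, which is what restricts the splitting of a level.
  ω : ℕ
  ω = y ^ 2 ^ (ρ ∸ κ)

  private
    N = 2 * K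

    0<N : 0 < N
    0<N = m^n>0 2 (suc κ)

    root : ω ^ 2 ^ κ ≈ σ
    root = ≡⇒≈ (trans (^-*-assoc y (2 ^ (ρ ∸ κ)) K)
      (trans (cong (y ^_) (trans (sym (^-distribˡ-+-* 2 (ρ ∸ κ) κ)) (cong (2 ^_) (m∸n+n≡m κ≤ρ)))) y^2^ρ))

  transform : ∀ f g b → b < 2 * K →
    ev y R (stages K R (suc κ) f) ((g * (2 * K) + b) * R) ≈
    ∑ (2 * K) (λ q → ω ^ (q * b) * ev y R f ((g * (2 * K) + q) * R))
  transform f g b b<N = ≈-trans
    (dft-stages f g (suc κ) 0 (ρ ∸ κ) (*-identityˡ N) size-R 0 b z<s b<N)
    (≡⇒≈ (∑-cong N λ q _ → cong (λ z → ω ^ (q * b) * ev y R f ((g * N + z) * R)) (*-identityʳ q)))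
    where
    size-R : 2 ^ (ρ ∸ κ) * 2 ^ suc κ ≡ R
    size-R = trans (sym (^-distribˡ-+-* 2 (ρ ∸ κ) (suc κ)))
      (cong (2 ^_) (trans (+-suc (ρ ∸ κ) κ) (cong suc (m∸n+n≡m κ≤ρ))))

  coefficient : (ℕ → ℕ) → ℕ → ℕ → ℕ
  coefficient f g q = ∑ R (λ i → f (g * (R * K) + i * K + q) * y ^ i)

  ev-pad-< : ∀ f g q → q < K → ev y R (pad K R f) ((g * (2 * K) + q) * R) ≡ coefficient f g q
  ev-pad-< f g q q<K = ∑-cong R λ i i<R → cong (_* y ^ i)
    (trans (blockwise (padAt K R f) R (g * N + q) i<R)
      (trans (cong₂ _*_ (cong f (cong₂ (λ a b → a * (R * K) + i * K + b) (quo-unique g q<N)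
          (trans (cong (λ z → rem z K) (rem-unique g q<N)) (rem-unique 0 q<K))))
        (cong (1 ∸_) (trans (cong (λ z → quo z K) (rem-unique g q<N)) (quo-unique 0 q<K))))
      (*-identityʳ (f (g * (R * K) + i * K + q)))))
    where
    q<N : q < N
    q<N = <-≤-trans q<K (m≤m+n K (K + 0))

  ev-pad-≥ : ∀ f g q → q < K → ev y R (pad K R f) ((g * (2 * K) + (K + q)) * R) ≡ 0
  ev-pad-≥ f g q q<K = ∑-zero R λ i i<R → cong (_* y ^ i)
    (trans (blockwise (padAt K R f) R (g * N + (K + q)) i<R)
      (trans (cong (z i *_) (cong (1 ∸_) (trans (cong (λ z → quo z K) (rem-unique g K+q<N)) one)))
          (*-zeroʳ (z i))))
    where
    z : ℕ → ℕ
    z i = f (quo (g * N + (K + q)) (2 * K) * (R * K) + i * K + rem (rem (g * N + (K + q)) (2 * K)) K)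
    K+q<N : K + q < N
    K+q<N = +-monoʳ-< K (<-≤-trans q<K (m≤m+n K 0))
    one : quo (K + q) K ≡ 1
    one = trans (cong (λ z → quo (z + q) K) (sym (*-identityˡ K))) (quo-unique 1 q<K)

  forward : ∀ f g b → b < 2 * K →
    ev y R (stages K R (suc κ) (pad K R f)) ((g * (2 * K) + b) * R) ≈
    ∑ K (λ q → ω ^ (q * b) * coefficient f g q)
  forward f g b b<N = ≈-trans (transform (pad K R f) g b b<N) (≡⇒≈ (begin
    ∑ (2 * K) h                              ≡⟨ cong (λ z → ∑ (K + z) h) (+-identityʳ K) ⟩
    ∑ (K + K) h                              ≡⟨ ∑-split K K h ⟩
    ∑ K h + ∑ K (λ i → h (K + i))            ≡⟨ cong₂ _+_ (∑-cong K λ q q<K → cong (ω ^ (q * b) *_)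
        (ev-pad-< f g q q<K))
                                                  (∑-zero K λ q q<K → trans (cong (ω ^ ((K + q) * b) *_)
                                                      (ev-pad-≥ f g q q<K)) (*-zeroʳ (ω ^ ((K + q) * b)))) ⟩
    ∑ K (λ q → ω ^ (q * b) * coefficient f g q) + 0 ≡⟨ +-identityʳ _ ⟩
    ∑ K (λ q → ω ^ (q * b) * coefficient f g q) ∎))
    where
    open ≡-Reasoning
    h : ℕ → ℕ
    h q = ω ^ (q * b) * ev y R (pad K R f) ((g * (2 * K) + q) * R)

  power-split : ∀ i j → X ^ (i * K + j) ≡ y ^ i * X ^ j
  power-split i j = trans (^-distribˡ-+-* X (i * K) j)
      (cong (_* X ^ j) (trans (cong (X ^_) (*-comm i K)) (sym (^-*-assoc X K i))))

  ev-coefficients : ∀ f g → ev X (R * K) f (g * (R * K)) ≡ ∑ K (λ q → coefficient f g q * X ^ q)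
  ev-coefficients f g = begin
    ∑ (R * K) (λ i → f (a + i) * X ^ i)
      ≡⟨ ∑-block R K (λ i → f (a + i) * X ^ i) ⟩
    ∑ R (λ i → ∑ K (λ j → f (a + (i * K + j)) * X ^ (i * K + j)))
      ≡⟨ ∑-swap R K (λ i j → f (a + (i * K + j)) * X ^ (i * K + j)) ⟩
    ∑ K (λ j → ∑ R (λ i → f (a + (i * K + j)) * X ^ (i * K + j)))
      ≡⟨ ∑-cong K (λ j _ → trans (∑-cong R λ i _ → trans (cong₂ (λ u v → f u * v) (sym (+-assoc a (i * K) j))
          (power-split i j))
                                                      (sym (*-assoc (f (a + i * K + j)) (y ^ i) (X ^ j))))
                                  (∑-*ʳ R (X ^ j) (λ i → f (a + i * K + j) * y ^ i))) ⟩
    ∑ K (λ q → coefficient f g q * X ^ q) ∎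
    where
    open ≡-Reasoning
    a = g * (R * K)

  reversed : ℕ → ℕ
  reversed v = rem (2 * K ∸ v) (2 * K)

  -- The product of two polynomials of degree below K in X has terms from X^K on, which are folded
  -- back by X^K = y, a rotation by one place. Reading the blocks in reversed order makes an inverse
  -- transform out of the second forward one.
  ev-fold : ∀ F g → ev X (R * K) (fold K R F) (g * (R * K)) ≈
            ∑ (2 * K) (λ v → ev y R F ((g * (2 * K) + reversed v) * R) * X ^ v)
  ev-fold F g = begin
    ev X (R * K) (fold K R F) (g * (R * K))
      ≡⟨ ev-coefficients (fold K R F) g ⟩
    ∑ K (λ j → coefficient (fold K R F) g j * X ^ j)
      ≈⟨ ∑-≈ K (λ j j<K → *-≈ (coef j j<K) ≈-refl) ⟩
    ∑ K (λ j → (w (reversed j) + y * w (K ∸ j)) * X ^ j)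
      ≡⟨ ∑-cong K (λ j j<K → trans (*-distribʳ-+ (X ^ j) (w (reversed j)) (y * w (K ∸ j)))
                                 (cong (w (reversed j) * X ^ j +_) (upper j j<K))) ⟩
    ∑ K (λ j → w (reversed j) * X ^ j + w (reversed (K + j)) * X ^ (K + j))
      ≡⟨ ∑-+ K (λ j → w (reversed j) * X ^ j) _ ⟩
    ∑ K (λ j → w (reversed j) * X ^ j) + ∑ K (λ j → w (reversed (K + j)) * X ^ (K + j))
      ≡⟨ ∑-split K K (λ v → w (reversed v) * X ^ v) ⟨
    ∑ (K + K) (λ v → w (reversed v) * X ^ v)
      ≡⟨ cong (λ z → ∑ (K + z) (λ v → w (reversed v) * X ^ v)) (sym (+-identityʳ K)) ⟩
    ∑ (2 * K) (λ v → w (reversed v) * X ^ v) ∎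
    where
    open ≈-Reasoning
    w : ℕ → ℕ
    w u = ev y R F ((g * (2 * K) + u) * R)
    1<R : 1 < R
    1<R = ^-monoʳ-≤ 2 {1} {suc ρ} (s≤s z≤n)
    upper : ∀ j → j < K → y * w (K ∸ j) * X ^ j ≡ w (reversed (K + j)) * X ^ (K + j)
    upper j j<K = trans (lemma y (w (K ∸ j)) (X ^ j))
      (cong₂ (λ u v → w u * v) (sym rev) (sym (^-distribˡ-+-* X K j)))
      where
      lemma : ∀ a b c → a * b * c ≡ b * (a * c)
      lemma = solve-∀
      rev : reversed (K + j) ≡ K ∸ j
      rev = trans (cong (λ z → rem z (2 * K)) (trans (sym (∸-+-assoc (2 * K) K j))
          (cong (_∸ j) (trans (m+n∸m≡n K (K + 0)) (+-identityʳ K)))))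
        (rem-unique 0 (≤-<-trans (m∸n≤m K j) (m<m+n K (subst (0 <_) (sym (+-identityʳ K)) 0<K))))
    coef : ∀ j → j < K → coefficient (fold K R F) g j ≈ w (reversed j) + y * w (K ∸ j)
    coef j j<K = begin
      ∑ R (λ i → fold K R F (g * (R * K) + i * K + j) * y ^ i)
        ≡⟨ ∑-cong R (λ i i<R → cong (_* y ^ i) (at-fold i i<R)) ⟩
      ∑ R (λ i → (F ((g * N + reversed j) * R + i) + F ((g * N + (K ∸ j)) * R + rem (i + (R ∸ 1)) R)) * y ^ i)
        ≡⟨ ∑-cong R (λ i _ → *-distribʳ-+ (y ^ i) (F ((g * N + reversed j) * R + i)) _) ⟩
      ∑ R (λ i → F ((g * N + reversed j) * R + i) * y ^ i + F ((g * N + (K ∸ j)) * R + rem (i + (R ∸ 1)) R) *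
          y ^ i)
        ≡⟨ ∑-+ R (λ i → F ((g * N + reversed j) * R + i) * y ^ i) _ ⟩
      w (reversed j) + ∑ R (λ i → F ((g * N + (K ∸ j)) * R + rem (i + (R ∸ 1)) R) * y ^ i)
        ≈⟨ +-≈ (≈-refl {w (reversed j)}) (shift-∑ (λ i → F ((g * N + (K ∸ j)) * R + i)) 1 1<R) ⟩
      w (reversed j) + y ^ 1 * w (K ∸ j)
        ≡⟨ cong (λ z → w (reversed j) + z * w (K ∸ j)) (^-identityʳ y) ⟩
      w (reversed j) + y * w (K ∸ j) ∎
      where
      at-fold : ∀ i → i < R → fold K R F (g * (R * K) + i * K + j) ≡
                F ((g * N + reversed j) * R + i) + F ((g * N + (K ∸ j)) * R + rem (i + (R ∸ 1)) R)
      at-fold i i<R = trans (cong (fold K R F) (cong (_+ j) (lemma g R K i)))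
        (trans (blockwise (foldAt K R F) K (g * R + i) j<K)
          (cong₂ (λ a b → F ((a * N + reversed j) * R + b) + F ((a * N + (K ∸ j)) * R + rem (b + (R ∸ 1)) R))
            (quo-unique g i<R) (rem-unique g i<R)))
        where lemma : ∀ g r k i → g * (r * k) + i * k ≡ (g * r + i) * k
              lemma = solve-∀

  delta-yes : ∀ i j → i + j < N → ∑ N (λ b → ω ^ (b * (reversed (i + j) + (i + j)))) ≈ N
  delta-yes i j p with i + j
  ... | zero  = ≈-trans (≡⇒≈ (∑-cong N λ b _ → cong (λ z → ω ^ (b * z)) (trans (+-identityʳ (reversed 0))
      rem0))) (orthogonal-yes κ ω root 0)
    where
    rem0 : reversed 0 ≡ N * 0
    rem0 = trans (trans (cong (λ z → rem z N) (sym (trans (+-identityʳ (1 * N)) (*-identityˡ N))))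
        (rem-unique 1 0<N)) (sym (*-zeroʳ N))
  ... | suc v = ≈-trans (≡⇒≈ (∑-cong N λ b _ → cong (λ z → ω ^ (b * z)) total)) (orthogonal-yes κ ω root 1)
    where
    total : reversed (suc v) + suc v ≡ N * 1
    total = trans (cong (_+ suc v) (rem-unique 0 (∸-monoʳ-< z<s (<⇒≤ p)))) (trans (m∸n+n≡m (<⇒≤ p))
        (sym (*-identityʳ N)))

  delta-no : ∀ i j v → i + j < N → v < N → v ≢ i + j → ∑ N (λ b → ω ^ (b * (reversed v + (i + j)))) ≈ 0
  delta-no i j v p v<N v≢ = orthogonal-no κ ω root (reversed v + (i + j)) ¬div
    where
    split : N ≡ quo (N ∸ v) N * N + (reversed v + v)
    split = trans (sym (m∸n+n≡m (<⇒≤ v<N))) (trans (cong (_+ v) (quo-rem (N ∸ v) N))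
        (+-assoc (quo (N ∸ v) N * N) _ v))
    ¬div : ∀ e → reversed v + (i + j) ≢ N * e
    ¬div e q = v≢ (trans (sym (rem-unique (quo (N ∸ v) N + e) v<N))
      (trans (cong (λ z → rem z N) eq) (rem-unique 1 p)))
      where
      c = quo (N ∸ v) N
      eq : (c + e) * N + v ≡ 1 * N + (i + j)
      eq = begin
        (c + e) * N + v                       ≡⟨ lemma₁ c e N v ⟩
        c * N + (N * e + v)                   ≡⟨ cong (λ z → c * N + (z + v)) (sym q) ⟩
        c * N + (reversed v + (i + j) + v)    ≡⟨ lemma₂ (c * N) (reversed v) (i + j) v ⟩
        c * N + (reversed v + v) + (i + j)    ≡⟨ cong (_+ (i + j)) (sym split) ⟩
        N + (i + j)                           ≡⟨ cong (_+ (i + j)) (sym (*-identityˡ N)) ⟩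
        1 * N + (i + j)                       ∎
        where
        open ≡-Reasoning
        lemma₁ : ∀ c e n v → (c + e) * n + v ≡ c * n + (n * e + v)
        lemma₁ = solve-∀
        lemma₂ : ∀ a b c d → a + (b + c + d) ≡ a + (b + d) + c
        lemma₂ = solve-∀

  -- Once the sum over `b` is taken innermost, orthogonality leaves only v = i + j. There is no
  -- wrap-around since i + j < 2K; this is why `pad` doubles the length. The factor 2K of the
  -- unnormalised transforms joins `s`, the factor left by the levels below.
  bilinear : ∀ s (α β : ℕ → ℕ) →
    ∑ N (λ v → ∑ N (λ b → ω ^ (b * reversed v) *
                (s * (∑ K (λ i → ω ^ (i * b) * α i) * ∑ K (λ j → ω ^ (j * b) * β j)))) * X ^ v) ≈
    N * s * (∑ K (λ i → α i * X ^ i) * ∑ K (λ j → β j * X ^ j))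
  bilinear s α β = begin
    ∑ N (λ v → ∑ N (λ b → ω ^ (b * reversed v) * (s * (∑ K (P b) * ∑ K (Q b)))) * X ^ v)
      ≡⟨ ∑-cong N (λ v _ → trans (sym (∑-*ʳ N (X ^ v) _)) (∑-cong N λ b _ → expand v b)) ⟩
    ∑ N (λ v → ∑ N (λ b → ∑ K (λ i → ∑ K (λ j → Z v b i j))))
      ≡⟨ ∑-cong N (λ v _ → trans (∑-swap N K (λ b i → ∑ K (Z v b i))) (∑-cong K λ i _ → ∑-swap N K
          (λ b j → Z v b i j))) ⟩
    ∑ N (λ v → ∑ K (λ i → ∑ K (λ j → ∑ N (λ b → Z v b i j))))
      ≡⟨ trans (∑-swap N K (λ v i → ∑ K (λ j → ∑ N (λ b → Z v b i j)))) (∑-cong K λ i _ → ∑-swap N K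
          (λ v j → ∑ N (λ b → Z v b i j))) ⟩
    ∑ K (λ i → ∑ K (λ j → ∑ N (λ v → ∑ N (λ b → Z v b i j))))
      ≈⟨ ∑-≈ K (λ i i<K → ∑-≈ K λ j j<K → collapse i j i<K j<K) ⟩
    ∑ K (λ i → ∑ K (λ j → N * s * (α i * X ^ i * (β j * X ^ j))))
      ≡⟨ ∑-cong K (λ i _ → ∑-*ˡ K (N * s) (λ j → α i * X ^ i * (β j * X ^ j))) ⟩
    ∑ K (λ i → N * s * ∑ K (λ j → α i * X ^ i * (β j * X ^ j)))
      ≡⟨ ∑-*ˡ K (N * s) (λ i → ∑ K (λ j → α i * X ^ i * (β j * X ^ j))) ⟩
    N * s * ∑ K (λ i → ∑ K (λ j → α i * X ^ i * (β j * X ^ j)))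
      ≡⟨ cong (N * s *_) (∑-*∑ K K (λ i → α i * X ^ i) (λ j → β j * X ^ j)) ⟨
    N * s * (∑ K (λ i → α i * X ^ i) * ∑ K (λ j → β j * X ^ j)) ∎
    where
    open ≈-Reasoning
    P Q : ℕ → ℕ → ℕ
    P b i = ω ^ (i * b) * α i
    Q b j = ω ^ (j * b) * β j
    Z : ℕ → ℕ → ℕ → ℕ → ℕ
    Z v b i j = s * (α i * β j) * (ω ^ (b * (reversed v + (i + j))) * X ^ v)
    expand : ∀ v b → ω ^ (b * reversed v) * (s * (∑ K (P b) * ∑ K (Q b))) * X ^ v ≡ ∑ K
        (λ i → ∑ K (λ j → Z v b i j))
    expand v b = trans (cong (λ z → ω ^ (b * reversed v) * (s * z) * X ^ v) (∑-*∑ K K (P b) (Q b)))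
      (trans (factor (ω ^ (b * reversed v)) s _ (X ^ v))
        (trans (sym (∑-*ˡ K c (λ i → ∑ K (λ j → P b i * Q b j)))) (∑-cong K λ i _ →
          trans (sym (∑-*ˡ K c (λ j → P b i * Q b j))) (∑-cong K λ j _ → term i j))))
      where
      c = ω ^ (b * reversed v) * s * X ^ v
      factor : ∀ a s z x → a * (s * z) * x ≡ a * s * x * z
      factor = solve-∀
      term : ∀ i j → c * (P b i * Q b j) ≡ Z v b i j
      term i j = trans (regroup (ω ^ (b * reversed v)) s (X ^ v) (ω ^ (i * b)) (α i) (ω ^ (j * b)) (β j))
        (cong (λ z → s * (α i * β j) * (z * X ^ v)) powers)
        where
        regroup : ∀ a s x p u q v → a * s * x * (p * u * (q * v)) ≡ s * (u * v) * (a * (p * q) * x)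
        regroup = solve-∀
        index : ∀ b r i j → b * r + (i * b + j * b) ≡ b * (r + (i + j))
        index = solve-∀
        powers : ω ^ (b * reversed v) * (ω ^ (i * b) * ω ^ (j * b)) ≡ ω ^ (b * (reversed v + (i + j)))
        powers = trans (cong (ω ^ (b * reversed v) *_) (sym (^-distribˡ-+-* ω (i * b) (j * b))))
          (trans (sym (^-distribˡ-+-* ω (b * reversed v) (i * b + j * b))) (cong (ω ^_)
              (index b (reversed v) i j)))
    collapse : ∀ i j → i < K → j < K → ∑ N (λ v → ∑ N (λ b → Z v b i j)) ≈ N * s *
        (α i * X ^ i * (β j * X ^ j))
    collapse i j i<K j<K = begin
      ∑ N (λ v → ∑ N (λ b → Z v b i j))
        ≡⟨ ∑-cong N (λ v _ → trans (∑-*ˡ N (s * (α i * β j)) _) (cong (s * (α i * β j) *_)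
            (∑-*ʳ N (X ^ v) (λ b → ω ^ (b * (reversed v + (i + j))))))) ⟩
      ∑ N (λ v → s * (α i * β j) * (∑ N (λ b → ω ^ (b * (reversed v + (i + j)))) * X ^ v))
        ≡⟨ ∑-*ˡ N (s * (α i * β j)) _ ⟩
      s * (α i * β j) * ∑ N (λ v → ∑ N (λ b → ω ^ (b * (reversed v + (i + j)))) * X ^ v)
        ≈⟨ *-≈ (≈-refl {s * (α i * β j)}) (∑-delta N (i + j) i+j<N λ v v<N v≢ → *-≈
            (delta-no i j v i+j<N v<N v≢) ≈-refl) ⟩
      s * (α i * β j) * (∑ N (λ b → ω ^ (b * (reversed (i + j) + (i + j)))) * X ^ (i + j))
        ≈⟨ *-≈ (≈-refl {s * (α i * β j)}) (*-≈ (delta-yes i j i+j<N) (≡⇒≈ (^-distribˡ-+-* X i j))) ⟩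
      s * (α i * β j) * (N * (X ^ i * X ^ j))
        ≡⟨ lemma s (α i) (β j) N (X ^ i) (X ^ j) ⟩
      N * s * (α i * X ^ i * (β j * X ^ j)) ∎
      where
      i+j<N : i + j < N
      i+j<N = subst (i + j <_) (cong (K +_) (sym (+-identityʳ K))) (+-mono-< i<K j<K)
      lemma : ∀ s a b n x z → s * (a * b) * (n * (x * z)) ≡ n * s * (a * x * (b * z))
      lemma = solve-∀

  -- O holds the products of the transformed blocks g and B + g of A.
  level-correct : ∀ s B A O g →
    (∀ b → b < 2 * K → let q = g * (2 * K) + b; A′ = stages K R (suc κ) (pad K R A) in
      ev y R O (q * R) ≈ s * (ev y R A′ (q * R) * ev y R A′ ((B * (2 * K) + q) * R))) →
    ev X (R * K) (fold K R (stages K R (suc κ) O)) (g * (R * K)) ≈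
    2 * K * s * (ev X (R * K) A (g * (R * K)) * ev X (R * K) A ((B + g) * (R * K)))
  level-correct s B A O g products = begin
    ev X (R * K) (fold K R (stages K R (suc κ) O)) (g * (R * K))
      ≈⟨ ev-fold (stages K R (suc κ) O) g ⟩
    ∑ N (λ v → ev y R (stages K R (suc κ) O) ((g * N + reversed v) * R) * X ^ v)
      ≈⟨ ∑-≈ N (λ v _ → *-≈ (transform O g (reversed v) (rem-< (2 * K ∸ v) 0<N)) ≈-refl) ⟩
    ∑ N (λ v → ∑ N (λ b → ω ^ (b * reversed v) * ev y R O ((g * N + b) * R)) * X ^ v)
      ≈⟨ ∑-≈ N (λ v _ → *-≈ (∑-≈ N λ b b<N → *-≈ (≈-refl {ω ^ (b * reversed v)}) (product b b<N)) ≈-refl) ⟩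
    ∑ N (λ v → ∑ N (λ b → ω ^ (b * reversed v) *
      (s * (∑ K (λ i → ω ^ (i * b) * coefficient A g i) * ∑ K (λ j → ω ^ (j * b) * coefficient A (B + g)
          j)))) * X ^ v)
      ≈⟨ bilinear s (coefficient A g) (coefficient A (B + g)) ⟩
    N * s * (∑ K (λ i → coefficient A g i * X ^ i) * ∑ K (λ j → coefficient A (B + g) j * X ^ j))
      ≡⟨ cong₂ (λ p q → N * s * (p * q)) (sym (ev-coefficients A g)) (sym (ev-coefficients A (B + g))) ⟩
    N * s * (ev X (R * K) A (g * (R * K)) * ev X (R * K) A ((B + g) * (R * K))) ∎
    where
    open ≈-Reasoning
    A′ = stages K R (suc κ) (pad K R A)
    product : ∀ b → b < N → ev y R O ((g * N + b) * R) ≈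
      s * (∑ K (λ i → ω ^ (i * b) * coefficient A g i) * ∑ K (λ j → ω ^ (j * b) * coefficient A (B + g) j))
    product b b<N = ≈-trans (products b b<N) (*-≈ (≈-refl {s}) (*-≈ (forward A g b b<N)
      (≈-trans (≡⇒≈ (cong (λ z → ev y R A′ (z * R)) (lemma B N g b))) (forward A (B + g) b b<N))))
      where lemma : ∀ B n g b → B * n + (g * n + b) ≡ (B + g) * n + b
            lemma = solve-∀

-- Halving the exponent m of the block length 2^(m+1) from level to level

halve : ℕ → ℕ
halve a = quo (a + 1) 2

halve-≥ : ∀ a → a ≤ 2 * halve a
halve-≥ a = ≤-pred (begin
  1 + a                              ≡⟨ +-comm 1 a ⟩
  a + 1                              ≡⟨ quo-rem (a + 1) 2 ⟩
  halve a * 2 + rem (a + 1) 2        ≤⟨ +-monoʳ-≤ (halve a * 2) (≤-pred (rem-< (a + 1) {2} z<s)) ⟩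
  halve a * 2 + 1                    ≡⟨ lemma (halve a) ⟩
  1 + 2 * halve a                    ∎)
  where
  open ≤-Reasoning
  lemma : ∀ a → a * 2 + 1 ≡ 1 + 2 * a
  lemma = solve-∀

halve-*2 : ∀ a → halve a * 2 ≤ a + 1
halve-*2 a = quo-*-≤ (a + 1) 2

halve-≤ : ∀ {a} → 1 ≤ a → halve a ≤ a
halve-≤ {a} 1≤a = *-cancelʳ-≤ (halve a) a 2 (≤-trans (halve-*2 a)
  (≤-trans (+-monoʳ-≤ a 1≤a) (≤-reflexive (lemma a))))
  where lemma : ∀ a → a + a ≡ a * 2
        lemma = solve-∀

halve-pos : ∀ {a} → 1 ≤ a → 1 ≤ halve a
halve-pos {a} 1≤a with halve a | halve-≥ a
... | zero  | p = contradiction (≤-trans 1≤a p) λ ()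
... | suc _ | _ = s≤s z≤n

halve-2^ : ∀ {a} D → a ≤ 2 ^ suc D → halve a ≤ 2 ^ D
halve-2^ {a} D p = ≤-pred (*-cancelʳ-< 2 (halve a) (suc (2 ^ D)) (begin-strict
  halve a * 2        ≤⟨ halve-*2 a ⟩
  a + 1              ≤⟨ +-monoˡ-≤ 1 p ⟩
  2 * 2 ^ D + 1      <⟨ ≤-reflexive (lemma (2 ^ D)) ⟩
  suc (2 ^ D) * 2    ∎))
  where
  open ≤-Reasoning
  lemma : ∀ a → suc (2 * a + 1) ≡ suc a * 2
  lemma = solve-∀

-- At the bottom, products of cyclic length 4 are computed directly.
baseAt : ℕ → (ℕ → ℕ) → ℕ → ℕ → ℕ
baseAt H f q i = t 0 + (t 1 + (t 2 + t 3))
  where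
  t : ℕ → ℕ
  t j = f (q * 4 + j) * f (H + (q * 4 + rem (i + (4 ∸ j)) 4))

base : ℕ → (ℕ → ℕ) → ℕ → ℕ
base H f p = baseAt H f (quo p 4) (rem p 4)

base-correct : ∀ X H f q → let open Modular (X ^ 2) in
               ev X 4 (base H f) (q * 4) ≈ ev X 4 f (q * 4) * ev X 4 f (H + q * 4)
base-correct X H f q = begin
  ∑ 4 (λ i → base H f (q * 4 + i) * X ^ i)
    ≡⟨ ∑-cong 4 (λ i i<4 → trans (cong (_* X ^ i) (trans (blockwise (baseAt H f) 4 q i<4) (sum4 i)))
        (sym (∑-*ʳ 4 (X ^ i) (λ j → t i j)))) ⟩
  ∑ 4 (λ i → ∑ 4 (λ j → t i j * X ^ i))
    ≡⟨ ∑-swap 4 4 (λ i j → t i j * X ^ i) ⟩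
  ∑ 4 (λ j → ∑ 4 (λ i → t i j * X ^ i))
    ≡⟨ ∑-cong 4 (λ j _ → trans (∑-cong 4 λ i _ → *-assoc (f (q * 4 + j)) (b j i) (X ^ i))
        (∑-*ˡ 4 (f (q * 4 + j)) (λ i → b j i * X ^ i))) ⟩
  ∑ 4 (λ j → f (q * 4 + j) * ∑ 4 (λ i → b j i * X ^ i))
    ≈⟨ ∑-≈ 4 (λ j j<4 → ≈-trans (*-≈ (≈-refl {f (q * 4 + j)}) (shifted j j<4))
        (≡⇒≈ (sym (*-assoc (f (q * 4 + j)) (X ^ j) _)))) ⟩
  ∑ 4 (λ j → f (q * 4 + j) * X ^ j * ev X 4 f (H + q * 4))
    ≡⟨ ∑-*ʳ 4 (ev X 4 f (H + q * 4)) (λ j → f (q * 4 + j) * X ^ j) ⟩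
  ev X 4 f (q * 4) * ev X 4 f (H + q * 4) ∎
  where
  open Modular (X ^ 2)
  open ≈-Reasoning
  b t : ℕ → ℕ → ℕ
  b j i = f (H + (q * 4 + rem (i + (4 ∸ j)) 4))
  t i j = f (q * 4 + j) * b j i
  sum4 : ∀ i → baseAt H f q i ≡ ∑ 4 (t i)
  sum4 i = cong (λ z → t i 0 + (t i 1 + (t i 2 + z))) (sym (+-identityʳ (t i 3)))
  shifted : ∀ j → j < 4 → ∑ 4 (λ i → b j i * X ^ i) ≈ X ^ j * ev X 4 f (H + q * 4)
  shifted j j<4 = ≈-trans
    -- Rotations of length 4 are the case κ = 0, ρ = 1 of a level, where K = 1, y = X^1 and R = 4.
    (subst (λ Y → ∑ 4 (λ i → b j i * Y ^ i) ≈ Y ^ j * ∑ 4 (λ i → f (H + (q * 4 + i)) * Y ^ i)) (*-identityʳ X)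
      (Level.shift-∑ 0 1 X z≤n (λ i → f (H + (q * 4 + i))) j j<4))
    (≡⇒≈ (cong (X ^ j *_) (∑-cong 4 λ i _ → cong (λ z → f z * X ^ i) (sym (+-assoc H (q * 4) i)))))

-- All levels together

module Levels (m : ℕ) (1≤m : 1 ≤ m) (f : ℕ → ℕ) where

  -- A block on level `d` has length 2^(exponent d + 1), twice the degree at which X plays -1.
  -- `blocks d` counts the blocks of one factor; `down d` holds the two factors one behind the
  -- other.
  exponent κ ρ K R blocks : ℕ → ℕ
  exponent zero    = m
  exponent (suc d) = halve (exponent d)
  κ d = exponent d ∸ exponent (suc d)
  ρ d = exponent (suc d)
  K d = 2 ^ κ d
  R d = 2 ^ suc (ρ d)
  blocks zero    = 1
  blocks (suc d) = blocks d * (2 * K d)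

  down : ℕ → ℕ → ℕ
  down zero    = f
  down (suc d) = stages (K d) (R d) (suc (κ d)) (pad (K d) (R d) (down d))

  -- up j d is the result at level d when the bottom is at level j + d.
  up : ℕ → ℕ → ℕ → ℕ
  up zero    d = base (blocks d * 4) (down d)
  up (suc j) d = fold (K d) (R d) (stages (K d) (R d) (suc (κ d)) (up j (suc d)))

  -- The product of the factors 2K lost by not normalising the transforms. It is positive, which is
  -- all that the detection of nonzero coefficients requires.
  scale : ℕ → ℕ → ℕ
  scale zero    d = 1
  scale (suc j) d = 2 * K d * scale j (suc d)

  scale>0 : ∀ j d → 0 < scale j d
  scale>0 zero    d = z<s
  scale>0 (suc j) d = *-mono-≤ (m^n>0 2 (suc (κ d))) (scale>0 j (suc d))

  exponent≥1 : ∀ d → 1 ≤ exponent d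
  exponent≥1 zero    = 1≤m
  exponent≥1 (suc d) = halve-pos (exponent≥1 d)

  κ+ρ : ∀ d → κ d + ρ d ≡ exponent d
  κ+ρ d = m∸n+n≡m (halve-≤ (exponent≥1 d))

  -- This is the reason why `halve` rounds up.
  κ≤ρ : ∀ d → κ d ≤ ρ d
  κ≤ρ d = ≤-trans (∸-monoˡ-≤ (ρ d) (halve-≥ (exponent d)))
            (≤-reflexive (trans (m+n∸m≡n (ρ d) (ρ d + 0)) (+-identityʳ (ρ d))))

  exponent-2^ : ∀ d j → m ≤ 2 ^ (j + d) → exponent d ≤ 2 ^ j
  exponent-2^ zero    j p = subst (λ z → m ≤ 2 ^ z) (+-identityʳ j) p
  exponent-2^ (suc d) j p = halve-2^ j (exponent-2^ d (suc j) (subst (λ z → m ≤ 2 ^ z) (+-suc j d) p))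

  exponent-bottom : ∀ D → m ≤ 2 ^ D → exponent D ≡ 1
  exponent-bottom D p = ≤-antisym (exponent-2^ D 0 p) (exponent≥1 D)

  block : ℕ → ℕ
  block d = 2 ^ suc (exponent d)

  R*K : ∀ d → R d * K d ≡ block d
  R*K d = trans (sym (^-distribˡ-+-* 2 (suc (ρ d)) (κ d)))
    (cong (λ z → 2 ^ suc z) (trans (+-comm (ρ d) (κ d)) (κ+ρ d)))

  -- The modulus 1 + τ is the same number on all levels: the next level has base y = X^K and
  -- exponent ρ, and y^(2^ρ) = X^(2^(κ+ρ)). So the levels are linked by congruences of natural
  -- numbers, and no tower of polynomial rings is needed.
  up-correct : ∀ j d X τ → exponent (j + d) ≡ 1 → X ^ 2 ^ exponent d ≡ τ → ∀ g →
    let open Modular τ; n = block d in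
    ev X n (up j d) (g * n) ≈ scale j d * (ev X n (down d) (g * n) * ev X n (down d) ((blocks d + g) * n))
  up-correct zero d X _ bottom refl g = subst (λ e → let open Modular (X ^ 2 ^ e); n = 2 ^ suc e in
      ev X n (up 0 d) (g * n) ≈ 1 * (ev X n (down d) (g * n) * ev X n (down d) ((blocks d + g) * n)))
    (sym bottom)
    (Modular.≈-trans (X ^ 2) (base-correct X (blocks d * 4) (down d) g)
      (Modular.≡⇒≈ (X ^ 2) (trans (cong (λ z → ev X 4 (down d) (g * 4) * ev X 4 (down d) z)
          (sym (*-distribʳ-+ 4 (blocks d) g)))
        (sym (*-identityˡ _)))))
  up-correct (suc j) d X τ bottom X^ g =
    subst (λ n → ev X n (up (suc j) d) (g * n) ≈ scale (suc j) d * (ev X n (down d) (g * n) * ev X n (down d)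
        ((blocks d + g) * n)))
      (R*K d)
      (subst (λ τ → Modular._≈_ τ (ev X n′ (up (suc j) d) (g * n′)) (scale (suc j) d *
          (ev X n′ (down d) (g * n′) * ev X n′ (down d) ((blocks d + g) * n′))))
        σ≡
        (L.level-correct (scale j (suc d)) (blocks d) (down d) (up j (suc d)) g products))
    where
    open Modular τ
    module L = LevelCorrect (κ d) (ρ d) X (κ≤ρ d)
    n′ = R d * K d
    σ≡ : L.σ ≡ τ
    σ≡ = trans (cong (λ z → X ^ 2 ^ z) (κ+ρ d)) X^
    products : ∀ b → b < 2 * K d → let q = g * (2 * K d) + b in
      Modular._≈_ L.σ (ev L.y (R d) (up j (suc d)) (q * R d))
        (scale j (suc d) * (ev L.y (R d) (down (suc d)) (q * R d) * ev L.y (R d) (down (suc d))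
            ((blocks d * (2 * K d) + q) * R d)))
    products b _ = up-correct j (suc d) L.y L.σ (trans (cong exponent (+-suc j d)) bottom) L.y^2^ρ
        (g * (2 * K d) + b)

-- Kronecker substitution: coefficients are read off at an X exceeding them

∑-≥ : ∀ n f {i} → i < n → f i ≤ ∑ n f
∑-≥ (suc n) f {zero}  _         = m≤m+n (f 0) _
∑-≥ (suc n) f {suc i} (s<s i<n) = ≤-trans (∑-≥ n (f ∘ suc) i<n) (m≤n+m _ (f 0))

horner : ∀ X n (f : ℕ → ℕ) → ∑ (suc n) (λ i → f i * X ^ i) ≡ ∑ n (λ i → f (suc i) * X ^ i) * X + f 0
horner X n f = trans (cong₂ _+_ (*-identityʳ (f 0))
  (trans (∑-cong n λ i _ → lemma (f (suc i)) X (X ^ i)) (∑-*ʳ n X (λ i → f (suc i) * X ^ i))))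
      (+-comm (f 0) _)
  where lemma : ∀ a x p → a * (x * p) ≡ a * p * x
        lemma = solve-∀

digits-< : ∀ X n (f : ℕ → ℕ) → (∀ i → i < n → f i < X) → ∑ n (λ i → f i * X ^ i) < X ^ n
digits-< X zero    f p = z<s
digits-< X (suc n) f p = subst₂ _<_ (sym (horner X n f)) (*-comm (X ^ n) X)
  (pair-< (digits-< X n (f ∘ suc) λ i q → p (suc i) (s<s q)) (p 0 z<s))

digits-unique : ∀ X n (f g : ℕ → ℕ) → (∀ i → i < n → f i < X) → (∀ i → i < n → g i < X) →
                ∑ n (λ i → f i * X ^ i) ≡ ∑ n (λ i → g i * X ^ i) → ∀ i → i < n → f i ≡ g i
digits-unique X (suc n) f g p q eq i i<n = go i i<n
  where
  F = ∑ n (λ i → f (suc i) * X ^ i)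
  G = ∑ n (λ i → g (suc i) * X ^ i)
  eq′ : ∑ n (λ i → f (suc i) * X ^ i) * X + f 0 ≡ ∑ n (λ i → g (suc i) * X ^ i) * X + g 0
  eq′ = trans (sym (horner X n f)) (trans eq (horner X n g))
  go : ∀ i → i < suc n → f i ≡ g i
  go zero    _ = trans (sym (rem-unique F (p 0 z<s))) (trans (cong (λ z → rem z X) eq′)
      (rem-unique G (q 0 z<s)))
  go (suc i) (s<s i<n) = digits-unique X n (f ∘ suc) (g ∘ suc) (λ i r → p (suc i) (s<s r))
      (λ i r → q (suc i) (s<s r))
    (trans (sym (quo-unique _ (p 0 z<s))) (trans (cong (λ z → quo z X) eq′) (quo-unique _ (q 0 z<s)))) i i<n

triangle : ∀ n (h : ℕ → ℕ → ℕ) → ∑ n (λ p → ∑ (suc p) (λ i → h i (p ∸ i))) ≡ ∑ n (λ i → ∑ (n ∸ i) (h i))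
triangle zero    h = refl
triangle (suc n) h = begin
  h 0 0 + 0 + ∑ n (λ p → h 0 (suc p) + ∑ (suc p) (λ i → h (suc i) (p ∸ i)))
    ≡⟨ cong₂ _+_ (+-identityʳ (h 0 0)) (∑-+ n (λ p → h 0 (suc p)) _) ⟩
  h 0 0 + (∑ n (λ p → h 0 (suc p)) + ∑ n (λ p → ∑ (suc p) (λ i → h (suc i) (p ∸ i))))
    ≡⟨ sym (+-assoc (h 0 0) _ _) ⟩
  h 0 0 + ∑ n (λ p → h 0 (suc p)) + ∑ n (λ p → ∑ (suc p) (λ i → h (suc i) (p ∸ i)))
    ≡⟨ cong (h 0 0 + ∑ n (λ p → h 0 (suc p)) +_) (triangle n (λ i → h (suc i))) ⟩
  h 0 0 + ∑ n (λ p → h 0 (suc p)) + ∑ n (λ i → ∑ (n ∸ i) (h (suc i))) ∎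
  where open ≡-Reasoning

convolve : (ℕ → ℕ) → (ℕ → ℕ) → ℕ → ℕ
convolve a b p = ∑ (suc p) (λ i → a i * b (p ∸ i))

∑-support : ∀ {Q n} f → Q ≤ n → (∀ i → Q ≤ i → f i ≡ 0) → ∑ n f ≡ ∑ Q f
∑-support {Q} {n} f Q≤n z = trans (cong (λ k → ∑ k f) (sym (m+[n∸m]≡n Q≤n)))
  (trans (∑-split Q (n ∸ Q) f) (trans (cong (∑ Q f +_) (∑-zero (n ∸ Q) λ i _ → z (Q + i) (m≤m+n Q i)))
      (+-identityʳ _)))

cauchy : ∀ X Q N (a b : ℕ → ℕ) → Q + Q ≤ N → (∀ i → Q ≤ i → a i ≡ 0) → (∀ i → Q ≤ i → b i ≡ 0) →
         ∑ Q (λ i → a i * X ^ i) * ∑ Q (λ i → b i * X ^ i) ≡ ∑ N (λ p → convolve a b p * X ^ p)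
cauchy X Q N a b 2Q≤N az bz = sym (begin
  ∑ N (λ p → convolve a b p * X ^ p)
    ≡⟨ ∑-cong N (λ p _ → trans (sym (∑-*ʳ (suc p) (X ^ p) (λ i → a i * b (p ∸ i))))
        (∑-cong (suc p) λ i i≤p → term p i (≤-pred i≤p))) ⟩
  ∑ N (λ p → ∑ (suc p) (λ i → h i (p ∸ i)))
    ≡⟨ triangle N h ⟩
  ∑ N (λ i → ∑ (N ∸ i) (h i))
    ≡⟨ ∑-support (λ i → ∑ (N ∸ i) (h i)) (≤-trans (m≤m+n Q Q) 2Q≤N) (λ i Q≤i → ∑-zero (N ∸ i) λ j _ → cong
        (λ z → z * X ^ i * (b j * X ^ j)) (az i Q≤i)) ⟩
  ∑ Q (λ i → ∑ (N ∸ i) (h i))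
    ≡⟨ ∑-cong Q (λ i i<Q → ∑-support (h i) (Q≤N∸i i i<Q) λ j Q≤j → trans (cong
        (λ z → a i * X ^ i * (z * X ^ j)) (bz j Q≤j)) (*-zeroʳ (a i * X ^ i))) ⟩
  ∑ Q (λ i → ∑ Q (h i))
    ≡⟨ ∑-*∑ Q Q (λ i → a i * X ^ i) (λ j → b j * X ^ j) ⟨
  ∑ Q (λ i → a i * X ^ i) * ∑ Q (λ i → b i * X ^ i) ∎)
  where
  open ≡-Reasoning
  h : ℕ → ℕ → ℕ
  h i j = a i * X ^ i * (b j * X ^ j)
  term : ∀ p i → i ≤ p → a i * b (p ∸ i) * X ^ p ≡ h i (p ∸ i)
  term p i i≤p = trans (cong (λ z → a i * b (p ∸ i) * z) (trans (cong (X ^_) (sym (m+[n∸m]≡n i≤p)))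
      (^-distribˡ-+-* X i (p ∸ i))))
    (lemma (a i) (b (p ∸ i)) (X ^ i) (X ^ (p ∸ i)))
    where lemma : ∀ a b x y → a * b * (x * y) ≡ a * x * (b * y)
          lemma = solve-∀
  Q≤N∸i : ∀ i → i < Q → Q ≤ N ∸ i
  Q≤N∸i i i<Q = ≤-trans (≤-reflexive (sym (m+n∸n≡m Q i))) (∸-monoˡ-≤ i (≤-trans (+-monoʳ-≤ Q (<⇒≤ i<Q)) 2Q≤N))

module _ (m : ℕ) (1≤m : 1 ≤ m) (D : ℕ) (m≤2^D : m ≤ 2 ^ D) (f : ℕ → ℕ) where
  open Levels m 1≤m f

  -- As X^N stands for -1, the coefficient is the difference of the two halves of the result; with
  -- the upper half on the other side the statement stays within ℕ. Both sides, read in base X, are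
  -- numbers below X^N, so that their congruence modulo 1 + X^N is an equality and their digits
  -- agree. `Q + Q ≤ 2 ^ m` prevents the product itself from wrapping around.
  product-coefficients : ∀ Q (a b : ℕ → ℕ) → Q + Q ≤ 2 ^ m →
    (∀ i → i < 2 * 2 ^ m → f i ≡ a i) → (∀ i → i < 2 * 2 ^ m → f (2 * 2 ^ m + i) ≡ b i) →
    (∀ i → Q ≤ i → a i ≡ 0) → (∀ i → Q ≤ i → b i ≡ 0) →
    ∀ p → p < 2 ^ m → up D 0 p ≡ scale D 0 * convolve a b p + up D 0 (2 ^ m + p)
  product-coefficients Q a b 2Q≤N fa fb az bz =
      digits-unique X N o (λ p → s * c p + o (N + p)) small₁ small₂ sums≡
    where
    N = 2 ^ m
    s = scale D 0
    c = convolve a b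
    o = up D 0
    -- Larger than every digit on both sides. This base exists in the proof only; the program never
    -- computes with it.
    X = suc (∑ N (λ p → o p + (s * c p + o (N + p))))
    small₁ : ∀ p → p < N → o p < X
    small₁ p p<N = s≤s (≤-trans (m≤m+n (o p) _) (∑-≥ N (λ p → o p + (s * c p + o (N + p))) p<N))
    small₂ : ∀ p → p < N → s * c p + o (N + p) < X
    small₂ p p<N = s≤s (≤-trans (m≤n+m (s * c p + o (N + p)) (o p))
        (∑-≥ N (λ p → o p + (s * c p + o (N + p))) p<N))
    open Modular (X ^ N)
    L = ∑ N (λ i → o (N + i) * X ^ i)
    Q≤2N : Q ≤ 2 * N
    Q≤2N = ≤-trans (m≤m+n Q Q) (≤-trans 2Q≤N (m≤m+n N (N + 0)))
    factor : ∀ (h h′ : ℕ → ℕ) → (∀ i → i < 2 * N → h i ≡ h′ i) → (∀ i → Q ≤ i → h′ i ≡ 0) →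
             ∑ (2 * N) (λ i → h i * X ^ i) ≡ ∑ Q (λ i → h′ i * X ^ i)
    factor h h′ e z = trans (∑-cong (2 * N) λ i i< → cong (_* X ^ i) (e i i<))
      (∑-support (λ i → h′ i * X ^ i) Q≤2N λ i Q≤i → cong (_* X ^ i) (z i Q≤i))
    correct : ev X (2 * N) o 0 ≈ s * ∑ N (λ p → c p * X ^ p)
    correct = ≈-trans (up-correct D 0 X (X ^ N) (trans (cong exponent (+-identityʳ D))
        (exponent-bottom D m≤2^D)) refl 0)
      (≡⇒≈ (cong (s *_) (trans (cong₂ _*_ (factor f a fa az)
        (factor (λ i → f (1 * (2 * N) + i)) b (λ i i< → trans (cong (λ z → f (z + i)) (*-identityˡ (2 * N)))
            (fb i i<)) bz))
        (cauchy X Q N a b 2Q≤N az bz))))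
    halves′ : ev X (2 * N) o 0 ≡ ∑ N (λ i → o i * X ^ i) + X ^ N * L
    halves′ = trans (cong (λ z → ∑ (N + z) (λ i → o i * X ^ i)) (+-identityʳ N))
      (trans (∑-split N N (λ i → o i * X ^ i)) (cong (∑ N (λ i → o i * X ^ i) +_)
        (trans (∑-cong N λ i _ → trans (cong (o (N + i) *_) (^-distribˡ-+-* X N i))
            (lemma (o (N + i)) (X ^ N) (X ^ i)))
          (∑-*ˡ N (X ^ N) (λ i → o (N + i) * X ^ i)))))
      where lemma : ∀ a b c → a * (b * c) ≡ b * (a * c)
            lemma = solve-∀
    -- In place of a subtraction, `L * (1 + X ^ N)` is added, which vanishes: this carries the upper
    -- half `X ^ N * L` over as `L`.
    congruent : ∑ N (λ i → o i * X ^ i) ≈ ∑ N (λ p → (s * c p + o (N + p)) * X ^ p)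
    congruent = begin
      U                             ≡⟨ +-identityʳ U ⟨
      U + 0                         ≈⟨ +-≈ (≈-refl {U}) (≈-sym (*1+σ≈0 L)) ⟩
      U + L * (1 + X ^ N)           ≡⟨ lemma U L (X ^ N) ⟩
      U + X ^ N * L + L             ≡⟨ cong (_+ L) (sym halves′) ⟩
      ev X (2 * N) o 0 + L          ≈⟨ +-≈ correct ≈-refl ⟩
      s * ∑ N (λ p → c p * X ^ p) + L ≡⟨ cong (_+ L) (sym (∑-*ˡ N s (λ p → c p * X ^ p))) ⟩
      ∑ N (λ p → s * (c p * X ^ p)) + L ≡⟨ ∑-+ N (λ p → s * (c p * X ^ p)) (λ i → o (N + i) * X ^ i) ⟨
      ∑ N (λ p → s * (c p * X ^ p) + o (N + p) * X ^ p)
        ≡⟨ ∑-cong N (λ p _ → lemma₂ s (c p) (X ^ p) (o (N + p))) ⟩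
      ∑ N (λ p → (s * c p + o (N + p)) * X ^ p) ∎
      where
      open ≈-Reasoning
      U = ∑ N (λ i → o i * X ^ i)
      lemma : ∀ u l x → u + l * (1 + x) ≡ u + x * l + l
      lemma = solve-∀
      lemma₂ : ∀ s c x o → s * (c * x) + o * x ≡ (s * c + o) * x
      lemma₂ = solve-∀
    sums≡ : ∑ N (λ i → o i * X ^ i) ≡ ∑ N (λ p → (s * c p + o (N + p)) * X ^ p)
    sums≡ = trans (sym (m<n⇒m%n≡m (m≤n⇒m≤1+n (digits-< X N o small₁))))
      (trans (remainders congruent) (m<n⇒m%n≡m (m≤n⇒m≤1+n (digits-< X N (λ p → s * c p + o (N + p)) small₂))))

-- Magnitude of the intermediate values

pad-bound : ∀ K R f {c} → (∀ p → f p ≤ c) → ∀ p → pad K R f p ≤ c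
pad-bound K R f {c} h p = ≤-trans (*-mono-≤ (h _) (m∸n≤m 1 (quo (rem (quo p R) (2 * K)) K)))
    (≤-reflexive (*-identityʳ c))

stages-bound : ∀ K R s f {c} → (∀ p → f p ≤ c) → ∀ p → stages K R s f p ≤ 2 ^ s * c
stages-bound K R zero    f {c} h p = ≤-trans (h p) (≤-reflexive (sym (+-identityʳ c)))
stages-bound K R (suc s) f {c} h p = ≤-trans (+-mono-≤ (stages-bound K R s f h _) (stages-bound K R s f h _))
  (≤-reflexive (lemma (2 ^ s) c))
  where lemma : ∀ a c → a * c + a * c ≡ 2 * a * c
        lemma = solve-∀

fold-bound : ∀ K R f {c} → (∀ p → f p ≤ c) → ∀ p → fold K R f p ≤ 2 * c
fold-bound K R f {c} h p = ≤-trans (+-mono-≤ (h _) (h _)) (≤-reflexive (cong (c +_) (sym (+-identityʳ c))))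

base-bound : ∀ H f {c} → (∀ p → f p ≤ c) → ∀ p → base H f p ≤ 4 * (c * c)
base-bound H f {c} h p = ≤-trans
  (+-mono-≤ (*-mono-≤ (h _) (h _)) (+-mono-≤ (*-mono-≤ (h _) (h _)) (+-mono-≤ (*-mono-≤ (h _) (h _))
      (*-mono-≤ (h _) (h _)))))
  (≤-reflexive (lemma (c * c)))
  where lemma : ∀ z → z + (z + (z + z)) ≡ 4 * z
        lemma = solve-∀

module LevelBounds (m : ℕ) (1≤m : 1 ≤ m) (D : ℕ) (f : ℕ → ℕ) (f≤1 : ∀ p → f p ≤ 1) where
  open Levels m 1≤m f

  -- The binary logarithm of a bound for all values
  magnitude : ℕ
  magnitude = 2 + 2 * (m + D) + (m + 2 * D)

  private
    step-exponent : ∀ d → exponent d ≡ exponent (suc d) + κ d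
    step-exponent d = trans (sym (κ+ρ d)) (+-comm (κ d) (ρ d))

    -- A level multiplies the values by at most 2^(1 + κ d), while the exponent of the block length
    -- falls by κ d. The sum telescopes, so a level costs just one bit beyond the total of m.
    down-bound : ∀ d → ∃ λ x → x + exponent d ≡ m + d × (∀ p → down d p ≤ 2 ^ x)
    down-bound zero    = 0 , sym (+-identityʳ m) , f≤1
    down-bound (suc d) with down-bound d
    ... | x , eq , h = suc (κ d) + x , eq′ , λ p → ≤-trans
      (stages-bound (K d) (R d) (suc (κ d)) _ (pad-bound (K d) (R d) (down d) h) p)
      (≤-reflexive (sym (^-distribˡ-+-* 2 (suc (κ d)) x)))
      where
      eq′ : suc (κ d) + x + exponent (suc d) ≡ m + suc d
      eq′ = trans (lemma (κ d) x (exponent (suc d)))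
          (trans (cong suc (trans (cong (x +_) (sym (step-exponent d))) eq)) (sym (+-suc m d)))
        where lemma : ∀ a x e → suc a + x + e ≡ suc (x + (e + a))
              lemma = solve-∀

    -- At the bottom the values are squared, with a factor 4. On the way up a level contributes 2^(1
    -- + κ d) by its transform and 2 by folding, which telescopes again.
    up-bound : ∀ j d → j + d ≡ D → ∃ λ x → x + exponent D ≡ 2 + 2 * (m + D) + exponent d + 2 * j ×
        (∀ p → up j d p ≤ 2 ^ x)
    up-bound zero d refl with down-bound d
    ... | x , eq , h = 2 + 2 * (m + d) , sym (+-identityʳ _) , λ p → ≤-trans
        (base-bound (blocks d * 4) (down d) h p)
      (≤-trans (≤-reflexive (trans (cong (4 *_) (sym (^-distribˡ-+-* 2 x x)))
          (sym (^-distribˡ-+-* 2 2 (x + x)))))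
        (^-monoʳ-≤ 2 (+-monoʳ-≤ 2 (subst₂ _≤_ refl (cong (m + d +_) (sym (+-identityʳ (m + d))))
            (+-mono-≤ x≤ x≤)))))
      where
      x≤ : x ≤ m + d
      x≤ = ≤-trans (m≤m+n x (exponent d)) (≤-reflexive eq)
    up-bound (suc j) d p≡ with up-bound j (suc d) (trans (+-suc j d) p≡)
    ... | x , eq , h = suc (suc (κ d)) + x , eq′ , λ p → ≤-trans
      (fold-bound (K d) (R d) _ (stages-bound (K d) (R d) (suc (κ d)) _ h) p)
      (≤-reflexive (cong (2 *_) (sym (^-distribˡ-+-* 2 (suc (κ d)) x))))
      where
      eq′ : suc (suc (κ d)) + x + exponent D ≡ 2 + 2 * (m + D) + exponent d + 2 * suc j
      eq′ = trans (cong (λ z → suc (suc z)) (+-assoc (κ d) x (exponent D))) (trans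
          (cong (λ z → 2 + (κ d + z)) eq)
        (trans (lemma (κ d) (2 * (m + D)) (exponent (suc d)) j) (cong (λ z → 2 + 2 * (m + D) + z + 2 * suc j)
            (sym (step-exponent d)))))
        where lemma : ∀ k a e j → 2 + (k + (2 + a + e + 2 * j)) ≡ 2 + a + (e + k) + 2 * suc j
              lemma = solve-∀

    exponent≤m : ∀ d → exponent d ≤ m
    exponent≤m zero    = ≤-refl
    exponent≤m (suc d) = ≤-trans (halve-≤ (exponent≥1 d)) (exponent≤m d)

  down-stages-≤ : ∀ d s → d < D → s ≤ suc (κ d) → ∀ p → stages (K d) (R d) s (pad (K d) (R d) (down d)) p ≤ 2
      ^ magnitude
  down-stages-≤ d s d<D s≤ p with down-bound d
  ... | x , eq , h = ≤-trans (stages-bound (K d) (R d) s _ (pad-bound (K d) (R d) (down d) h) p)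
    (≤-trans (≤-reflexive (sym (^-distribˡ-+-* 2 s x))) (^-monoʳ-≤ 2 (≤-trans (+-mono-≤ s≤m+1 x≤)
      (≤-trans (m≤m+n (1 + m + (m + D)) (1 + m + 3 * D)) (≤-reflexive (lemma m D))))))
    where
    x≤ : x ≤ m + D
    x≤ = ≤-trans (m≤m+n x (exponent d)) (≤-trans (≤-reflexive eq) (+-monoʳ-≤ m (<⇒≤ d<D)))
    s≤m+1 : s ≤ 1 + m
    s≤m+1 = ≤-trans s≤ (s≤s (≤-trans (m∸n≤m (exponent d) (exponent (suc d))) (exponent≤m d)))
    lemma : ∀ m D → 1 + m + (m + D) + (1 + m + 3 * D) ≡ 2 + 2 * (m + D) + (m + 2 * D)
    lemma = solve-∀

  up-stages-≤ : ∀ j d s → suc j + d ≡ D → s ≤ suc (κ d) → ∀ p → stages (K d) (R d) s (up j (suc d)) p ≤ 2 ^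
      magnitude
  up-stages-≤ j d s e s≤ p with up-bound j (suc d) (trans (+-suc j d) e)
  ... | x , eq , h = ≤-trans (stages-bound (K d) (R d) s _ h p)
    (≤-trans (≤-reflexive (sym (^-distribˡ-+-* 2 s x))) (^-monoʳ-≤ 2 (≤-trans (+-monoˡ-≤ x s≤) bound)))
    where
    open ≤-Reasoning
    bound : suc (κ d) + x ≤ magnitude
    bound = begin
      suc (κ d) + x                        ≤⟨ m≤m+n _ (exponent D) ⟩
      suc (κ d) + x + exponent D           ≡⟨ +-assoc (suc (κ d)) x (exponent D) ⟩
      suc (κ d) + (x + exponent D)         ≡⟨ cong (suc (κ d) +_) eq ⟩
      suc (κ d) + (2 + 2 * (m + D) + exponent (suc d) + 2 * j) ≡⟨ lemma (κ d) (2 * (m + D))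
          (exponent (suc d)) j ⟩
      2 + 2 * (m + D) + (exponent (suc d) + κ d + (1 + 2 * j)) ≡⟨ cong (λ z → 2 + 2 * (m + D) +
          (z + (1 + 2 * j))) (sym (step-exponent d)) ⟩
      2 + 2 * (m + D) + (exponent d + (1 + 2 * j)) ≤⟨ +-monoʳ-≤ (2 + 2 * (m + D))
          (+-mono-≤ (exponent≤m d) 2j≤) ⟩
      magnitude ∎
      where
      lemma : ∀ k a e j → suc k + (2 + a + e + 2 * j) ≡ 2 + a + (e + k + (1 + 2 * j))
      lemma = solve-∀
      2j≤ : 1 + 2 * j ≤ 2 * D
      2j≤ = ≤-trans (n≤1+n _) (≤-trans (≤-reflexive (lemma₂ j)) (*-monoʳ-≤ 2
          (≤-trans (m≤m+n (suc j) d) (≤-reflexive e))))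
        where lemma₂ : ∀ j → suc (1 + 2 * j) ≡ 2 * suc j
              lemma₂ = solve-∀

  up-≤ : ∀ j d → j + d ≡ D → ∀ p → up j d p ≤ 2 ^ magnitude
  up-≤ j d e p with up-bound j d e
  ... | x , eq , h = ≤-trans (h p) (^-monoʳ-≤ 2 bound)
    where
    open ≤-Reasoning
    bound : x ≤ magnitude
    bound = begin
      x                                      ≤⟨ m≤m+n x (exponent D) ⟩
      x + exponent D                         ≡⟨ eq ⟩
      2 + 2 * (m + D) + exponent d + 2 * j   ≡⟨ +-assoc (2 + 2 * (m + D)) (exponent d) (2 * j) ⟩
      2 + 2 * (m + D) + (exponent d + 2 * j) ≤⟨ +-monoʳ-≤ (2 + 2 * (m + D)) (+-mono-≤ (exponent≤m d)
                                                  (*-monoʳ-≤ 2 (≤-trans (m≤m+n j d) (≤-reflexive e)))) ⟩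
      magnitude                              ∎

-- The program

infixl 7 _⊜_
_⊜_ : Exp → Exp → Exp
x ⊜ y = x ⊖ (x ⊘ y) ⊗ y

-- The language has no conditionals, so conditions are computed as factors 0 or 1. Division by zero
-- yields zero, whence x / x indicates that x is positive.
positive : Exp → Exp
positive x = x ⊘ x

below : Exp → Exp → Exp
below x y = lit 1 ⊖ (x ⊕ lit 1 ⊖ y)

notBelow : Exp → Exp → Exp
notBelow x y = lit 1 ⊖ (y ⊖ x)

-- Registers are prefixed by r-, arrays by a-; the input is in registers 0 to 3.
module Names where
  r-n = 0 ; r-t = 1 ; r-num = 2 ; r-den = 3
  r-E = 4 ; r-e = 5 ; r-P = 6 ; r-lam = 7 ; r-Λ = 8 ; r-picks = 9 ; r-M = 10 ; r-Q = 11
  r-m = 12 ; r-N = 13 ; r-D = 14 ; r-2N = 15 ; r-4N = 16 ; r-2Λ = 17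
  r-k = 20 ; r-d = 21 ; r-s = 22 ; r-p = 23 ; r-i = 24 ; r-j = 25
  r-blocks = 30 ; r-exp = 31 ; r-ρ = 32 ; r-K = 33 ; r-R = 34 ; r-size = 35 ; r-S = 36 ; r-rounds = 37
  r-cur = 40 ; r-pick = 41 ; r-old = 42 ; r-flag = 43 ; r-x = 44 ; r-c = 45 ; r-w = 46
  a-work = 0 ; a-temp = 1 ; a-rows = 2 ; a-owner = 3 ; a-mult = 4 ; a-pow = 5 ; a-stack = 6

module Program where
  open Names

  private
    p q i K R K₂ S₂ : Exp
    p = var r-p
    K = var r-K
    R = var r-R
    q = p ⊘ R
    i = p ⊜ R
    K₂ = lit 2 ⊗ K
    S₂ = lit 2 ⊗ var r-S

  padE stageE foldE baseE : Exp
  padE = at a-work (q ⊘ K₂ ⊗ (R ⊗ K) ⊕ i ⊗ K ⊕ (q ⊜ K₂) ⊜ K) ⊗ (lit 1 ⊖ (q ⊜ K₂) ⊘ K)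

  lowerE : Exp
  lowerE = q ⊘ K₂ ⊗ K₂ ⊕ ((q ⊜ K₂) ⊘ S₂ ⊗ var r-S ⊕ (q ⊜ K₂) ⊜ var r-S)
  stageE = at a-work (lowerE ⊗ R ⊕ i) ⊕
           at a-work ((lowerE ⊕ K) ⊗ R ⊕ (i ⊕ (R ⊖ (q ⊜ K₂) ⊜ S₂ ⊗ (R ⊘ S₂))) ⊜ R)

  foldE = at a-work ((p ⊘ K ⊘ R ⊗ K₂ ⊕ (K₂ ⊖ p ⊜ K) ⊜ K₂) ⊗ R ⊕ (p ⊘ K) ⊜ R) ⊕
          at a-work ((p ⊘ K ⊘ R ⊗ K₂ ⊕ (K ⊖ p ⊜ K)) ⊗ R ⊕ ((p ⊘ K) ⊜ R ⊕ (R ⊖ lit 1)) ⊜ R)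

  baseTerm : ℕ → Exp
  baseTerm j = at a-work (p ⊘ lit 4 ⊗ lit 4 ⊕ lit j) ⊗
    at a-work (var r-size ⊕ (p ⊘ lit 4 ⊗ lit 4 ⊕ (p ⊜ lit 4 ⊕ (lit 4 ⊖ lit j)) ⊜ lit 4))
  baseE = baseTerm 0 ⊕ (baseTerm 1 ⊕ (baseTerm 2 ⊕ baseTerm 3))

  -- The expression reads cells of `a-work` that could already have been overwritten, hence the
  -- detour through `a-temp`.
  pass : Exp → Cmd
  pass e = for long r-p r-size (a-temp ⟨ p ⟩⇐ e) ⨾ for long r-p r-size (a-work ⟨ p ⟩⇐ at a-temp p)

  -- Because of its rounding, the halving of the exponent cannot be undone; the exponents are
  -- stacked on the way down. On that way the array holds both factors, on the way up only their
  -- product, which explains the additional 2 in the `r-size` of `downStep`.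
  setLevel transform downStep upStep : Cmd
  setLevel = r-ρ ⇐ (var r-exp ⊕ lit 1) ⊘ lit 2 ⨾
             r-K ⇐ at a-pow (var r-exp ⊖ var r-ρ) ⨾
             r-R ⇐ at a-pow (lit 1 ⊕ var r-ρ)

  transform = r-S ⇐ lit 1 ⨾
              r-rounds ⇐ lit 1 ⊕ (var r-exp ⊖ var r-ρ) ⨾
              for short r-s r-rounds (pass stageE ⨾ r-S ⇐ lit 2 ⊗ var r-S)

  downStep = a-stack ⟨ var r-d ⟩⇐ var r-exp ⨾
             setLevel ⨾
             r-size ⇐ lit 2 ⊗ var r-blocks ⊗ K₂ ⊗ R ⨾
             pass padE ⨾
             transform ⨾
             r-blocks ⇐ var r-blocks ⊗ K₂ ⨾
             r-exp ⇐ var r-ρ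

  upStep = r-exp ⇐ at a-stack (var r-D ⊖ (lit 1 ⊕ var r-d)) ⨾
           setLevel ⨾
           r-size ⇐ var r-blocks ⊗ R ⨾
           transform ⨾
           r-blocks ⇐ var r-blocks ⊘ K₂ ⨾
           r-size ⇐ var r-blocks ⊗ (R ⊗ K) ⨾
           pass foldE

  -- Cells below 2N receive row k of the table of sums, the next 2N cells the
  -- indicator of the values of the items.
  loadE : Exp
  loadE = at a-rows (var r-k ⊗ var r-Q ⊕ p) ⊗ below p (var r-Q) ⊕
          positive (at a-owner (p ⊖ var r-2N)) ⊗ (notBelow p (var r-2N) ⊗ below (p ⊖ var r-2N) (var r-Q))

  convolution sumset : Cmd
  convolution = r-blocks ⇐ lit 1 ⨾
                r-exp ⇐ var r-m ⨾
                for short r-d r-D downStep ⨾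
                r-size ⇐ var r-blocks ⊗ lit 4 ⨾
                pass baseE ⨾
                for short r-d r-D upStep
  sumset = for long r-p r-4N (a-work ⟨ p ⟩⇐ loadE) ⨾
           convolution ⨾
           for long r-p r-Q (a-rows ⟨ (lit 1 ⊕ var r-k) ⊗ var r-Q ⊕ p ⟩⇐
             positive (at a-work p ⊖ at a-work (var r-N ⊕ p)))

  -- The flag, 0 or 1, multiplies the amount that is added, so a round either doubles or does
  -- nothing. One doubling of Λ per round keeps up with `e`, which grows by at most one.
  double : Cmd
  double = r-flag ⇐ positive (var r-E ⊖ var r-P) ⨾
           r-e ⇐ var r-flag ⊕ var r-e ⨾
           r-P ⇐ var r-P ⊕ var r-flag ⊗ var r-P ⨾
           r-flag ⇐ positive (var r-e ⊕ lit 8 ⊖ var r-Λ) ⨾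
           r-lam ⇐ var r-flag ⊕ var r-lam ⨾
           r-Λ ⇐ var r-Λ ⊕ var r-flag ⊗ var r-Λ

  parameters powers : Cmd
  -- The quotient plus one exceeds 1/ε, so that E > 4/ε. The start Λ = 2^3 satisfies e + 8 ≤ Λ for e
  -- = 0.
  parameters = r-E ⇐ lit 4 ⊗ (var r-den ⊘ var r-num ⊕ lit 1) ⨾
               r-e ⇐ lit 0 ⨾ r-P ⇐ lit 1 ⨾ r-lam ⇐ lit 3 ⨾ r-Λ ⇐ lit 8 ⨾
               for long r-i r-E double
  -- A support of 2 + 2e items with e + 1 binary digits each gives at most 2Λ² picks, as e + 1 ≤ Λ.
  -- This being a power of two, N = 4M = 2^(e + 2λ + 5) = 2^m is one as well. D = 1 + λ levels
  -- reduce the exponent m < 2Λ = 2^D to 1.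
  derived : Cmd
  derived = r-picks ⇐ lit 2 ⊗ var r-Λ ⊗ var r-Λ ⨾
            r-M ⇐ lit 4 ⊗ var r-picks ⊗ var r-P ⨾
            r-Q ⇐ var r-M ⊕ var r-picks ⊕ lit 1 ⨾
            r-m ⇐ var r-e ⊕ lit 2 ⊗ var r-lam ⊕ lit 5 ⨾
            r-N ⇐ lit 4 ⊗ var r-M ⨾
            r-D ⇐ lit 1 ⊕ var r-lam ⨾
            r-2N ⇐ lit 2 ⊗ var r-N ⨾
            r-4N ⇐ lit 4 ⊗ var r-N ⨾
            r-2Λ ⇐ lit 2 ⊗ var r-Λ
  powers = a-pow ⟨ lit 0 ⟩⇐ lit 1 ⨾
           for short r-i r-2Λ (a-pow ⟨ lit 1 ⊕ var r-i ⟩⇐ lit 2 ⊗ at a-pow (var r-i))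

  -- Items with x P ≤ t enter the table only in multiples of about t / P.
  factorE : Exp
  factorE = let a = var r-t ⊘ (var r-x ⊗ var r-P) in a ⊕ (lit 1 ⊖ a)

  -- In `a-owner` the item numbers are increased by one, so that 0 marks an empty cell.
  enter items clear findBest traceBack : Cmd
  enter = get r-x (var r-i) ⨾
          r-c ⇐ at a-pow (var r-j) ⊗ factorE ⨾
          r-w ⇐ var r-c ⊗ var r-x ⊗ var r-M ⊘ var r-t ⨾
          -- The minimum of `r-w` and Q: a value that is too large lands in cell Q, just outside the
          -- table.
          r-w ⇐ var r-w ⊖ (var r-w ⊖ var r-Q) ⨾
          a-owner ⟨ var r-w ⟩⇐ lit 1 ⊕ var r-i ⨾
          a-mult ⟨ var r-w ⟩⇐ var r-c
  items = for short r-j r-Λ (for long r-i r-n enter) ⨾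
          -- Value 0 comes to mean picking nothing, as no copies of item 0. Thus sums of fewer
          -- values also count as sums of exactly `picks` values. An item entered at 0 before is
          -- worth less than one unit and may be overwritten.
          a-owner ⟨ lit 0 ⟩⇐ lit 1 ⨾
          a-mult ⟨ lit 0 ⟩⇐ lit 0
  clear = for long r-i r-n (put (var r-i) (lit 0)) ⨾
          a-rows ⟨ lit 0 ⟩⇐ lit 1
  findBest = r-cur ⇐ lit 0 ⨾
             for long r-p r-Q
               -- Since `cur` never exceeds `p`, adding the difference times 0 or 1 sets `cur` to
               -- `p` precisely when the last row contains `p`.
               (r-cur ⇐ var r-cur ⊕ at a-rows (var r-picks ⊗ var r-Q ⊕ p) ⊗ (p ⊖ var r-cur))

  findPick takePick : Cmd
  findPick = r-pick ⇐ lit 0 ⨾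
             for long r-p r-Q
               (r-pick ⇐ var r-pick ⊕
                 positive (at a-owner p) ⊗
                 at a-rows ((var r-picks ⊖ (lit 1 ⊕ var r-k)) ⊗ var r-Q ⊕ (var r-cur ⊖ p)) ⊗
                 notBelow (var r-cur) p ⊗
                 (p ⊖ var r-pick))
  takePick = get r-old (at a-owner (var r-pick) ⊖ lit 1) ⨾
             put (at a-owner (var r-pick) ⊖ lit 1) (var r-old ⊕ at a-mult (var r-pick)) ⨾
             r-cur ⇐ var r-cur ⊖ var r-pick
  traceBack = for short r-k r-picks (findPick ⨾ takePick)

  sums program : Cmd
  sums = for short r-k r-picks sumset
  program = parameters ⨾ derived ⨾ powers ⨾ items ⨾ clear ⨾ sums ⨾ findBest ⨾ traceBack

open Program public

program-wf : wf program ≡ true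
program-wf = refl

-- Locality of the passes

lower-+ : ∀ κ s G q → s ≤ κ → q < G * (2 * 2 ^ κ) → lower (2 ^ κ) (2 ^ s) q + 2 ^ κ < G * (2 * 2 ^ κ)
lower-+ κ s G q s≤κ q< = begin-strict
  quo q K₂ * K₂ + (quo idx (2 * S) * S + rem idx S) + K ≡⟨ +-assoc (quo q K₂ * K₂) _ K ⟩
  quo q K₂ * K₂ + (quo idx (2 * S) * S + rem idx S + K) <⟨ +-monoʳ-< (quo q K₂ * K₂) (+-monoˡ-< K inner) ⟩
  quo q K₂ * K₂ + (K + K)                ≡⟨ cong (λ z → quo q K₂ * K₂ + (K + z)) (sym (+-identityʳ K)) ⟩
  quo q K₂ * K₂ + K₂                     ≡⟨ +-comm (quo q K₂ * K₂) K₂ ⟩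
  suc (quo q K₂) * K₂                    ≤⟨ *-monoˡ-≤ K₂ (quo-<ᵐ q G q<) ⟩
  G * K₂                                 ∎
  where
  open ≤-Reasoning
  K = 2 ^ κ
  K₂ = 2 * K
  S = 2 ^ s
  L = 2 ^ (κ ∸ s)
  idx = rem q K₂
  L*S : L * S ≡ K
  L*S = trans (sym (^-distribˡ-+-* 2 (κ ∸ s) s)) (cong (2 ^_) (m∸n+n≡m s≤κ))
  L*2S : L * (2 * S) ≡ K₂
  L*2S = trans (lemma L S) (cong (2 *_) L*S)
    where lemma : ∀ a b → a * (2 * b) ≡ 2 * (a * b)
          lemma = solve-∀
  inner : quo idx (2 * S) * S + rem idx S < K
  inner = subst (quo idx (2 * S) * S + rem idx S <_) L*S
      (pair-< (quo-<ᵐ idx L (subst (idx <_) (sym L*2S) (rem-< q (m^n>0 2 (suc κ)))))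
                                   (rem-< idx (m^n>0 2 s)))

-- The work array is known to agree with the functions of the model on a prefix only, so each pass
-- must be shown to read nothing beyond that prefix. Here both inputs of an output block lie in its
-- own group of 2K blocks.
stage-local : ∀ κ R s G f g → s ≤ κ → 0 < R → (∀ p → p < G * (2 * 2 ^ κ) * R → f p ≡ g p) →
              ∀ p → p < G * (2 * 2 ^ κ) * R → stage (2 ^ κ) R (2 ^ s) f p ≡ stage (2 ^ κ) R (2 ^ s) g p
stage-local κ R s G f g s≤κ 0<R e p p< =
  cong₂ _+_ (e _ (pair-< (≤-<-trans (m≤m+n _ (2 ^ κ)) high) (rem-< p 0<R))) (e _ (pair-< high (rem-< _ 0<R)))
  where high = lower-+ κ s G (quo p R) s≤κ (quo-<ᵐ p (G * (2 * 2 ^ κ)) p<)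

pad-local : ∀ K R G f g → 0 < K → 0 < R → (∀ p → p < G * (R * K) → f p ≡ g p) →
            ∀ p → p < G * (2 * K) * R → pad K R f p ≡ pad K R g p
pad-local K R G f g 0<K 0<R e p p< = cong (_* (1 ∸ quo (rem q (2 * K)) K)) (e _ (begin-strict
    quo q (2 * K) * (R * K) + i * K + r ≡⟨ lemma (quo q (2 * K)) R K i r ⟩
    (quo q (2 * K) * R + i) * K + r     <⟨ pair-< (pair-< (quo-<ᵐ q G (quo-<ᵐ p (G * (2 * K)) p<))
        (rem-< p 0<R)) (rem-< _ 0<K) ⟩
    G * R * K                           ≡⟨ *-assoc G R K ⟩
    G * (R * K)                         ∎))
  where
  open ≤-Reasoning
  q = quo p R
  i = rem p R
  r = rem (rem q (2 * K)) K
  lemma : ∀ a b c d e → a * (b * c) + d * c + e ≡ (a * b + d) * c + e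
  lemma = solve-∀

fold-local : ∀ K R G f g → 0 < K → 0 < R → (∀ p → p < G * (2 * K) * R → f p ≡ g p) →
             ∀ p → p < G * (R * K) → fold K R f p ≡ fold K R g p
fold-local K R G f g 0<K 0<R e p p< = cong₂ _+_
    (e _ (pair-< (pair-< g< (rem-< _ 0<2K)) (rem-< q 0<R)))
    (e _ (pair-< (pair-< g< (≤-<-trans (m∸n≤m K (rem p K))
        (m<m+n K (subst (0 <_) (sym (+-identityʳ K)) 0<K)))) (rem-< _ 0<R)))
  where
  q = quo p K
  0<2K : 0 < 2 * K
  0<2K = <-≤-trans 0<K (m≤m+n K (K + 0))
  g< : quo q R < G
  g< = quo-<ᵐ q G (quo-<ᵐ p (G * R) (subst (p <_) (sym (*-assoc G R K)) p<))

base-local : ∀ B f g → (∀ p → p < 2 * B * 4 → f p ≡ g p) →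
             ∀ p → p < B * 4 → base (B * 4) f p ≡ base (B * 4) g p
base-local B f g e p p< = cong₂ _+_ (term 0 z<s) (cong₂ _+_ (term 1 (s<s z<s))
    (cong₂ _+_ (term 2 (s<s (s<s z<s))) (term 3 (s<s (s<s (s<s z<s))))))
  where
  q<B : quo p 4 < B
  q<B = quo-<ᵐ p B p<
  2H : B * 4 + B * 4 ≡ 2 * B * 4
  2H = lemma B
    where lemma : ∀ B → B * 4 + B * 4 ≡ 2 * B * 4
          lemma = solve-∀
  term : ∀ j → j < 4 → f (quo p 4 * 4 + j) * f (B * 4 + (quo p 4 * 4 + rem (rem p 4 + (4 ∸ j)) 4)) ≡
                       g (quo p 4 * 4 + j) * g (B * 4 + (quo p 4 * 4 + rem (rem p 4 + (4 ∸ j)) 4))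
  term j j<4 = cong₂ _*_
    (e _ (<-≤-trans (pair-< q<B j<4) (≤-trans (m≤m+n (B * 4) (B * 4)) (≤-reflexive 2H))))
    (e _ (<-≤-trans (+-monoʳ-< (B * 4) (pair-< q<B (rem-< (rem p 4 + (4 ∸ j)) {4} z<s))) (≤-reflexive 2H)))

allFalse : (ℕ → Bool) → ℕ → Bool
allFalse f zero    = true
allFalse f (suc k) = not (f k) ∧ allFalse f k

allFalse⇒ : ∀ f k {r} → allFalse f k ≡ true → r < k → f r ≡ false
allFalse⇒ f (suc k) {r} p r<1+k with ∧-true {not (f k)} p | r ≟ k
... | a , b | yes refl = not-true (f r) a
  where not-true : ∀ b → not b ≡ true → b ≡ false
        not-true false _ = refl
... | a , b | no r≢k   = allFalse⇒ f k b (≤∧≢⇒< (≤-pred r<1+k) r≢k)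

stage-cong : ∀ {K K′ R R′ S S′} f p → K ≡ K′ → R ≡ R′ → S ≡ S′ → stage K R S f p ≡ stage K′ R′ S′ f p
stage-cong f p refl refl refl = refl

pad-cong : ∀ {K K′ R R′} f p → K ≡ K′ → R ≡ R′ → pad K R f p ≡ pad K′ R′ f p
pad-cong f p refl refl = refl

fold-cong : ∀ {K K′ R R′} f p → K ≡ K′ → R ≡ R′ → fold K R f p ≡ fold K′ R′ f p
fold-cong f p refl refl = refl

-- Verification of the convolution

module Parameters (n t num den E e lam : ℕ) where
  P Λ picks M Q m N D : ℕ
  P = 2 ^ e
  Λ = 2 ^ lam
  picks = 2 * Λ * Λ
  M = 4 * picks * P
  Q = M + picks + 1
  m = e + 2 * lam + 5
  N = 4 * M
  D = 1 + lam

  value : ℕ → ℕ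
  value 0 = n
  value 1 = t
  value 2 = num
  value 3 = den
  value 4 = E
  value 5 = e
  value 6 = P
  value 7 = lam
  value 8 = Λ
  value 9 = picks
  value 10 = M
  value 11 = Q
  value 12 = m
  value 13 = N
  value 14 = D
  value 15 = 2 * N
  value 16 = 4 * N
  value _ = 2 * Λ

  record Ready (s : St) : Set where
    constructor ready
    field
      const≡ : ∀ r → (r <ᵇ 18) ≡ true → env s r ≡ value r
      power≡ : ∀ i → i ≤ 2 * Λ → arr s 5 i ≡ 2 ^ i
  open Ready public

  ready-frame : ∀ {c s s′} → allFalse (modVar c) 18 ≡ true → modArr c 5 ≡ false →
                Ready s → Frame c s s′ → Ready s′
  ready-frame {c} p q (ready a b) fr =
    ready (λ r z → trans (sameVar fr r (allFalse⇒ (modVar c) 18 p (<ᵇ-true {r} z))) (a r z))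
          (λ i z → trans (sameArr fr 5 q i) (b i z))

  ready-setVar : ∀ {s} r {v} → Ready s → (r <ᵇ 18) ≡ false → Ready (setVar s r v)
  ready-setVar {s} r {v} (ready a b) p = ready (λ x z → trans (set-other (env s) v (other x z)) (a x z)) b
    where
    other : ∀ x → (x <ᵇ 18) ≡ true → r ≢ x
    other x z refl = case trans (sym p) z of λ ()

  -- W bounds the values in registers and cells, L and S the rounds of long and
  -- short loops.
  record Fits (W L S : ℕ) : Set where
    field
      1≤m    : 1 ≤ m
      m≤2^D  : m ≤ 2 ^ D
      N≡     : 2 ^ m ≡ N
      2Q≤N   : Q + Q ≤ N
      m<2Λ   : m < 2 * Λ
      work≤L : 2 ^ D * (4 * N) ≤ L
      n≤L    : n ≤ L
      picks≤S : picks ≤ S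
      2Λ≤picks : 2 * Λ ≤ picks
      D≤m    : D ≤ m
      L≤W    : L ≤ W
      S≤L    : S ≤ L
      powers≤W : 2 ^ (2 * Λ) ≤ W
      values≤W : 2 ^ (2 + 2 * (m + D) + (m + 2 * D)) ≤ W

  module ConvolutionVerification (W L S : ℕ) (fits : Fits W L S) where
    open Fits fits
    open Hoare W n (limits S L) public
    open Names

    N≤L : 4 * N ≤ L
    N≤L = ≤-trans (m≤n*m (4 * N) (2 ^ D) {{m^n≢0 2 D}}) work≤L

    2Λ≤S : 2 * Λ ≤ S
    2Λ≤S = ≤-trans 2Λ≤picks picks≤S

    S≤W : S ≤ W
    S≤W = ≤-trans S≤L L≤W

    1≤W : 1 ≤ W
    1≤W = ≤-trans (m^n>0 2 (2 + 2 * (m + D) + (m + 2 * D))) values≤W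

    _≤∘_ : ∀ {a b c} → a ≤ b → b ≤ c → a ≤ c
    _≤∘_ = ≤-trans

    write-ends : ∀ {s} k e f → eval f s ≤ W → Ends (k ⟨ e ⟩⇐ f) s (λ s′ → arr s′ k (eval e s) ≡ eval f s ×
      (∀ j → j ≢ eval e s → arr s′ k j ≡ arr s k j))
    write-ends {s} k e f q = ends (write q) (updateArr-same (arr s) k (eval e s) (eval f s) ,
      λ j → updateArr-other (arr s) k (eval e s) (eval f s) j)

    pass-ends : ∀ {s} e → Bounded s → env s r-size ≤ L → noArr 1 e ≡ true →
      (∀ p → p < env s r-size → eval e (setVar s r-p p) ≤ W) →
      Ends (pass e) s (λ s′ → ∀ p → p < env s r-size → arr s′ 0 p ≡ eval e (setVar s r-p p))
    pass-ends {s} e bd few none small =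
      (tabulate-ends {long} {r-p} {r-size} {1} (var r-p) e 0 bd few refl none (λ _ _ → refl) small , bd)
          andThen
      λ s₁ t₁ bd₁ fr₁ → weaken bd₁
        (tabulate-ends {long} {r-p} {r-size} {0} (var r-p) (at 1 (var r-p)) 0 bd₁
          (subst (_≤ L) (sym (sameVar fr₁ r-size refl)) few) refl refl (λ _ _ → refl) (λ p _ → arrB bd₁ 1 p))
        λ s₂ t₂ _ _ p p< → trans (proj₁ t₂ p (subst (p <_) (sym (sameVar fr₁ r-size refl)) p<))
            (proj₁ t₁ p p<)

    transform-ends : ∀ {s} κ R G F → Bounded s → 0 < R →
      env s r-K ≡ 2 ^ κ → env s r-R ≡ R → env s r-exp ∸ env s r-ρ ≡ κ →
      env s r-size ≡ G * (2 * 2 ^ κ) * R → env s r-size ≤ L → suc κ ≤ S → 2 ^ suc κ ≤ W →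
      (∀ r → r ≤ suc κ → ∀ p → stages (2 ^ κ) R r F p ≤ W) →
      (∀ p → p < G * (2 * 2 ^ κ) * R → arr s 0 p ≡ F p) →
      Ends transform s (λ s′ → ∀ p → p < G * (2 * 2 ^ κ) * R → arr s′ 0 p ≡ stages (2 ^ κ) R (suc κ) F p)
    transform-ends {s} κ R G F bd 0<R K≡ R≡ κ≡ size≡ few rounds≤S 2K≤W small start =
      assign-then {r-S} bd 1≤W λ bd₁ → assign-then {r-rounds} bd₁ (≤-trans (≤-reflexive (cong suc κ≡))
          (≤-trans rounds≤S S≤W)) λ bd₂ →
      weaken bd₂ (for-ends {short} {r-s} {r-rounds} Inv bd₂ (≤-trans (≤-reflexive (cong suc κ≡)) rounds≤S)
          refl refl refl
        (refl , start) body)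
      λ s′ inv _ _ p p< → trans (proj₂ inv p p<) (cong (λ z → stages (2 ^ κ) R z F p) (cong suc κ≡))
      where
      Inv : ℕ → St → Set
      Inv r s′ = env s′ r-S ≡ 2 ^ r × (∀ p → p < G * (2 * 2 ^ κ) * R → arr s′ 0 p ≡ stages (2 ^ κ) R r F p)
      s₂ = setVar (setVar s r-S 1) r-rounds (1 + (env s r-exp ∸ env s r-ρ))
      body : ∀ r s′ → r < 1 + (env s r-exp ∸ env s r-ρ) → env s′ r-s ≡ r → Bounded s′ →
             Frame (for short r-s r-rounds (pass stageE ⨾ r-S ⇐ lit 2 ⊗ var r-S)) s₂ s′ → Inv r s′ →
             Ends (pass stageE ⨾ r-S ⇐ lit 2 ⊗ var r-S) s′ (λ s″ → Inv (suc r) (setVar s″ r-s (suc r)))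
      body r s′ r< _ bd′ fr (S≡ , eq) =
        (pass-ends stageE bd′ (subst (_≤ L) (sym size′) few) refl
          (λ p p< → ≤-trans (≤-reflexive (advance p (subst (p <_) (trans size′ size≡) p<)))
              (small (suc r) r<′ p)) , bd′) andThen
        λ s″ t bd″ fr″ → assign-ends (≤-trans (≤-reflexive (cong (2 *_) (trans (sameVar fr″ r-S refl) S≡)))
            (≤-trans (^-monoʳ-≤ 2 r<′) 2K≤W))
          (cong (2 *_) (trans (sameVar fr″ r-S refl) S≡) ,
           λ p p< → trans (t p (subst (p <_) (sym (trans size′ size≡)) p<)) (advance p p<))
        where
        r<′ : suc r ≤ suc κ
        r<′ = subst (λ z → r < 1 + z) κ≡ r<
        size′ : env s′ r-size ≡ env s r-size
        size′ = sameVar fr r-size refl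
        advance : ∀ p → p < G * (2 * 2 ^ κ) * R → eval stageE (setVar s′ r-p p) ≡ stages (2 ^ κ) R (suc r) F p
        advance p p< = trans (stage-cong (arr s′ 0) p (trans (sameVar fr r-K refl) K≡)
            (trans (sameVar fr r-R refl) R≡) S≡)
          (stage-local κ R r G (arr s′ 0) (stages (2 ^ κ) R r F) (≤-pred r<′) 0<R eq p p<)

    setLevel-ends : ∀ {s} a → Ready s → Bounded s → env s r-exp ≡ a → 1 ≤ a → a ≤ m →
      Ends setLevel s (λ s′ → env s′ r-ρ ≡ halve a × env s′ r-K ≡ 2 ^ (a ∸ halve a) × env s′ r-R ≡ 2 ^ suc
          (halve a))
    setLevel-ends {s} a rdy bd refl 1≤a a≤m =
      assign-then {r-ρ} bd (≤-trans h≤a (envB bd r-exp)) λ bd₁ →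
      assign-then {r-K} bd₁ (arrB bd₁ a-pow _) λ bd₂ →
      assign-ends (arrB bd₂ a-pow _)
        (refl , power≡ rdy (a ∸ halve a) (≤-trans (m∸n≤m a (halve a)) (≤-trans a≤m (<⇒≤ m<2Λ))) ,
         power≡ rdy (suc (halve a)) (≤-trans (s≤s (≤-trans h≤a a≤m)) m<2Λ))
      where h≤a = halve-≤ 1≤a

    module Convolution (f : ℕ → ℕ) (f≤1 : ∀ p → f p ≤ 1) where
      open Levels m 1≤m f
      open LevelBounds m 1≤m D f f≤1

      size-suc : ∀ d → 2 * blocks d * (2 * K d) * R d ≡ 2 * blocks (suc d) * block (suc d)
      size-suc d = cong (_* R d) (*-assoc 2 (blocks d) (2 * K d))

      -- Padding doubles the total length on each level. With D = 1 + λ levels this amounts to the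
      -- factor 2^D = 2Λ, still polylogarithmic; a depth proportional to m would have destroyed the
      -- running time.
      size-formula : ∀ d → 2 * blocks d * block d ≡ 2 ^ d * (4 * N)
      size-formula zero = trans (lemma (2 ^ m)) (cong (λ z → 1 * (4 * z)) N≡)
        where lemma : ∀ z → 2 * 1 * (2 * z) ≡ 1 * (4 * z)
              lemma = solve-∀
      size-formula (suc d) = trans (sym (size-suc d)) (trans (lemma (blocks d) (K d) (R d))
        (trans (cong (λ z → 2 * (2 * blocks d * z)) (R*K d)) (trans (cong (2 *_) (size-formula d))
            (sym (*-assoc 2 (2 ^ d) (4 * N))))))
        where lemma : ∀ b k r → 2 * b * (2 * k) * r ≡ 2 * (2 * b * (r * k))
              lemma = solve-∀

      size≤L : ∀ d → d ≤ D → 2 * blocks d * block d ≤ L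
      size≤L d d≤D = ≤-trans (≤-reflexive (size-formula d)) (≤-trans (*-monoˡ-≤ (4 * N) (^-monoʳ-≤ 2 d≤D))
          work≤L)

      exponent≤m : ∀ d → exponent d ≤ m
      exponent≤m zero    = ≤-refl
      exponent≤m (suc d) = ≤-trans (halve-≤ (exponent≥1 d)) (exponent≤m d)

      blocks≤W : ∀ d → d ≤ D → blocks d ≤ W
      blocks≤W d d≤D = ≤-trans (≤-trans (m≤m+n (blocks d) (blocks d + 0)) (m≤m*n (2 * blocks d) (block d)
          {{m^n≢0 2 (suc (exponent d))}}))
        (≤-trans (size≤L d d≤D) L≤W)

      rounds≤S : ∀ d → suc (κ d) ≤ S
      rounds≤S d = ≤-trans (s≤s (≤-trans (m∸n≤m (exponent d) (exponent (suc d))) (exponent≤m d)))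
          (≤-trans m<2Λ 2Λ≤S)

      2K≤W : ∀ d → 2 ^ suc (κ d) ≤ W
      2K≤W d = ≤-trans (^-monoʳ-≤ 2 bound) values≤W
        where
        bound : suc (κ d) ≤ 2 + 2 * (m + D) + (m + 2 * D)
        bound = ≤-trans (s≤s (≤-trans (m∸n≤m (exponent d) (exponent (suc d))) (exponent≤m d)))
          (≤-trans (m≤m+n (1 + m) (1 + (2 * m + 4 * D))) (≤-reflexive (lemma m D)))
          where lemma : ∀ m D → 1 + m + (1 + (2 * m + 4 * D)) ≡ 2 + 2 * (m + D) + (m + 2 * D)
                lemma = solve-∀

      0<R : ∀ d → 0 < R d
      0<R d = m^n>0 2 (suc (ρ d))

      0<K : ∀ d → 0 < K d
      0<K d = m^n>0 2 (κ d)

      Down : ℕ → St → Set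
      Down d s = env s r-blocks ≡ blocks d × env s r-exp ≡ exponent d ×
        (∀ p → p < 2 * blocks d * block d → arr s 0 p ≡ down d p) ×
        (∀ j → j < d → arr s a-stack j ≡ exponent j)

      level-size : ∀ {s} d → env s r-blocks ≡ blocks d → env s r-K ≡ K d → env s r-R ≡ R d →
        2 * env s r-blocks * (2 * env s r-K) * env s r-R ≡ 2 * blocks d * (2 * K d) * R d
      level-size d b k r = cong₂ _*_ (cong₂ (λ x y → 2 * x * (2 * y)) b k) r

      downStep-ends : ∀ d s → d < D → env s r-d ≡ d → Ready s → Bounded s → Down d s →
        Ends downStep s (λ s′ → Down (suc d) (setVar s′ r-d (suc d)))
      downStep-ends d s d<D d≡ rdy bd (b≡ , e≡ , work , stack) =
        (write-ends a-stack (var r-d) (var r-exp) (envB bd r-exp) , bd) andThen λ s₁ (new , old) bd₁ fr₁ →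
        (setLevel-ends (exponent d) (ready-frame refl refl rdy fr₁) bd₁ (trans (sameVar fr₁ r-exp refl) e≡)
          (exponent≥1 d) (exponent≤m d) , bd₁) andThen λ s₂ (ρ≡ , K≡ , R≡) bd₂ fr₂ →
        let b₂ = trans (sameVar fr₂ r-blocks refl) (trans (sameVar fr₁ r-blocks refl) b≡)
            size≡ = level-size {s₂} d b₂ K≡ R≡
            few = ≤-trans (≤-reflexive (trans size≡ (size-suc d))) (size≤L (suc d) d<D)
            work₂ : ∀ p → p < 2 * blocks d * (R d * K d) → arr s₂ 0 p ≡ down d p
            work₂ p p< = trans (sameArr fr₂ 0 refl p) (trans (sameArr fr₁ 0 refl p)
              (work p (subst (λ z → p < 2 * blocks d * z) (R*K d) p<)))
            padded : ∀ p → p < 2 * blocks d * (2 * K d) * R d →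
                     pad (env s₂ r-K) (env s₂ r-R) (arr s₂ 0) p ≡ pad (K d) (R d) (down d) p
            padded p p< = trans (pad-cong (arr s₂ 0) p K≡ R≡)
              (pad-local (K d) (R d) (2 * blocks d) (arr s₂ 0) (down d) (0<K d) (0<R d) work₂ p p<)
        in assign-then {r-size} bd₂ (≤-trans few L≤W) λ bd₃ →
        (pass-ends padE bd₃ few refl (λ p p< → ≤-trans (≤-reflexive (padded p (subst (p <_) size≡ p<)))
          (down-stages-≤ d 0 d<D z≤n p ≤∘ values≤W)) , bd₃) andThen λ s₄ t₄ bd₄ fr₄ →
        (transform-ends (κ d) (R d) (2 * blocks d) (pad (K d) (R d) (down d)) bd₄ (0<R d)
          (trans (sameVar fr₄ r-K refl) K≡) (trans (sameVar fr₄ r-R refl) R≡)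
          (cong₂ _∸_ (trans (sameVar fr₄ r-exp refl) (trans (sameVar fr₂ r-exp refl)
              (trans (sameVar fr₁ r-exp refl) e≡)))
                     (trans (sameVar fr₄ r-ρ refl) ρ≡))
          (trans (sameVar fr₄ r-size refl) size≡) (≤-trans (≤-reflexive (sameVar fr₄ r-size refl)) few)
          (rounds≤S d) (2K≤W d) (λ r r≤ p → down-stages-≤ d r d<D r≤ p ≤∘ values≤W)
          (λ p p< → trans (t₄ p (subst (p <_) (sym size≡) p<)) (padded p p<)) , bd₄) andThen λ s₅ t₅ bd₅ fr₅ →
        let b₅ = trans (sameVar fr₅ r-blocks refl) (trans (sameVar fr₄ r-blocks refl) b₂)
            blocks≡ = cong₂ (λ x y → x * (2 * y)) b₅ (trans (sameVar fr₅ r-K refl)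
                (trans (sameVar fr₄ r-K refl) K≡))
            ρ₅ = trans (sameVar fr₅ r-ρ refl) (trans (sameVar fr₄ r-ρ refl) ρ≡)
            same-stack : ∀ j → arr s₅ a-stack j ≡ arr s₁ a-stack j
            same-stack j = trans (sameArr fr₅ a-stack refl j) (trans (sameArr fr₄ a-stack refl j)
                (sameArr fr₂ a-stack refl j))
            stack₅ : ∀ j → j < suc d → arr s₅ a-stack j ≡ exponent j
            stack₅ j j< = case j ≟ d of λ where
              (yes refl) → trans (same-stack j) (trans (cong (arr s₁ a-stack) (sym d≡)) (trans new e≡))
              (no j≢d)   → trans (same-stack j) (trans (old j (λ z → j≢d (trans z d≡)))
                             (stack j (≤∧≢⇒< (≤-pred j<) j≢d)))
        in assign-then {r-blocks} bd₅ (≤-trans (≤-reflexive blocks≡) (blocks≤W (suc d) d<D)) λ bd₆ →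
        assign-ends (envB bd₅ r-ρ)
          (blocks≡ , ρ₅ , (λ p p< → t₅ p (subst (p <_) (sym (size-suc d)) p<)) , stack₅)

      Up : ℕ → St → Set
      Up j s = env s r-blocks ≡ blocks (D ∸ j) × (∀ p → p < blocks (D ∸ j) * block (D ∸ j) → arr s 0 p ≡ up j
          (D ∸ j) p)

      upStep-ends : ∀ j s → j < D → env s r-d ≡ j → Ready s → Bounded s →
        (∀ d → d < D → arr s a-stack d ≡ exponent d) → Up j s →
        Ends upStep s (λ s′ → Up (suc j) (setVar s′ r-d (suc j)))
      upStep-ends j s j<D d≡ rdy bd stack (b≡ , work) =
        assign-then {r-exp} bd (arrB bd a-stack _) λ bd₁ →
        (setLevel-ends (exponent d) (ready-setVar {s} r-exp rdy refl)
          bd₁ e≡ (exponent≥1 d) (exponent≤m d) , bd₁) andThen λ s₂ (ρ≡ , K≡ , R≡) bd₂ fr₂ →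
        let b₂ = trans (sameVar fr₂ r-blocks refl) (trans b≡ (cong blocks D∸j))
            size≡ : env s₂ r-blocks * env s₂ r-R ≡ blocks d * (2 * K d) * R d
            size≡ = cong₂ _*_ b₂ R≡
            few : env s₂ r-blocks * env s₂ r-R ≤ L
            few = ≤-trans (≤-reflexive size≡) (≤-trans (m≤m+n (blocks (suc d) * R d) _)
              (≤-trans (≤-reflexive (sym (*-assoc 2 (blocks (suc d)) (R d)))) (size≤L (suc d) d<D)))
        in assign-then {r-size} bd₂ (≤-trans few L≤W) λ bd₃ →
        (transform-ends (κ d) (R d) (blocks d) (up j (suc d)) bd₃ (0<R d) K≡ R≡
          (cong₂ _∸_ (trans (sameVar fr₂ r-exp refl) e≡) ρ≡) size≡ few (rounds≤S d) (2K≤W d)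
          (λ r r≤ p → up-stages-≤ j d r j+d r≤ p ≤∘ values≤W)
          (λ p p< → trans (sameArr fr₂ 0 refl p) (trans
              (work p (subst (λ z → p < blocks z * block z) (sym D∸j) p<))
            (cong (λ z → up j z p) D∸j))) , bd₃) andThen λ s₄ t₄ bd₄ fr₄ →
        let K₄ = trans (sameVar fr₄ r-K refl) K≡
            R₄ = trans (sameVar fr₄ r-R refl) R≡
            b₅ : quo (env s₄ r-blocks) (2 * env s₄ r-K) ≡ blocks d
            b₅ = trans (cong₂ quo (trans (trans (sameVar fr₄ r-blocks refl) b₂)
                (sym (+-identityʳ (blocks (suc d))))) (cong (2 *_) K₄))
              (quo-unique (blocks d) (m^n>0 2 (suc (κ d))))
            size≡′ : quo (env s₄ r-blocks) (2 * env s₄ r-K) * (env s₄ r-R * env s₄ r-K) ≡ blocks d *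
                (R d * K d)
            size≡′ = cong₂ _*_ b₅ (cong₂ _*_ R₄ K₄)
            few′ = ≤-trans (≤-reflexive (trans size≡′ (cong (blocks d *_) (R*K d))))
              (≤-trans (≤-trans (m≤m+n (blocks d * block d) _)
                  (≤-reflexive (sym (*-assoc 2 (blocks d) (block d))))) (size≤L d (<⇒≤ d<D)))
            folded : ∀ p → p < blocks d * (R d * K d) → fold (env s₄ r-K) (env s₄ r-R) (arr s₄ 0) p ≡ up
                (suc j) d p
            folded p p< = trans (fold-cong (arr s₄ 0) p K₄ R₄)
              (fold-local (K d) (R d) (blocks d) (arr s₄ 0) _ (0<K d) (0<R d) t₄ p p<)
        in assign-then {r-blocks} bd₄ (≤-trans (quo-≤ (env s₄ r-blocks) (2 * env s₄ r-K))
            (envB bd₄ r-blocks)) λ bd₅ →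
        assign-then {r-size} bd₅ (≤-trans few′ L≤W) λ bd₆ →
        weaken bd₆ (pass-ends foldE bd₆ few′ refl (λ p p< → ≤-trans (≤-reflexive
            (folded p (subst (p <_) size≡′ p<)))
          (up-≤ (suc j) d j+d p ≤∘ values≤W)))
        λ s₇ t₇ _ fr₇ → trans (sameVar fr₇ r-blocks refl) b₅ ,
          λ p p< → trans (t₇ p (subst (p <_) (sym (trans size≡′ (cong (blocks d *_) (R*K d)))) p<))
            (folded p (subst (p <_) (cong (blocks d *_) (sym (R*K d))) p<))
        where
        d = D ∸ suc j
        d<D : d < D
        d<D = ∸-monoʳ-< z<s j<D
        j+d : suc j + d ≡ D
        j+d = m+[n∸m]≡n j<D
        D∸j : D ∸ j ≡ suc d
        D∸j = trans (cong (_∸ j) (trans (sym j+d) (sym (+-suc j d)))) (m+n∸m≡n j (suc d))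
        e≡ : arr s a-stack (env s r-D ∸ (1 + env s r-d)) ≡ exponent d
        e≡ = trans (cong (arr s a-stack) (cong₂ (λ x y → x ∸ suc y) (const≡ rdy r-D refl) d≡)) (stack d d<D)

      convolution-ends : ∀ s → Ready s → Bounded s → (∀ p → p < 4 * N → arr s 0 p ≡ f p) →
        Ends convolution s (λ s′ → ∀ p → p < 2 * N → arr s′ 0 p ≡ up D 0 p)
      convolution-ends s rdy bd loaded =
        assign-then {r-blocks} bd 1≤W λ bd₁ →
        assign-then {r-exp} bd₁ (envB bd r-m) λ bd₂ →
        (for-ends {short} {r-d} {r-D} Down bd₂ D≤S refl refl refl
          (refl , const≡ rdy r-m refl , (λ p p< → loaded p
              (subst (p <_) (trans (size-formula 0) (*-identityˡ (4 * N))) p<)) , λ _ ())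
          (λ d s₃ d< d≡ bd₃ fr₃ inv → downStep-ends d s₃ (subst (d <_) (const≡ rdy r-D refl) d<) d≡
            (ready-frame {for short r-d r-D downStep} refl refl rdy₂ fr₃) bd₃ inv) , bd₂) andThen λ s₄ inv₄
                bd₄ fr₄ →
        let inv = subst (λ z → Down z s₄) (const≡ rdy r-D refl) inv₄
            b₄ : env s₄ r-blocks * 4 ≡ blocks D * 4
            b₄ = cong (_* 4) (proj₁ inv)
            few = ≤-trans (≤-reflexive b₄) (≤-trans (≤-trans (m≤m+n (blocks D * 4) _)
                (≤-reflexive (sym (*-assoc 2 (blocks D) 4))))
              (subst (λ z → 2 * blocks D * 2 ^ suc z ≤ L) bottom (size≤L D ≤-refl)))
            based : ∀ p → p < blocks D * 4 → base (env s₄ r-blocks * 4) (arr s₄ 0) p ≡ up 0 D p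
            based p p< = trans (cong (λ z → base z (arr s₄ 0) p) b₄)
              (base-local (blocks D) (arr s₄ 0) (down D)
                (λ p p< → proj₁ (proj₂ (proj₂ inv)) p (subst (λ z → p < 2 * blocks D * 2 ^ suc z)
                    (sym bottom) p<)) p p<)
        in assign-then {r-size} bd₄ (≤-trans few L≤W) λ bd₅ →
        (pass-ends baseE bd₅ few refl (λ p p< → ≤-trans (≤-reflexive (based p (subst (p <_) b₄ p<)))
          (up-≤ 0 D refl p ≤∘ values≤W)) , bd₅) andThen λ s₆ t₆ bd₆ fr₆ →
        let rdy₆ = ready-frame {pass baseE} {setVar s₄ r-size (env s₄ r-blocks * 4)} refl refl
                     (ready-setVar {s₄} r-size (ready-frame {for short r-d r-D downStep} refl refl rdy₂ fr₄)
                         refl) fr₆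
            D≡ = const≡ rdy₆ r-D refl
        in weaken bd₆ (for-ends {short} {r-d} {r-D} Up bd₆ (≤-trans (≤-reflexive D≡) D≤S′) refl refl refl
          (trans (sameVar fr₆ r-blocks refl) (proj₁ inv) ,
            λ p p< → trans (t₆ p (subst (p <_) (sym b₄) (subst (λ z → p < blocks D * 2 ^ suc z) bottom p<)))
              (based p (subst (λ z → p < blocks D * 2 ^ suc z) bottom p<)))
          (λ j s₇ j< j≡ bd₇ fr₇ inv₇ → upStep-ends j s₇ (subst (j <_) D≡ j<) j≡
            (ready-frame {for short r-d r-D upStep} refl refl rdy₆ fr₇) bd₇
            (λ d d<D → trans (sameArr fr₇ a-stack refl d) (trans (sameArr fr₆ a-stack refl d)
                (proj₂ (proj₂ (proj₂ inv)) d d<D))) inv₇))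
        λ s₈ inv₈ _ _ p p< → let h = subst (λ z → Up z s₈) D≡ inv₈ in
          trans (proj₂ h p (subst (λ z → p < blocks z * block z) (sym (n∸n≡0 D))
              (subst (p <_) (cong (λ z → 1 * (2 * z)) (sym N≡)) (subst (p <_) (sym (*-identityˡ (2 * N)))
              p<))))
            (cong (λ z → up D z p) (n∸n≡0 D))
        where
        bottom : exponent D ≡ 1
        bottom = exponent-bottom D m≤2^D
        D≤S′ : D ≤ S
        D≤S′ = ≤-trans D≤m (≤-trans (<⇒≤ m<2Λ) 2Λ≤S)
        D≤S : env s r-D ≤ S
        D≤S = ≤-trans (≤-reflexive (const≡ rdy r-D refl)) D≤S′
        rdy₂ : Ready (setVar (setVar s r-blocks 1) r-exp (env s r-m))
        rdy₂ = ready-setVar {setVar s r-blocks 1} r-exp (ready-setVar {s} r-blocks rdy refl) refl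

-- Indicators and sumsets

sgn : ℕ → ℕ
sgn a = quo a a

sgn-suc : ∀ a → sgn (suc a) ≡ 1
sgn-suc a = n/n≡1 (suc a)

sgn-pos : ∀ {a} → 0 < a → sgn a ≡ 1
sgn-pos {suc a} _ = sgn-suc a

sgn≤1 : ∀ a → sgn a ≤ 1
sgn≤1 zero    = z≤n
sgn≤1 (suc a) = ≤-reflexive (sgn-suc a)

sgn≢0 : ∀ {a} → sgn a ≢ 0 → 0 < a
sgn≢0 {zero}  p = contradiction refl p
sgn≢0 {suc a} _ = z<s

sgn-* : ∀ {s} c → 0 < s → sgn (s * c) ≡ sgn c
sgn-* {s} zero    _ = cong sgn (*-zeroʳ s)
sgn-* {s} (suc c) p = trans (sgn-pos (*-mono-≤ p (s≤s z≤n))) (sym (sgn-suc c))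

lt : ℕ → ℕ → ℕ
lt p q = 1 ∸ (p + 1 ∸ q)

lt-yes : ∀ {p q} → p < q → lt p q ≡ 1
lt-yes {p} {q} p<q = cong (1 ∸_) (m≤n⇒m∸n≡0 (subst (_≤ q) (+-comm 1 p) p<q))

lt-no : ∀ {p q} → q ≤ p → lt p q ≡ 0
lt-no {p} {q} q≤p = m≤n⇒m∸n≡0 (m<n⇒0<n∸m (subst (q <_) (+-comm 1 p) (s≤s q≤p)))

lt≤1 : ∀ p q → lt p q ≤ 1
lt≤1 p q = m∸n≤m 1 (p + 1 ∸ q)

*≢0 : ∀ {a b} → a * b ≢ 0 → a ≢ 0 × b ≢ 0
*≢0 {a} {b} p = (λ { refl → p refl }) , λ { refl → p (*-zeroʳ a) }

∑≢0 : ∀ n (f : ℕ → ℕ) → ∑ n f ≢ 0 → ∃ λ i → i < n × f i ≢ 0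
∑≢0 zero    f p = contradiction refl p
∑≢0 (suc n) f p with f 0 in eq
... | suc _ = 0 , z<s , λ z → contradiction (trans (sym eq) z) λ ()
... | zero  with ∑≢0 n (f ∘ suc) p
...   | i , i<n , q = suc i , s<s i<n , q

-- row k is the indicator of the values below Q that are sums of k values
-- of the table.
module Rows (Q : ℕ) (1≤Q : 1 ≤ Q) (own : ℕ → ℕ) where

  bits : ℕ → ℕ
  bits p = sgn (own p) * lt p Q

  row : ℕ → ℕ → ℕ
  row zero    p = 1 ∸ p
  row (suc k) p = sgn (convolve (row k) bits p) * lt p Q

  bits≤1 : ∀ p → bits p ≤ 1
  bits≤1 p = *-mono-≤ (sgn≤1 (own p)) (lt≤1 p Q)

  row≤1 : ∀ k p → row k p ≤ 1
  row≤1 zero    p = m∸n≤m 1 p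
  row≤1 (suc k) p = *-mono-≤ (sgn≤1 (convolve (row k) bits p)) (lt≤1 p Q)

  bits-support : ∀ p → Q ≤ p → bits p ≡ 0
  bits-support p Q≤p = trans (cong (sgn (own p) *_) (lt-no Q≤p)) (*-zeroʳ (sgn (own p)))

  row-support : ∀ k p → Q ≤ p → row k p ≡ 0
  row-support zero    p Q≤p = m≤n⇒m∸n≡0 (≤-trans 1≤Q Q≤p)
  row-support (suc k) p Q≤p = trans (cong (sgn (convolve (row k) bits p) *_) (lt-no Q≤p))
      (*-zeroʳ (sgn (convolve (row k) bits p)))

  row-below : ∀ k {p} → row k p ≢ 0 → p < Q
  row-below k {p} r = ≰⇒> λ Q≤p → r (row-support k p Q≤p)

  row-step : ∀ k u v → row k u ≢ 0 → own v ≢ 0 → u + v < Q → row (suc k) (u + v) ≢ 0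
  row-step k u v r b u+v<Q = λ z → contradiction (trans (sym z) one) λ ()
    where
    b≢0 : bits v ≢ 0
    b≢0 z = contradiction (trans (sym z) (trans (cong₂ _*_ (sgn-pos (n≢0⇒n>0 b))
        (lt-yes (≤-<-trans (m≤n+m v u) u+v<Q))) refl)) λ ()
    term : 0 < convolve (row k) bits (u + v)
    term = <-≤-trans (*-mono-≤ (n≢0⇒n>0 r) (n≢0⇒n>0 (subst (λ z → bits z ≢ 0) (sym (m+n∸m≡n u v)) b≢0)))
      (∑-≥ (suc (u + v)) (λ i → row k i * bits (u + v ∸ i)) (s≤s (m≤m+n u v)))
    one : row (suc k) (u + v) ≡ 1
    one = cong₂ _*_ (sgn-pos term) (lt-yes u+v<Q)

  row-split : ∀ k p → row (suc k) p ≢ 0 → ∃ λ w → w ≤ p × own w ≢ 0 × row k (p ∸ w) ≢ 0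
  row-split k p r with ∑≢0 (suc p) (λ i → row k i * bits (p ∸ i)) (n>0⇒n≢0 (sgn≢0 (proj₁ (*≢0 r))))
  ... | i , s≤s i≤p , q with *≢0 {row k i} q
  ... | a , b = p ∸ i , m∸n≤m p i , (λ z → proj₁ (*≢0 {sgn (own (p ∸ i))} b) (cong sgn z)) ,
                subst (λ z → row k z ≢ 0) (sym (m∸[m∸n]≡n i≤p)) a

module SumsetVerification (n t num den E e lam W L S : ℕ) (fits : Parameters.Fits n t num den E e lam W L S)
    where
  open Parameters n t num den E e lam public
  open Fits fits public
  open ConvolutionVerification W L S fits public
  open Names

  1≤Q : 1 ≤ Q
  1≤Q = m≤n+m 1 (M + picks)

  Q≤N : Q ≤ N
  Q≤N = ≤-trans (m≤m+n Q Q) 2Q≤N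

  Q≤L : Q ≤ L
  Q≤L = ≤-trans Q≤N (≤-trans (m≤m+n N (3 * N)) N≤L)

  picks≤L : picks ≤ L
  picks≤L = ≤-trans picks≤S S≤L

  module Sums (own : ℕ → ℕ) where
    open Rows Q 1≤Q own public

    -- Below 2N the truncated differences switch the second term off; from 2N on the first term
    -- vanishes, because rows are supported below Q ≤ 2N. The formula makes sense for all `p`, as
    -- does the bound by 1 on which the magnitudes rest.
    loaded : ℕ → ℕ → ℕ
    loaded k p = row k p + bits (p ∸ 2 * N) * (1 ∸ (2 * N ∸ p))

    loaded-low : ∀ k p → p < 2 * N → loaded k p ≡ row k p
    loaded-low k p p< = trans (cong (row k p +_) (trans (cong (bits (p ∸ 2 * N) *_)
        (m≤n⇒m∸n≡0 (m<n⇒0<n∸m p<))) (*-zeroʳ (bits (p ∸ 2 * N)))))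
      (+-identityʳ (row k p))

    Q≤2N : Q ≤ 2 * N
    Q≤2N = ≤-trans Q≤N (m≤m+n N (N + 0))

    loaded-high : ∀ k p → loaded k (2 * N + p) ≡ bits p
    loaded-high k p = cong₂ _+_ (row-support k (2 * N + p) (≤-trans Q≤2N (m≤m+n (2 * N) p)))
      (trans (cong₂ (λ a b → bits a * (1 ∸ b)) (m+n∸m≡n (2 * N) p) (m≤n⇒m∸n≡0 (m≤m+n (2 * N) p)))
          (*-identityʳ (bits p)))

    loaded≤1 : ∀ k p → loaded k p ≤ 1
    loaded≤1 k p with p <? 2 * N
    ... | yes p< = subst (_≤ 1) (sym (loaded-low k p p<)) (row≤1 k p)
    ... | no p≮ = subst (λ z → loaded k z ≤ 1) (m+[n∸m]≡n (≮⇒≥ p≮))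
      (subst (_≤ 1) (sym (loaded-high k (p ∸ 2 * N))) (bits≤1 (p ∸ 2 * N)))

    RowsUpTo : ℕ → St → Set
    RowsUpTo k s = ∀ i p → i ≤ k → p < Q → arr s a-rows (i * Q + p) ≡ row i p

    sumset-ends : ∀ k s → k < picks → env s r-k ≡ k → Ready s → Bounded s →
      (∀ p → p < Q → arr s a-owner p ≡ own p) → RowsUpTo k s →
      Ends sumset s (RowsUpTo (suc k))
    sumset-ends k s k< k≡ rdy bd owner rows =
      (tabulate-ends {long} {r-p} {r-4N} {0} (var r-p) loadE 0 bd (≤-trans (≤-reflexive 4N≡) N≤L) refl refl
          (λ _ _ → refl)
        (λ p _ → ≤-trans (≤-reflexive (load≡ p)) (≤-trans (loaded≤1 k p) 1≤W)) , bd) andThen λ s₁ t₁ bd₁ fr₁ →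
      let rdy₁ = ready-frame {for long r-p r-4N (0 ⟨ var r-p ⟩⇐ loadE)} refl refl rdy fr₁ in
      (C.convolution-ends s₁ rdy₁ bd₁ (λ p p< → trans (proj₁ t₁ p (subst (p <_) (sym 4N≡) p<)) (load≡ p)) ,
          bd₁) andThen λ s₂ t₂ bd₂ fr₂ →
      let rdy₂ = ready-frame {convolution} refl refl rdy₁ fr₂
          Q₂ = const≡ rdy₂ r-Q refl
          k₂ = trans (sameVar fr₂ r-k refl) (trans (sameVar fr₁ r-k refl) k≡)
          -- The lower half exceeds the upper half by `scale D 0` times the coefficient. Taking the
          -- sign disposes of the scale without a division and turns the number of representations
          -- into an indicator.
          result : ∀ p → p < Q → sgn (arr s₂ 0 p ∸ arr s₂ 0 (env s₂ r-N + p)) ≡ row (suc k) p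
          result p p<Q = begin
            sgn (arr s₂ 0 p ∸ arr s₂ 0 (env s₂ r-N + p)) ≡⟨ cong (λ z → sgn (arr s₂ 0 p ∸ arr s₂ 0 (z + p)))
                (const≡ rdy₂ r-N refl) ⟩
            sgn (arr s₂ 0 p ∸ arr s₂ 0 (N + p))           ≡⟨ cong₂ (λ a b → sgn (a ∸ b))
                (t₂ p (<-≤-trans p<Q Q≤2N))
                                                               (t₂ (N + p) (subst (N + p <_)
                                                                   (cong (N +_) (sym (+-identityʳ N)))
                                                                   (+-monoʳ-< N (<-≤-trans p<Q Q≤N)))) ⟩
            sgn (up D 0 p ∸ up D 0 (N + p))               ≡⟨ cong (λ z → sgn (z ∸ up D 0 (N + p)))
                (coefficients p p<Q) ⟩
            sgn (scale D 0 * convolve (row k) bits p + up D 0 (N + p) ∸ up D 0 (N + p))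
                                                          ≡⟨ cong sgn (m+n∸n≡m (scale D 0 * convolve (row k)
                                                              bits p) (up D 0 (N + p))) ⟩
            sgn (scale D 0 * convolve (row k) bits p)     ≡⟨ sgn-* (convolve (row k) bits p) (scale>0 D 0) ⟩
            sgn (convolve (row k) bits p)                 ≡⟨ *-identityʳ _ ⟨
            sgn (convolve (row k) bits p) * 1             ≡⟨ cong (sgn (convolve (row k) bits p) *_)
                (sym (lt-yes p<Q)) ⟩
            row (suc k) p                                 ∎
      in weaken bd₂ (tabulate-ends {long} {r-p} {r-Q} {a-rows} {s₂} ((lit 1 ⊕ var r-k) ⊗ var r-Q ⊕ var r-p)
          (positive (at a-work (var r-p) ⊖ at a-work (var r-N ⊕ var r-p))) (suc k * Q) bd₂
              (≤-trans (≤-reflexive Q₂) Q≤L) refl refl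
          (λ p _ → cong₂ (λ a b → (1 + a) * b + p) k₂ Q₂)
          (λ p _ → ≤-trans (sgn≤1 (arr s₂ 0 p ∸ arr s₂ 0 (env s₂ r-N + p))) 1≤W))
      λ s₃ t₃ _ _ i p i≤ p<Q → case i ≟ suc k of λ where
        (yes refl) → trans (proj₁ t₃ p (subst (p <_) (sym Q₂) p<Q)) (result p p<Q)
        (no i≢) → trans (proj₂ t₃ (i * Q + p) (λ p′ p′< → <⇒≢ (<-≤-trans (pair-< (≤∧≢⇒< i≤ i≢) p<Q)
            (m≤m+n (suc k * Q) p′))))
          (trans (sameArr fr₂ a-rows refl _) (trans (sameArr fr₁ a-rows refl _)
              (rows i p (≤-pred (≤∧≢⇒< i≤ i≢)) p<Q)))
      where
      open ≡-Reasoning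
      module C = Convolution (loaded k) (loaded≤1 k)
      open Levels m 1≤m (loaded k)
      4N≡ = const≡ rdy r-4N refl
      load≡ : ∀ p → eval loadE (setVar s r-p p) ≡ loaded k p
      load≡ p = trans (cong₂ (λ z w → arr s a-rows (z * w + p) * lt p w + sgn
          (arr s a-owner (p ∸ env s r-2N)) * ((1 ∸ (env s r-2N ∸ p)) * lt (p ∸ env s r-2N) w)) k≡
          (const≡ rdy r-Q refl))
        (trans (cong (λ z → arr s a-rows (k * Q + p) * lt p Q + sgn (arr s a-owner (p ∸ z)) *
            ((1 ∸ (z ∸ p)) * lt (p ∸ z) Q)) (const≡ rdy r-2N refl))
          (cong₂ _+_ (left p) (trans (lemma (sgn (arr s a-owner (p ∸ 2 * N))) (1 ∸ (2 * N ∸ p))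
              (lt (p ∸ 2 * N) Q)) (cong (_* (1 ∸ (2 * N ∸ p))) (right (p ∸ 2 * N))))))
        where
        lemma : ∀ a b c → a * (b * c) ≡ a * c * b
        lemma = solve-∀
        left : ∀ p → arr s a-rows (k * Q + p) * lt p Q ≡ row k p
        left p with p <? Q
        ... | yes p<Q = trans (cong₂ _*_ (rows k p ≤-refl p<Q) (lt-yes p<Q)) (*-identityʳ (row k p))
        ... | no p≮Q = trans (cong (arr s a-rows (k * Q + p) *_) (lt-no (≮⇒≥ p≮Q)))
          (trans (*-zeroʳ (arr s a-rows (k * Q + p))) (sym (row-support k p (≮⇒≥ p≮Q))))
        right : ∀ p → sgn (arr s a-owner p) * lt p Q ≡ bits p
        right p with p <? Q
        ... | yes p<Q = cong (λ z → sgn z * lt p Q) (owner p p<Q)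
        ... | no p≮Q = trans (cong (sgn (arr s a-owner p) *_) (lt-no (≮⇒≥ p≮Q)))
          (trans (*-zeroʳ (sgn (arr s a-owner p))) (sym (bits-support p (≮⇒≥ p≮Q))))
      coefficients : ∀ p → p < Q → up D 0 p ≡ scale D 0 * convolve (row k) bits p + up D 0 (N + p)
      coefficients p p<Q = subst (λ z → up D 0 p ≡ scale D 0 * convolve (row k) bits p + up D 0 (z + p)) N≡
        (product-coefficients m 1≤m D m≤2^D (loaded k) Q (row k) bits (subst (Q + Q ≤_) (sym N≡) 2Q≤N)
          (λ i i< → loaded-low k i (subst (λ z → i < 2 * z) N≡ i<))
          (λ i i< → trans (cong (λ z → loaded k (2 * z + i)) N≡) (loaded-high k i))
          (row-support k) bits-support p (<-≤-trans p<Q (≤-trans Q≤N (≤-reflexive (sym N≡)))))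

    sums-ends : ∀ s → Ready s → Bounded s → (∀ p → p < Q → arr s a-owner p ≡ own p) →
      (∀ p → p < Q → arr s a-rows p ≡ row 0 p) → Ends sums s (RowsUpTo picks)
    sums-ends s rdy bd owner row0 = weaken bd
      (for-ends {short} {r-k} {r-picks} RowsUpTo bd (≤-trans (≤-reflexive picks≡) picks≤S) refl refl refl
        (λ { zero p _ p<Q → row0 p p<Q })
        λ k s′ k< k≡ bd′ fr rows → weaken bd′
          (sumset-ends k s′ (subst (k <_) picks≡ k<) k≡ (ready-frame {for short r-k r-picks sumset} refl refl
              rdy fr) bd′
            (λ p p<Q → trans (sameArr fr a-owner refl p) (owner p p<Q)) rows)
          λ _ r _ _ → r)
      λ s′ rows _ _ → subst (λ k → RowsUpTo k s′) picks≡ rows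
      where picks≡ = const≡ rdy r-picks refl

    findBest-ends : ∀ s → Ready s → Bounded s → RowsUpTo picks s → row picks 0 ≢ 0 →
      Ends findBest s (λ s′ → row picks (env s′ r-cur) ≢ 0 × (∀ p → row picks p ≢ 0 → p ≤ env s′ r-cur))
    findBest-ends s rdy bd rows zero-ok = assign-then {r-cur} bd z≤n λ bd₁ → weaken bd₁
      (for-ends {long} {r-p} {r-Q} Inv bd₁ (≤-trans (≤-reflexive Q≡) Q≤L) refl refl refl
          (zero-ok , z≤n , λ _ _ ()) body)
      λ s′ inv _ _ → proj₁ inv , λ p r → proj₂ (proj₂ inv) p r (subst (p <_) (sym Q≡) (row-below picks r))
      where
      Q≡ = const≡ rdy r-Q refl
      Inv : ℕ → St → Set
      Inv i s′ = row picks (env s′ r-cur) ≢ 0 × env s′ r-cur ≤ i × (∀ p → row picks p ≢ 0 → p < i → p ≤ env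
          s′ r-cur)
      body : ∀ i s′ → i < env s r-Q → env s′ r-p ≡ i → Bounded s′ →
        Frame (for long r-p r-Q (r-cur ⇐ var r-cur ⊕ at a-rows (var r-picks ⊗ var r-Q ⊕ var r-p) ⊗
            (var r-p ⊖ var r-cur))) (setVar s r-cur 0) s′ →
        Inv i s′ → Ends (r-cur ⇐ var r-cur ⊕ at a-rows (var r-picks ⊗ var r-Q ⊕ var r-p) ⊗
            (var r-p ⊖ var r-cur)) s′
          (λ s″ → Inv (suc i) (setVar s″ r-p (suc i)))
      body i s′ i< i≡ bd′ fr (ok , cur≤i , best) = assign-ends
          (≤-trans (≤-trans (≤-reflexive new≡) new≤) (≤-trans (<⇒≤ i<Q) (≤-trans Q≤L L≤W)))
          (subst (λ c → row picks c ≢ 0 × c ≤ suc i × (∀ p → row picks p ≢ 0 → p < suc i → p ≤ c)) (sym new≡)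
            (ok′ , ≤-trans new≤ (n≤1+n i) , best′))
        where
        i<Q : i < Q
        i<Q = subst (i <_) Q≡ i<
        cur = env s′ r-cur
        r = row picks i
        new≡ : cur + arr s′ a-rows (env s′ r-picks * env s′ r-Q + env s′ r-p) * (env s′ r-p ∸ cur) ≡ cur + r
            * (i ∸ cur)
        new≡ = cong₂ (λ a b → cur + a * (b ∸ cur))
          (trans (cong (arr s′ a-rows) (cong₂ _+_ (cong₂ _*_ (trans (sameVar fr r-picks refl)
              (const≡ rdy r-picks refl)) (trans (sameVar fr r-Q refl) Q≡)) i≡))
            (trans (sameArr fr a-rows refl _) (rows picks i ≤-refl i<Q))) i≡
        cases : (r ≡ 0 × cur + r * (i ∸ cur) ≡ cur) ⊎ (r ≢ 0 × cur + r * (i ∸ cur) ≡ i)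
        cases with row picks i | row≤1 picks i
        ... | zero        | _ = inj₁ (refl , +-identityʳ cur)
        ... | suc zero    | _ = inj₂ ((λ ()) , trans (cong (cur +_) (+-identityʳ (i ∸ cur)))
            (m+[n∸m]≡n cur≤i))
        ... | suc (suc _) | s≤s ()
        new≤ : cur + r * (i ∸ cur) ≤ i
        new≤ with cases
        ... | inj₁ (_ , q) = subst (_≤ i) (sym q) cur≤i
        ... | inj₂ (_ , q) = ≤-reflexive q
        ok′ : row picks (cur + r * (i ∸ cur)) ≢ 0
        ok′ with cases
        ... | inj₁ (_ , q) = subst (λ c → row picks c ≢ 0) (sym q) ok
        ... | inj₂ (z , q) = subst (λ c → row picks c ≢ 0) (sym q) z
        best′ : ∀ p → row picks p ≢ 0 → p < suc i → p ≤ cur + r * (i ∸ cur)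
        best′ p z p≤i with p ≟ i | cases
        ... | yes refl | inj₁ (z′ , _) = contradiction z′ z
        ... | yes refl | inj₂ (_ , q)  = ≤-reflexive (sym q)
        ... | no p≢i   | _ = ≤-trans (best p z (≤∧≢⇒< (≤-pred p≤i) p≢i)) (m≤m+n cur _)

-- The table of items and the trace back

∑-update : ∀ n (X f : ℕ → ℕ) i c → i < n →
           ∑ n (λ j → X j * (f [ i ≔ f i + c ]) j) ≡ ∑ n (λ j → X j * f j) + X i * c
∑-update (suc n) X f zero    c _ = lemma (X 0) (f 0) c (∑ n (λ j → X (suc j) * f (suc j)))
  where lemma : ∀ x y c s → x * (y + c) + s ≡ x * y + s + x * c
        lemma = solve-∀
∑-update (suc n) X f (suc i) c (s<s i<n) =
  trans (cong (X 0 * f 0 +_) (∑-update n (X ∘ suc) (f ∘ suc) i c i<n)) (sym (+-assoc (X 0 * f 0) _ _))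

set-id : ∀ (f : ℕ → ℕ) i j → (f [ i ≔ f i + 0 ]) j ≡ f j
set-id f i j with i ≡ᵇ j in eq
... | true  = trans (+-identityʳ (f i)) (cong f (≡ᵇ⇒≡ i j (subst T (sym eq) tt)))
... | false = refl

module Items (n t P M Q : ℕ) (X : ℕ → ℕ) where
  -- The maximum of 1 and ⌊t / (x P)⌋: for an item above t/P the quotient is 0 and the item counts
  -- singly.
  factor : ℕ → ℕ
  factor i = quo t (X i * P) + (1 ∸ quo t (X i * P))

  multiple : ℕ → ℕ → ℕ
  multiple j i = 2 ^ j * factor i

  itemValue : ℕ → ℕ → ℕ
  itemValue j i = quo (multiple j i * X i * M) t

  -- The table entry (i , c) at w represents c copies of item i, of rounded
  -- value w.
  record Valid (cmax i c w : ℕ) : Set where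
    constructor valid
    field
      index   : i < n ⊎ c ≡ 0
      index≤n : i ≤ n
      lower≤  : w * t ≤ c * X i * M
      upper≤  : c * X i * M ≤ suc w * t
      mult≤   : c ≤ cmax

module TraceVerification (n t num den E e lam W L S : ℕ) (fits : Parameters.Fits n t num den E e lam W L S)
  (X : ℕ → ℕ) (0<t : 0 < t)
  (item≤W : ∀ i → 2 ^ 2 ^ lam * (t + 1) * X i * Parameters.M n t num den E e lam ≤ W)
  (total≤W : Parameters.picks n t num den E e lam * (2 ^ 2 ^ lam * (t + 1)) ≤ W) where
  open SumsetVerification n t num den E e lam W L S fits public
  open Items n t P M Q X public
  open Names

  cmax : ℕ
  cmax = 2 ^ Λ * (t + 1)

  TableOK : (ℕ → ℕ) → (ℕ → ℕ) → Set
  TableOK own mult = ∀ w → w < Q → own w ≢ 0 → Valid cmax (own w ∸ 1) (mult w) w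

  total : St → ℕ
  total s = ∑ n (λ i → X i * io s i)

  module Trace (own mult : ℕ → ℕ) (table : TableOK own mult) (v : ℕ) where
    open Sums own public

    Stored : St → Set
    Stored s = (∀ p → p < Q → arr s a-owner p ≡ own p) × (∀ p → p < Q → arr s a-mult p ≡ mult p) × RowsUpTo
        picks s

    Pickable : ℕ → ℕ → ℕ → Set
    Pickable k cur w = w ≤ cur × own w ≢ 0 × row k (cur ∸ w) ≢ 0

    -- The loop keeps the last pickable value seen, and its initial 0 is only a default. It cannot
    -- end without a hit, because by `row-split` the current value was reached in its row through
    -- some pick.
    findPick-ends : ∀ k s → k < picks → env s r-k ≡ k → Ready s → Bounded s → Stored s →
      row (suc (picks ∸ suc k)) (env s r-cur) ≢ 0 →
      Ends findPick s (λ s′ → Pickable (picks ∸ suc k) (env s r-cur) (env s′ r-pick))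
    findPick-ends k s k< k≡ rdy bd (owner , _ , rows) here = assign-then {r-pick} bd z≤n λ bd₁ → weaken bd₁
      (for-ends {long} {r-p} {r-Q} Inv bd₁ (≤-trans (≤-reflexive Q≡) Q≤L) refl refl refl (z≤n , inj₂ λ _ ())
          body)
      λ s′ inv _ _ → finish s′ inv
      where
      Q≡ = const≡ rdy r-Q refl
      k′ = picks ∸ suc k
      cur = env s r-cur
      cur<Q : cur < Q
      cur<Q = row-below (suc k′) here
      Inv : ℕ → St → Set
      Inv i s′ = env s′ r-pick ≤ i × (Pickable k′ cur (env s′ r-pick) ⊎ (∀ w → w < i → ¬ Pickable k′ cur w))
      finish : ∀ s′ → Inv (env s r-Q) s′ → Pickable k′ cur (env s′ r-pick)
      finish s′ (_ , inj₁ p) = p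
      finish s′ (_ , inj₂ none) with row-split k′ cur here
      ... | w , w≤ , o , r = contradiction (w≤ , o , r)
          (none w (≤-<-trans w≤ (subst (cur <_) (sym Q≡) cur<Q)))
      update = r-pick ⇐ var r-pick ⊕
                 positive (at a-owner (var r-p)) ⊗
                 at a-rows ((var r-picks ⊖ (lit 1 ⊕ var r-k)) ⊗ var r-Q ⊕ (var r-cur ⊖ var r-p)) ⊗
                 notBelow (var r-cur) (var r-p) ⊗
                 (var r-p ⊖ var r-pick)
      body : ∀ i s′ → i < env s r-Q → env s′ r-p ≡ i → Bounded s′ →
        Frame (for long r-p r-Q update) (setVar s r-pick 0) s′ → Inv i s′ →
        Ends update s′ (λ s″ → Inv (suc i) (setVar s″ r-p (suc i)))
      body i s′ i< i≡ bd′ fr (pick≤i , found) = assign-ends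
          (≤-trans (≤-reflexive new≡) (≤-trans new≤ (≤-trans (<⇒≤ i<Q) (≤-trans Q≤L L≤W))))
          (subst (λ c → c ≤ suc i × (Pickable k′ cur c ⊎ (∀ w → w < suc i → ¬ Pickable k′ cur w))) (sym new≡)
            (≤-trans new≤ (n≤1+n i) , found′))
        where
        i<Q : i < Q
        i<Q = subst (i <_) Q≡ i<
        pick = env s′ r-pick
        g = sgn (own i) * row k′ (cur ∸ i) * (1 ∸ (i ∸ cur))
        new≡ : eval (var r-pick ⊕ positive (at a-owner (var r-p)) ⊗
                 at a-rows ((var r-picks ⊖ (lit 1 ⊕ var r-k)) ⊗ var r-Q ⊕ (var r-cur ⊖ var r-p)) ⊗
                 notBelow (var r-cur) (var r-p) ⊗ (var r-p ⊖ var r-pick)) s′ ≡ pick + g * (i ∸ pick)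
        new≡ = cong (pick +_) (cong₂ _*_ (cong₂ _*_ (cong₂ _*_
            (cong sgn (trans (cong (arr s′ a-owner) i≡) (trans (sameArr fr a-owner refl i) (owner i i<Q))))
            (trans (cong (arr s′ a-rows) (cong₂ _+_ (cong₂ _*_
                (cong₂ _∸_ (trans (sameVar fr r-picks refl) (const≡ rdy r-picks refl))
                    (cong suc (trans (sameVar fr r-k refl) k≡)))
                (trans (sameVar fr r-Q refl) Q≡)) (cong₂ _∸_ (sameVar fr r-cur refl) i≡)))
              (trans (sameArr fr a-rows refl _) (rows k′ (cur ∸ i) (m∸n≤m picks (suc k))
                  (≤-<-trans (m∸n≤m cur i) cur<Q)))))
            (cong₂ (λ a b → 1 ∸ (a ∸ b)) i≡ (sameVar fr r-cur refl))) (cong (_∸ pick) i≡))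
        g≤1 : g ≤ 1
        g≤1 = *-mono-≤ (*-mono-≤ (sgn≤1 (own i)) (row≤1 k′ (cur ∸ i))) (m∸n≤m 1 (i ∸ cur))
        g≢0 : g ≢ 0 → Pickable k′ cur i
        g≢0 z = let ab , c = *≢0 {sgn (own i) * row k′ (cur ∸ i)} z ; a , b = *≢0 {sgn (own i)} ab in
          ≮⇒≥ (λ cur<i → c (m≤n⇒m∸n≡0 (m<n⇒0<n∸m cur<i))) , (λ q → a (cong sgn q)) , b
        g≡0 : g ≡ 0 → ¬ Pickable k′ cur i
        g≡0 z (i≤cur , o , r) = contradiction (subst (1 ≤_) z
          (*-mono-≤ {1} (*-mono-≤ {1} (≤-reflexive (sym (sgn-pos (n≢0⇒n>0 o)))) (n≢0⇒n>0 r))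
              (≤-reflexive (sym (cong (1 ∸_) (m≤n⇒m∸n≡0 i≤cur)))))) λ ()
        cases : (g ≡ 0 × pick + g * (i ∸ pick) ≡ pick) ⊎ (g ≢ 0 × pick + g * (i ∸ pick) ≡ i)
        cases with g | g≤1
        ... | zero        | _ = inj₁ (refl , +-identityʳ pick)
        ... | suc zero    | _ = inj₂ ((λ ()) , trans (cong (pick +_) (+-identityʳ (i ∸ pick)))
            (m+[n∸m]≡n pick≤i))
        ... | suc (suc _) | s≤s ()
        new≤ : pick + g * (i ∸ pick) ≤ i
        new≤ with cases
        ... | inj₁ (_ , q) = subst (_≤ i) (sym q) pick≤i
        ... | inj₂ (_ , q) = ≤-reflexive q
        found′ : Pickable k′ cur (pick + g * (i ∸ pick)) ⊎ (∀ w → w < suc i → ¬ Pickable k′ cur w)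
        found′ = go cases found
          where
          go : (g ≡ 0 × pick + g * (i ∸ pick) ≡ pick) ⊎ (g ≢ 0 × pick + g * (i ∸ pick) ≡ i) →
               Pickable k′ cur pick ⊎ (∀ w → w < i → ¬ Pickable k′ cur w) →
               Pickable k′ cur (pick + g * (i ∸ pick)) ⊎ (∀ w → w < suc i → ¬ Pickable k′ cur w)
          go (inj₂ (z , q)) _ = inj₁ (subst (Pickable k′ cur) (sym q) (g≢0 z))
          go (inj₁ (z , q)) (inj₁ p) = inj₁ (subst (Pickable k′ cur) (sym q) p)
          go (inj₁ (z , q)) (inj₂ none) = inj₂ λ w w<1+i → case w ≟ i of λ where
            (yes refl) → g≡0 z
            (no w≢i)   → none w (≤∧≢⇒< (≤-pred w<1+i) w≢i)

    -- `u` is the part of `v` already accounted for. Every pick adds its rounded value to `u`,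
    -- whereas its true worth is larger by at most one unit t/M; so after `k` picks the true sum is
    -- between u and u + k units. The last clause keeps the multiplicities within words.
    Remaining : ℕ → St → Set
    Remaining k s = row (picks ∸ k) (env s r-cur) ≢ 0 × (∃ λ u → u + env s r-cur ≡ v ×
      u * t ≤ total s * M × total s * M ≤ (u + k) * t) × (∀ i → io s i ≤ k * cmax)

    takePick-ends : ∀ k s → k < picks → Bounded s → Stored s → Remaining k s →
      Pickable (picks ∸ suc k) (env s r-cur) (env s r-pick) →
      Ends takePick s (λ s′ → Remaining (suc k) (setVar s′ r-k (suc k)))
    takePick-ends k s k< bd (owner , mults , _) (here , (u , u+cur , low , high) , small) (w≤cur , o , r) =
      ends (read i≤n then (emit i≤n fits′ then assign (≤-trans (m∸n≤m (env s r-cur) w) (envB bd r-cur))))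
        (r , (u + w , trans (+-assoc u w (env s r-cur ∸ w)) (trans (cong (u +_) (m+[n∸m]≡n w≤cur)) u+cur) ,
            low′ , high′) , small′)
      where
      w = env s r-pick
      w<Q : w < Q
      w<Q = ≤-<-trans w≤cur (row-below (picks ∸ k) here)
      i = arr s a-owner w ∸ 1
      c = arr s a-mult w
      i≡ : i ≡ own w ∸ 1
      i≡ = cong (_∸ 1) (owner w w<Q)
      ok : Valid cmax i c w
      ok = subst₂ (λ i c → Valid cmax i c w) (sym i≡) (sym (mults w w<Q)) (table w w<Q o)
      open Valid ok
      i≤n : i ≤ n
      i≤n = index≤n
      next≤ : io s i + c ≤ suc k * cmax
      next≤ = ≤-trans (+-mono-≤ (small i) mult≤) (≤-reflexive (+-comm (k * cmax) cmax))
      fits′ : io s i + c ≤ W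
      fits′ = ≤-trans next≤ (≤-trans (*-monoˡ-≤ cmax k<) total≤W)
      io′ = io s [ i ≔ io s i + c ]
      sum′ : ∑ n (λ j → X j * io′ j) ≡ total s + c * X i
      sum′ with index
      ... | inj₁ i<n = trans (∑-update n X (io s) i c i<n) (cong (total s +_) (*-comm (X i) c))
      ... | inj₂ c≡0 = trans (∑-cong n λ j _ → cong (X j *_)
          (trans (cong (λ z → (io s [ i ≔ io s i + z ]) j) c≡0) (set-id (io s) i j)))
                       (sym (trans (cong (λ z → total s + z * X i) c≡0) (+-identityʳ (total s))))
      low′ : (u + w) * t ≤ ∑ n (λ j → X j * io′ j) * M
      low′ = begin
        (u + w) * t                  ≡⟨ *-distribʳ-+ t u w ⟩
        u * t + w * t                ≤⟨ +-mono-≤ low lower≤ ⟩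
        total s * M + c * X i * M    ≡⟨ *-distribʳ-+ M (total s) (c * X i) ⟨
        (total s + c * X i) * M      ≡⟨ cong (_* M) sum′ ⟨
        ∑ n (λ j → X j * io′ j) * M  ∎
        where open ≤-Reasoning
      high′ : ∑ n (λ j → X j * io′ j) * M ≤ (u + w + suc k) * t
      high′ = begin
        ∑ n (λ j → X j * io′ j) * M  ≡⟨ cong (_* M) sum′ ⟩
        (total s + c * X i) * M      ≡⟨ *-distribʳ-+ M (total s) (c * X i) ⟩
        total s * M + c * X i * M    ≤⟨ +-mono-≤ high upper≤ ⟩
        (u + k) * t + suc w * t      ≡⟨ lemma u k w t ⟩
        (u + w + suc k) * t          ∎
        where
        open ≤-Reasoning
        lemma : ∀ u k w t → (u + k) * t + suc w * t ≡ (u + w + suc k) * t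
        lemma = solve-∀
      small′ : ∀ j → io′ j ≤ suc k * cmax
      small′ j with i ≡ᵇ j
      ... | true  = next≤
      ... | false = ≤-trans (small j) (m≤n+m (k * cmax) cmax)

    -- Row 0 contains 0 only, so that nothing of `v` remains after the last pick.
    traceBack-ends : ∀ s → Ready s → Bounded s → Stored s → Remaining 0 s →
      Ends traceBack s (λ s′ → v * t ≤ total s′ * M × total s′ * M ≤ (v + picks) * t)
    traceBack-ends s rdy bd stored start = weaken bd
      (for-ends {short} {r-k} {r-picks} Remaining bd (≤-trans (≤-reflexive picks≡) picks≤S) refl refl refl
          start
        λ k s₁ k< k≡ bd₁ fr₁ inv →
          let k<′ = subst (k <_) picks≡ k<
              rdy₁ = ready-frame {for short r-k r-picks (findPick ⨾ takePick)} refl refl rdy fr₁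
              stored₁ = stored-frame {for short r-k r-picks (findPick ⨾ takePick)} fr₁ refl refl refl
          in (findPick-ends k s₁ k<′ k≡ rdy₁ bd₁ stored₁ (subst (λ z → row z (env s₁ r-cur) ≢ 0)
              (+-∸-assoc 1 k<′) (proj₁ inv)) , bd₁) andThen
          λ s₂ pick bd₂ fr₂ → let cur≡ = sameVar fr₂ r-cur refl in
            takePick-ends k s₂ k<′ bd₂
              (stored-frame-from {findPick} stored₁ fr₂ refl refl refl)
              (subst (λ z → row (picks ∸ k) z ≢ 0) (sym cur≡) (proj₁ inv) ,
               (let u , a , b , c = proj₁ (proj₂ inv) in
                u , trans (cong (u +_) cur≡) a , subst (λ z → u * t ≤ z * M) (sym (total≡ fr₂)) b ,
                subst (λ z → z * M ≤ (u + k) * t) (sym (total≡ fr₂)) c) ,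
               λ i → subst (_≤ k * cmax) (sym (sameIO fr₂ refl i)) (proj₂ (proj₂ inv) i))
              (subst (λ z → Pickable (picks ∸ suc k) z (env s₂ r-pick)) (sym cur≡) pick))
      λ s′ inv _ _ → finish s′ (subst (λ k → Remaining k s′) picks≡ inv)
      where
      picks≡ = const≡ rdy r-picks refl
      total≡ : ∀ {s₁ s₂} → Frame findPick s₁ s₂ → total s₂ ≡ total s₁
      total≡ fr = ∑-cong n λ i _ → cong (X i *_) (sameIO fr refl i)
      stored-frame-from : ∀ {c s₁ s₂} → Stored s₁ → Frame c s₁ s₂ → modArr c a-owner ≡ false → modArr c
          a-mult ≡ false →
        modArr c a-rows ≡ false → Stored s₂
      stored-frame-from (a , b , c) fr x y z =
        (λ p p< → trans (sameArr fr a-owner x p) (a p p<)) , (λ p p< → trans (sameArr fr a-mult y p)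
            (b p p<)) ,
        (λ i p i≤ p< → trans (sameArr fr a-rows z _) (c i p i≤ p<))
      stored-frame : ∀ {c s₂} → Frame c s s₂ → modArr c a-owner ≡ false → modArr c a-mult ≡ false →
        modArr c a-rows ≡ false → Stored s₂
      stored-frame = stored-frame-from stored
      finish : ∀ s′ → Remaining picks s′ → v * t ≤ total s′ * M × total s′ * M ≤ (v + picks) * t
      finish s′ (r , (u , u+cur , low , high) , _) =
        subst (λ z → z * t ≤ total s′ * M) u≡v low , subst (λ z → total s′ * M ≤ (z + picks) * t) u≡v high
        where
        cur≡0 : ∀ c → row (picks ∸ picks) c ≢ 0 → c ≡ 0
        cur≡0 zero    _ = refl
        cur≡0 (suc c) z = contradiction (trans (cong (λ k → row k (suc c)) (n∸n≡0 picks)) (0∸n≡0 c)) z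
        u≡v : u ≡ v
        u≡v = trans (sym (+-identityʳ u)) (trans (cong (u +_) (sym (cur≡0 (env s′ r-cur) r))) u+cur)

-- The phases after the choice of parameters

module MainVerification (n t num den E e lam W L S : ℕ) (fits : Parameters.Fits n t num den E e lam W L S)
  (X : ℕ → ℕ) (0<t : 0 < t)
  (item≤W : ∀ i → 2 ^ 2 ^ lam * (t + 1) * X i * Parameters.M n t num den E e lam ≤ W)
  (total≤W : Parameters.picks n t num den E e lam * (2 ^ 2 ^ lam * (t + 1)) ≤ W) where
  open TraceVerification n t num den E e lam W L S fits X 0<t item≤W total≤W public
  open Names

  factor≤ : ∀ i → factor i ≤ t + 1
  factor≤ i = +-mono-≤ (quo-≤ t (X i * P)) (m∸n≤m 1 (quo t (X i * P)))

  multiple≤ : ∀ j i → j ≤ Λ → multiple j i ≤ cmax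
  multiple≤ j i j≤ = *-mono-≤ (^-monoʳ-≤ 2 j≤) (factor≤ i)

  cmax≤W : cmax ≤ W
  cmax≤W = ≤-trans (m≤n*m cmax picks {{>-nonZero 1≤picks}}) total≤W
    where
    1≤picks : 1 ≤ picks
    1≤picks = ≤-trans (≤-trans (m^n>0 2 lam) (m≤m+n Λ (Λ + 0))) 2Λ≤picks

  item-valid : ∀ j i → j ≤ Λ → i < n → Valid cmax i (multiple j i) (itemValue j i)
  item-valid j i j≤ i<n = valid (inj₁ i<n) (<⇒≤ i<n) (quo-*-≤ (multiple j i * X i * M) t)
    (<⇒≤ (<-quo (multiple j i * X i * M) 0<t)) (multiple≤ j i j≤)

  -- Different multiples may round to the same value and overwrite one another. It suffices that the
  -- cell is occupied at all: any entry with this rounded value serves equally well, and `TableOK`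
  -- vouches for whichever is there.
  Complete : (ℕ → ℕ → Set) → (ℕ → ℕ) → Set
  Complete Seen own = ∀ j i → Seen j i → i < n → itemValue j i < Q → own (itemValue j i) ≢ 0

  TableOf : St → Set
  TableOf s = TableOK (arr s a-owner) (arr s a-mult)

  enter-ends : ∀ j i s (Seen : ℕ → ℕ → Set) → j < Λ → i < n → env s r-j ≡ j → env s r-i ≡ i → Ready s →
      Bounded s →
    io s i ≡ X i → TableOf s → Complete Seen (arr s a-owner) →
    Ends enter s (λ s′ → TableOf s′ × Complete (λ j′ i′ → Seen j′ i′ ⊎ (j′ ≡ j × i′ ≡ i)) (arr s′ a-owner))
  enter-ends j i s Seen j< i<n j≡ i≡ rdy bd x≡ table seen =
    (ends (read {r = r-x} {var r-i} (≤-trans (≤-reflexive i≡) (<⇒≤ i<n)))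
       (trans (set-same (env s) r-x (io s (env s r-i))) (trans (cong (io s) i≡) x≡)) , bd) andThen λ s₁ x₁
           bd₁ fr₁ →
    let j₁ = trans (sameVar fr₁ r-j refl) j≡
        i₁ = trans (sameVar fr₁ r-i refl) i≡
        rdy₁ = ready-frame {get r-x (var r-i)} refl refl rdy fr₁
        c≡ : arr s₁ a-pow (env s₁ r-j) * (quo (env s₁ r-t) (env s₁ r-x * env s₁ r-P) +
            (1 ∸ quo (env s₁ r-t) (env s₁ r-x * env s₁ r-P))) ≡ multiple j i
        c≡ = cong₂ _*_ (trans (cong (arr s₁ a-pow) j₁) (power≡ rdy₁ j (≤-trans (<⇒≤ j<) (m≤m+n Λ (Λ + 0)))))
               (cong (λ z → z + (1 ∸ z)) (cong₂ quo (const≡ rdy₁ r-t refl) (cong₂ _*_ x₁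
                   (const≡ rdy₁ r-P refl))))
    in (assign-ends {r-c} {_} {s₁} {λ s′ → env s′ r-c ≡ multiple j i}
          (≤-trans (≤-reflexive c≡) (≤-trans (multiple≤ j i (<⇒≤ j<)) cmax≤W)) c≡ , bd₁) andThen λ s₂ c₂ bd₂
              fr₂ →
    let rdy₂ = ready-frame {r-c ⇐ at a-pow (var r-j) ⊗ factorE} refl refl rdy₁ fr₂
        x₂ = trans (sameVar fr₂ r-x refl) x₁
        w≡ : quo (env s₂ r-c * env s₂ r-x * env s₂ r-M) (env s₂ r-t) ≡ itemValue j i
        w≡ = cong₂ quo (cong₂ _*_ (cong₂ _*_ c₂ x₂) (const≡ rdy₂ r-M refl)) (const≡ rdy₂ r-t refl)
        large : itemValue j i ≤ W
        large = ≤-trans (quo-≤ (multiple j i * X i * M) t)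
                  (≤-trans (*-monoˡ-≤ M (*-monoˡ-≤ (X i) (multiple≤ j i (<⇒≤ j<)))) (item≤W i))
    in (assign-ends {r-w} {_} {s₂} {λ s′ → env s′ r-w ≡ itemValue j i} (≤-trans (≤-reflexive w≡) large) w≡ ,
        bd₂) andThen λ s₃ w₃ bd₃ fr₃ →
    let rdy₃ = ready-frame {r-w ⇐ var r-c ⊗ var r-x ⊗ var r-M ⊘ var r-t} refl refl rdy₂ fr₃
        c₃ = trans (sameVar fr₃ r-c refl) c₂
        clamp≡ : env s₃ r-w ∸ (env s₃ r-w ∸ env s₃ r-Q) ≡ clamped
        clamp≡ = cong₂ (λ a b → a ∸ (a ∸ b)) w₃ (const≡ rdy₃ r-Q refl)
    in (assign-ends {r-w} {_} {s₃} {λ s′ → env s′ r-w ≡ clamped}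
          (≤-trans (m∸n≤m (env s₃ r-w) (env s₃ r-w ∸ env s₃ r-Q)) (envB bd₃ r-w)) clamp≡ , bd₃) andThen λ s₄
              w₄ bd₄ fr₄ →
    let i₄ = trans (sameVar fr₄ r-i refl) (trans (sameVar fr₃ r-i refl) (trans (sameVar fr₂ r-i refl) i₁))
        c₄ = trans (sameVar fr₄ r-c refl) c₃
        owner₄ : ∀ w → arr s₄ a-owner w ≡ arr s a-owner w
        owner₄ w = trans (sameArr fr₄ a-owner refl w) (trans (sameArr fr₃ a-owner refl w)
            (trans (sameArr fr₂ a-owner refl w) (sameArr fr₁ a-owner refl w)))
        mult₄ : ∀ w → arr s₄ a-mult w ≡ arr s a-mult w
        mult₄ w = trans (sameArr fr₄ a-mult refl w) (trans (sameArr fr₃ a-mult refl w)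
            (trans (sameArr fr₂ a-mult refl w) (sameArr fr₁ a-mult refl w)))
    in (write-ends {s₄} a-owner (var r-w) (lit 1 ⊕ var r-i) (≤-trans (≤-reflexive (cong suc i₄))
        (≤-trans i<n (≤-trans n≤L L≤W))) , bd₄) andThen λ s₅ (new₅ , old₅) bd₅ fr₅ →
    weaken bd₅ (write-ends {s₅} a-mult (var r-w) (var r-c) (envB bd₅ r-c)) λ s₆ (new₆ , old₆) _ fr₆ →
    let w₅ = trans (sameVar fr₅ r-w refl) w₄
        owner-new : arr s₆ a-owner clamped ≡ suc i
        owner-new = trans (sameArr fr₆ a-owner refl clamped) (trans (cong (arr s₅ a-owner) (sym w₄))
            (trans new₅ (cong suc i₄)))
        owner-old : ∀ w → w ≢ clamped → arr s₆ a-owner w ≡ arr s a-owner w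
        owner-old w z = trans (sameArr fr₆ a-owner refl w) (trans (old₅ w (λ q → z (trans q w₄))) (owner₄ w))
        mult-new : arr s₆ a-mult clamped ≡ multiple j i
        mult-new = trans (cong (arr s₆ a-mult) (sym w₅)) (trans new₆ (trans (sameVar fr₅ r-c refl) c₄))
        mult-old : ∀ w → w ≢ clamped → arr s₆ a-mult w ≡ arr s a-mult w
        mult-old w z = trans (old₆ w (λ q → z (trans q w₅))) (trans (sameArr fr₅ a-mult refl w) (mult₄ w))
    in (λ w w<Q o → case w ≟ clamped of λ where
          (yes refl) → subst₂ (λ a b → Valid cmax (a ∸ 1) b clamped) (sym owner-new) (sym mult-new)
                         (subst (Valid cmax i (multiple j i)) (sym (unclamped w<Q))
                             (item-valid j i (<⇒≤ j<) i<n))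
          (no z) → subst₂ (λ a b → Valid cmax (a ∸ 1) b w) (sym (owner-old w z)) (sym (mult-old w z))
                     (table w w<Q (λ q → o (trans (owner-old w z) q)))) ,
       λ j′ i′ s′ i′<n v<Q → case itemValue j′ i′ ≟ clamped of λ where
          (yes q) → λ z → contradiction (trans (sym owner-new) (trans (cong (arr s₆ a-owner) (sym q)) z)) λ ()
          (no z) → subst (_≢ 0) (sym (owner-old (itemValue j′ i′) z)) (case s′ of λ where
            (inj₁ b) → seen j′ i′ b i′<n v<Q
            (inj₂ (refl , refl)) → contradiction (sym (m≤Q⇒clamped (<⇒≤ v<Q))) z)
    where
    clamped = itemValue j i ∸ (itemValue j i ∸ Q)
    m≤Q⇒clamped : itemValue j i ≤ Q → clamped ≡ itemValue j i
    m≤Q⇒clamped q = cong (itemValue j i ∸_) (m≤n⇒m∸n≡0 q)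
    unclamped : clamped < Q → clamped ≡ itemValue j i
    unclamped q with itemValue j i ≤? Q
    ... | yes p = m≤Q⇒clamped p
    ... | no p  = contradiction q (≤⇒≯ (≤-reflexive (sym (m∸[m∸n]≡n (<⇒≤ (≰⇒> p))))))

  items-ends : ∀ s → Ready s → Bounded s → (∀ i → io s i ≡ X i) → (∀ w → arr s a-owner w ≡ 0) →
    Ends items s (λ s′ → TableOf s′ × Complete (λ j _ → j < Λ) (arr s′ a-owner) × arr s′ a-owner 0 ≢ 0)
  items-ends s rdy bd x≡ empty =
    (for-ends {short} {r-j} {r-Λ} Outer bd (≤-trans (≤-reflexive Λ≡) (≤-trans (m≤m+n Λ (Λ + 0)) 2Λ≤S)) refl
        refl refl
      ((λ w _ o → contradiction (empty w) o) , (λ _ _ ()))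
      (λ j s₁ j< j≡ bd₁ fr₁ (table , seen) →
        let rdy₁ = ready-frame {for short r-j r-Λ (for long r-i r-n enter)} refl refl rdy fr₁
            n₁ = const≡ rdy₁ r-n refl
        in weaken bd₁ (for-ends {long} {r-i} {r-n} (Inner j) bd₁ (≤-trans (≤-reflexive n₁) n≤L) refl refl refl
          (table , λ { j′ i′ (inj₁ q) → seen j′ i′ q ; _ _ (inj₂ (_ , ())) })
          (λ i s₂ i< i≡ bd₂ fr₂ (table₂ , seen₂) → weaken bd₂
            (enter-ends j i s₂ (λ j′ i′ → j′ < j ⊎ (j′ ≡ j × i′ < i)) (subst (j <_) Λ≡ j<)
                (subst (i <_) n₁ i<)
              (trans (sameVar fr₂ r-j refl) j≡) i≡ (ready-frame {for long r-i r-n enter} refl refl rdy₁ fr₂)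
                  bd₂
              (trans (sameIO fr₂ refl i) (trans (sameIO fr₁ refl i) (x≡ i))) table₂ seen₂)
            λ s₃ (table₃ , seen₃) _ _ → table₃ , λ where
              j′ i′ (inj₁ q) → seen₃ j′ i′ (inj₁ (inj₁ q))
              j′ i′ (inj₂ (q , r)) → case i′ ≟ i of λ where
                (yes z) → seen₃ j′ i′ (inj₂ (q , z))
                (no z)  → seen₃ j′ i′ (inj₁ (inj₂ (q , ≤∧≢⇒< (≤-pred r) z)))))
        λ s₄ (table₄ , seen₄) _ _ → table₄ , λ j′ i′ j′< i′<n → case j′ ≟ j of λ where
          (yes z) → seen₄ j′ i′ (inj₂ (z , subst (i′ <_) (sym n₁) i′<n)) i′<n
          (no z)  → seen₄ j′ i′ (inj₁ (≤∧≢⇒< (≤-pred j′<) z)) i′<n) , bd) andThen λ s₅ (table₅ , seen₅) bd₅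
              fr₅ →
    (write-ends {s₅} a-owner (lit 0) (lit 1) 1≤W , bd₅) andThen λ s₆ (new₆ , old₆) bd₆ fr₆ →
    weaken bd₆ (write-ends {s₆} a-mult (lit 0) (lit 0) z≤n) λ s₇ (new₇ , old₇) bd₇ fr₇ →
    let owner0 : arr s₇ a-owner 0 ≡ 1
        owner0 = trans (sameArr fr₇ a-owner refl 0) new₆
        owner-old : ∀ w → w ≢ 0 → arr s₇ a-owner w ≡ arr s₅ a-owner w
        owner-old w z = trans (sameArr fr₇ a-owner refl w) (old₆ w z)
        0≢ : arr s₇ a-owner 0 ≢ 0
        0≢ z = contradiction (trans (sym owner0) z) λ ()
    in (λ w w<Q o → case w ≟ 0 of λ where
          (yes refl) → subst₂ (λ a b → Valid cmax (a ∸ 1) b 0) (sym owner0) (sym new₇)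
              (valid (inj₂ refl) z≤n z≤n z≤n z≤n)
          (no z) → subst₂ (λ a b → Valid cmax (a ∸ 1) b w) (sym (owner-old w z))
              (sym (trans (old₇ w z) (sameArr fr₆ a-mult refl w)))
                     (table₅ w w<Q (λ q → o (trans (owner-old w z) q)))) ,
       (λ j i j< i<n v<Q → case itemValue j i ≟ 0 of λ where
          (yes q) → subst (λ z → arr s₇ a-owner z ≢ 0) (sym q) 0≢
          (no z)  → subst (_≢ 0) (sym (owner-old (itemValue j i) z)) (seen₅ j i (subst (j <_) (sym Λ≡) j<)
              i<n v<Q)) ,
       0≢
    where
    Λ≡ = const≡ rdy r-Λ refl
    Outer : ℕ → St → Set
    Outer j s′ = TableOf s′ × Complete (λ j′ _ → j′ < j) (arr s′ a-owner)
    Inner : ℕ → ℕ → St → Set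
    Inner j i s′ = TableOf s′ × Complete (λ j′ i′ → j′ < j ⊎ (j′ ≡ j × i′ < i)) (arr s′ a-owner)

  clear-ends : ∀ s → Ready s → Bounded s → (∀ i → io s i ≡ X i) → (∀ i → n ≤ i → X i ≡ 0) →
      (∀ p → arr s a-rows p ≡ 0) →
    Ends clear s (λ s′ → (∀ i → io s′ i ≡ 0) × (∀ p → arr s′ a-rows p ≡ 1 ∸ p))
  clear-ends s rdy bd x≡ beyond empty =
    (for-ends {long} {r-i} {r-n} (λ i s′ → ∀ k → k < i ⊎ n ≤ k → io s′ k ≡ 0) bd
        (≤-trans (≤-reflexive n≡) n≤L) refl refl refl
      (λ { k (inj₂ q) → trans (x≡ k) (beyond k q) })
      (λ i s₁ i< i≡ bd₁ fr₁ inv → ends (emit {e = var r-i} {lit 0} (≤-trans (≤-reflexive i≡)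
          (≤-trans (<⇒≤ i<) (≤-reflexive n≡))) z≤n)
        λ k q → zeroed i s₁ i≡ k (λ k≢i → inv k (case q of λ where
          (inj₁ k<) → inj₁ (≤∧≢⇒< (≤-pred k<) k≢i)
          (inj₂ k≥) → inj₂ k≥))) , bd) andThen λ s₂ z₂ bd₂ fr₂ →
    weaken bd₂ (write-ends {s₂} a-rows (lit 0) (lit 1) 1≤W) λ s₃ (new , old) _ fr₃ →
      (λ i → trans (sameIO fr₃ refl i) (z₂ i (subst (λ z → i < z ⊎ n ≤ i) (sym n≡) (<-≤ i)))) ,
      λ { zero → new ; (suc p) → trans (old (suc p) (λ ())) (trans (sameArr fr₂ a-rows refl (suc p))
          (trans (empty (suc p)) (sym (0∸n≡0 p)))) }
    where
    n≡ = const≡ rdy r-n refl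
    <-≤ : ∀ i → i < n ⊎ n ≤ i
    <-≤ i with i <? n
    ... | yes p = inj₁ p
    ... | no p  = inj₂ (≮⇒≥ p)
    zeroed : ∀ i s₁ → env s₁ r-i ≡ i → ∀ k → (k ≢ i → io s₁ k ≡ 0) → (io s₁ [ env s₁ r-i ≔ 0 ]) k ≡ 0
    zeroed i s₁ refl k f with env s₁ r-i ≡ᵇ k in q
    ... | true  = refl
    ... | false = f (λ z → ≡ᵇ⇒≢ {env s₁ r-i} q (sym z))

  derived-ends : ∀ s → Bounded s → (∀ r → (r <ᵇ 9) ≡ true → env s r ≡ value r) →
    Ends derived s (λ s′ → ∀ r → (r <ᵇ 18) ≡ true → env s′ r ≡ value r)
  derived-ends s bd given =
    assign-then {r-picks} bd (≤-trans (≤-reflexive picks≡) (≤-trans picks≤L L≤W)) λ bd₁ →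
    assign-then {r-M} bd₁ (≤-trans (≤-reflexive M≡) (≤-trans M≤L L≤W)) λ bd₂ →
    assign-then {r-Q} bd₂ (≤-trans (≤-reflexive Q≡) (≤-trans Q≤L L≤W)) λ bd₃ →
    assign-then {r-m} bd₃ (≤-trans (≤-reflexive m≡) (≤-trans (<⇒≤ m<2Λ) (≤-trans 2Λ≤S S≤W))) λ bd₄ →
    assign-then {r-N} bd₄ (≤-trans (≤-reflexive N≡′) (≤-trans (m≤m+n N (3 * N)) (≤-trans N≤L L≤W))) λ bd₅ →
    assign-then {r-D} bd₅ (≤-trans (≤-reflexive D≡) (≤-trans D≤m (≤-trans (<⇒≤ m<2Λ) (≤-trans 2Λ≤S S≤W)))) λ
        bd₆ →
    assign-then {r-2N} bd₆ (≤-trans (≤-reflexive (cong (2 *_) N≡′)) (≤-trans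
        (*-monoˡ-≤ N {2} {4} (s≤s (s≤s z≤n))) (≤-trans N≤L L≤W))) λ bd₇ →
    assign-then {r-4N} bd₇ (≤-trans (≤-reflexive (cong (4 *_) N≡′)) (≤-trans N≤L L≤W)) λ bd₈ →
    assign-ends (≤-trans (≤-reflexive (cong (2 *_) Λ≡)) (≤-trans 2Λ≤S S≤W)) values≡
    where
    Λ≡ = given r-Λ refl
    P≡ = given r-P refl
    e≡ = given r-e refl
    lam≡ = given r-lam refl
    M≤L : M ≤ L
    M≤L = ≤-trans (m≤m+n M (3 * M)) (≤-trans (m≤m+n N (3 * N)) N≤L)
    x = env s
    picks≡ : 2 * x 8 * x 8 ≡ picks
    picks≡ = cong (λ z → 2 * z * z) Λ≡
    M≡ : 4 * (2 * x 8 * x 8) * x 6 ≡ M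
    M≡ = cong₂ (λ a b → 4 * a * b) picks≡ P≡
    Q≡ : 4 * (2 * x 8 * x 8) * x 6 + 2 * x 8 * x 8 + 1 ≡ Q
    Q≡ = cong₂ (λ a b → a + b + 1) M≡ picks≡
    m≡ : x 5 + 2 * x 7 + 5 ≡ m
    m≡ = cong₂ (λ a b → a + 2 * b + 5) e≡ lam≡
    N≡′ : 4 * (4 * (2 * x 8 * x 8) * x 6) ≡ N
    N≡′ = cong (4 *_) M≡
    D≡ : 1 + x 7 ≡ D
    D≡ = cong suc lam≡
    last : St
    last = setVar (setVar (setVar (setVar (setVar (setVar
        (setVar (setVar (setVar s 9 (2 * x 8 * x 8)) 10 (4 * (2 * x 8 * x 8) * x 6))
      11 (4 * (2 * x 8 * x 8) * x 6 + 2 * x 8 * x 8 + 1)) 12 (x 5 + 2 * x 7 + 5)) 13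
          (4 * (4 * (2 * x 8 * x 8) * x 6))) 14 (1 + x 7))
      15 (2 * (4 * (4 * (2 * x 8 * x 8) * x 6)))) 16 (4 * (4 * (4 * (2 * x 8 * x 8) * x 6)))) 17 (2 * x 8)
    values≡ : ∀ r → (r <ᵇ 18) ≡ true → env last r ≡ value r
    values≡ 0 _ = given 0 refl
    values≡ 1 _ = given 1 refl
    values≡ 2 _ = given 2 refl
    values≡ 3 _ = given 3 refl
    values≡ 4 _ = given 4 refl
    values≡ 5 _ = given 5 refl
    values≡ 6 _ = given 6 refl
    values≡ 7 _ = given 7 refl
    values≡ 8 _ = given 8 refl
    values≡ 9 _ = picks≡
    values≡ 10 _ = M≡
    values≡ 11 _ = Q≡
    values≡ 12 _ = m≡
    values≡ 13 _ = N≡′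
    values≡ 14 _ = D≡
    values≡ 15 _ = cong (2 *_) N≡′
    values≡ 16 _ = cong (4 *_) N≡′
    values≡ 17 _ = cong (2 *_) Λ≡
    values≡ (suc (suc (suc (suc (suc (suc (suc (suc
        (suc (suc (suc (suc (suc (suc (suc (suc (suc (suc r)))))))))))))))))) ()

  powers-ends : ∀ s → Bounded s → (∀ r → (r <ᵇ 18) ≡ true → env s r ≡ value r) → Ends powers s Ready
  powers-ends s bd given =
    (write-ends {s} a-pow (lit 0) (lit 1) 1≤W , bd) andThen λ s₁ (new , _) bd₁ fr₁ →
    let 2Λ≡ : env s₁ r-2Λ ≡ 2 * Λ
        2Λ≡ = trans (sameVar fr₁ r-2Λ refl) (given r-2Λ refl)
    in weaken bd₁ (for-ends {short} {r-i} {r-2Λ} (λ i s′ → ∀ k → k ≤ i → arr s′ a-pow k ≡ 2 ^ k) bd₁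
        (≤-trans (≤-reflexive 2Λ≡) 2Λ≤S) refl refl refl
      (λ { zero _ → new })
      (λ i s₂ i< i≡ bd₂ fr₂ inv →
        let v≡ : 2 * arr s₂ a-pow (env s₂ r-i) ≡ 2 ^ suc i
            v≡ = cong (2 *_) (trans (cong (arr s₂ a-pow) i≡) (inv i ≤-refl))
        in weaken bd₂ (write-ends {s₂} a-pow (lit 1 ⊕ var r-i) (lit 2 ⊗ at a-pow (var r-i))
             (≤-trans (≤-reflexive v≡) (≤-trans (^-monoʳ-≤ 2 (subst (i <_) 2Λ≡ i<)) powers≤W)))
           λ s₃ (new₃ , old₃) _ _ k k≤ → case k ≟ suc i of λ where
             (yes refl) → trans (cong (arr s₃ a-pow) (cong suc (sym i≡))) (trans new₃ v≡)
             (no k≢) → trans (old₃ k (λ q → k≢ (trans q (cong suc i≡)))) (inv k (≤-pred (≤∧≢⇒< k≤ k≢)))))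
    λ s₄ inv _ fr₄ → ready (λ r z → trans (sameVar fr₄ r (small r z)) (trans (sameVar fr₁ r refl)
        (given r z)))
      (λ i i≤ → inv i (≤-trans i≤ (≤-reflexive (sym 2Λ≡))))
    where
    small : ∀ r → (r <ᵇ 18) ≡ true → modVar (for short r-i r-2Λ (a-pow ⟨ lit 1 ⊕ var r-i ⟩⇐ lit 2 ⊗ at a-pow
        (var r-i))) r ≡ false
    small r z = allFalse⇒ (modVar (for short r-i r-2Λ (a-pow ⟨ lit 1 ⊕ var r-i ⟩⇐ lit 2 ⊗ at a-pow
        (var r-i)))) 18 refl (<ᵇ-true {r} z)

  main : Cmd
  main = derived ⨾ powers ⨾ items ⨾ clear ⨾ sums ⨾ findBest ⨾ traceBack

  record Solution (s : St) : Set where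
    constructor solution
    field
      own   : ℕ → ℕ
      best  : ℕ
      zero∈ : own 0 ≢ 0
      items∈ : Complete (λ j _ → j < Λ) own
      best∈ : Rows.row Q 1≤Q own picks best ≢ 0
      best-max : ∀ p → Rows.row Q 1≤Q own picks p ≢ 0 → p ≤ best
      total-≥ : best * t ≤ total s * M
      total-≤ : total s * M ≤ (best + picks) * t

  main-ends : ∀ s → Bounded s → (∀ r → (r <ᵇ 9) ≡ true → env s r ≡ value r) →
    (∀ i → io s i ≡ X i) → (∀ i → n ≤ i → X i ≡ 0) → (∀ k i → arr s k i ≡ 0) → Ends main s Solution
  main-ends s bd given x≡ beyond empty =
    (derived-ends s bd given , bd) andThen λ s₁ given₁ bd₁ fr₁ →
    (powers-ends s₁ bd₁ given₁ , bd₁) andThen λ s₂ rdy₂ bd₂ fr₂ →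
    let x₂ : ∀ i → io s₂ i ≡ X i
        x₂ i = trans (sameIO fr₂ refl i) (trans (sameIO fr₁ refl i) (x≡ i))
    in (items-ends s₂ rdy₂ bd₂ x₂
          (λ w → trans (sameArr fr₂ a-owner refl w) (trans (sameArr fr₁ a-owner refl w) (empty a-owner w))) ,
              bd₂) andThen
    λ s₃ (table , complete , zero-in) bd₃ fr₃ →
    let rdy₃ = ready-frame {items} refl refl rdy₂ fr₃ in
    (clear-ends s₃ rdy₃ bd₃ (λ i → trans (sameIO fr₃ refl i) (x₂ i)) beyond
       (λ p → trans (sameArr fr₃ a-rows refl p) (trans (sameArr fr₂ a-rows refl p)
           (trans (sameArr fr₁ a-rows refl p) (empty a-rows p)))) , bd₃) andThen
    λ s₄ (io₄ , row₄) bd₄ fr₄ →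
    let rdy₄ = ready-frame {clear} refl refl rdy₃ fr₄
        own  = arr s₃ a-owner
        mult = arr s₃ a-mult
        module T₀ = Trace own mult table 0
    in (T₀.sums-ends s₄ rdy₄ bd₄ (λ p _ → sameArr fr₄ a-owner refl p) (λ p _ → row₄ p) , bd₄) andThen λ s₅
        rows₅ bd₅ fr₅ →
    let rdy₅ = ready-frame {sums} refl refl rdy₄ fr₅ in
    (T₀.findBest-ends s₅ rdy₅ bd₅ rows₅ (row-zero own zero-in picks) , bd₅) andThen λ s₆ (best∈ , best-max)
        bd₆ fr₆ →
    let rdy₆ = ready-frame {findBest} refl refl rdy₅ fr₆
        best = env s₆ r-cur
        module T = Trace own mult table best
        io₆ : ∀ i → io s₆ i ≡ 0
        io₆ i = trans (sameIO fr₆ refl i) (trans (sameIO fr₅ refl i) (io₄ i))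
        total≡0 : total s₆ ≡ 0
        total≡0 = ∑-zero n λ i _ → trans (cong (X i *_) (io₆ i)) (*-zeroʳ (X i))
    in weaken bd₆ (T.traceBack-ends s₆ rdy₆ bd₆
         ((λ p _ → trans (sameArr fr₆ a-owner refl p) (trans (sameArr fr₅ a-owner refl p)
             (sameArr fr₄ a-owner refl p))) ,
          (λ p _ → trans (sameArr fr₆ a-mult refl p) (trans (sameArr fr₅ a-mult refl p)
              (sameArr fr₄ a-mult refl p))) ,
          λ i p i≤ p<Q → trans (sameArr fr₆ a-rows refl _) (rows₅ i p i≤ p<Q))
         (best∈ , (0 , refl , z≤n , ≤-reflexive (cong (_* M) total≡0)) , λ i → ≤-reflexive (io₆ i)))
       λ s₇ (low , high) _ _ → solution own best zero-in complete best∈ best-max low high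
    where
    row-zero : ∀ own → own 0 ≢ 0 → ∀ k → Rows.row Q 1≤Q own k 0 ≢ 0
    row-zero own z zero    = λ ()
    row-zero own z (suc k) = Rows.row-step Q 1≤Q own k 0 0 (row-zero own z k) z 1≤Q

-- e = ⌈log₂ E⌉ and λ are found by doubling.
record Logarithms (E e lam : ℕ) : Set where
  constructor logarithms
  field
    2^e≤2E : 2 ^ e ≤ 2 * E
    e+8≤Λ  : e + 8 ≤ 2 ^ lam
    Λ≤     : 2 ^ lam ≤ 2 * (e + 8)
    3≤lam  : 3 ≤ lam

-- Finding the parameters by doubling

m<2^m : ∀ m → m < 2 ^ m
m<2^m zero    = z<s
m<2^m (suc m) = ≤-trans (s<s (m<2^m m)) (+-mono-≤ (m^n>0 2 m) (m≤m+n (2 ^ m) 0))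

-- The alternative `e ≡ i` says that every round so far has doubled. If it still held after E
-- rounds, then e = E, and E < 2^E shows that the target has been reached after all.
double-logarithms : ∀ {E i e lam} → Logarithms E e lam → E ≤ 2 ^ e ⊎ e ≡ i →
  let f = sgn (E ∸ 2 ^ e); f′ = sgn (f + e + 8 ∸ 2 ^ lam) in
  ∃₂ λ e′ lam′ → f + e ≡ e′ × 2 ^ e + f * 2 ^ e ≡ 2 ^ e′ × f′ + lam ≡ lam′ × 2 ^ lam + f′ * 2 ^ lam ≡ 2 ^
      lam′ ×
    Logarithms E e′ lam′ × (E ≤ 2 ^ e′ ⊎ e′ ≡ suc i)
double-logarithms {E} {i} {e} {lam} (logarithms a b c d) reached with E ≤? 2 ^ e
... | yes E≤ rewrite m≤n⇒m∸n≡0 E≤ | m≤n⇒m∸n≡0 b =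
  e , lam , refl , +-identityʳ (2 ^ e) , refl , +-identityʳ (2 ^ lam) , logarithms a b c d , inj₁ E≤
... | no E≰ rewrite sgn-pos (m<n⇒0<n∸m (≰⇒> E≰)) with suc e + 8 ≤? 2 ^ lam
...   | yes b′ rewrite m≤n⇒m∸n≡0 b′ =
  suc e , lam , refl , refl , refl , +-identityʳ (2 ^ lam) ,
  logarithms (*-monoʳ-≤ 2 (<⇒≤ (≰⇒> E≰))) b′ (≤-trans c (*-monoʳ-≤ 2 (n≤1+n (e + 8)))) d ,
  inj₂ (cong suc (reached-i reached))
  where
  reached-i : E ≤ 2 ^ e ⊎ e ≡ i → e ≡ i
  reached-i (inj₁ q) = contradiction q E≰
  reached-i (inj₂ q) = q
...   | no b≰ rewrite sgn-pos (m<n⇒0<n∸m (≰⇒> b≰)) =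
  suc e , suc lam , refl , refl , refl , refl ,
  logarithms (*-monoʳ-≤ 2 (<⇒≤ (≰⇒> E≰)))
    (≤-trans (s≤s b) (+-mono-≤ (m^n>0 2 lam) (m≤m+n (2 ^ lam) 0)))
    (*-monoʳ-≤ 2 (<⇒≤ (≰⇒> b≰))) (m≤n⇒m≤1+n d) ,
  inj₂ (cong suc (reached-i reached))
  where
  reached-i : E ≤ 2 ^ e ⊎ e ≡ i → e ≡ i
  reached-i (inj₁ q) = contradiction q E≰
  reached-i (inj₂ q) = q

module ParameterPhase (W n L S t num den E : ℕ) (E≡ : 4 * (quo den num + 1) ≡ E) where
  open Hoare W n (limits S L)
  open Names

  module _ (E≤L : E ≤ L) (E≤W : 8 * E + 32 ≤ W) where

    e-bound : ∀ {e lam} → Logarithms E e lam → e ≤ 2 * E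
    e-bound {e} (logarithms a _ _ _) = ≤-trans (<⇒≤ (m<2^m e)) a

    Λ-bound : ∀ {e lam} → Logarithms E e lam → 2 ^ lam ≤ W
    Λ-bound {e} l@(logarithms _ _ c _) = ≤-trans c (≤-trans (*-monoʳ-≤ 2 (+-monoˡ-≤ 8 (e-bound l)))
      (≤-trans (≤-reflexive (lemma E)) (≤-trans (+-mono-≤ (*-monoˡ-≤ E {4} {8} (m≤m+n 4 4)) (m≤m+n 16 16))
          E≤W)))
      where lemma : ∀ E → 2 * (2 * E + 8) ≡ 4 * E + 16
            lemma = solve-∀

    2E≤W : 2 * E ≤ W
    2E≤W = ≤-trans (*-monoˡ-≤ E {2} {8} (m≤m+n 2 6)) (≤-trans (m≤m+n (8 * E) 32) E≤W)

    1≤W : 1 ≤ W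
    1≤W = ≤-trans (≤-trans (m≤m+n 1 31) (m≤n+m 32 (8 * E))) E≤W

    Found : ℕ → ℕ → St → Set
    Found e lam s = env s r-e ≡ e × env s r-P ≡ 2 ^ e × env s r-lam ≡ lam × env s r-Λ ≡ 2 ^ lam

    Inv : ℕ → St → Set
    Inv i s = ∃₂ λ e lam → Found e lam s × Logarithms E e lam × (E ≤ 2 ^ e ⊎ e ≡ i)

    double-ends : ∀ i s → Bounded s → env s r-E ≡ E → Inv i s → Ends double s
        (λ s′ → Inv (suc i) (setVar s′ r-i (suc i)))
    double-ends i s bd E≡ (e , lam , (e≡ , P≡ , lam≡ , Λ≡) , logs , reached)
      with double-logarithms logs reached
    ... | e′ , lam′ , q₁ , q₂ , q₃ , q₄ , logs′ , reached′ =
      assign-then {r-flag} bd (≤-trans (sgn≤1 (env s r-E ∸ env s r-P)) 1≤W) λ bd₁ →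
      assign-then {r-e} bd₁ (≤-trans (≤-reflexive e₁) (≤-trans (e-bound logs′) 2E≤W)) λ bd₂ →
      assign-then {r-P} bd₂ (≤-trans (≤-reflexive P₁) (≤-trans (Logarithms.2^e≤2E logs′) 2E≤W)) λ bd₃ →
      assign-then {r-flag} bd₃ (≤-trans (sgn≤1 (f + env s r-e + 8 ∸ env s r-Λ)) 1≤W) λ bd₄ →
      assign-then {r-lam} bd₄ (≤-trans (≤-reflexive lam₁) (≤-trans (<⇒≤ (m<2^m lam′)) (Λ-bound logs′))) λ bd₅
          →
      assign-ends (≤-trans (≤-reflexive Λ₁) (Λ-bound logs′))
        (e′ , lam′ , (e₁ , P₁ , lam₁ , Λ₁) , logs′ , reached′)
      where
      f = sgn (env s r-E ∸ env s r-P)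
      f≡ : f ≡ sgn (E ∸ 2 ^ e)
      f≡ = cong₂ (λ a b → sgn (a ∸ b)) E≡ P≡
      e₁ : f + env s r-e ≡ e′
      e₁ = trans (cong₂ _+_ f≡ e≡) q₁
      P₁ : env s r-P + f * env s r-P ≡ 2 ^ e′
      P₁ = trans (cong₂ (λ a b → b + a * b) f≡ P≡) q₂
      f′ = sgn (f + env s r-e + 8 ∸ env s r-Λ)
      f′≡ : f′ ≡ sgn (sgn (E ∸ 2 ^ e) + e + 8 ∸ 2 ^ lam)
      f′≡ = cong₂ (λ a b → sgn (a + 8 ∸ b)) (cong₂ _+_ f≡ e≡) Λ≡
      lam₁ : f′ + env s r-lam ≡ lam′
      lam₁ = trans (cong₂ _+_ f′≡ lam≡) q₃
      Λ₁ : env s r-Λ + f′ * env s r-Λ ≡ 2 ^ lam′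
      Λ₁ = trans (cong₂ (λ a b → b + a * b) f′≡ Λ≡) q₄

    parameters-ends : ∀ s → Bounded s → env s r-n ≡ n → env s r-t ≡ t → env s r-num ≡ num → env s r-den ≡ den
        →
      Ends parameters s (λ s′ → ∃₂ λ e lam → Logarithms E e lam × E ≤ 2 ^ e ×
        (∀ r → (r <ᵇ 9) ≡ true → env s′ r ≡ Parameters.value n t num den E e lam r))
    parameters-ends s bd n≡ t≡ num≡ den≡ =
      assign-then {r-E} bd (≤-trans (≤-reflexive E′≡) (≤-trans (m≤m+n E (E + 0)) 2E≤W)) λ bd₁ →
      assign-then {r-e} bd₁ z≤n λ bd₂ →
      assign-then {r-P} bd₂ 1≤W λ bd₃ →
      assign-then {r-lam} bd₃ (≤-trans (≤-trans (m≤m+n 3 29) (m≤n+m 32 (8 * E))) E≤W) λ bd₄ →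
      assign-then {r-Λ} bd₄ (≤-trans (≤-trans (m≤m+n 8 24) (m≤n+m 32 (8 * E))) E≤W) λ bd₅ →
      weaken bd₅ (for-ends {long} {r-i} {r-E} Inv bd₅ (≤-trans (≤-reflexive E′≡) E≤L) refl refl refl
        (0 , 3 , (refl , refl , refl , refl) , logarithms (≤-trans 1≤E (m≤m+n E (E + 0))) ≤-refl (m≤m+n 8 8)
            ≤-refl , inj₂ refl)
        λ i s₁ i< i≡ bd₁ fr₁ inv → double-ends i s₁ bd₁ (trans (sameVar fr₁ r-E refl) E′≡) inv)
      λ s₂ (e , lam , (e≡ , P≡ , lam≡ , Λ≡) , logs , reached) _ fr₂ → e , lam , logs , enough e reached , λ
          where
        0 _ → trans (sameVar fr₂ 0 refl) n≡
        1 _ → trans (sameVar fr₂ 1 refl) t≡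
        2 _ → trans (sameVar fr₂ 2 refl) num≡
        3 _ → trans (sameVar fr₂ 3 refl) den≡
        4 _ → trans (sameVar fr₂ 4 refl) E′≡
        5 _ → e≡
        6 _ → P≡
        7 _ → lam≡
        8 _ → Λ≡
        (suc (suc (suc (suc (suc (suc (suc (suc (suc r))))))))) ()
      where
      E′≡ : 4 * (quo (env s r-den) (env s r-num) + 1) ≡ E
      E′≡ = trans (cong₂ (λ a b → 4 * (quo a b + 1)) den≡ num≡) E≡
      1≤E : 1 ≤ E
      1≤E = ≤-trans (*-mono-≤ {1} {4} (s≤s z≤n) (m≤n+m 1 (quo den num))) (≤-reflexive E≡)
      enough : ∀ e → E ≤ 2 ^ e ⊎ e ≡ 4 * (quo (env s r-den) (env s r-num) + 1) → E ≤ 2 ^ e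
      enough e (inj₁ q) = q
      enough e (inj₂ q) = subst (λ z → E ≤ 2 ^ z) (sym (trans q E′≡)) (<⇒≤ (m<2^m E))

    module _ (X : ℕ → ℕ) (0<t : 0 < t)
      (fits : ∀ {e lam} → Logarithms E e lam → Parameters.Fits n t num den E e lam W L S)
      (item≤W : ∀ {e lam} → Logarithms E e lam → ∀ i → 2 ^ 2 ^ lam * (t + 1) * X i * Parameters.M n t num den
          E e lam ≤ W)
      (total≤W : ∀ {e lam} → Logarithms E e lam → Parameters.picks n t num den E e lam *
          (2 ^ 2 ^ lam * (t + 1)) ≤ W) where

      record Outcome (s : St) : Set where
        constructor outcome
        field
          e lam : ℕ
          logs  : Logarithms E e lam
          E≤2^e : E ≤ 2 ^ e
          found : MainVerification.Solution n t num den E e lam W L S (fits logs) X 0<t (item≤W logs)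
              (total≤W logs) s

      program-ends : ∀ s → Bounded s → env s r-n ≡ n → env s r-t ≡ t → env s r-num ≡ num → env s r-den ≡ den →
        (∀ i → io s i ≡ X i) → (∀ i → n ≤ i → X i ≡ 0) → (∀ k i → arr s k i ≡ 0) → Ends program s Outcome
      program-ends s bd n≡ t≡ num≡ den≡ x≡ beyond empty =
        (parameters-ends s bd n≡ t≡ num≡ den≡ , bd) andThen λ s₁ (e , lam , logs , E≤ , given) bd₁ fr₁ →
        weaken bd₁ (MainVerification.main-ends n t num den E e lam W L S (fits logs) X 0<t (item≤W logs)
            (total≤W logs) s₁ bd₁ given
          (λ i → trans (sameIO fr₁ refl i) (x≡ i)) beyond (λ k i → trans (sameArr fr₁ k refl i) (empty k i)))
        λ s₂ sol _ _ → outcome e lam logs E≤ sol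

-- Small support (Eisenbrand and Shmonin): if there are more subsets of the
-- support than values of subset sums, then two subsets have the same sum and
-- copies of the one can be exchanged for copies of the other until an item
-- disappears.

listSum : ∀ {A : Set} → (A → ℕ) → List A → ℕ
listSum f []       = 0
listSum f (a ∷ as) = f a + listSum f as

listSum-++ : ∀ {A : Set} (f : A → ℕ) as bs → listSum f (as ++ bs) ≡ listSum f as + listSum f bs
listSum-++ f []       bs = refl
listSum-++ f (a ∷ as) bs = trans (cong (f a +_) (listSum-++ f as bs)) (sym (+-assoc (f a) _ _))

record Entry : Set where
  constructor _×′_
  field
    count item : ℕ
open Entry

module Support (w : ℕ → ℕ) (w>0 : ℕ → Set) (positive-weight : ∀ i → w>0 i → 0 < w i) where

  Good : Entry → Set
  Good a = 0 < count a × w>0 (item a)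

  value weightOf : Entry → ℕ
  value a    = count a * w (item a)
  weightOf a = w (item a)

  -- A subset is coded by the binary digits of `c`, the lowest one belonging to the head of the
  -- list. The sum takes one copy of each member, whatever its count.
  subsetSum : List Entry → ℕ → ℕ
  subsetSum []       c = 0
  subsetSum (a ∷ as) c = rem c 2 * weightOf a + subsetSum as (quo c 2)

  rem2≤1 : ∀ c → rem c 2 ≤ 1
  rem2≤1 c = ≤-pred (rem-< c {2} z<s)

  subsetSum-≤ : ∀ as c → All Good as → subsetSum as c ≤ listSum value as
  subsetSum-≤ []       c []             = z≤n
  subsetSum-≤ (a ∷ as) c ((p , _) ∷ gs) =
    +-mono-≤ (*-monoˡ-≤ (weightOf a) (≤-trans (rem2≤1 c) p)) (subsetSum-≤ as (quo c 2) gs)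

  -- The contributions to the sums of the items in the first but not in the
  -- second subset, and conversely.
  only : List Entry → ℕ → ℕ → ℕ
  only []       c d = 0
  only (a ∷ as) c d = (rem c 2 ∸ rem d 2) * weightOf a + only as (quo c 2) (quo d 2)

  only-balance : ∀ as c d → only as c d + subsetSum as d ≡ only as d c + subsetSum as c
  only-balance []       c d = refl
  only-balance (a ∷ as) c d = begin
    (x ∸ y) * v + only as c′ d′ + (y * v + subsetSum as d′)     ≡⟨ regroup (x ∸ y) y v _ _ ⟩
    (x ∸ y + y) * v + (only as c′ d′ + subsetSum as d′)         ≡⟨ cong₂ (λ p q → p * v + q) (swap x y)
        (only-balance as c′ d′) ⟩
    (y ∸ x + x) * v + (only as d′ c′ + subsetSum as c′)         ≡⟨ regroup (y ∸ x) x v _ _ ⟨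
    (y ∸ x) * v + only as d′ c′ + (x * v + subsetSum as c′)     ∎
    where
    open ≡-Reasoning
    x = rem c 2
    y = rem d 2
    c′ = quo c 2
    d′ = quo d 2
    v = weightOf a
    regroup : ∀ a y v p q → a * v + p + (y * v + q) ≡ (a + y) * v + (p + q)
    regroup = solve-∀
    swap : ∀ x y → x ∸ y + y ≡ y ∸ x + x
    swap x y with ≤-total x y
    ... | inj₁ p = trans (cong (_+ y) (m≤n⇒m∸n≡0 p)) (sym (m∸n+n≡m p))
    ... | inj₂ p = trans (m∸n+n≡m p) (sym (cong (_+ x) (m≤n⇒m∸n≡0 p)))

  -- With positive weights, vanishing differences in both directions force equal digits, and codes
  -- below 2 ^ length have no further digits.
  only-zero : ∀ as c d → All Good as → only as c d ≡ 0 → only as d c ≡ 0 → c < 2 ^ length as → d < 2 ^ length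
      as → c ≡ d
  only-zero [] c d _ _ _ c< d< = trans (n<1⇒n≡0 c<) (sym (n<1⇒n≡0 d<))
  only-zero (a ∷ as) c d ((_ , g) ∷ gs) p q c< d< = begin
    c                          ≡⟨ quo-rem c 2 ⟩
    quo c 2 * 2 + rem c 2      ≡⟨ cong₂ (λ x y → x * 2 + y) (only-zero as (quo c 2) (quo d 2) gs
                                    (m+n≡0⇒n≡0 ((rem c 2 ∸ rem d 2) * weightOf a) p)
                                        (m+n≡0⇒n≡0 ((rem d 2 ∸ rem c 2) * weightOf a) q)
                                    (smaller c c<) (smaller d d<))
                                    (≤-antisym (m∸n≡0⇒m≤n (cancel (rem c 2 ∸ rem d 2) p))
                                        (m∸n≡0⇒m≤n (cancel (rem d 2 ∸ rem c 2) q))) ⟩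
    quo d 2 * 2 + rem d 2      ≡⟨ quo-rem d 2 ⟨
    d                          ∎
    where
    open ≡-Reasoning
    smaller : ∀ c → c < 2 * 2 ^ length as → quo c 2 < 2 ^ length as
    smaller c c< = quo-<ᵐ c (2 ^ length as) (subst (c <_) (*-comm 2 (2 ^ length as)) c<)
    cancel : ∀ z {r} → z * weightOf a + r ≡ 0 → z ≡ 0
    cancel zero    _ = refl
    cancel (suc z) e = contradiction (m+n≡0⇒m≡0 (weightOf a) (m+n≡0⇒m≡0 (suc z * weightOf a) e))
        (n>0⇒n≢0 (positive-weight (item a) g))

  -- Moving μ copies from the first subset to the second.
  exchanged : ℕ → ℕ → ℕ → ℕ → ℕ
  exchanged μ c d k = k + μ * (rem d 2 ∸ rem c 2) ∸ μ * (rem c 2 ∸ rem d 2)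

  keep : ℕ → ℕ → List Entry → List Entry
  keep zero    i as = as
  keep (suc k) i as = (suc k ×′ i) ∷ as

  exchange : ℕ → List Entry → ℕ → ℕ → List Entry
  exchange μ []       c d = []
  exchange μ (a ∷ as) c d = keep (exchanged μ c d (count a)) (item a) (exchange μ as (quo c 2) (quo d 2))

  -- This makes the truncated subtraction in `exchanged` exact.
  Removable : ℕ → List Entry → ℕ → ℕ → Set
  Removable μ []       c d = ⊤
  Removable μ (a ∷ as) c d = μ * (rem c 2 ∸ rem d 2) ≤ count a × Removable μ as (quo c 2) (quo d 2)

  keep-value : ∀ k i as → listSum value (keep k i as) ≡ k * w i + listSum value as
  keep-value zero    i as = refl
  keep-value (suc k) i as = refl

  exchange-value : ∀ μ as c d → Removable μ as c d →
    listSum value (exchange μ as c d) + μ * only as c d ≡ listSum value as + μ * only as d c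
  exchange-value μ []       c d _ = refl
  exchange-value μ (a ∷ as) c d (p , ps) = begin
    listSum value (keep k (item a) bs) + μ * (z * v + only as c′ d′)
      ≡⟨ cong (_+ μ * (z * v + only as c′ d′)) (keep-value k (item a) bs) ⟩
    k * v + listSum value bs + μ * (z * v + only as c′ d′)
      ≡⟨ lemma₁ k v (listSum value bs) μ z (only as c′ d′) ⟩
    (k + μ * z) * v + (listSum value bs + μ * only as c′ d′)
      ≡⟨ cong₂ (λ p q → p * v + q) (m∸n+n≡m (≤-trans p (m≤m+n (count a) (μ * z′))))
          (exchange-value μ as c′ d′ ps) ⟩
    (count a + μ * z′) * v + (listSum value as + μ * only as d′ c′)
      ≡⟨ lemma₂ (count a) v (listSum value as) μ z′ (only as d′ c′) ⟩
    count a * v + listSum value as + μ * (z′ * v + only as d′ c′) ∎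
    where
    open ≡-Reasoning
    c′ = quo c 2
    d′ = quo d 2
    z = rem c 2 ∸ rem d 2
    z′ = rem d 2 ∸ rem c 2
    v = weightOf a
    k = exchanged μ c d (count a)
    bs = exchange μ as c′ d′
    lemma₁ : ∀ k v s μ z o → k * v + s + μ * (z * v + o) ≡ (k + μ * z) * v + (s + μ * o)
    lemma₁ = solve-∀
    lemma₂ : ∀ k v s μ z o → (k + μ * z) * v + (s + μ * o) ≡ k * v + s + μ * (z * v + o)
    lemma₂ = solve-∀

  keep-good : ∀ k i as → w>0 i → All Good as → All Good (keep k i as)
  keep-good zero    i as g gs = gs
  keep-good (suc k) i as g gs = (z<s , g) ∷ gs

  exchange-good : ∀ μ as c d → All Good as → All Good (exchange μ as c d)
  exchange-good μ []       c d []             = []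
  exchange-good μ (a ∷ as) c d ((_ , g) ∷ gs) = keep-good (exchanged μ c d (count a)) (item a) _ g
      (exchange-good μ as _ _ gs)

  keep-length : ∀ k i as → length (keep k i as) ≤ suc (length as)
  keep-length zero    i as = n≤1+n (length as)
  keep-length (suc k) i as = ≤-refl

  exchange-length : ∀ μ as c d → length (exchange μ as c d) ≤ length as
  exchange-length μ []       c d = z≤n
  exchange-length μ (a ∷ as) c d = ≤-trans (keep-length (exchanged μ c d (count a)) (item a) _)
      (s≤s (exchange-length μ as _ _))

  Exhausted : ℕ → List Entry → ℕ → ℕ → Set
  Exhausted μ []       c d = ⊥
  Exhausted μ (a ∷ as) c d = (rem c 2 ∸ rem d 2 ≡ 1 × count a ≡ μ) ⊎ Exhausted μ as (quo c 2) (quo d 2)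

  exchange-shorter : ∀ μ as c d → Exhausted μ as c d → length (exchange μ as c d) < length as
  exchange-shorter μ (a ∷ as) c d (inj₁ (z , refl)) = s≤s
      (subst (λ k → length (keep k (item a) bs) ≤ length as) (sym vanish)
      (exchange-length μ as (quo c 2) (quo d 2)))
    where
    bs = exchange μ as (quo c 2) (quo d 2)
    other : ∀ x y → y ≤ 1 → x ∸ y ≡ 1 → x ≤ 1 → y ∸ x ≡ 0
    other x zero    _ _ _ = 0∸n≡0 x
    other x (suc y) _ p x≤1 = contradiction (trans (sym p) (m≤n⇒m∸n≡0 (≤-trans x≤1 (s≤s z≤n)))) λ ()
    vanish : exchanged (count a) c d (count a) ≡ 0
    vanish = trans (cong₂ (λ p q → count a + count a * p ∸ count a * q) (other (rem c 2) (rem d 2) (rem2≤1 d)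
        z (rem2≤1 c)) z)
      (trans (cong₂ _∸_ (trans (cong (count a +_) (*-zeroʳ (count a))) (+-identityʳ (count a)))
          (*-identityʳ (count a))) (n∸n≡0 (count a)))
  exchange-shorter μ (a ∷ as) c d (inj₂ q) =
    ≤-<-trans (keep-length (exchanged μ c d (count a)) (item a) _) (s<s (exchange-shorter μ as _ _ q))

  -- `μ` is the smallest count among the members of the first subset that are missing from the
  -- second. It is the largest amount that can be exchanged, and exchanging it uses up an item. If
  -- there is no such member, the difference is zero, which `collision` rules out.
  least : ∀ as c d → only as c d ≡ 0 × (∀ μ → Removable μ as c d) ⊎
                     ∃ λ μ → Exhausted μ as c d × (∀ ν → ν ≤ μ → Removable ν as c d)
  least []       c d = inj₁ (refl , λ _ → tt)
  least (a ∷ as) c d with rem c 2 ∸ rem d 2 in eq | ≤-trans (m∸n≤m (rem c 2) (rem d 2)) (rem2≤1 c) | least as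
      (quo c 2) (quo d 2)
  ... | zero | _ | inj₁ (p , all) = inj₁ (p , λ μ → ≤-trans (≤-reflexive (*-zeroʳ μ)) z≤n , all μ)
  ... | zero | _ | inj₂ (μ , x , all) =
    inj₂ (μ , inj₂ x , λ ν ν≤ → ≤-trans (≤-reflexive (*-zeroʳ ν)) z≤n , all ν ν≤)
  ... | suc zero | _ | inj₁ (p , all) =
    inj₂ (count a , inj₁ (refl , refl) ,
          λ ν ν≤ → ≤-trans (≤-reflexive (*-identityʳ ν)) ν≤ , all ν)
  ... | suc (suc _) | s≤s () | _
  ... | suc zero | _ | inj₂ (μ , x , all) with ≤-total μ (count a)
  ...   | inj₁ μ≤ = inj₂ (μ , inj₂ x ,
          λ ν ν≤ → ≤-trans (≤-reflexive (*-identityʳ ν)) (≤-trans ν≤ μ≤) , all ν ν≤)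
  ...   | inj₂ ≤μ = inj₂ (count a , inj₁ (refl , refl) ,
          λ ν ν≤ → ≤-trans (≤-reflexive (*-identityʳ ν)) ν≤ , all ν (≤-trans ν≤ ≤μ))

  -- Since all counts are positive, subset sums lie between 0 and the total value, and there are
  -- more codes than such numbers. From two equal sums the common members cancel, and what is left
  -- is nonzero because the codes differ.
  collision : ∀ as → All Good as → suc (listSum value as) < 2 ^ length as →
    ∃₂ λ c d → only as c d ≡ only as d c × only as c d ≢ 0
  collision as gs many with pigeonhole many (λ c → fromℕ< (s≤s (subsetSum-≤ as (toℕ c) gs)))
  ... | c , d , c<d , same = toℕ c , toℕ d , balanced , nonzero
    where
    sums≡ : subsetSum as (toℕ c) ≡ subsetSum as (toℕ d)
    sums≡ = trans (sym (toℕ-fromℕ< _)) (trans (cong toℕ same) (toℕ-fromℕ< _))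
    balanced : only as (toℕ c) (toℕ d) ≡ only as (toℕ d) (toℕ c)
    balanced = +-cancelʳ-≡ (subsetSum as (toℕ d)) _ _ (trans (only-balance as (toℕ c) (toℕ d))
        (cong (only as (toℕ d) (toℕ c) +_) sums≡))
    nonzero : only as (toℕ c) (toℕ d) ≢ 0
    nonzero z = <⇒≢ c<d (only-zero as (toℕ c) (toℕ d) gs z (trans (sym balanced) z) (toℕ<n c) (toℕ<n d))

  -- An exchange shortens the list without changing its value, so the hypothesis on the value
  -- persists and the argument can be repeated; `k` bounds the length and makes the recursion
  -- structural.
  small-support : ∀ l k as → length as ≤ k → All Good as → suc (listSum value as) < 2 ^ suc l →
    ∃ λ bs → length bs ≤ l × All Good bs × listSum value bs ≡ listSum value as
  small-support l k as len gs V< with length as ≤? l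
  ... | yes short′ = as , short′ , gs , refl
  small-support l zero    as len gs V< | no long′ = contradiction (≤-trans len z≤n) long′
  small-support l (suc k) as len gs V< | no long′
    with collision as gs (<-≤-trans V< (^-monoʳ-≤ 2 (≰⇒> long′)))
  ... | c , d , balanced , nonzero with least as c d
  ...   | inj₁ (z , _) = contradiction z nonzero
  ...   | inj₂ (μ , x , all) = shrink (small-support l k bs
      (≤-pred (≤-trans (exchange-shorter μ as c d x) len))
            (exchange-good μ as c d gs) (subst (λ z → suc z < 2 ^ suc l) (sym value≡) V<))
    where
    bs = exchange μ as c d
    value≡ : listSum value bs ≡ listSum value as
    value≡ = +-cancelʳ-≡ (μ * only as c d) _ _ (trans (exchange-value μ as c d (all μ ≤-refl))
        (cong (λ z → listSum value as + μ * z) (sym balanced)))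
    shrink : (∃ λ cs → length cs ≤ l × All Good cs × listSum value cs ≡ listSum value bs) →
             ∃ λ cs → length cs ≤ l × All Good cs × listSum value cs ≡ listSum value as
    shrink (cs , p , g , q) = cs , p , g , trans q value≡

-- Binary expansion of multiplicities

quo-≥ : ∀ k a {t} → 0 < t → k * t ≤ a → k ≤ quo a t
quo-≥ k a {t} 0<t p = ≤-pred (*-cancelʳ-< t k (suc (quo a t)) (≤-<-trans p (<-quo a 0<t)))

∑-last : ∀ n f → ∑ (suc n) f ≡ ∑ n f + f n
∑-last n f = trans (cong (λ z → ∑ z f) (+-comm 1 n)) (trans (∑-split n 1 f)
  (cong (∑ n f +_) (trans (+-identityʳ _) (cong f (+-identityʳ n)))))

module Binary where

  binary : ℕ → ℕ → ℕ → ℕ → List (ℕ × ℕ)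
  binary zero    j m i = []
  binary (suc b) j m i with rem m 2
  ... | zero  = binary b (suc j) (quo m 2) i
  ... | suc _ = (j , i) ∷ binary b (suc j) (quo m 2) i

  binary-length : ∀ b j m i → length (binary b j m i) ≤ b
  binary-length zero    j m i = z≤n
  binary-length (suc b) j m i with rem m 2
  ... | zero  = m≤n⇒m≤1+n (binary-length b (suc j) (quo m 2) i)
  ... | suc _ = s≤s (binary-length b (suc j) (quo m 2) i)

  binary-all : ∀ b j m i → All (λ p → proj₁ p < j + b × proj₂ p ≡ i) (binary b j m i)
  binary-all zero    j m i = []
  binary-all (suc b) j m i with rem m 2 | subst (λ z → All (λ p → proj₁ p < z × proj₂ p ≡ i)
      (binary b (suc j) (quo m 2) i)) (sym (+-suc j b)) (binary-all b (suc j) (quo m 2) i)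
  ... | zero  | ps = ps
  ... | suc _ | ps = (m<m+n j z<s , refl) ∷ ps

  binary-sum : ∀ (F : ℕ → ℕ) b j m i → m < 2 ^ b → listSum (λ p → 2 ^ proj₁ p * F (proj₂ p)) (binary b j m i)
      ≡ 2 ^ j * m * F i
  binary-sum F zero j m i m< rewrite n<1⇒n≡0 m< = cong (_* F i) (sym (*-zeroʳ (2 ^ j)))
  binary-sum F (suc b) j m i m< with rem m 2 | quo-rem m 2 | rem-< m {2} z<s
                                   | binary-sum F b (suc j) (quo m 2) i (quo-<ᵐ m (2 ^ b)
                                       (subst (m <_) (*-comm 2 (2 ^ b)) m<))
  ... | zero        | eq | _ | ih = trans ih (cong (_* F i) (trans (lemma (2 ^ j) (quo m 2))
      (cong (2 ^ j *_) (sym eq))))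
    where lemma : ∀ p q → 2 * p * q ≡ p * (q * 2 + 0)
          lemma = solve-∀
  ... | suc zero    | eq | _ | ih = trans (cong (2 ^ j * F i +_) ih) (trans (lemma (2 ^ j) (quo m 2) (F i))
      (cong (λ z → 2 ^ j * z * F i) (sym eq)))
    where lemma : ∀ p q f → p * f + 2 * p * q * f ≡ p * (q * 2 + 1) * f
          lemma = solve-∀
  ... | suc (suc _) | _ | s≤s (s≤s ()) | _

  expand : ℕ → List Entry → List (ℕ × ℕ)
  expand b []       = []
  expand b (a ∷ as) = binary b 0 (Entry.count a) (Entry.item a) ++ expand b as

  expand-length : ∀ b as → length (expand b as) ≤ length as * b
  expand-length b []       = z≤n
  expand-length b (a ∷ as) = ≤-trans (≤-reflexive (length-++ (binary b 0 (Entry.count a) (Entry.item a))))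
    (+-mono-≤ (binary-length b 0 (Entry.count a) (Entry.item a)) (expand-length b as))

  expand-all : ∀ b n as → All (λ a → Entry.item a < n) as → All (λ p → proj₁ p < b × proj₂ p < n)
      (expand b as)
  expand-all b n []       []       = []
  expand-all b n (a ∷ as) (p ∷ ps) = ++⁺ (All.map (λ (q , r) → q , subst (_< n) (sym r) p)
    (binary-all b 0 (Entry.count a) (Entry.item a))) (expand-all b n as ps)

  expand-sum : ∀ (F : ℕ → ℕ) b as → listSum Entry.count as < 2 ^ b →
    listSum (λ p → 2 ^ proj₁ p * F (proj₂ p)) (expand b as) ≡ listSum (λ a → Entry.count a * F
        (Entry.item a)) as
  expand-sum F b []       _ = refl
  expand-sum F b (a ∷ as) p = trans (listSum-++ _ (binary b 0 (Entry.count a) (Entry.item a)) (expand b as))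
    (cong₂ _+_ (trans (binary-sum F b 0 (Entry.count a) (Entry.item a) (≤-<-trans (m≤m+n (Entry.count a) _)
        p))
                      (cong (_* F (Entry.item a)) (*-identityˡ (Entry.count a))))
      (expand-sum F b as (≤-<-trans (m≤n+m _ (Entry.count a)) p)))

listSum-mono : ∀ {A : Set} {G : A → Set} {f g : A → ℕ} → (∀ a → G a → f a ≤ g a) →
  ∀ as → All G as → listSum f as ≤ listSum g as
listSum-mono h []       _ = z≤n
listSum-mono h (a ∷ as) (p ∷ ps) = +-mono-≤ (h a p) (listSum-mono h as ps)

listSum-*ʳ : ∀ {A : Set} (f : A → ℕ) c as → listSum (λ a → f a * c) as ≡ listSum f as * c
listSum-*ʳ f c []       = refl
listSum-*ʳ f c (a ∷ as) = trans (cong (f a * c +_) (listSum-*ʳ f c as)) (sym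
    (*-distribʳ-+ c (f a) (listSum f as)))

listSum-+ : ∀ {A : Set} (f g : A → ℕ) as → listSum (λ a → f a + g a) as ≡ listSum f as + listSum g as
listSum-+ f g []       = refl
listSum-+ f g (a ∷ as) = trans (cong (f a + g a +_) (listSum-+ f g as)) (lemma (f a) (g a) _ _)
  where lemma : ∀ a b c d → a + b + (c + d) ≡ a + c + (b + d)
        lemma = solve-∀

-- Quality of the approximation

module Approximation (n t num den E e lam : ℕ) (X : ℕ → ℕ) (0<t : 0 < t) (0<X : ∀ i → i < n → 0 < X i)
  (e+8≤Λ : e + 8 ≤ 2 ^ lam) where
  open Parameters n t num den E e lam
  open Items n t P M Q X
  open Binary

  private
    instance
      t≢0 : NonZero t
      t≢0 = >-nonZero 0<t
      P≢0 : NonZero P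
      P≢0 = m^n≢0 2 e

    0<P : 0 < P
    0<P = m^n>0 2 e

    e+1≤Λ : e + 1 ≤ Λ
    e+1≤Λ = ≤-trans (+-monoʳ-≤ e (m≤m+n 1 7)) e+8≤Λ

    1≤Λ : 1 ≤ Λ
    1≤Λ = m^n>0 2 lam

    instance
      picks≢0 : NonZero picks
      picks≢0 = >-nonZero (*-mono-≤ (*-mono-≤ {1} {2} (s≤s z≤n) 1≤Λ) 1≤Λ)

  unit : ℕ → ℕ
  unit i = factor i * X i

  worth : ℕ × ℕ → ℕ
  worth p = 2 ^ proj₁ p * unit (proj₂ p)

  -- A multiset of at most picks multiples 2^j factor(i) x(i) that approximates the optimum
  record Selection (opt : ℕ) : Set where
    constructor selection
    field
      chosen  : List (ℕ × ℕ)
      few     : length chosen ≤ picks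
      allowed : All (λ p → proj₁ p < Λ × proj₂ p < n) chosen
      sum≤    : 4 * P * listSum worth chosen ≤ (4 * P + 1) * t
      sum≥    : 4 * P * opt ≤ 4 * P * listSum worth chosen + 4 * t

  -- One item is enough. Its multiple `u` satisfies t/(2P) < u ≤ t/P: by the lower bound fewer than
  -- 2P copies of `u` fit into t, so e + 1 binary digits suffice, and by the upper bound the gap
  -- left below t is at most t/P.
  small-selection : ∀ opt i → i < n → X i * P ≤ t → opt ≤ t → Selection opt
  small-selection opt i i<n small opt≤t = selection (binary (e + 1) 0 μ i)
    (≤-trans (binary-length (e + 1) 0 μ i) (≤-trans e+1≤Λ Λ≤picks))
    (All.map (λ (p , q) → <-≤-trans p e+1≤Λ , subst (_< n) (sym q) i<n) (binary-all (e + 1) 0 μ i))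
    (subst (λ z → 4 * P * z ≤ (4 * P + 1) * t) (sym sum≡) (≤-trans (*-monoʳ-≤ (4 * P) (quo-*-≤ t u))
        (*-monoˡ-≤ t (m≤m+n (4 * P) 1))))
    (subst (λ z → 4 * P * opt ≤ 4 * P * z + 4 * t) (sym sum≡) lower-bound)
    where
    open ≤-Reasoning
    Λ≤picks : Λ ≤ picks
    Λ≤picks = ≤-trans (m≤n*m Λ 2) (m≤m*n (2 * Λ) Λ {{>-nonZero 1≤Λ}})
    q = quo t (X i * P)
    u = unit i
    μ = quo t u
    0<XP : 0 < X i * P
    0<XP = *-mono-≤ (0<X i i<n) 0<P
    1≤q : 1 ≤ q
    1≤q = quo-≥ 1 t 0<XP (≤-trans (≤-reflexive (*-identityˡ (X i * P))) small)
    u≡ : u ≡ q * X i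
    u≡ = cong (_* X i) (trans (cong (q +_) (m≤n⇒m∸n≡0 1≤q)) (+-identityʳ q))
    u*P≤t : u * P ≤ t
    u*P≤t = ≤-trans (≤-reflexive (trans (cong (_* P) u≡) (*-assoc q (X i) P))) (quo-*-≤ t (X i * P))
    0<u : 0 < u
    0<u = subst (0 <_) (sym u≡) (*-mono-≤ 1≤q (0<X i i<n))
    t<2uP : t < 2 * P * u
    t<2uP = begin-strict
      t                          <⟨ <-quo t 0<XP ⟩
      suc q * (X i * P)          ≤⟨ *-monoˡ-≤ (X i * P) (≤-trans (+-monoˡ-≤ q 1≤q)
          (≤-reflexive (cong (q +_) (sym (+-identityʳ q))))) ⟩
      2 * q * (X i * P)          ≡⟨ lemma q (X i) P ⟩
      2 * P * (q * X i)          ≡⟨ cong (2 * P *_) u≡ ⟨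
      2 * P * u                  ∎
      where lemma : ∀ q x p → 2 * q * (x * p) ≡ 2 * p * (q * x)
            lemma = solve-∀
    μ< : μ < 2 ^ (e + 1)
    μ< = quo-<ᵐ t (2 ^ (e + 1)) (subst (λ z → t < z * u) (cong (2 ^_) (+-comm 1 e)) t<2uP)
    sum≡ : listSum worth (binary (e + 1) 0 μ i) ≡ μ * u
    sum≡ = trans (binary-sum unit (e + 1) 0 μ i μ<) (cong (_* u) (*-identityˡ μ))
    lower-bound : 4 * P * opt ≤ 4 * P * (μ * u) + 4 * t
    lower-bound = begin
      4 * P * opt                    ≤⟨ *-monoʳ-≤ (4 * P) (≤-trans opt≤t (<⇒≤ (<-quo t 0<u))) ⟩
      4 * P * (suc μ * u)            ≡⟨ lemma P μ u ⟩
      4 * P * (μ * u) + 4 * (u * P)  ≤⟨ +-monoʳ-≤ (4 * P * (μ * u)) (*-monoʳ-≤ 4 u*P≤t) ⟩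
      4 * P * (μ * u) + 4 * t        ∎
      where lemma : ∀ p m u → 4 * p * (suc m * u) ≡ 4 * p * (m * u) + 4 * (u * p)
            lemma = solve-∀

  -- As every item exceeds t/P, a feasible solution has at most P copies in all, and rounding them
  -- in units of t/(4P²) costs at most t/(4P). The exchange preserves the rounded value and again
  -- leaves at most P copies, so the true sum after it is off by no more than t/(4P) either way.
  large-selection : ∀ (y : ℕ → ℕ) → (∀ i → i < n → t < X i * P) → ∑ n (λ i → X i * y i) ≤ t →
                    Selection (∑ n (λ i → X i * y i))
  large-selection y large opt≤t = from (small-support l (length support) support ≤-refl support-good V<)
    where
    open ≤-Reasoning
    opt = ∑ n (λ i → X i * y i)
    H l : ℕ
    H = 4 * P * P
    -- H = 2^l bounds the rounded value V, so l + 1 items already force a collision.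
    l = 2 + 2 * e
    H≡ : H ≡ 2 ^ l
    H≡ = trans (*-assoc 4 P P) (trans (cong (4 *_) (trans (sym (^-distribˡ-+-* 2 e e))
        (cong (λ z → 2 ^ (e + z)) (sym (+-identityʳ e)))))
      (sym (^-distribˡ-+-* 2 2 (2 * e))))
    rounded : ℕ → ℕ
    rounded i = quo (X i * H) t
    rounded-≥ : ∀ i → i < n → 4 * P ≤ rounded i
    rounded-≥ i i<n = quo-≥ (4 * P) (X i * H) 0<t (begin
      4 * P * t          ≤⟨ *-monoʳ-≤ (4 * P) (<⇒≤ (large i i<n)) ⟩
      4 * P * (X i * P)  ≡⟨ lemma P (X i) ⟩
      X i * H            ∎)
      where lemma : ∀ p x → 4 * p * (x * p) ≡ x * (4 * p * p)
            lemma = solve-∀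
    1≤4P : 1 ≤ 4 * P
    1≤4P = *-mono-≤ {1} {4} (s≤s z≤n) 0<P
    open Support rounded (_< n) (λ i i<n → ≤-trans 1≤4P (rounded-≥ i i<n)) using
        (Good; keep; keep-good; small-support) renaming (value to roundedValue)

    entries : ∀ k → List Entry
    entries zero    = []
    entries (suc k) = keep (y k) k (entries k)
    entries-sum : ∀ (F : ℕ → ℕ) k → listSum (λ a → Entry.count a * F (Entry.item a)) (entries k) ≡ ∑ k
        (λ i → y i * F i)
    entries-sum F zero    = refl
    entries-sum F (suc k) = trans (kept (y k)) (trans (cong (y k * F k +_) (entries-sum F k))
      (trans (+-comm (y k * F k) _) (sym (∑-last k (λ i → y i * F i)))))
      where
      kept : ∀ c → listSum (λ a → Entry.count a * F (Entry.item a)) (keep c k (entries k)) ≡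
                   c * F k + listSum (λ a → Entry.count a * F (Entry.item a)) (entries k)
      kept zero    = refl
      kept (suc c) = refl
    entries-good : ∀ k → k ≤ n → All Good (entries k)
    entries-good zero    _   = []
    entries-good (suc k) k<n = keep-good (y k) k (entries k) k<n (entries-good k (<⇒≤ k<n))

    support = entries n
    support-good = entries-good n ≤-refl
    V = listSum roundedValue support
    V≡ : V ≡ ∑ n (λ i → y i * rounded i)
    V≡ = entries-sum rounded n
    V*t≤ : V * t ≤ opt * H
    V*t≤ = begin
      V * t                              ≡⟨ trans (cong (_* t) V≡) (sym (∑-*ʳ n t (λ i → y i * rounded i))) ⟩
      ∑ n (λ i → y i * rounded i * t)    ≤⟨ ∑-mono n
          (λ i _ → ≤-trans (≤-reflexive (*-assoc (y i) (rounded i) t))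
                                              (≤-trans (*-monoʳ-≤ (y i) (quo-*-≤ (X i * H) t))
                                                  (≤-reflexive (lemma (y i) (X i) H)))) ⟩
      ∑ n (λ i → X i * y i * H)          ≡⟨ ∑-*ʳ n H (λ i → X i * y i) ⟩
      opt * H                            ∎
      where lemma : ∀ y x h → y * (x * h) ≡ x * y * h
            lemma = solve-∀
    V≤H : V ≤ H
    V≤H = *-cancelʳ-≤ V H t (≤-trans V*t≤ (≤-trans (*-monoˡ-≤ H opt≤t) (≤-reflexive (*-comm t H))))
    V< : suc V < 2 ^ suc l
    V< = begin-strict
      suc V           ≤⟨ s≤s V≤H ⟩
      suc H           <⟨ +-monoˡ-< H (≤-trans (m≤m+n 2 2) (≤-trans (≤-reflexive (sym (*-identityʳ 4)))
          (*-mono-≤ (*-monoʳ-≤ 4 0<P) 0<P))) ⟩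
      H + H           ≡⟨ cong (H +_) (sym (+-identityʳ H)) ⟩
      2 * H           ≡⟨ cong (2 *_) H≡ ⟩
      2 ^ suc l       ∎
    ∑y≤P : ∑ n y ≤ P
    ∑y≤P = *-cancelʳ-≤ (∑ n y) P t (begin
      ∑ n y * t                    ≡⟨ ∑-*ʳ n t y ⟨
      ∑ n (λ i → y i * t)          ≤⟨ ∑-mono n (λ i i<n → ≤-trans (*-monoʳ-≤ (y i) (<⇒≤ (large i i<n)))
          (≤-reflexive (lemma (y i) (X i) P))) ⟩
      ∑ n (λ i → X i * y i * P)    ≡⟨ ∑-*ʳ n P (λ i → X i * y i) ⟩
      opt * P                      ≤⟨ *-monoˡ-≤ P opt≤t ⟩
      t * P                        ≡⟨ *-comm t P ⟩
      P * t                        ∎)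
      where lemma : ∀ y x p → y * (x * p) ≡ x * y * p
            lemma = solve-∀
    opt*H≤ : opt * H ≤ V * t + P * t
    opt*H≤ = begin
      opt * H                                         ≡⟨ ∑-*ʳ n H (λ i → X i * y i) ⟨
      ∑ n (λ i → X i * y i * H)                       ≤⟨ ∑-mono n (λ i _ → ≤-trans
          (≤-reflexive (lemma₁ (X i) (y i) H))
                                                           (≤-trans (*-monoʳ-≤ (y i)
                                                               (<⇒≤ (<-quo (X i * H) 0<t)))
                                                               (≤-reflexive (lemma₂ (y i) (rounded i) t)))) ⟩
      ∑ n (λ i → (y i * rounded i + y i) * t)         ≡⟨ trans (∑-*ʳ n t (λ i → y i * rounded i + y i))
          (cong (_* t) (∑-+ n (λ i → y i * rounded i) y)) ⟩
      (∑ n (λ i → y i * rounded i) + ∑ n y) * t       ≡⟨ cong (λ z → (z + ∑ n y) * t) V≡ ⟨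
      (V + ∑ n y) * t                                 ≤⟨ *-monoˡ-≤ t (+-monoʳ-≤ V ∑y≤P) ⟩
      (V + P) * t                                     ≡⟨ *-distribʳ-+ t V P ⟩
      V * t + P * t                                   ∎
      where
      lemma₁ : ∀ x y h → x * y * h ≡ y * (x * h)
      lemma₁ = solve-∀
      lemma₂ : ∀ y r t → y * (suc r * t) ≡ (y * r + y) * t
      lemma₂ = solve-∀

    from : (∃ λ bs → length bs ≤ l × All Good bs × listSum roundedValue bs ≡ V) → Selection opt
    from (bs , short′ , good , sum≡) = selection (expand (e + 1) bs)
        (≤-trans (expand-length (e + 1) bs) (*-mono-≤ (≤-trans short′ l≤) e+1≤Λ))
        (All.map (λ (p , q) → <-≤-trans p e+1≤Λ , q) (expand-all (e + 1) n bs (All.map proj₂ good)))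
        (subst (λ z → 4 * P * z ≤ (4 * P + 1) * t) (sym worth≡) upper-bound)
        (subst (λ z → 4 * P * opt ≤ 4 * P * z + 4 * t) (sym worth≡) lower-bound)
      where
      l≤ : l ≤ 2 * Λ
      l≤ = ≤-trans (≤-reflexive (lemma e)) (*-monoʳ-≤ 2 e+1≤Λ)
        where lemma : ∀ e → 2 + 2 * e ≡ 2 * (e + 1)
              lemma = solve-∀
      C = listSum Entry.count bs
      Z = listSum (λ a → Entry.count a * X (Entry.item a)) bs
      -- The exchange may alter the number of copies, but not V ≤ 4P², to which each copy
      -- contributes at least 4P. This bound is the reason for the factor 4P² in the rounding.
      C≤P : C ≤ P
      C≤P = *-cancelʳ-≤ C P (4 * P) {{>-nonZero 1≤4P}} (begin
        C * (4 * P)                                        ≡⟨ listSum-*ʳ Entry.count (4 * P) bs ⟨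
        listSum (λ a → Entry.count a * (4 * P)) bs         ≤⟨ listSum-mono (λ a g → *-monoʳ-≤ (Entry.count a)
            (rounded-≥ (Entry.item a) (proj₂ g))) bs good ⟩
        listSum roundedValue bs                            ≡⟨ sum≡ ⟩
        V                                                  ≤⟨ V≤H ⟩
        4 * P * P                                          ≡⟨ *-comm (4 * P) P ⟩
        P * (4 * P)                                        ∎)
      unit≡ : ∀ i → i < n → unit i ≡ X i
      unit≡ i i<n = trans (cong (λ z → (z + (1 ∸ z)) * X i) (quo-unique 0 (large i i<n))) (*-identityˡ (X i))
      worth≡ : listSum worth (expand (e + 1) bs) ≡ Z
      worth≡ = trans (expand-sum unit (e + 1) bs (≤-<-trans C≤P (≤-trans (+-monoˡ-≤ P 0<P)
          (≤-reflexive (trans (cong (P +_) (sym (+-identityʳ P))) (cong (2 ^_) (+-comm 1 e)))))))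
        (≤-antisym (listSum-mono (λ a g → ≤-reflexive (cong (Entry.count a *_)
            (unit≡ (Entry.item a) (proj₂ g)))) bs good)
                   (listSum-mono (λ a g → ≤-reflexive (cong (Entry.count a *_)
                       (sym (unit≡ (Entry.item a) (proj₂ g))))) bs good))
      V≤Z : V * t ≤ Z * H
      V≤Z = begin
        V * t                                                          ≡⟨ cong (_* t) sum≡ ⟨
        listSum roundedValue bs * t                                    ≡⟨ listSum-*ʳ roundedValue t bs ⟨
        listSum (λ a → Entry.count a * rounded (Entry.item a) * t) bs  ≤⟨ listSum-mono {G = Good} (λ a _ →
            ≤-trans (≤-reflexive (*-assoc (Entry.count a) (rounded (Entry.item a)) t))
                (≤-trans (*-monoʳ-≤ (Entry.count a) (quo-*-≤ (X (Entry.item a) * H) t))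
              (≤-reflexive (sym (*-assoc (Entry.count a) (X (Entry.item a)) H))))) bs good ⟩
        listSum (λ a → Entry.count a * X (Entry.item a) * H) bs        ≡⟨ listSum-*ʳ
            (λ a → Entry.count a * X (Entry.item a)) H bs ⟩
        Z * H                                                          ∎
      Z≤V : Z * H ≤ V * t + P * t
      Z≤V = begin
        Z * H                                                          ≡⟨ listSum-*ʳ
            (λ a → Entry.count a * X (Entry.item a)) H bs ⟨
        listSum (λ a → Entry.count a * X (Entry.item a) * H) bs        ≤⟨ listSum-mono {G = Good} (λ a _ →
            ≤-trans (≤-reflexive (*-assoc (Entry.count a) (X (Entry.item a)) H))
                (≤-trans (*-monoʳ-≤ (Entry.count a) (<⇒≤ (<-quo (X (Entry.item a) * H) 0<t)))
              (≤-reflexive (lemma (Entry.count a) (rounded (Entry.item a)) t)))) bs good ⟩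
        listSum (λ a → (roundedValue a + Entry.count a) * t) bs        ≡⟨ listSum-*ʳ
            (λ a → roundedValue a + Entry.count a) t bs ⟩
        listSum (λ a → roundedValue a + Entry.count a) bs * t          ≡⟨ cong (_* t)
            (listSum-+ roundedValue Entry.count bs) ⟩
        (listSum roundedValue bs + C) * t                              ≤⟨ *-monoˡ-≤ t
            (+-mono-≤ (≤-reflexive sum≡) C≤P) ⟩
        (V + P) * t                                                    ≡⟨ *-distribʳ-+ t V P ⟩
        V * t + P * t                                                  ∎
        where lemma : ∀ y r t → y * (suc r * t) ≡ (y * r + y) * t
              lemma = solve-∀
      upper-bound : 4 * P * Z ≤ (4 * P + 1) * t
      upper-bound = *-cancelʳ-≤ (4 * P * Z) ((4 * P + 1) * t) P (begin
        4 * P * Z * P            ≡⟨ lemma₁ P Z ⟩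
        Z * H                    ≤⟨ Z≤V ⟩
        V * t + P * t            ≤⟨ +-monoˡ-≤ (P * t) (*-monoˡ-≤ t V≤H) ⟩
        4 * P * P * t + P * t    ≡⟨ lemma₂ P t ⟩
        (4 * P + 1) * t * P      ∎)
        where
        lemma₁ : ∀ p z → 4 * p * z * p ≡ z * (4 * p * p)
        lemma₁ = solve-∀
        lemma₂ : ∀ p t → 4 * p * p * t + p * t ≡ (4 * p + 1) * t * p
        lemma₂ = solve-∀
      lower-bound : 4 * P * opt ≤ 4 * P * Z + 4 * t
      lower-bound = ≤-trans (*-cancelʳ-≤ (4 * P * opt) (4 * P * Z + t) P (begin
        4 * P * opt * P          ≡⟨ lemma₁ P opt ⟩
        opt * H                  ≤⟨ opt*H≤ ⟩
        V * t + P * t            ≤⟨ +-monoˡ-≤ (P * t) V≤Z ⟩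
        Z * (4 * P * P) + P * t  ≡⟨ lemma₂ P Z t ⟩
        (4 * P * Z + t) * P      ∎)) (+-monoʳ-≤ (4 * P * Z) (m≤n*m t 4))
        where
        lemma₁ : ∀ p z → 4 * p * z * p ≡ z * (4 * p * p)
        lemma₁ = solve-∀
        lemma₂ : ∀ p z t → z * (4 * p * p) + p * t ≡ (4 * p * z + t) * p
        lemma₂ = solve-∀

  select : ∀ (y : ℕ → ℕ) → ∑ n (λ i → X i * y i) ≤ t → Selection (∑ n (λ i → X i * y i))
  select y opt≤t with anyUpTo? (λ i → X i * P ≤? t) n
  ... | yes (i , i<n , small) = small-selection _ i i<n small opt≤t
  ... | no none = large-selection y (λ i i<n → ≰⇒> λ small → none (i , i<n , small)) opt≤t

  module _ (own : ℕ → ℕ) (1≤Q : 1 ≤ Q) (own0 : own 0 ≢ 0)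
    (complete : ∀ j i → j < Λ → i < n → itemValue j i < Q → own (itemValue j i) ≢ 0) where
    open Rows Q 1≤Q own

    itemValue′ : ℕ × ℕ → ℕ
    itemValue′ p = itemValue (proj₁ p) (proj₂ p)

    -- Zero is an entry of the table and can be added as often as desired.
    row-more : ∀ d {k u} → row k u ≢ 0 → row (d + k) u ≢ 0
    row-more zero    r = r
    row-more (suc d) {k} {u} r = subst (λ z → row (suc (d + k)) z ≢ 0) (+-identityʳ u)
      (row-step (d + k) u 0 (row-more d r) own0 (subst (_< Q) (sym (+-identityʳ u))
          (row-below (d + k) (row-more d r))))

    row-list : ∀ ps → All (λ p → proj₁ p < Λ × proj₂ p < n) ps → listSum itemValue′ ps < Q →
               row (length ps) (listSum itemValue′ ps) ≢ 0
    row-list []       []              _   = λ ()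
    row-list (p ∷ ps) ((a , b) ∷ all) sum<Q = subst (λ z → row (suc (length ps)) z ≢ 0)
        (+-comm (listSum itemValue′ ps) (itemValue′ p))
      (row-step (length ps) (listSum itemValue′ ps) (itemValue′ p)
        (row-list ps all (≤-<-trans (m≤n+m _ (itemValue′ p)) sum<Q))
        (complete (proj₁ p) (proj₂ p) a b (≤-<-trans (m≤m+n (itemValue′ p) _) sum<Q))
        (subst (_< Q) (+-comm (itemValue′ p) (listSum itemValue′ ps)) sum<Q))

    worth≡ : ∀ p → multiple (proj₁ p) (proj₂ p) * X (proj₂ p) ≡ worth p
    worth≡ p = *-assoc (2 ^ proj₁ p) (factor (proj₂ p)) (X (proj₂ p))

    values-≤ : ∀ ps → listSum itemValue′ ps * t ≤ listSum worth ps * M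
    values-≤ []       = z≤n
    values-≤ (p ∷ ps) = begin
      (itemValue′ p + listSum itemValue′ ps) * t     ≡⟨ *-distribʳ-+ t (itemValue′ p) _ ⟩
      itemValue′ p * t + listSum itemValue′ ps * t   ≤⟨ +-mono-≤ (≤-trans (quo-*-≤ _ t)
          (≤-reflexive (cong (_* M) (worth≡ p)))) (values-≤ ps) ⟩
      worth p * M + listSum worth ps * M             ≡⟨ *-distribʳ-+ M (worth p) _ ⟨
      (worth p + listSum worth ps) * M               ∎
      where open ≤-Reasoning

    values-≥ : ∀ ps → listSum worth ps * M ≤ (listSum itemValue′ ps + length ps) * t
    values-≥ []       = z≤n
    values-≥ (p ∷ ps) = begin
      (worth p + listSum worth ps) * M               ≡⟨ *-distribʳ-+ M (worth p) _ ⟩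
      worth p * M + listSum worth ps * M             ≤⟨ +-mono-≤
          (≤-trans (≤-reflexive (cong (_* M) (sym (worth≡ p)))) (<⇒≤ (<-quo _ 0<t))) (values-≥ ps) ⟩
      suc (itemValue′ p) * t + (listSum itemValue′ ps + length ps) * t ≡⟨ lemma (itemValue′ p)
          (listSum itemValue′ ps) (length ps) t ⟩
      (itemValue′ p + listSum itemValue′ ps + suc (length ps)) * t ∎
      where
      open ≤-Reasoning
      lemma : ∀ a b c t → suc a * t + (b + c) * t ≡ (a + b + suc c) * t
      lemma = solve-∀

    M*t : M * t + picks * t ≡ picks * ((4 * P + 1) * t)
    M*t = lemma picks P t
      where lemma : ∀ k p t → 4 * k * p * t + k * t ≡ k * ((4 * p + 1) * t)
            lemma = solve-∀

    scaled : ∀ z → z * M ≡ picks * (4 * P * z)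
    scaled z = lemma picks P z
      where lemma : ∀ k p z → z * (4 * k * p) ≡ k * (4 * p * z)
            lemma = solve-∀

    -- Everything is measured in t/(4P), which equals `picks` units of t/M. Below the optimum, the
    -- selection loses at most 4 of these and the rounding of its values one more, hence 5. Above t,
    -- the table extends by one and the rounding of the picks adds another, hence 2.
    guarantee : ∀ best out opt → Selection opt →
      row picks best ≢ 0 → (∀ p → row picks p ≢ 0 → p ≤ best) → best * t ≤ out * M → out * M ≤ (best + picks)
          * t →
      4 * P * opt ≤ 4 * P * out + 5 * t × 4 * P * out ≤ (4 * P + 2) * t
    guarantee best out opt (selection ps few all sum≤ sum≥) best∈ best-max low high = lower-bound ,
        upper-bound
      where
      open ≤-Reasoning
      v = listSum itemValue′ ps
      Z = listSum worth ps
      -- A selection may exceed t by t/(4P), that is, by `picks` units. This accounts for the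
      -- summand `picks` in Q.
      v≤ : v ≤ M + picks
      v≤ = *-cancelʳ-≤ v (M + picks) t (begin
        v * t                      ≤⟨ values-≤ ps ⟩
        Z * M                      ≡⟨ scaled Z ⟩
        picks * (4 * P * Z)        ≤⟨ *-monoʳ-≤ picks sum≤ ⟩
        picks * ((4 * P + 1) * t)  ≡⟨ M*t ⟨
        M * t + picks * t          ≡⟨ *-distribʳ-+ t M picks ⟨
        (M + picks) * t            ∎)
      v<Q : v < Q
      v<Q = ≤-trans (s≤s v≤) (≤-reflexive (+-comm 1 (M + picks)))
      v≤best : v ≤ best
      v≤best = best-max v (subst (λ k → row k v ≢ 0) (m∸n+n≡m few) (row-more (picks ∸ length ps)
          (row-list ps all v<Q)))
      Z≤ : 4 * P * Z ≤ 4 * P * out + t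
      Z≤ = *-cancelˡ-≤ picks (begin
        picks * (4 * P * Z)              ≡⟨ scaled Z ⟨
        Z * M                            ≤⟨ values-≥ ps ⟩
        (v + length ps) * t              ≤⟨ *-monoˡ-≤ t (+-mono-≤ v≤best few) ⟩
        (best + picks) * t               ≡⟨ *-distribʳ-+ t best picks ⟩
        best * t + picks * t             ≤⟨ +-monoˡ-≤ (picks * t) low ⟩
        out * M + picks * t              ≡⟨ cong (_+ picks * t) (scaled out) ⟩
        picks * (4 * P * out) + picks * t ≡⟨ *-distribˡ-+ picks (4 * P * out) t ⟨
        picks * (4 * P * out + t)        ∎)
      lower-bound : 4 * P * opt ≤ 4 * P * out + 5 * t
      lower-bound = begin
        4 * P * opt                ≤⟨ sum≥ ⟩
        4 * P * Z + 4 * t          ≤⟨ +-monoˡ-≤ (4 * t) Z≤ ⟩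
        4 * P * out + t + 4 * t    ≡⟨ +-assoc (4 * P * out) t (4 * t) ⟩
        4 * P * out + 5 * t        ∎
      upper-bound : 4 * P * out ≤ (4 * P + 2) * t
      upper-bound = *-cancelˡ-≤ picks (begin
        picks * (4 * P * out)      ≡⟨ scaled out ⟨
        out * M                    ≤⟨ high ⟩
        (best + picks) * t         ≤⟨ *-monoˡ-≤ t (+-monoˡ-≤ picks
            (≤-pred (≤-trans (row-below picks best∈) (≤-reflexive (+-comm (M + picks) 1))))) ⟩
        (M + picks + picks) * t    ≡⟨ lemma picks P t ⟩
        picks * ((4 * P + 2) * t)  ∎)
        where lemma : ∀ k p t → (4 * k * p + k + k) * t ≡ k * ((4 * p + 2) * t)
              lemma = solve-∀

-- Word size and loop bounds

record Below (U i a : ℕ) : Set where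
  constructor below-power
  field bound : a ≤ U ^ i
open Below

module PowerBounds {U : ℕ} (2≤U : 2 ≤ U) where
  private
    instance
      U≢0 : NonZero U
      U≢0 = >-nonZero (<-≤-trans z<s 2≤U)

  weaken-power : ∀ {i j a} → i ≤ j → Below U i a → Below U j a
  weaken-power p (below-power q) = below-power (≤-trans q (^-monoʳ-≤ U p))

  below-≤ : ∀ {i a b} → a ≤ b → Below U i b → Below U i a
  below-≤ p (below-power q) = below-power (≤-trans p q)

  below-2^ : ∀ k → Below U k (2 ^ k)
  below-2^ k = below-power (^-monoˡ-≤ k 2≤U)

  below-* : ∀ {i j a b} → Below U i a → Below U j b → Below U (i + j) (a * b)
  below-* {i} {j} (below-power p) (below-power q) =
    below-power (≤-trans (*-mono-≤ p q) (≤-reflexive (sym (^-distribˡ-+-* U i j))))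

  below-+ : ∀ {i a b} → Below U i a → Below U i b → Below U (suc i) (a + b)
  below-+ {i} (below-power p) (below-power q) = below-power (≤-trans (+-mono-≤ p q)
    (≤-trans (≤-reflexive (cong (U ^ i +_) (sym (+-identityʳ (U ^ i))))) (*-monoˡ-≤ (U ^ i) 2≤U)))

2*m≤2^m : ∀ m → 2 * m ≤ 2 ^ m
2*m≤2^m zero          = z≤n
2*m≤2^m (suc zero)    = ≤-refl
2*m≤2^m (suc (suc m)) = ≤-trans (≤-reflexive (lemma (suc m)))
  (+-mono-≤ (2*m≤2^m (suc m)) (≤-trans (^-monoʳ-≤ 2 {1} {suc m} (s≤s z≤n)) (m≤m+n (2 ^ suc m) 0)))
  where lemma : ∀ m → 2 * suc m ≡ 2 * m + 2
        lemma = solve-∀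

-- These numbers are abstract because products with literals get unfolded.
abstract
  logFactor sizeFactor : ℕ
  logFactor  = 24
  sizeFactor = 4096

  24≤logFactor : 24 ≤ logFactor
  24≤logFactor = ≤-refl

  logFactor≤ : logFactor ≤ 2 ^ 5
  logFactor≤ = m≤m+n 24 8

  4096≤sizeFactor : 4096 ≤ sizeFactor
  4096≤sizeFactor = ≤-refl

  sizeFactor≤ : sizeFactor ≤ 2 ^ 12
  sizeFactor≤ = ≤-refl

-- ℓ ≥ log₂ (8 N′) − 3, where N′ is the parameter of the running time
module Resources (n t num den ℓ N′ U W E : ℕ) (W≡ : U ^ 300 ≡ W) (E≡ : 4 * (quo den num + 1) ≡ E)
    (2≤U : 2 ≤ U)
  (n≤U : n ≤ U) (t≤U : t ≤ U) (n≤N′ : n ≤ N′) (1≤ℓ : 1 ≤ ℓ) (1≤N′ : 1 ≤ N′)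
  (log : ∀ e → 2 ^ e ≤ 8 * suc N′ → e ≤ 3 + ℓ) (E₀≤ : quo den num + 1 ≤ suc N′)
  (ℓ≤ : ℓ ≤ suc N′) (N′≤U³ : N′ ≤ U ^ 3) where
  open PowerBounds 2≤U

  -- A bounds Λ, S bounds picks = 2Λ², and L bounds the length 2^D · 4N = 256 Λ³ P of the work
  -- array; with P ≤ 16 N′ this leads to 256 · 16 = 4096.
  A S L : ℕ
  A = logFactor * ℓ
  S = 2 * A * A
  L = sizeFactor * (A * A * A) * N′

  private
    instance
      A≢0 : NonZero A
      A≢0 = >-nonZero (*-mono-≤ (≤-trans (m≤m+n 1 23) 24≤logFactor) 1≤ℓ)
      N′≢0 : NonZero N′
      N′≢0 = >-nonZero 1≤N′

    1≤A : 1 ≤ A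
    1≤A = *-mono-≤ (≤-trans (m≤m+n 1 23) 24≤logFactor) 1≤ℓ

  L-below : Below U 42 L
  -- The exponents add up as 12 for the size factor, 9 for each of the three A, and 3 for N′. The 9
  -- is 5 for the factor of the logarithm and 4 for ℓ ≤ N′ + 1.
  L-below = below-* {39} {3} (below-* {12} {27} (below-≤ sizeFactor≤ (below-2^ 12))
      (below-* {18} {9} (below-* {9} {9} A-below A-below) A-below)) (below-power N′≤U³)
    where
    A-below : Below U 9 A
    A-below = below-* {5} {4} (below-≤ logFactor≤ (below-2^ 5))
      (below-≤ (≤-trans ℓ≤ (≤-reflexive (+-comm 1 N′))) (below-+ (below-power N′≤U³)
          (weaken-power z≤n (below-2^ 0))))

  1≤A³ : 1 ≤ A * A * A
  1≤A³ = *-mono-≤ (*-mono-≤ 1≤A 1≤A) 1≤A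

  N′≤L : 4096 * N′ ≤ L
  N′≤L = *-monoˡ-≤ N′ (≤-trans 4096≤sizeFactor (m≤m*n sizeFactor (A * A * A) {{>-nonZero 1≤A³}}))

  S≤L : S ≤ L
  S≤L = ≤-trans (≤-trans (≤-reflexive (*-assoc 2 A A)) (≤-trans (m≤m*n (2 * (A * A)) A)
      (≤-trans (≤-reflexive (*-assoc 2 (A * A) A))
    (*-monoˡ-≤ (A * A * A) (≤-trans (m≤m+n 2 4094) 4096≤sizeFactor))))) (m≤m*n (sizeFactor * (A * A * A)) N′)

  E≤8N′ : E ≤ 8 * N′
  E≤8N′ = ≤-trans (≤-trans (≤-reflexive (sym E≡)) (*-monoʳ-≤ 4 E₀≤)) (≤-trans
      (*-monoʳ-≤ 4 (+-monoˡ-≤ N′ 1≤N′)) (≤-reflexive (lemma N′)))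
    where lemma : ∀ N → 4 * (N + N) ≡ 8 * N
          lemma = solve-∀

  E≤L : E ≤ L
  E≤L = ≤-trans E≤8N′ (≤-trans (*-monoˡ-≤ N′ (m≤m+n 8 4088)) N′≤L)

  W-bound : ∀ {i a} → (i ≤ᵇ 300) ≡ true → Below U i a → a ≤ W
  W-bound {i} {a} p b = ≤-trans (bound (weaken-power {i} {300} {a} (≤ᵇ⇒≤ i 300 (subst T (sym p) tt)) b))
      (≤-reflexive W≡)

  E≤W : 8 * E + 32 ≤ W
  E≤W = W-bound {46} refl (below-+ (below-* {3} {42} (below-2^ 3) (below-≤ E≤L L-below))
      (weaken-power (m≤m+n 5 40) (below-2^ 5)))

  L≤W : L ≤ W
  L≤W = W-bound {42} refl L-below

  module _ {e lam : ℕ} (logs : Logarithms E e lam) where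
    open Logarithms logs
    open Parameters n t num den E e lam

    -- The origin of 24: Λ ≤ 2 (e + 8) ≤ 2 (ℓ + 11) = 2ℓ + 22 ≤ 24ℓ.
    Λ≤A : Λ ≤ A
    Λ≤A = ≤-trans Λ≤ (≤-trans (*-monoʳ-≤ 2 (+-monoˡ-≤ 8
        (log e (≤-trans 2^e≤2E (≤-trans (*-monoʳ-≤ 2 (≤-trans (≤-reflexive (sym E≡)) (*-monoʳ-≤ 4 E₀≤)))
        (≤-reflexive (lemma₁ (suc N′))))))))
      (≤-trans (≤-reflexive (lemma₂ ℓ)) (≤-trans (+-monoʳ-≤ (2 * ℓ) (*-monoʳ-≤ 22 1≤ℓ))
          (≤-trans (≤-reflexive (lemma₃ ℓ)) (*-monoˡ-≤ ℓ 24≤logFactor)))))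
      where
      lemma₁ : ∀ N → 2 * (4 * N) ≡ 8 * N
      lemma₁ = solve-∀
      lemma₂ : ∀ l → 2 * (3 + l + 8) ≡ 2 * l + 22 * 1
      lemma₂ = solve-∀
      lemma₃ : ∀ l → 2 * l + 22 * l ≡ 24 * l
      lemma₃ = solve-∀

    1≤Λ : 1 ≤ Λ
    1≤Λ = m^n>0 2 lam

    1≤picks : 1 ≤ picks
    1≤picks = *-mono-≤ (*-mono-≤ {1} {2} (s≤s z≤n) 1≤Λ) 1≤Λ

    P≤16N′ : P ≤ 16 * N′
    P≤16N′ = ≤-trans 2^e≤2E (≤-trans (*-monoʳ-≤ 2 E≤8N′) (≤-reflexive (sym (*-assoc 2 8 N′))))

    work≤ : 2 ^ D * (4 * N) ≤ L
    work≤ = begin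
      2 * Λ * (4 * (4 * (4 * (2 * Λ * Λ) * P)))   ≡⟨ lemma₁ Λ P ⟩
      256 * (Λ * Λ * Λ) * P                       ≤⟨ *-mono-≤ (*-monoʳ-≤ 256
          (*-mono-≤ (*-mono-≤ Λ≤A Λ≤A) Λ≤A)) P≤16N′ ⟩
      256 * (A * A * A) * (16 * N′)               ≡⟨ lemma₂ (A * A * A) N′ ⟩
      4096 * (A * A * A) * N′                     ≤⟨ *-monoˡ-≤ N′ (*-monoˡ-≤ (A * A * A) 4096≤sizeFactor) ⟩
      sizeFactor * (A * A * A) * N′               ∎
      where
      open ≤-Reasoning
      lemma₁ : ∀ l p → 2 * l * (4 * (4 * (4 * (2 * l * l) * p))) ≡ 256 * (l * l * l) * p
      lemma₁ = solve-∀
      lemma₂ : ∀ a n → 256 * a * (16 * n) ≡ 4096 * a * n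
      lemma₂ = solve-∀

    N≡′ : 2 ^ m ≡ N
    N≡′ = begin
      2 ^ (e + 2 * lam + 5)                    ≡⟨ ^-distribˡ-+-* 2 (e + 2 * lam) 5 ⟩
      2 ^ (e + 2 * lam) * 32                   ≡⟨ cong (_* 32) (^-distribˡ-+-* 2 e (2 * lam)) ⟩
      P * 2 ^ (2 * lam) * 32                   ≡⟨ cong (λ z → P * z * 32) (trans
          (cong (λ z → 2 ^ (lam + z)) (+-identityʳ lam)) (^-distribˡ-+-* 2 lam lam)) ⟩
      P * (Λ * Λ) * 32                         ≡⟨ lemma P Λ ⟩
      4 * (4 * (2 * Λ * Λ) * P)                ∎
      where
      open ≡-Reasoning
      lemma : ∀ p l → p * (l * l) * 32 ≡ 4 * (4 * (2 * l * l) * p)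
      lemma = solve-∀

    m<2Λ′ : m < 2 * Λ
    m<2Λ′ = begin-strict
      e + 2 * lam + 5         <⟨ +-monoʳ-< (e + 2 * lam) (m≤m+n 6 2) ⟩
      e + 2 * lam + 8         ≡⟨ lemma e (2 * lam) ⟩
      e + 8 + 2 * lam         ≤⟨ +-mono-≤ e+8≤Λ (2*m≤2^m lam) ⟩
      Λ + Λ                   ≡⟨ cong (Λ +_) (sym (+-identityʳ Λ)) ⟩
      2 * Λ                   ∎
      where
      open ≤-Reasoning
      lemma : ∀ e l → e + l + 8 ≡ e + 8 + l
      lemma = solve-∀

    2Q≤N′ : Q + Q ≤ N
    2Q≤N′ = begin
      M + picks + 1 + (M + picks + 1)             ≤⟨ +-mono-≤ (+-monoʳ-≤ (M + picks) 1≤picks)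
          (+-monoʳ-≤ (M + picks) 1≤picks) ⟩
      M + picks + picks + (M + picks + picks)     ≡⟨ lemma₁ M picks ⟩
      2 * M + 4 * picks                           ≤⟨ +-monoʳ-≤ (2 * M) (≤-trans
          (m≤m*n (4 * picks) P {{m^n≢0 2 e}}) (m≤m+n M (M + 0))) ⟩
      2 * M + 2 * M                               ≡⟨ lemma₂ M ⟩
      4 * M                                       ∎
      where
      open ≤-Reasoning
      lemma₁ : ∀ m p → m + p + p + (m + p + p) ≡ 2 * m + 4 * p
      lemma₁ = solve-∀
      lemma₂ : ∀ m → 2 * m + 2 * m ≡ 4 * m
      lemma₂ = solve-∀

    N≤L : N ≤ L
    N≤L = ≤-trans (≤-trans (m≤m+n N (3 * N)) (m≤n*m (4 * N) (2 ^ D) {{m^n≢0 2 D}})) work≤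

    -- Since Λ ≤ 2 (e + 8), this power is at most P^4 · 2^32 and fits into a word. Hence Λ has to
    -- stay linear in log P, although any larger Λ would do for the approximation.
    powers-below : Below U 200 (2 ^ (2 * Λ))
    powers-below = below-≤ bound′ (below-* {168} {32} (below-* {84} {84} (below-* {42} {42} P-below P-below)
        (below-* {42} {42} P-below P-below)) (below-2^ 32))
      where
      P-below : Below U 42 P
      P-below = below-≤ (≤-trans P≤16N′ (≤-trans (*-monoˡ-≤ N′ (m≤m+n 16 4080)) N′≤L)) L-below
      bound′ : 2 ^ (2 * Λ) ≤ P * P * (P * P) * 2 ^ 32
      bound′ = begin
        2 ^ (2 * Λ)                   ≤⟨ ^-monoʳ-≤ 2 (*-monoʳ-≤ 2 Λ≤) ⟩
        2 ^ (2 * (2 * (e + 8)))       ≡⟨ cong (2 ^_) (lemma e) ⟩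
        2 ^ (e + e + (e + e) + 32)    ≡⟨ ^-distribˡ-+-* 2 (e + e + (e + e)) 32 ⟩
        2 ^ (e + e + (e + e)) * 2 ^ 32 ≡⟨ cong (_* 2 ^ 32) (trans (^-distribˡ-+-* 2 (e + e) (e + e))
            (cong₂ _*_ (^-distribˡ-+-* 2 e e) (^-distribˡ-+-* 2 e e))) ⟩
        P * P * (P * P) * 2 ^ 32      ∎
        where
        open ≤-Reasoning
        lemma : ∀ e → 2 * (2 * (e + 8)) ≡ e + e + (e + e) + 32
        lemma = solve-∀

    -- The values of the convolution are the largest numbers of all; their exponent 296 decides the
    -- choice W = U^300.
    values≤ : 2 ^ (2 + 2 * (m + D) + (m + 2 * D)) ≤ W
    values≤ = W-bound {296} refl (below-≤ (≤-reflexive split) (below-* {128} {168}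
        (below-* {2} {126} (below-2^ 2) (below-* {84} {42} (below-* {42} {42} m-below m-below) m-below))
        (below-* {84} {84} (below-* {42} {42} D-below D-below) (below-* {42} {42} D-below D-below))))
      where
      m-below : Below U 42 (2 ^ m)
      m-below = below-≤ (≤-trans (≤-reflexive N≡′) N≤L) L-below
      D-below : Below U 42 (2 ^ D)
      D-below = below-≤ (≤-trans (m≤m*n (2 ^ D) (4 * N)
          {{>-nonZero (*-mono-≤ {1} {4} (s≤s z≤n) (subst (1 ≤_) N≡′ (m^n>0 2 m)))}}) work≤) L-below
      split : 2 ^ (2 + 2 * (m + D) + (m + 2 * D)) ≡ 2 ^ 2 * (2 ^ m * 2 ^ m * 2 ^ m) *
          (2 ^ D * 2 ^ D * (2 ^ D * 2 ^ D))
      split = begin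
        2 ^ (2 + 2 * (m + D) + (m + 2 * D))            ≡⟨ cong (2 ^_) (lemma m D) ⟩
        2 ^ (2 + (m + m + m) + (D + D + (D + D)))      ≡⟨ ^-distribˡ-+-* 2 (2 + (m + m + m))
            (D + D + (D + D)) ⟩
        2 ^ (2 + (m + m + m)) * 2 ^ (D + D + (D + D))  ≡⟨ cong₂ _*_ (^-distribˡ-+-* 2 2 (m + m + m))
            (^-distribˡ-+-* 2 (D + D) (D + D)) ⟩
        2 ^ 2 * 2 ^ (m + m + m) * (2 ^ (D + D) * 2 ^ (D + D))
          ≡⟨ cong₂ (λ a b → 2 ^ 2 * a * (b * b)) (trans (^-distribˡ-+-* 2 (m + m) m)
              (cong (_* 2 ^ m) (^-distribˡ-+-* 2 m m))) (^-distribˡ-+-* 2 D D) ⟩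
        2 ^ 2 * (2 ^ m * 2 ^ m * 2 ^ m) * (2 ^ D * 2 ^ D * (2 ^ D * 2 ^ D)) ∎
        where
        open ≡-Reasoning
        lemma : ∀ m D → 2 + 2 * (m + D) + (m + 2 * D) ≡ 2 + (m + m + m) + (D + D + (D + D))
        lemma = solve-∀

    resources-fit : Fits W L S
    resources-fit = record
      { 1≤m = ≤-trans (m≤n+m 1 (e + 2 * lam)) (+-monoʳ-≤ (e + 2 * lam) (m≤m+n 1 4))
      ; m≤2^D = <⇒≤ m<2Λ′
      ; N≡ = N≡′
      ; 2Q≤N = 2Q≤N′
      ; m<2Λ = m<2Λ′
      ; work≤L = work≤
      ; n≤L = ≤-trans n≤N′ (≤-trans (m≤n*m N′ 4096) N′≤L)
      ; picks≤S = *-mono-≤ (*-monoʳ-≤ 2 Λ≤A) Λ≤A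
      ; 2Λ≤picks = m≤m*n (2 * Λ) Λ {{m^n≢0 2 lam}}
      ; D≤m = ≤-trans (+-mono-≤ (m≤m+n 1 4) (≤-trans (m≤m+n lam (lam + 0)) (m≤n+m (2 * lam) e)))
          (≤-reflexive (+-comm 5 (e + 2 * lam)))
      ; L≤W = L≤W
      ; S≤L = S≤L
      ; powers≤W = W-bound {200} refl powers-below
      ; values≤W = values≤ }

    cmax-below : Below U 202 (2 ^ Λ * (t + 1))
    cmax-below = below-* {200} {2} (below-≤ (^-monoʳ-≤ 2 (m≤m+n Λ (Λ + 0))) powers-below)
      (below-+ (below-≤ t≤U U-below) (below-≤ (≤-trans (n≤1+n 1) 2≤U) U-below))
      where
      U-below : Below U 1 U
      U-below = below-power (≤-reflexive (sym (^-identityʳ U)))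

    items-fit : ∀ (X : ℕ → ℕ) → (∀ i → X i ≤ U) → ∀ i → 2 ^ Λ * (t + 1) * X i * M ≤ W
    items-fit X X≤U i = W-bound {245} refl (below-* {203} {42} (below-* {202} {1} cmax-below
        (below-power (≤-trans (X≤U i) (≤-reflexive (sym (^-identityʳ U))))))
      (below-≤ (≤-trans (m≤m+n M (3 * M)) N≤L) L-below))

    total-fit : picks * (2 ^ Λ * (t + 1)) ≤ W
    total-fit = W-bound {244} refl (below-* {42} {202}
        (below-≤ (≤-trans (*-mono-≤ (*-monoʳ-≤ 2 Λ≤A) Λ≤A) S≤L) L-below) cmax-below)

-- From natural numbers to rationals

module Rationals where
  open import Data.Integer.Base as ℤ using (ℤ; +_; -[1+_]; +[1+_])
  import Data.Integer.Properties as ℤ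
  open import Data.Integer.Tactic.RingSolver using () renaming (solve-∀ to ℤsolve-∀)
  open import Data.Rational.Base using (mkℚ; toℚᵘ; fromℚᵘ; ↧ₙ_)
  import Data.Rational.Properties as ℚ
  open import Data.Rational.Unnormalised.Base as ℚᵘ using (ℚᵘ; mkℚᵘ; *≤*)
  import Data.Rational.Unnormalised.Properties as ℚᵘ

  fraction : ∀ ε .{{_ : Positive ε}} → 0 < numerator ε
  fraction (mkℚ +[1+ a ] b _) = z<s

  -- The ceiling of 1/ε unfolds to a negated floor of -1/ε, and the integer division of a negative
  -- number distinguishes whether there is a remainder.
  quotient-bounds : ∀ a b → let c = ℤ.∣ -[1+ b ] ℤ./ℕ suc a ∣ in
    suc b / suc a ≤ c × c ≤ suc b + 1 × 1 ≤ c
  quotient-bounds a b with suc b % suc a in eq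
  ... | zero rewrite ℤ.∣-i∣≡∣i∣ (+ (suc b / suc a)) =
    ≤-refl , ≤-trans (m/n≤m (suc b) (suc a)) (m≤m+n (suc b) 1) ,
    n≢0⇒n>0 (λ z → contradiction (trans (m≡m%n+[m/n]*n (suc b) (suc a)) (cong₂ (λ p q → p + q * suc a) eq z))
        λ ())
  ... | suc r =
    n≤1+n (suc b / suc a) , ≤-trans (s≤s (m/n≤m (suc b) (suc a))) (≤-reflexive (+-comm 1 (suc b))) , s≤s z≤n

  reciprocal-bounds : ∀ ε .{{_ : Positive ε}} →
    quo (↧ₙ ε) (numerator ε) ≤ ⌈1/ ε ⌉ × ⌈1/ ε ⌉ ≤ ↧ₙ ε + 1 × 1 ≤ ⌈1/ ε ⌉
  reciprocal-bounds (mkℚ +[1+ a ] b _) =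
    subst (λ c → suc b / suc a ≤ c × c ≤ suc b + 1 × 1 ≤ c) (sym same) (quotient-bounds a b)
    where
    q = -[1+ b ] ℤ./ℕ suc a
    same : ℤ.∣ ℤ.- (+ 1 ℤ.* q) ∣ ≡ ℤ.∣ q ∣
    same = trans (ℤ.∣-i∣≡∣i∣ (+ 1 ℤ.* q)) (cong ℤ.∣_∣ (ℤ.*-identityˡ q))

  toℚᵘ-ℕ : ∀ k → toℚᵘ (ℕ→ℚ k) ℚᵘ.≃ mkℚᵘ (+ k) 0
  toℚᵘ-ℕ k = ℚ.toℚᵘ-fromℚᵘ (mkℚᵘ (+ k) 0)

  lower-ℚ : ∀ ε .{{_ : Positive ε}} opt out → ↧ₙ ε * opt ≤ ↧ₙ ε * out + numerator ε * opt →
            (1ℚ ℚ.- ε) ℚ.* ℕ→ℚ opt ℚ.≤ ℕ→ℚ out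
  lower-ℚ ε@(mkℚ +[1+ a ] b _) opt out p = ℚ.toℚᵘ-cancel-≤ (ℚᵘ.≤-respˡ-≃ (ℚᵘ.≃-sym left)
      (ℚᵘ.≤-respʳ-≃ (ℚᵘ.≃-sym (toℚᵘ-ℕ out)) (*≤* goal)))
    where
    ε′ = mkℚᵘ +[1+ a ] b
    left : toℚᵘ ((1ℚ ℚ.- ε) ℚ.* ℕ→ℚ opt) ℚᵘ.≃ (mkℚᵘ (+ 1) 0 ℚᵘ.+ (ℚᵘ.- ε′)) ℚᵘ.* mkℚᵘ (+ opt) 0
    left = ℚᵘ.≃-trans (ℚ.toℚᵘ-homo-* (1ℚ ℚ.- ε) (ℕ→ℚ opt)) (ℚᵘ.*-cong (ℚ.toℚᵘ-homo-+ 1ℚ (ℚ.- ε)) (toℚᵘ-ℕ opt))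
    open ℤ.≤-Reasoning
    D N : ℤ
    D = + suc b
    N = + suc a
    expand : ∀ D N o → (+ 1 ℤ.* D ℤ.+ (ℤ.- N) ℤ.* + 1) ℤ.* o ℤ.* + 1 ≡ D ℤ.* o ℤ.- N ℤ.* o
    expand = ℤsolve-∀
    cancel : ∀ x y → x ℤ.+ y ℤ.- y ≡ x
    cancel = ℤsolve-∀
    goal : (+ 1 ℤ.* D ℤ.+ (ℤ.- N) ℤ.* + 1) ℤ.* + opt ℤ.* + 1 ℤ.≤ + out ℤ.* + (1 * suc b * 1)
    goal = begin
      (+ 1 ℤ.* D ℤ.+ (ℤ.- N) ℤ.* + 1) ℤ.* + opt ℤ.* + 1  ≡⟨ expand D N (+ opt) ⟩
      D ℤ.* + opt ℤ.- N ℤ.* + opt                        ≡⟨ cong₂ ℤ._-_ (sym (ℤ.pos-* (suc b) opt))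
          (sym (ℤ.pos-* (suc a) opt)) ⟩
      + (suc b * opt) ℤ.- + (suc a * opt)                ≤⟨ ℤ.+-monoˡ-≤ (ℤ.- + (suc a * opt)) (ℤ.+≤+ p) ⟩
      + (suc b * out + suc a * opt) ℤ.- + (suc a * opt)  ≡⟨ cancel (+ (suc b * out)) (+ (suc a * opt)) ⟩
      + (suc b * out)                                    ≡⟨ cong +_ (trans (*-comm (suc b) out)
          (cong (out *_) (sym (trans (*-identityʳ (1 * suc b)) (*-identityˡ (suc b)))))) ⟩
      + (out * (1 * suc b * 1))                          ≡⟨ ℤ.pos-* out (1 * suc b * 1) ⟩
      + out ℤ.* + (1 * suc b * 1)                        ∎

  upper-ℚ : ∀ ε .{{_ : Positive ε}} t out → ↧ₙ ε * out ≤ (↧ₙ ε + numerator ε) * t →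
            ℕ→ℚ out ℚ.≤ (1ℚ ℚ.+ ε) ℚ.* ℕ→ℚ t
  upper-ℚ ε@(mkℚ +[1+ a ] b _) t out p = ℚ.toℚᵘ-cancel-≤ (ℚᵘ.≤-respʳ-≃ (ℚᵘ.≃-sym right)
      (ℚᵘ.≤-respˡ-≃ (ℚᵘ.≃-sym (toℚᵘ-ℕ out)) (*≤* goal)))
    where
    ε′ = mkℚᵘ +[1+ a ] b
    right : toℚᵘ ((1ℚ ℚ.+ ε) ℚ.* ℕ→ℚ t) ℚᵘ.≃ (mkℚᵘ (+ 1) 0 ℚᵘ.+ ε′) ℚᵘ.* mkℚᵘ (+ t) 0
    right = ℚᵘ.≃-trans (ℚ.toℚᵘ-homo-* (1ℚ ℚ.+ ε) (ℕ→ℚ t)) (ℚᵘ.*-cong (ℚ.toℚᵘ-homo-+ 1ℚ ε) (toℚᵘ-ℕ t))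
    open ℤ.≤-Reasoning
    D N : ℤ
    D = + suc b
    N = + suc a
    expand : ∀ D N o → D ℤ.* o ℤ.+ N ℤ.* o ≡ (+ 1 ℤ.* D ℤ.+ N ℤ.* + 1) ℤ.* o ℤ.* + 1
    expand = ℤsolve-∀
    goal : + out ℤ.* + (1 * suc b * 1) ℤ.≤ (+ 1 ℤ.* D ℤ.+ N ℤ.* + 1) ℤ.* + t ℤ.* + 1
    goal = begin
      + out ℤ.* + (1 * suc b * 1)                 ≡⟨ ℤ.pos-* out (1 * suc b * 1) ⟨
      + (out * (1 * suc b * 1))                   ≡⟨ cong +_
          (trans (cong (out *_) (trans (*-identityʳ (1 * suc b)) (*-identityˡ (suc b))))
          (*-comm out (suc b))) ⟩
      + (suc b * out)                             ≤⟨ ℤ.+≤+ p ⟩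
      + ((suc b + suc a) * t)                     ≡⟨ cong +_ (*-distribʳ-+ t (suc b) (suc a)) ⟩
      + (suc b * t) ℤ.+ + (suc a * t)             ≡⟨ cong₂ ℤ._+_ (ℤ.pos-* (suc b) t) (ℤ.pos-* (suc a) t) ⟩
      D ℤ.* + t ℤ.+ N ℤ.* + t                     ≡⟨ expand D N (+ t) ⟩
      (+ 1 ℤ.* D ℤ.+ N ℤ.* + 1) ℤ.* + t ℤ.* + 1   ∎

-- Input arrays and the optimum

array-< : ∀ {n} (x : Vector ℕ n) i → array x (toℕ i) ≡ x i
array-< {n} x i with toℕ i <? n
... | yes p = cong x (fromℕ<-toℕ i p)
... | no p  = contradiction (toℕ<n i) p

array-≥ : ∀ {n} (x : Vector ℕ n) a → n ≤ a → array x a ≡ 0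
array-≥ {n} x a n≤a with a <? n
... | yes p = contradiction p (≤⇒≯ n≤a)
... | no _  = refl

array-∃ : ∀ {n} (x : Vector ℕ n) {a} → a < n → ∃ λ i → toℕ i ≡ a × array x a ≡ x i
array-∃ {n} x {a} p with a <? n
... | yes q = fromℕ< q , toℕ-fromℕ< q , refl
... | no q  = contradiction p q

largest-≥ : ∀ {n} (x : Vector ℕ n) i → x i ≤ Data.Vec.Functional.foldr _⊔_ 0 x
largest-≥ x zero    = m≤m⊔n (x zero) _
largest-≥ x (suc i) = ≤-trans (largest-≥ (x ∘ suc) i) (m≤n⊔m (x zero) _)

Σ-∑ : ∀ {n} (x y : Vector ℕ n) (f : ℕ → ℕ) → (∀ i → x i * y i ≡ f (toℕ i)) → Σ⟨ x , y ⟩ ≡ ∑ n f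
Σ-∑ {zero}  x y f p = refl
Σ-∑ {suc n} x y f p = cong₂ _+_ (p zero) (Σ-∑ (x ∘ suc) (y ∘ suc) (f ∘ suc) (p ∘ suc))

-- Filling the target with copies of one item uses more than half of it.
t≤2·OPT : ∀ {n} (x : Vector ℕ n) t → (∀ i → 0 < x i) → OPT x t ≡ 0 ⊎ t ≤ 2 * OPT x t
t≤2·OPT {n} x t 0<x with OPT x t ≟ 0
... | yes z = inj₁ z
... | no z with optimum x t
...   | v , (y , refl , v≤t) , max with ∑≢0 n (λ i → array x i * array y i) (λ q → z
    (trans (Σ-∑ x y _ (λ i → sym (cong₂ _*_ (array-< x i) (array-< y i)))) q))
...     | a , a<n , nz with array-∃ x a<n
...       | i , refl , xi≡ = inj₂ (≤-trans (<⇒≤ (<-quo t (0<x i)))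
    (≤-trans (≤-trans (*-monoˡ-≤ (x i) (+-monoˡ-≤ k 1≤k)) (≤-reflexive (lemma k (x i)))) (*-monoʳ-≤ 2 full)))
  where
  lemma : ∀ k x → (k + k) * x ≡ 2 * (k * x)
  lemma = solve-∀
  k = quo t (x i)
  f = (λ _ → 0) [ toℕ i ≔ k ]
  sum≡ : Σ⟨ x , f ∘ toℕ ⟩ ≡ k * x i
  sum≡ = begin
    Σ⟨ x , f ∘ toℕ ⟩                 ≡⟨ Σ-∑ x (f ∘ toℕ) (λ j → array x j * f j)
        (λ j → cong (_* f (toℕ j)) (sym (array-< x j))) ⟩
    ∑ n (λ j → array x j * f j)      ≡⟨ ∑-update n (array x) (λ _ → 0) (toℕ i) k (toℕ<n i) ⟩
    ∑ n (λ j → array x j * 0) + array x (toℕ i) * k ≡⟨ cong₂ _+_ (∑-zero n λ j _ → *-zeroʳ (array x j))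
        (cong (_* k) (array-< x i)) ⟩
    x i * k                          ≡⟨ *-comm (x i) k ⟩
    k * x i                          ∎
    where open ≡-Reasoning
  full : k * x i ≤ Σ⟨ x , y ⟩
  full = max (k * x i) (f ∘ toℕ , sum≡ , quo-*-≤ t (x i))
  xi≤t : x i ≤ t
  xi≤t = ≤-trans (≤-trans (≤-trans (≤-reflexive (sym xi≡)) (m≤m*n (array x (toℕ i)) (array y (toℕ i))
      {{>-nonZero (n≢0⇒n>0 λ q → nz (trans (cong (array x (toℕ i) *_) q) (*-zeroʳ (array x (toℕ i)))))}}))
      (≤-trans (∑-≥ n (λ i → array x i * array y i) (toℕ<n i))
          (≤-reflexive (sym (Σ-∑ x y _ (λ i → sym (cong₂ _*_ (array-< x i) (array-< y i)))))))) v≤t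
  1≤k : 1 ≤ k
  1≤k = quo-≥ 1 t (0<x i) (≤-trans (≤-reflexive (*-identityˡ (x i))) xi≤t)

-- Assembling the algorithm

fetch-end : ∀ (P : Program) → fetch P (length P + 0) ≡ nothing
fetch-end []      = refl
fetch-end (_ ∷ P) = fetch-end P

module Run {n : ℕ} (x : Vector ℕ n) (t : ℕ) (ε : ℚ) (W L S B : ℕ) (2≤W : 2 ≤ W) (1≤S : 1 ≤ S) (1≤L : 1 ≤ L)
    where
  open Hoare W n (limits S L)

  initial : St
  initial = st (inputRegs x t ε) (array x) (λ _ _ → 0)

  run : ∀ c {P w i j z} {Q : St → Set} → compile c 0 ≡ P → weight c ≡ w → shortDegree c ≡ i → longDegree c ≡
      j →
    sizeCmd c ≡ z → wf c ≡ true → W ^ z ≤ B → Bounded initial → Ends c initial Q →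
    ∃₂ λ T s → (P , B ⊢ input x t ε ⇓[ T ] s) × T ≤ w * (S ^ i * L ^ j) ×
      ∃ λ s′ → Q s′ × (∀ i → i ≤ n → State.mem s i ≡ io s′ i)
  run c {Q = Q} refl refl refl refl refl w fits bd (ends {s′} trace q) =
      finish (run-cmd 2≤W trace w (codeAt-self (compile c 0)) start bd fits)
    where
    start : Rel n initial (inputRegs x t ε) (array x)
    start = rel (λ _ _ → refl) (λ _ _ → refl) (λ k i _ → array-≥ x (address n k i) (<⇒≤ (n<address n k i)))
        refl
    finish : CmdRun 2≤W (compile c 0) (cost (limits S L) c) 0 s′ (inputRegs x t ε) (array x) →
      ∃₂ λ T s → (compile c 0 , B ⊢ input x t ε ⇓[ T ] s) × T ≤ weight c * (S ^ shortDegree c * L ^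
          longDegree c) ×
        ∃ λ s′ → Q s′ × (∀ i → i ≤ n → State.mem s i ≡ io s′ i)
    finish (cmdRun {ρ} {μ} {T} r time≤ related) =
      T + 0 , state (length (compile c 0) + 0) ρ μ , Reach.before r (halt (fetch-end (compile c 0))) ,
      ≤-trans (≤-reflexive (+-identityʳ T)) (≤-trans time≤ (cost-≤ 1≤S 1≤L c)) , s′ , q , Rel.ios related

power-* : ∀ a b k → (a * b) ^ k ≡ a ^ k * b ^ k
power-* a b zero    = refl
power-* a b (suc k) = trans (cong (a * b *_) (power-* a b k)) (lemma a b (a ^ k) (b ^ k))
  where lemma : ∀ a b c d → a * b * (c * d) ≡ a * c * (b * d)
        lemma = solve-∀

power-fits : ∀ U {W B} a s → U ^ a ≡ W → U ^ (a * s) ≡ B → W ^ s ≤ B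
power-fits U a s refl refl = ≤-reflexive (^-*-assoc U a s)

-- The origin of the exponent 9: S is quadratic in the logarithm and occurs with power 3, L is cubic
-- in it and occurs once.
time-power : ∀ w a b l n → w * ((2 * (a * l) * (a * l)) ^ 3 * (b * (a * l * (a * l) * (a * l)) * n) ^ 1) ≡
             w * (8 * b * a ^ 9) * (n * l ^ 9)
time-power w a b l n = begin
  w * ((2 * A * A) ^ 3 * (b * (A * A * A) * n) ^ 1) ≡⟨ lemma₁ w A b n ⟩
  w * (8 * b * (n * A ^ 9))                         ≡⟨ cong (λ z → w * (8 * b * (n * z))) (power-* a l 9) ⟩
  w * (8 * b * (n * (a ^ 9 * l ^ 9)))               ≡⟨ lemma₂ w (8 * b) n (a ^ 9) (l ^ 9) ⟩
  w * (8 * b * a ^ 9) * (n * l ^ 9)                 ∎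
  where
  open ≡-Reasoning
  A = a * l
  lemma₁ : ∀ w a b n → w * (2 * a * a * (2 * a * a * (2 * a * a * 1)) * (b * (a * a * a) * n * 1)) ≡
           w * (8 * b * (n * (a * (a * (a * (a * (a * (a * (a * (a * (a * 1)))))))))))
  lemma₁ = solve-∀
  lemma₂ : ∀ w c n d l → w * (c * (n * (d * l))) ≡ w * (c * d) * (n * l)
  lemma₂ = solve-∀

-- The large numbers are parameters so that they are not unfolded.
module Algorithm {n : ℕ} (x : Vector ℕ n) (t : ℕ) (ε : ℚ) .{{_ : Positive ε}} (0<x : ∀ i → 0 < x i)
    (0<t : 0 < t)
  (P : Program) (w z U W E B C : ℕ) (P≡ : compile program 0 ≡ P) (w≡ : weight program ≡ w)
      (z≡ : sizeCmd program ≡ z)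
  (U≡ : 2 + largestInput x t ε ≡ U) (W≡ : U ^ 300 ≡ W)
  (E≡ : 4 * (quo (ℚ.↧ₙ ε) (numerator ε) + 1) ≡ E) (B≡ : U ^ (300 * z) ≡ B)
  (C≡ : w * (8 * sizeFactor * logFactor ^ 9) ≡ C) where
  open Rationals

  num den N′ ℓ opt : ℕ
  num = numerator ε
  den = ℚ.↧ₙ ε
  N′ = n + ⌈1/ ε ⌉
  ℓ = ⌈log₂ suc N′ ⌉
  opt = OPT x t

  X : ℕ → ℕ
  X = array x

  private
    E₀ = quo den num + 1
    a₁ = n
    a₂ = a₁ ⊔ t
    a₃ = a₂ ⊔ num
    a₄ = a₃ ⊔ den
    largest = largestInput x t ε

  den≤largest : den ≤ largest
  den≤largest = ≤-trans (m≤n⊔m a₃ den) (m≤m⊔n a₄ _)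

  num≤largest : num ≤ largest
  num≤largest = ≤-trans (m≤n⊔m a₂ num) (≤-trans (m≤m⊔n a₃ den) (m≤m⊔n a₄ _))

  t≤largest : t ≤ largest
  t≤largest = ≤-trans (m≤n⊔m a₁ t) (≤-trans (m≤m⊔n a₂ num) (≤-trans (m≤m⊔n a₃ den) (m≤m⊔n a₄ _)))

  n≤largest : n ≤ largest
  n≤largest = ≤-trans (m≤m⊔n a₁ t) (≤-trans (m≤m⊔n a₂ num) (≤-trans (m≤m⊔n a₃ den) (m≤m⊔n a₄ _)))

  X≤largest : ∀ a → X a ≤ largest
  X≤largest a with a <? n
  ... | yes p = ≤-trans (largest-≥ x (fromℕ< p)) (m≤n⊔m a₄ _)
  ... | no _  = z≤n

  largest≤U : largest ≤ U
  largest≤U = ≤-trans (m≤n+m largest 2) (≤-reflexive U≡)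

  2≤U : 2 ≤ U
  2≤U = ≤-trans (m≤m+n 2 largest) (≤-reflexive U≡)

  1≤N′ : 1 ≤ N′
  1≤N′ = ≤-trans (proj₂ (proj₂ (reciprocal-bounds ε))) (m≤n+m ⌈1/ ε ⌉ n)

  E₀≤ : E₀ ≤ suc N′
  E₀≤ = ≤-trans (≤-reflexive (+-comm (quo den num) 1))
      (s≤s (≤-trans (proj₁ (reciprocal-bounds ε)) (m≤n+m ⌈1/ ε ⌉ n)))

  log : ∀ e → 2 ^ e ≤ 8 * suc N′ → e ≤ 3 + ℓ
  log e p = subst₂ _≤_ (⌈log₂2^n⌉≡n e) log8 (⌈log₂⌉-mono-≤ p)
    where
    log8 : ⌈log₂ 8 * suc N′ ⌉ ≡ 3 + ℓ
    log8 = trans (cong ⌈log₂_⌉ (lemma (suc N′)))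
      (trans (⌈log₂2*n⌉≡1+⌈log₂n⌉ (2 * (2 * suc N′)))
          (cong suc (trans (⌈log₂2*n⌉≡1+⌈log₂n⌉ (2 * suc N′)) (cong suc (⌈log₂2*n⌉≡1+⌈log₂n⌉ (suc N′))))))
      where lemma : ∀ a → 8 * a ≡ 2 * (2 * (2 * a))
            lemma = solve-∀

  ℓ≤ : ℓ ≤ suc N′
  ℓ≤ = subst (ℓ ≤_) (⌈log₂2^n⌉≡n (suc N′)) (⌈log₂⌉-mono-≤ (<⇒≤ (m<2^m (suc N′))))

  1≤ℓ : 1 ≤ ℓ
  1≤ℓ = ⌈log₂⌉-mono-≤ {2} {suc N′} (s≤s 1≤N′)

  N′≤U³ : N′ ≤ U ^ 3
  N′≤U³ = begin
    n + ⌈1/ ε ⌉                    ≤⟨ +-mono-≤ n≤largest (≤-trans (proj₁ (proj₂ (reciprocal-bounds ε)))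
        (+-monoˡ-≤ 1 den≤largest)) ⟩
    largest + (largest + 1)        ≤⟨ +-mono-≤ largest≤U
        (≤-trans (≤-trans (≤-reflexive (+-comm largest 1)) (n≤1+n (1 + largest))) (≤-reflexive U≡)) ⟩
    U + U                          ≤⟨ m+n≤m*n {W = 2} {n = 0} {limit = λ _ → 0} ≤-refl 2≤U 2≤U ⟩
    U * U                          ≤⟨ m≤m*n (U * U) U {{>-nonZero (<-≤-trans z<s 2≤U)}} ⟩
    U * U * U                      ≡⟨ lemma U ⟩
    U * (U * (U * 1))              ∎
    where
    open ≤-Reasoning
    lemma : ∀ u → u * u * u ≡ u * (u * (u * 1))
    lemma = solve-∀

  module R = Resources n t num den ℓ N′ U W E W≡ E≡ 2≤U (≤-trans n≤largest largest≤U)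
      (≤-trans t≤largest largest≤U)
    (m≤m+n n ⌈1/ ε ⌉) 1≤ℓ 1≤N′ log E₀≤ ℓ≤ N′≤U³
  open R using (S; L)

  U≤W : U ≤ W
  U≤W = R.W-bound {1} refl (below-power (≤-reflexive (sym (^-identityʳ U))))

  2≤W : 2 ≤ W
  2≤W = ≤-trans 2≤U U≤W

  1≤S : 1 ≤ S
  1≤S = *-mono-≤ (*-mono-≤ {1} {2} (s≤s z≤n) 1≤A) 1≤A
    where 1≤A = *-mono-≤ (≤-trans (m≤m+n 1 23) 24≤logFactor) 1≤ℓ

  1≤L : 1 ≤ L
  1≤L = ≤-trans 1≤S R.S≤L

  items≤W : ∀ {e lam} → Logarithms E e lam → ∀ i → 2 ^ 2 ^ lam * (t + 1) * X i * Parameters.M n t num den E e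
      lam ≤ W
  items≤W logs = R.items-fit logs X (λ i → ≤-trans (X≤largest i) largest≤U)

  open Hoare W n (limits S L) using (Bounded; bounded; Ends)
  module Phase = ParameterPhase W n L S t num den E E≡
  open Run x t ε W L S B 2≤W 1≤S 1≤L

  initial-bounded : Bounded initial
  initial-bounded = bounded regs (λ i → ≤-trans (X≤largest i) (≤-trans largest≤U U≤W)) (λ _ _ → z≤n)
    where
    regs : ∀ r → inputRegs x t ε r ≤ W
    regs 0 = ≤-trans n≤largest (≤-trans largest≤U U≤W)
    regs 1 = ≤-trans t≤largest (≤-trans largest≤U U≤W)
    regs 2 = ≤-trans num≤largest (≤-trans largest≤U U≤W)
    regs 3 = ≤-trans den≤largest (≤-trans largest≤U U≤W)
    regs (suc (suc (suc (suc _)))) = z≤n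

  Result : St → Set
  Result = Phase.Outcome R.E≤L R.E≤W X 0<t R.resources-fit items≤W R.total-fit

  program-run : Ends program initial Result
  program-run = Phase.program-ends R.E≤L R.E≤W X 0<t R.resources-fit items≤W R.total-fit initial
      initial-bounded
    refl refl refl refl (λ _ → refl) (array-≥ x) (λ _ _ → refl)

  fits : W ^ z ≤ B
  fits = power-fits U 300 z W≡ B≡

  time-bound : w * (S ^ 3 * L ^ 1) ≡ polylogTimes C 9 (n + ⌈1/ ε ⌉)
  time-bound = trans (time-power w logFactor sizeFactor ℓ N′) (cong (_* (N′ * ℓ ^ 9)) C≡)

  Guarantee : ℕ → Set
  Guarantee out = (1ℚ ℚ.- ε) ℚ.* ℕ→ℚ opt ℚ.≤ ℕ→ℚ out × ℕ→ℚ out ℚ.≤ (1ℚ ℚ.+ ε) ℚ.* ℕ→ℚ t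

  -- For OPT > 0 the loss 5t/(4P) is at most 10 OPT/(4P), and P ≥ 4/ε, in the form 16 den ≤ 4P num,
  -- makes this at most ε OPT. The excess 2t/(4P) is at most ε t for the same reason.
  guarantee-ℕ : ∀ e out → E ≤ 2 ^ e → 4 * 2 ^ e * opt ≤ 4 * 2 ^ e * out + 5 * t → 4 * 2 ^ e * out ≤
      (4 * 2 ^ e + 2) * t → Guarantee out
  guarantee-ℕ e out E≤P low high = lower-ℚ ε opt out (low-den (t≤2·OPT x t 0<x)) , upper-ℚ ε t out high-den
    where
    open ≤-Reasoning
    p = 2 ^ e
    instance
      4p≢0 : NonZero (4 * p)
      4p≢0 = m*n≢0 4 p {{_}} {{m^n≢0 2 e}}
    den≤ : den ≤ E₀ * num
    den≤ = ≤-trans (<⇒≤ (<-quo den (fraction ε))) (≤-reflexive (cong (_* num) (+-comm 1 (quo den num))))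
    16den≤ : 16 * den ≤ 4 * p * num
    16den≤ = begin
      16 * den                   ≤⟨ *-monoʳ-≤ 16 den≤ ⟩
      16 * (E₀ * num)            ≡⟨ lemma E₀ num ⟩
      4 * (4 * E₀) * num         ≤⟨ *-monoˡ-≤ num (*-monoʳ-≤ 4 (≤-trans (≤-reflexive E≡) E≤P)) ⟩
      4 * p * num                ∎
      where lemma : ∀ e n → 16 * (e * n) ≡ 4 * (4 * e) * n
            lemma = solve-∀
    low-den : opt ≡ 0 ⊎ t ≤ 2 * opt → den * opt ≤ den * out + num * opt
    low-den (inj₁ z) = ≤-trans (≤-reflexive (trans (cong (den *_) z) (*-zeroʳ den))) z≤n
    low-den (inj₂ t≤) = *-cancelˡ-≤ (4 * p) (begin
      4 * p * (den * opt)                       ≡⟨ lemma₁ (4 * p) den opt ⟩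
      den * (4 * p * opt)                       ≤⟨ *-monoʳ-≤ den (≤-trans low
          (+-monoʳ-≤ (4 * p * out) (*-monoʳ-≤ 5 t≤))) ⟩
      den * (4 * p * out + 5 * (2 * opt))       ≡⟨ lemma₂ den (4 * p) out opt ⟩
      4 * p * (den * out) + 10 * den * opt      ≤⟨ +-monoʳ-≤ (4 * p * (den * out))
          (*-monoˡ-≤ opt (≤-trans (*-monoˡ-≤ den (m≤m+n 10 6)) 16den≤)) ⟩
      4 * p * (den * out) + 4 * p * num * opt   ≡⟨ lemma₃ (4 * p) (den * out) num opt ⟩
      4 * p * (den * out + num * opt)           ∎)
      where
      lemma₁ : ∀ p d o → p * (d * o) ≡ d * (p * o)
      lemma₁ = solve-∀
      lemma₂ : ∀ d p u o → d * (p * u + 5 * (2 * o)) ≡ p * (d * u) + 10 * d * o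
      lemma₂ = solve-∀
      lemma₃ : ∀ p a n o → p * a + p * n * o ≡ p * (a + n * o)
      lemma₃ = solve-∀
    high-den : den * out ≤ (den + num) * t
    high-den = *-cancelˡ-≤ (4 * p) (begin
      4 * p * (den * out)                       ≡⟨ lemma₁ (4 * p) den out ⟩
      den * (4 * p * out)                       ≤⟨ *-monoʳ-≤ den high ⟩
      den * ((4 * p + 2) * t)                   ≡⟨ lemma₂ den (4 * p) t ⟩
      4 * p * (den * t) + 2 * den * t           ≤⟨ +-monoʳ-≤ (4 * p * (den * t))
          (*-monoˡ-≤ t (≤-trans (*-monoˡ-≤ den (m≤m+n 2 14)) 16den≤)) ⟩
      4 * p * (den * t) + 4 * p * num * t       ≡⟨ lemma₃ (4 * p) den num t ⟩
      4 * p * ((den + num) * t)                 ∎)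
      where
      lemma₁ : ∀ p d o → p * (d * o) ≡ d * (p * o)
      lemma₁ = solve-∀
      lemma₂ : ∀ d p t → d * ((p + 2) * t) ≡ p * (d * t) + 2 * d * t
      lemma₂ = solve-∀
      lemma₃ : ∀ p d n t → p * (d * t) + p * n * t ≡ p * ((d + n) * t)
      lemma₃ = solve-∀

  0<X : ∀ i → i < n → 0 < X i
  0<X i i<n with array-∃ x i<n
  ... | j , _ , q = subst (0 <_) (sym q) (0<x j)

  result-guarantee : ∀ s → Result s → Guarantee (∑ n (λ i → X i * io s i))
  result-guarantee s (Phase.outcome e lam logs E≤P (MainVerification.solution own best zero∈ items∈ best∈
      best-max low high)) =
    guarantee-ℕ e (∑ n (λ i → X i * io s i)) E≤P (proj₁ bounds) (proj₂ bounds)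
    where
    open Logarithms logs
    module Ap = Approximation n t num den E e lam X 0<t 0<X e+8≤Λ
    y = proj₁ (proj₁ (proj₂ (optimum x t)))
    y-sum : ∑ n (λ i → X i * array y i) ≡ opt
    y-sum = trans (sym (Σ-∑ x y _ (λ i → sym (cong₂ _*_ (array-< x i) (array-< y i)))))
        (proj₁ (proj₂ (proj₁ (proj₂ (optimum x t)))))
    selected : Ap.Selection opt
    selected = subst Ap.Selection y-sum (Ap.select (array y) (subst (_≤ t) (sym y-sum)
        (proj₂ (proj₂ (proj₁ (proj₂ (optimum x t)))))))
    bounds = Ap.guarantee own (m≤n+m 1 (Parameters.M n t num den E e lam + Parameters.picks n t num den E e
        lam)) zero∈ items∈
      best (∑ n (λ i → X i * io s i)) opt selected best∈ best-max low high

  correct : ∃[ T ] ∃[ s ]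
    (P , B ⊢ input x t ε ⇓[ T ] s)
    × T ≤ polylogTimes C 9 (n + ⌈1/ ε ⌉)
    × (1ℚ ℚ.- ε) ℚ.* ℕ→ℚ (OPT x t) ℚ.≤ ℕ→ℚ Σ⟨ x , output s ⟩
    × ℕ→ℚ Σ⟨ x , output s ⟩ ℚ.≤ (1ℚ ℚ.+ ε) ℚ.* ℕ→ℚ t
  correct = finish (run program P≡ w≡ refl refl z≡ program-wf fits initial-bounded program-run)
    where
    finish : (∃₂ λ T s → (P , B ⊢ input x t ε ⇓[ T ] s) × T ≤ w * (S ^ 3 * L ^ 1) ×
                ∃ λ s′ → Result s′ × (∀ i → i ≤ n → State.mem s i ≡ io s′ i)) →
      ∃[ T ] ∃[ s ]
      (P , B ⊢ input x t ε ⇓[ T ] s)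
      × T ≤ polylogTimes C 9 (n + ⌈1/ ε ⌉)
      × (1ℚ ℚ.- ε) ℚ.* ℕ→ℚ (OPT x t) ℚ.≤ ℕ→ℚ Σ⟨ x , output s ⟩
      × ℕ→ℚ Σ⟨ x , output s ⟩ ℚ.≤ (1ℚ ℚ.+ ε) ℚ.* ℕ→ℚ t
    finish (T , s , halts , time≤ , s′ , q , outputs) =
      T , s , halts , ≤-trans time≤ (≤-reflexive time-bound) ,
      subst Guarantee (sym (Σ-∑ x (output s) (λ i → X i * io s′ i)
        (λ i → cong₂ _*_ (sym (array-< x i)) (outputs (toℕ i) (<⇒≤ (toℕ<n i)))))) (result-guarantee s′ q)

abstract
  machineProgram : Program
  machineProgram = compile program 0

  programWeight programSize : ℕ
  programWeight = weight program
  programSize   = sizeCmd program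

  machineProgram≡ : compile program 0 ≡ machineProgram
  machineProgram≡ = refl

  programWeight≡ : weight program ≡ programWeight
  programWeight≡ = refl

  programSize≡ : sizeCmd program ≡ programSize
  programSize≡ = refl

theorem4 : ∃[ P ] ∃[ c ] ∃[ C ] ∃[ k ]
    (∀ (n : ℕ) (x : Vector ℕ n) (t : ℕ) (ε : ℚ) .{{_ : Positive ε}} →
    (∀ i → 0 < x i) → Injective _≡_ _≡_ x → 0 < t →
    ∃[ T ] ∃[ s ]
    (P , wordBound c x t ε ⊢ input x t ε ⇓[ T ] s)
    × T ≤ polylogTimes C k (n + ⌈1/ ε ⌉)
    × (1ℚ ℚ.- ε) ℚ.* ℕ→ℚ (OPT x t) ℚ.≤ ℕ→ℚ Σ⟨ x , output s ⟩
    × ℕ→ℚ Σ⟨ x , output s ⟩ ℚ.≤ (1ℚ ℚ.+ ε) ℚ.* ℕ→ℚ t)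
-- Variables and cells hold values up to U^300, and the values inside an expression are at most this
-- number raised to its size; hence the exponent of the word bound.
theorem4 = machineProgram , 300 * programSize , programWeight * (8 * sizeFactor * logFactor ^ 9) , 9 ,
  λ n x t ε 0<x _ 0<t → let U = 2 + largestInput x t ε in
  Algorithm.correct x t ε 0<x 0<t machineProgram programWeight programSize U (U ^ 300)
      (4 * (quo (ℚ.↧ₙ ε) (numerator ε) + 1))
    (wordBound (300 * programSize) x t ε) (programWeight * (8 * sizeFactor * logFactor ^ 9))
    machineProgram≡ programWeight≡ programSize≡ refl refl refl refl refl
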